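{- There is a polynomial-time $2$-approximation algorithm for the 3-RSND problem.
   Context: Graphs are finite and undirected (parallel edges allowed). In the Relative Survivable Network Design problem (RSND) the input is a graph $G=(V,E)$ with edge weights $w:E\to\mathbb{R}_{\ge 0}$ and demands $\{(s_i,t_i,k_i)\}_{i\in[\ell]}$, where $s_i,t_i\in V$ and $k_i$ is a nonnegative integer. A feasible solution is a subgraph $H$ of $G$ such that for every $i\in[\ell]$ and every $F\subseteq E$ with $|F|<k_i$: if there is a path from $s_i$ to $t_i$ in $G\setminus F$, then there is a path from $s_i$ to $t_i$ in $H\setminus F$. The goal is to find a feasible solution of minimum total weight. The 3-RSND problem is the special case of RSND in which $k_i\le 3$ for all $i$ (the number of demands is arbitrary). A $\rho$-approximation algorithm always outputs a feasible solution of weight at most $\rho$ times the minimum weight of a feasible solution.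
   Formalization: The edge weights are nonnegative rational numbers (given in binary as numerator and denominator) instead of nonnegative real numbers. -}

module Defs where

open import Data.Digit using (toDigits)
open import Data.Fin using (Fin; zero; suc; toℕ)
open import Data.Fin.Subset using (Subset; ⊤; _─_; ∣_∣; _∈_)
open import Data.Integer using (+_) renaming (∣_∣ to ∣_∣ℤ)
open import Data.List using (List; []; _∷_; _++_; [_]; length; map; replicate; concat)
open import Data.Maybe using (Maybe; just; nothing)
import Data.Nat as ℕ
open import Data.Nat using (ℕ)
open import Data.Product using (Σ-syntax; ∃-syntax; _×_; _,_; proj₁; proj₂)
open import Data.Rational using (ℚ; 0ℚ; _≤_; _*_; ↥_; ↧ₙ_)
open import Data.Rational.Properties using (+-0-monoid)
open import Algebra.Properties.Monoid.Sum +-0-monoid using (sum)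
open import Data.Sum using (_⊎_)
open import Data.Vec as Vec using (Vec; lookup; toList; zipWith)
open import Data.Bool using (if_then_else_)
open import Relation.Binary.Construct.Closure.ReflexiveTransitive using (Star)
open import Relation.Binary.PropositionalEquality using (_≡_)

data Symbol : Set where
  bit : Fin 2 → Symbol
  #   : Symbol

Word : Set
Word = List Symbol

-- Tape alphabet: the blank, the input/output symbols, and g further
-- work symbols.
data Cell (g : ℕ) : Set where
  blank  : Cell g
  symbol : Symbol → Cell g
  work   : Fin g → Cell g

data Move : Set where
  left right stay : Move

-- States, tapes and alphabet are all finite, so δ is a finite table.
-- The machine halts when δ yields nothing.
record TM : Set where
  field
    workSymbols : ℕ
    extraTapes  : ℕ
    states      : ℕ
    start       : Fin states
    δ : Fin states → Vec (Cell workSymbols) (ℕ.suc extraTapes) →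
        Maybe (Fin states × Vec (Cell workSymbols × Move) (ℕ.suc extraTapes))

-- A two-way infinite tape; all cells not listed are blank.  Both lists
-- start with the cell adjacent to the head.
record Tape (g : ℕ) : Set where
  constructor tape
  field
    before : List (Cell g)
    head   : Cell g
    after  : List (Cell g)

module _ {g : ℕ} where

  emptyTape : Tape g
  emptyTape = tape [] blank []

  inputTape : Word → Tape g
  inputTape []       = emptyTape
  inputTape (x ∷ xs) = tape [] (symbol x) (map symbol xs)

  writeMove : Tape g → Cell g × Move → Tape g
  writeMove (tape ls       _ rs)       (c , stay)  = tape ls c rs
  writeMove (tape []       _ rs)       (c , left)  = tape [] blank (c ∷ rs)
  writeMove (tape (l ∷ ls) _ rs)       (c , left)  = tape ls l (c ∷ rs)
  writeMove (tape ls       _ [])       (c , right) = tape (c ∷ ls) blank []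
  writeMove (tape ls       _ (r ∷ rs)) (c , right) = tape (c ∷ ls) r rs

  symbolPrefix : List (Cell g) → Word
  symbolPrefix (symbol x ∷ cs) = x ∷ symbolPrefix cs
  symbolPrefix _            = []

  -- The word starting under the head and extending to the right up to
  -- the first cell that does not hold an input/output symbol.
  readWord : Tape g → Word
  readWord (tape _ c rs) = symbolPrefix (c ∷ rs)

module _ (M : TM) where
  open TM M

  record Config : Set where
    constructor config
    field
      state : Fin states
      tapes : Vec (Tape workSymbols) (ℕ.suc extraTapes)

  step : Config → Maybe Config
  step (config q ts) with δ q (Vec.map Tape.head ts)
  ... | nothing         = nothing
  ... | just (q′ , acts) = just (config q′ (zipWith writeMove ts acts))

  -- The halting configuration reached from the given one, if it is
  -- reached within t steps.
  haltsWithin : ℕ → Config → Maybe Config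
  haltsWithin t c with step c
  haltsWithin _         c | nothing = just c
  haltsWithin ℕ.zero    c | just _  = nothing
  haltsWithin (ℕ.suc t) c | just c′ = haltsWithin t c′

  -- Input and output are both on the first tape.
  initial : Word → Config
  initial x = config start (inputTape x Vec.∷ Vec.replicate extraTapes emptyTape)

  output : Config → Word
  output c = readWord (Vec.head (Config.tapes c))

  OutputsWithin : ℕ → Word → Word → Set
  OutputsWithin t x y = ∃[ c ] haltsWithin t (initial x) ≡ just c × output c ≡ y

record MinimisationProblem : Set₁ where
  field
    Instance       : Set
    Solution       : Instance → Set
    Feasible       : (I : Instance) → Solution I → Set
    cost           : (I : Instance) → Solution I → ℚ
    encodeInstance : Instance → Word
    encodeSolution : (I : Instance) → Solution I → Word

  Optimal : (I : Instance) → Solution I → Set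
  Optimal I S = Feasible I S × (∀ S′ → Feasible I S′ → cost I S ≤ cost I S′)

  ApproximateSolution : ℚ → (I : Instance) → Solution I → Set
  ApproximateSolution ρ I S =
    Feasible I S × (∃[ S* ] Optimal I S* × cost I S ≤ ρ * cost I S*)

  IsPolyTimeApproximation : ℚ → TM → Set
  IsPolyTimeApproximation ρ M =
    ∃[ c ] ∃[ d ] ∀ (I : Instance) →
      let size = length (encodeInstance I) in
      Σ[ S ∈ Solution I ]
        OutputsWithin M (c ℕ.* size ℕ.^ d ℕ.+ c) (encodeInstance I) (encodeSolution I S)
        × ApproximateSolution ρ I S

record Graph : Set where
  field
    ∣V∣ ∣E∣ : ℕ
    -- Edges are undirected: the order within each pair is irrelevant.
    ends : Vec (Fin ∣V∣ × Fin ∣V∣) ∣E∣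

  Vertex Edge EdgeSet : Set
  Vertex  = Fin ∣V∣
  Edge    = Fin ∣E∣
  EdgeSet = Subset ∣E∣

  Joins : Edge → Vertex → Vertex → Set
  Joins e u v = lookup ends e ≡ (u , v) ⊎ lookup ends e ≡ (v , u)

  Adjacent : EdgeSet → Vertex → Vertex → Set
  Adjacent A u v = ∃[ e ] e ∈ A × Joins e u v

  -- Paths from s to t in the spanning subgraph with edge set A.
  Path : EdgeSet → Vertex → Vertex → Set
  Path A = Star (Adjacent A)

record RSNDInstance : Set where
  field
    graph : Graph
  open Graph graph public
  field
    weight   : Vec ℚ ∣E∣
    weight≥0 : ∀ e → 0ℚ ≤ lookup weight e
    ℓ        : ℕ
    demand   : Vec (Vertex × Vertex × ℕ) ℓ

  source target : Fin ℓ → Vertex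
  source i = proj₁ (lookup demand i)
  target i = proj₁ (proj₂ (lookup demand i))

  requirement : Fin ℓ → ℕ
  requirement i = proj₂ (proj₂ (lookup demand i))

  RSNDFeasible : EdgeSet → Set
  RSNDFeasible H =
    ∀ (i : Fin ℓ) (F : EdgeSet) → ∣ F ∣ ℕ.< requirement i →
      Path (⊤ ─ F) (source i) (target i) →
      Path (H ─ F) (source i) (target i)

  totalWeight : EdgeSet → ℚ
  totalWeight H = sum λ e → if lookup H e then lookup weight e else 0ℚ

-- Binary expansion, least significant bit first, terminated by #.
encodeℕ : ℕ → Word
encodeℕ n = map bit (proj₁ (toDigits 2 n)) ++ [ # ]

-- For a nonnegative rational: numerator and denominator in lowest terms.
encodeℚ≥0 : ℚ → Word
encodeℚ≥0 p = encodeℕ ∣ ↥ p ∣ℤ ++ encodeℕ (↧ₙ p)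

-- The vertex set is listed in unary, so the length is at least
-- |V| + |E| + ℓ; every other number is in binary.  Since encodeℕ never
-- yields an empty field, the # after the edges marks the end of the list.
encodeRSND : RSNDInstance → Word
encodeRSND I =
  replicate ∣V∣ (bit (suc zero)) ++ [ # ] ++
  concat (toList (zipWith encodeEdge ends weight)) ++ [ # ] ++
  concat (toList (Vec.map encodeDemand demand))
  where
  open RSNDInstance I

  encodeEdge : Vertex × Vertex → ℚ → Word
  encodeEdge (u , v) w = encodeℕ (toℕ u) ++ encodeℕ (toℕ v) ++ encodeℚ≥0 w

  encodeDemand : Vertex × Vertex × ℕ → Word
  encodeDemand (s , t , k) = encodeℕ (toℕ s) ++ encodeℕ (toℕ t) ++ encodeℕ k

-- The characteristic bit string.
encodeSubset : ∀ {n} → Subset n → Word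
encodeSubset A = map (λ b → bit (if b then suc zero else zero)) (toList A)

_-RSND : ℕ → MinimisationProblem
r -RSND = record
  { Instance       = Σ[ I ∈ RSNDInstance ] (∀ i → requirement I i ℕ.≤ r)
  ; Solution       = λ (I , _) → EdgeSet I
  ; Feasible       = λ (I , _) → RSNDFeasible I
  ; cost           = λ (I , _) → totalWeight I
  ; encodeInstance = λ (I , _) → encodeRSND I
  ; encodeSolution = λ _ → encodeSubset
  }
  where open RSNDInstance

module Submission where

open import Data.Bool using (Bool; if_then_else_; _∧_; _∨_; not; _xor_) renaming (true to tt; false to ff)
open import Data.Bool.ListAction using (any)
open import Data.Digit using (fromDigits; toDigits)
open import Data.Empty using () renaming (⊥-elim to void)
open import Data.Fin using (Fin; zero; suc; toℕ; fromℕ<)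
open import Data.Fin.Properties using (splitAt-↑ʳ; splitAt-↑ˡ; toℕ-fromℕ<; toℕ≤pred[n])
open import Data.Integer using (+≤+; +<+) renaming (ℤ to Z; 0ℤ to 0#; 1ℤ to 1#)
open import Data.List using (List; []; _∷_; map; foldl; foldr; _++_; _ʳ++_; [_]; concat) renaming (allFin to fins; length to len; reverse to rev; concatMap to flat)
open import Data.List.Membership.Propositional using (_∈_)
open import Data.List.Membership.Propositional.Properties using (∈-++⁺ʳ; ∈-++⁺ˡ; ∈-cartesianProduct⁺; ∈-filter⁺; ∈-filter⁻; ∈-map⁺; ∈-map⁻) renaming (∈-allFin to ∈-fins)
open import Data.List.Properties using (++-assoc; ++-identityʳ; ++-ʳ++; foldl-++; foldl-ʳ++; foldr-++; length-++; length-map; length-replicate; length-reverse; length-tabulate; length-ʳ++; map-++; map-cong; map-replicate; map-tabulate; map-ʳ++; map-∘; reverse-++; reverse-foldr; reverse-involutive; unfold-reverse; ʳ++-defn)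
open import Data.List.Relation.Unary.All using (All; []; _∷_)
open import Data.List.Relation.Unary.AllPairs using (AllPairs; []; _∷_)
open import Data.List.Relation.Unary.Any using () renaming (here to hd; there to th)
open import Data.List.Relation.Unary.Unique.Propositional using (Unique)
open import Data.Maybe using (Maybe; just; nothing; is-just)
open import Data.Nat using (ℕ; zero; suc; z≤n; s≤s; _∸_)
open import Data.Nat.ListAction using ()
open import Data.Product using (Σ; ∃; _×_; _,_; Σ-syntax; ∃-syntax) renaming (proj₁ to fst; proj₂ to snd)
open import Data.Sum using (_⊎_; [_,_]′) renaming (inj₁ to inl; inj₂ to inr)
open import Data.Unit using (⊤) renaming (tt to unit)
open import Data.Vec using (Vec; []; _∷_) renaming (lookup to at)
open import Data.Vec.Properties using (lookup-replicate) renaming (lookup∘tabulate to at-tab; lookup-zipWith to at-zip)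
open import Function using (_∘_; id)
open import Relation.Binary.Definitions using () renaming (DecidableEquality to DecEq)
open import Relation.Binary.PropositionalEquality using (_≢_; refl; sym) renaming (_≡_ to _==_; trans to tr; cong to ap; cong₂ to ap2; subst to tp; subst₂ to subst2)
open import Relation.Nullary using (¬_; Dec; yes; no; does)
open import Relation.Nullary.Decidable using (map′; _×-dec_; ¬?) renaming (dec-true to dec-tt; dec-false to dec-ff; decidable-stable to stable)
import Data.Bool.Properties as Bool
import Data.Empty
import Data.Fin.Properties as Fin
import Data.Integer
import Data.Integer as ℤ
import Data.Integer.Properties as ℤₚ
import Data.List as List
import Data.List
import Data.List.Properties
import Data.List.Relation.Unary.All as All
import Data.List.Relation.Unary.Unique.Propositional.Properties as Uniqueₚ
import Data.Nat
import Data.Nat as ℕ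
import Data.Nat.ListAction
import Data.Nat.Properties as ℕₚ
import Data.Product.Properties as ×
import Data.Sum
import Data.Sum.Properties as ⊎
import Data.Unit.Properties as ⊤
import Data.Vec as Vec

module N where
 open import Data.Nat using (_+_; _*_; _^_; _∸_; _⊓_; _≤_; _<_; _≤ᵇ_; _≡ᵇ_; pred) public
 open import Data.Nat.Properties hiding (_≟_) renaming (≤-trans to via; m≤m+n to l≤; m≤n+m to r≤; <⇒≤ to lt; ≤-refl to rfl; ≤-<-trans to ≤<; <-≤-trans to <≤; ≤-reflexive to eq≤; +-identityʳ to +0; +-identityˡ to 0+; *-identityˡ to 1*; *-identityʳ to *1; *-zeroʳ to *0; *-zeroˡ to 0*; +-mono-≤ to +≤; +-monoʳ-≤ to +≤ʳ; +-monoˡ-≤ to +≤ˡ; *-monoʳ-≤ to *≤ʳ; *-monoˡ-≤ to *≤ˡ; *-mono-≤ to *≤) public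
 open import Data.Nat.Tactic.RingSolver using () renaming (solve-∀ to ring) public

 by : ∀ {x y z} -> x == y -> y ≤ z -> x ≤ z
 by refl p = p

 to : ∀ {x y z} -> x ≤ y -> y == z -> x ≤ z
 to p refl = p

module Int where
 open import Data.Integer using (+_; -[1+_]; _+_; _*_; _-_; -_; _≤_; _<_) public
 open import Data.Integer.Properties hiding (_≟_) renaming (≤-trans to via; <⇒≤ to lt; ≤-refl to rfl; ≤-<-trans to ≤<; <-≤-trans to <≤; ≤-reflexive to eq≤; +-identityʳ to +0; +-identityˡ to 0+; *-identityˡ to 1*; *-identityʳ to *1; *-zeroʳ to *0; *-zeroˡ to 0*; +-mono-≤ to +≤; +-monoʳ-≤ to +≤ʳ; +-monoˡ-≤ to +≤ˡ; *-monoʳ-≤-nonNeg to *≤ʳ; *-monoˡ-≤-nonNeg to *≤ˡ) public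
 open import Data.Integer.Tactic.RingSolver using () renaming (solve-∀ to ring) public

 by : ∀ {x y z} -> x == y -> y ≤ z -> x ≤ z
 by refl p = p

 to : ∀ {x y z} -> x ≤ y -> y == z -> x ≤ z
 to p refl = p

module Sums where
 open Int

 ∑ : {A : Set} -> List A -> (A -> Z) -> Z
 ∑ [] f = 0#
 ∑(x ∷ xs) f = f x + ∑ xs f

 χ : Bool -> Z
 χ tt = 1#
 χ ff = 0#

 χ≥0 : ∀ b -> 0# ≤ χ b
 χ≥0 tt = +≤+ z≤n
 χ≥0 ff = +≤+ z≤n

 bd : ∀ {a b e} -> b == a + e -> 0# ≤ e -> a ≤ b
 bd {a} {b} {e} eq 0≤e = by(sym(+0 a))(to(+≤ʳ a 0≤e)(sym eq))

 by-diff< : ∀ {a b e} -> b == a + e -> 0# < e -> a < b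
 by-diff< {a} {b} {e} eq 0<e = ≤<(eq≤(sym(+0 a)))(<≤(+-monoʳ-< a 0<e)(eq≤(sym eq)))

 d≥0 : ∀ {a b} -> a ≤ b -> 0# ≤ b - a
 d≥0 = i≤j⇒0≤j-i

 *≥0 : ∀ {a b} -> 0# ≤ a -> 0# ≤ b -> 0# ≤ a * b
 *≥0 {+ a} {+ b} _ _ = to(+≤+ z≤n)(pos-* a b)

 *>0 : ∀ {a b} -> 0# < a -> 0# < b -> 0# < a * b
 *>0 {+ suc a} {+ suc b} _ _ = +<+(s≤s z≤n)
 *>0 {+ zero}(+<+())
 *>0 {+ suc _} {+ zero} _(+<+())

 +≥0 : ∀ {a b} -> 0# ≤ a -> 0# ≤ b -> 0# ≤ a + b
 +≥0 p q = +≤ p q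

 ≢0⇒>0 : ∀ {a} -> 0# ≤ a -> a ≢ 0# -> 0# < a
 ≢0⇒>0 p q = ≤∧≢⇒< p(q ∘ sym)

 sum≡0ˡ : ∀ {a b} -> 0# ≤ a -> 0# ≤ b -> a + b == 0# -> a == 0#
 sum≡0ˡ {a} {b} p q eq = ≤-antisym(to(bd {a} {a + b} refl q) eq) p

 sum≡0ʳ : ∀ {a b} -> 0# ≤ a -> 0# ≤ b -> a + b == 0# -> b == 0#
 sum≡0ʳ {a} {b} p q eq = sum≡0ˡ q p(tr(+-comm b a) eq)

 module _ {A : Set} where

  ∑≡ : ∀ {f g : A -> Z} xs -> (∀ x -> x ∈ xs -> f x == g x) -> ∑ xs f == ∑ xs g
  ∑≡ [] h = refl
  ∑≡(x ∷ xs) h = ap2 _+_(h x(hd refl))(∑≡ xs \y -> h y ∘ th)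

  ∑-+ : ∀(f g : A -> Z) xs -> ∑ xs(\x -> f x + g x) == ∑ xs f + ∑ xs g
  ∑-+ f g [] = refl
  ∑-+ f g(x ∷ xs) = tr(ap(_+_(f x + g x))(∑-+ f g xs))(lm(f x)(g x)(∑ xs f)(∑ xs g)) where
   lm : ∀ a b c d -> (a + b) +(c + d) ==(a + c) +(b + d)
   lm = ring

  ∑-* : ∀ c(f : A -> Z) xs -> ∑ xs(\x -> c * f x) == c * ∑ xs f
  ∑-* c f [] = sym(*0 c)
  ∑-* c f(x ∷ xs) = tr(ap(_+_(c * f x))(∑-* c f xs))(sym(*-distribˡ-+ c(f x)(∑ xs f)))

  ∑-0 : ∀ {f : A -> Z} xs -> (∀ x -> x ∈ xs -> f x == 0#) -> ∑ xs f == 0#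
  ∑-0 [] h = refl
  ∑-0(x ∷ xs) h = ap2 _+_(h x(hd refl))(∑-0 xs \y -> h y ∘ th)

  ∑≤ : ∀ {f g : A -> Z} xs -> (∀ x -> x ∈ xs -> f x ≤ g x) -> ∑ xs f ≤ ∑ xs g
  ∑≤ [] h = rfl
  ∑≤(x ∷ xs) h = +≤(h x(hd refl))(∑≤ xs \y -> h y ∘ th)

  ∑≥0 : ∀ {f : A -> Z} xs -> (∀ x -> x ∈ xs -> 0# ≤ f x) -> 0# ≤ ∑ xs f
  ∑≥0 [] h = rfl
  ∑≥0(x ∷ xs) h = +≥0(h x(hd refl))(∑≥0 xs \y -> h y ∘ th)

  ∑≡0 : ∀ {f : A -> Z} xs -> (∀ x -> x ∈ xs -> 0# ≤ f x) -> ∑ xs f == 0# -> ∀ x -> x ∈ xs -> f x == 0#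
  ∑≡0(y ∷ xs) h eq x(hd refl) = sum≡0ˡ(h y(hd refl))(∑≥0 xs \z -> h z ∘ th) eq
  ∑≡0(y ∷ xs) h eq x(th p) = ∑≡0 xs(\z -> h z ∘ th)(sum≡0ʳ(h y(hd refl))(∑≥0 xs \z -> h z ∘ th) eq) x p

  term≤∑ : ∀ {f : A -> Z} xs -> (∀ x -> x ∈ xs -> 0# ≤ f x) -> ∀ {x} -> x ∈ xs -> f x ≤ ∑ xs f
  term≤∑(x ∷ xs) h(hd refl) = bd refl(∑≥0 xs \z -> h z ∘ th)
  term≤∑ {f}(y ∷ xs) h(th p) = via(term≤∑ xs(\z -> h z ∘ th) p)(bd(+-comm(f y) _)(h y(hd refl)))

  ∑-const : ∀ c(xs : List A) -> ∑ xs(\_ -> c) == + len xs * c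
  ∑-const c [] = refl
  ∑-const c(x ∷ xs) = tr(ap(_+_ c)(∑-const c xs))(lm c(+ len xs)) where
   lm : ∀ c l -> c + l * c ==(1# + l) * c
   lm = ring

 ∑-swap : ∀ {A B : Set}(f : A -> B -> Z) xs ys -> ∑ xs(\x -> ∑ ys(f x)) == ∑ ys(\y -> ∑ xs \x -> f x y)
 ∑-swap f [] ys = sym(∑-0 ys \_ _ -> refl)
 ∑-swap f(x ∷ xs) ys = tr(ap(_+_(∑ ys(f x)))(∑-swap f xs ys))(sym(∑-+(f x)(\y -> ∑ xs \x -> f x y) ys))

 ∑pt : ∀ {n}(g : Fin n -> Z) v -> ∑(fins n)(\u -> χ(does(v Fin.≟ u)) * g u) == g v
 ∑pt {n} g v = go(fins n)(∈-fins v)(Uniqueₚ.allFin⁺ n) where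
  absent : ∀ xs -> All(v ≢_) xs -> ∑ xs(\u -> χ(does(v Fin.≟ u)) * g u) == 0#
  absent [] [] = refl
  absent(u ∷ xs)(h ∷ hs) rewrite dec-ff(v Fin.≟ u) h = tr(ap2 _+_(0*(g u))(absent xs hs)) refl
  go : ∀ xs -> v ∈ xs -> Unique xs -> ∑ xs(\u -> χ(does(v Fin.≟ u)) * g u) == g v
  go(u ∷ xs)(hd refl)(h ∷ _) rewrite dec-tt(v Fin.≟ v) refl = tr(ap2 _+_(1*(g v))(absent xs h))(+0(g v))
  go(u ∷ xs)(th p)(h ∷ q) rewrite dec-ff(v Fin.≟ u)(\eq -> All.lookup h p(sym eq)) = tr(ap2 _+_(0*(g u))(go xs p q))(0+(g v))

 -- A homogeneous system with fewer equations than unknowns has a nonzero integral solution.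
 module Homog {A : Set} (_≟_ : DecEq A) where

  Solves : List A -> (A -> Z) -> (A -> Z) -> Set
  Solves xs d a = ∑ xs(\x -> a x * d x) == 0#

  record Solution(xs : List A)(eqs : List(A -> Z)) : Set where
   field
    d : A -> Z
    off : ∀ x -> ¬ x ∈ xs -> d x == 0#
    var : A
    var∈ : var ∈ xs
    nz1 : d var ≢ 0#
    solves : All(Solves xs d) eqs

  data Pivot(x : A)(eqs : List(A -> Z)) : Set₁ where
   none : All(\a -> a x == 0#) eqs -> Pivot x eqs
   found : ∀ a(rest : List(A -> Z)) -> a x ≢ 0# -> len eqs == suc(len rest) -> (∀(P : (A -> Z) -> Set) -> P a -> All P rest -> All P eqs) -> Pivot x eqs

  pivot : ∀ x eqs -> Pivot x eqs
  pivot x [] = none []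
  pivot x(a ∷ eqs) with a x Data.Integer.≟ 0#
  ... | no a≢0 = found a eqs a≢0 refl(\P pa ps -> pa ∷ ps)
  ... | yes a≡0 with pivot x eqs
  ... | none ps = none(a≡0 ∷ ps)
  ... | found b rest b≢0 len1 all = found b(a ∷ rest) b≢0(ap suc len1)(\ { P pb(pa ∷ ps) -> pa ∷ all P pb ps })

  elim : A -> (A -> Z) -> (A -> Z) -> (A -> Z)
  elim x a b y = a x * b y - b x * a y

  sol1 : ∀ xs -> Unique xs -> ∀ eqs -> len eqs N.< len xs -> Solution xs eqs
  sol1(x ∷ xs)(x∉ ∷ uniq) eqs l with pivot x eqs
  ... | none zeros = record
   { d = d ;off = off ;var = x ;var∈ = hd refl ;nz1 = d-x≢0
   ;solves = All.map(\ {a} a≡0 -> tr(ap2 _+_(ap(_* d x) a≡0)(∑-0 xs \y y∈ -> tr(ap(a y *_)(d-y y y∈))(*0(a y)))) refl) zeros } where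
   d : A -> Z
   d y with y ≟ x
   ... | yes _ = 1#
   ... | no _ = 0#
   off : ∀ y -> ¬ y ∈ x ∷ xs -> d y == 0#
   off y y∉ with y ≟ x
   ... | yes refl = void(y∉(hd refl))
   ... | no _ = refl
   d-x≢0 : d x ≢ 0#
   d-x≢0 with x ≟ x
   ... | yes _ = \()
   ... | no ¬p = void(¬p refl)
   d-y : ∀ y -> y ∈ xs -> d y == 0#
   d-y y y∈ with y ≟ x
   ... | yes refl = void(All.lookup x∉ y∈ refl)
   ... | no _ = refl
  ... | found a rest a≢0 len1 all with sol1 xs uniq(Data.List.map(elim x a) rest)(tp(N._< len xs)(sym(length-map(elim x a) rest))(ℕ.s≤s⁻¹(tp(N._< suc(len xs)) len1 l)))
  ... | record { d = d' ;off = off' ;var = z ;var∈ = z∈ ;nz1 = z≢0 ;solves = sol } = record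
   { d = d ;off = off ;var = z ;var∈ = th z∈
   ;nz1 = \eq -> a-nz(tr(sym(d-y z z∈)) eq)
   ;solves = all(Solves(x ∷ xs) d) solves-a(others rest sol) } where
   S = ∑ xs(\y -> a y * d' y)
   d : A -> Z
   d y with y ≟ x
   ... | yes _ = - S
   ... | no _ = a x * d' y
   d-x : d x == - S
   d-x with x ≟ x
   ... | yes _ = refl
   ... | no ¬p = void(¬p refl)
   d-y : ∀ y -> y ∈ xs -> d y == a x * d' y
   d-y y y∈ with y ≟ x
   ... | yes refl = void(All.lookup x∉ y∈ refl)
   ... | no _ = refl
   off : ∀ y -> ¬ y ∈ x ∷ xs -> d y == 0#
   off y y∉ with y ≟ x
   ... | yes refl = void(y∉(hd refl))
   ... | no _ = tr(ap(a x *_)(off' y(y∉ ∘ th)))(*0(a x))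
   a-nz : a x * d' z ≢ 0#
   a-nz eq with i*j≡0⇒i≡0∨j≡0(a x) eq
   ... | inl p = a≢0 p
   ... | inr p = z≢0 p
   tail : ∀ b -> ∑ xs(\y -> b y * d y) == a x * ∑ xs(\y -> b y * d' y)
   tail b = tr(∑≡ xs \y y∈ -> tr(ap(b y *_)(d-y y y∈))(lm(b y)(a x)(d' y)))(∑-*(a x)(\y -> b y * d' y) xs) where
    lm : ∀ b a d -> b *(a * d) == a *(b * d)
    lm = ring
   solves-a : Solves(x ∷ xs) d a
   solves-a = tr(ap2 _+_(ap(a x *_) d-x)(tail a))(lm(a x) S) where
    lm : ∀ a s -> a *(- s) + a * s == 0#
    lm = ring
   others : ∀ rest -> All(Solves xs d')(Data.List.map(elim x a) rest) -> All(Solves(x ∷ xs) d) rest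
   others [] [] = []
   others(b ∷ rest)(p ∷ ps) = tr(ap2 _+_(ap(b x *_) d-x)(tail b))(tr(sym split) p) ∷ others rest ps where
    lm1 : ∀ ax by1 bx ay d -> (ax * by1 - bx * ay) * d == ax *(by1 * d) +(- bx) *(ay * d)
    lm1 = ring
    lm2 : ∀ ax t bx s -> ax * t +(- bx) * s == bx *(- s) + ax * t
    lm2 = ring
    split : ∑ xs(\y -> elim x a b y * d' y) == b x *(- S) + a x * ∑ xs(\y -> b y * d' y)
    split = tr(∑≡ xs \y _ -> lm1(a x)(b y)(b x)(a y)(d' y))(tr(∑-+(\y -> a x *(b y * d' y))(\y -> (- b x) *(a y * d' y)) xs)(tr(ap2 _+_(∑-*(a x)(\y -> b y * d' y) xs)(∑-*(- b x)(\y -> a y * d' y) xs))(lm2(a x) _(b x) S)))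

module Machine where
 open N
 open import Defs
 open import Data.Fin using (_↑ˡ_; _↑ʳ_; splitAt; _≟_)
 open import Data.List using (tail; drop; head)
 open import Data.Nat.Properties using (m+[n∸m]≡n)
 open import Data.Vec using (zipWith; _[_]≔_)
 open import Data.Vec.Properties using (lookup∘updateAt; lookup∘update; lookup∘update′; lookup-map)

 Stacks : Set
 Stacks = Vec(List Symbol) 4

 data Prog : Set where
  skip : Prog
  push : Fin 4 -> Symbol -> Prog
  pop : Fin 4 -> Prog
  _⨾_ : Prog -> Prog -> Prog
  br1 : Fin 4 -> (Maybe Symbol -> Bool) -> Prog -> Prog -> Prog
  while : Fin 4 -> (Maybe Symbol -> Bool) -> Prog -> Prog

 infixr 5 _⨾_

 infix 4 _⊢_⇓[_]_

 data _⊢_⇓[_]_ : Prog -> Stacks -> ℕ -> Stacks -> Set where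
  skip : ∀ {σ} -> skip ⊢ σ ⇓[ 1 ] σ
  push : ∀ {σ j x} -> push j x ⊢ σ ⇓[ 2 ](σ [ j ]≔(x ∷ at σ j))
  pop : ∀ {σ j} -> pop j ⊢ σ ⇓[ 1 ](σ [ j ]≔ drop 1(at σ j))
  _⨾_ : ∀ {p q σ σ' σ'' n m} -> p ⊢ σ ⇓[ n ] σ' -> q ⊢ σ' ⇓[ m ] σ'' -> p ⨾ q ⊢ σ ⇓[ n + m ] σ''
  then : ∀ {j π p q σ σ' n} -> π(head(at σ j)) == tt -> p ⊢ σ ⇓[ n ] σ' -> br1 j π p q ⊢ σ ⇓[ suc n ] σ'
  else : ∀ {j π p q σ σ' n} -> π(head(at σ j)) == ff -> q ⊢ σ ⇓[ n ] σ' -> br1 j π p q ⊢ σ ⇓[ suc n ] σ'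
  done : ∀ {j π p σ} -> π(head(at σ j)) == ff -> while j π p ⊢ σ ⇓[ 1 ] σ
  loop : ∀ {j π p σ σ' σ'' n m} -> π(head(at σ j)) == tt -> p ⊢ σ ⇓[ n ] σ' -> while j π p ⊢ σ' ⇓[ m ] σ'' -> while j π p ⊢ σ ⇓[ suc(n + m) ] σ''

 Tapes Heads Acts : Set
 Tapes = Vec(Tape 0) 4
 Heads = Vec(Cell 0) 4
 Acts = Vec(Cell 0 × Move) 4

 heads : Tapes -> Heads
 heads = Vec.map Tape.head

 cellSym : Cell 0 -> Maybe Symbol
 cellSym(symbol x) = just x
 cellSym _ = nothing

 keep : Heads -> Acts
 keep = Vec.map(_, stay)

 size : Prog -> ℕ
 size skip = 1
 size(push _ _) = 2
 size(pop _) = 1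
 size(p ⨾ q) = size p + size q
 size(br1 _ _ p q) = suc(size p + size q)
 size(while _ _ p) = suc(size p)

 ent : ∀ p -> Fin(size p)
 ent skip = zero
 ent(push _ _) = zero
 ent(pop _) = zero
 ent(p ⨾ q) = ent p ↑ˡ size q
 ent(br1 _ _ _ _) = zero
 ent(while _ _ _) = zero

 -- Where control goes next; nothing means that the program is left.
 act : ∀ p -> Fin(size p) -> Heads -> Maybe(Fin(size p)) × Acts
 act skip _ hs = nothing , keep hs
 act(push j x) zero hs = just(suc zero) ,(keep hs [ j ]≔(at hs j , left))
 act(push j x)(suc _) hs = nothing ,(keep hs [ j ]≔(symbol x , stay))
 act(pop j) _ hs = nothing ,(keep hs [ j ]≔(blank , right))
 act(p ⨾ q) i hs with splitAt(size p) i
 ... | inl k with act p k hs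
 ... | just k' , as = just(k' ↑ˡ size q) , as
 ... | nothing , as = just(size p ↑ʳ ent q) , as
 act(p ⨾ q) i hs | inr k with act q k hs
 ... | just k' , as = just(size p ↑ʳ k') , as
 ... | nothing , as = nothing , as
 act(br1 j π p q) zero hs with π(cellSym(at hs j))
 ... | tt = just(suc(ent p ↑ˡ size q)) , keep hs
 ... | ff = just(suc(size p ↑ʳ ent q)) , keep hs
 act(br1 j π p q)(suc i) hs with splitAt(size p) i
 ... | inl k with act p k hs
 ... | just k' , as = just(suc(k' ↑ˡ size q)) , as
 ... | nothing , as = nothing , as
 act(br1 j π p q)(suc i) hs | inr k with act q k hs
 ... | just k' , as = just(suc(size p ↑ʳ k')) , as
 ... | nothing , as = nothing , as
 act(while j π p) zero hs with π(cellSym(at hs j))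
 ... | tt = just(suc(ent p)) , keep hs
 ... | ff = nothing , keep hs
 act(while j π p)(suc k) hs with act p k hs
 ... | just k' , as = just(suc k') , as
 ... | nothing , as = just zero , as

 apply : Tapes -> Acts -> Tapes
 apply = zipWith writeMove

 data Run(p : Prog) : Fin(size p) -> Tapes -> ℕ -> Tapes -> Set where
  exit : ∀ {i ts as} -> act p i(heads ts) ==(nothing , as) -> Run p i ts 1(apply ts as)
  next : ∀ {i i' ts as n ts'} -> act p i(heads ts) ==(just i' , as) -> Run p i'(apply ts as) n ts' -> Run p i ts(suc n) ts'

 apply-keep : ∀ {n}(ts : Vec(Tape 0) n) -> zipWith writeMove ts(Vec.map(_, stay)(Vec.map Tape.head ts)) == ts
 apply-keep [] = refl
 apply-keep(t ∷ ts) = ap(t ∷_)(apply-keep ts)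

 apply-upd : ∀ {n}(ts : Vec(Tape 0) n) j a -> zipWith writeMove ts(Vec.map(_, stay)(Vec.map Tape.head ts) [ j ]≔ a) ==(ts [ j ]≔ writeMove(at ts j) a)
 apply-upd(t ∷ ts) zero a = ap(writeMove t a ∷_)(apply-keep ts)
 apply-upd(t ∷ ts)(suc j) a = ap(t ∷_)(apply-upd ts j a)

 data Content : List(Cell 0) -> List Symbol -> Set where
  blanks : ∀ {cs} -> All(_== blank) cs -> Content cs []
  _∷_ : ∀ x {cs s} -> Content cs s -> Content(symbol x ∷ cs)(x ∷ s)

 Holds : Tape 0 -> List Symbol -> Set
 Holds(tape ls c rs) s = All(_== blank) ls × Content(c ∷ rs) s

 Rep : Tapes -> Stacks -> Set
 Rep ts σ = ∀ j -> Holds(at ts j)(at σ j)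

 holds-head : ∀ {t s} -> Holds t s -> cellSym(Tape.head t) == head s
 holds-head(_ , blanks(refl ∷ _)) = refl
 holds-head(_ , x ∷ _) = refl

 holds-pop : ∀ {t s} -> Holds t s -> Holds(writeMove t(blank , right))(drop 1 s)
 holds-pop {tape ls c []}(b , blanks _) = (refl ∷ b) , blanks(refl ∷ [])
 holds-pop {tape ls c []}(b , x ∷ blanks []) = (refl ∷ b) , blanks(refl ∷ [])
 holds-pop {tape ls c(r ∷ rs)}(b , blanks(_ ∷ bs)) = (refl ∷ b) , blanks bs
 holds-pop {tape ls c(r ∷ rs)}(b , x ∷ k) = (refl ∷ b) , k

 holds-push : ∀ {t s} x -> Holds t s -> Holds(writeMove(writeMove t(Tape.head t , left))(symbol x , stay))(x ∷ s)
 holds-push {tape [] c rs} x([] , k) = [] , x ∷ k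
 holds-push {tape(l ∷ ls) c rs} x((_ ∷ b) , k) = b , x ∷ k

 rep-upd : ∀ {ts σ j t s} -> Rep ts σ -> Holds t s -> Rep(ts [ j ]≔ t)(σ [ j ]≔ s)
 rep-upd {ts} {σ} {j} {t} {s} r h i with i ≟ j
 ... | yes refl = subst2 Holds(sym(lookup∘update i ts t))(sym(lookup∘update i σ s)) h
 ... | no i≢j = subst2 Holds(sym(lookup∘update′ i≢j ts t))(sym(lookup∘update′ i≢j σ s))(r i)

 rep-head : ∀ {ts σ} j -> Rep ts σ -> cellSym(at(heads ts) j) == head(at σ j)
 rep-head {ts} j r = tr(ap cellSym(lookup-map j Tape.head ts))(holds-head(r j))

 seqʳ : ∀ {p q i ts n ts'} -> Run q i ts n ts' -> Run(p ⨾ q)(size p ↑ʳ i) ts n ts'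
 seqʳ {p} {q} {i} {ts}(exit {as = as} e) = exit eq where
  eq : act(p ⨾ q)(size p ↑ʳ i)(heads ts) ==(nothing , as)
  eq rewrite splitAt-↑ʳ(size p)(size q) i | e = refl
 seqʳ {p} {q} {i} {ts}(next {i' = i'} {as = as} e r) = next eq(seqʳ r) where
  eq : act(p ⨾ q)(size p ↑ʳ i)(heads ts) ==(just(size p ↑ʳ i') , as)
  eq rewrite splitAt-↑ʳ(size p)(size q) i | e = refl

 seqˡ : ∀ {p q i ts n ts' m ts''} -> Run p i ts n ts' -> Run q(ent q) ts' m ts'' -> Run(p ⨾ q)(i ↑ˡ size q) ts(n + m) ts''
 seqˡ {p} {q} {i} {ts}(exit {as = as} e) r = next eq(seqʳ r) where
  eq : act(p ⨾ q)(i ↑ˡ size q)(heads ts) ==(just(size p ↑ʳ ent q) , as)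
  eq rewrite splitAt-↑ˡ(size p) i(size q) | e = refl
 seqˡ {p} {q} {i} {ts}(next {i' = i'} {as = as} e r) r' = next eq(seqˡ r r') where
  eq : act(p ⨾ q)(i ↑ˡ size q)(heads ts) ==(just(i' ↑ˡ size q) , as)
  eq rewrite splitAt-↑ˡ(size p) i(size q) | e = refl

 branchˡ : ∀ {j π p q i ts n ts'} -> Run p i ts n ts' -> Run(br1 j π p q)(suc(i ↑ˡ size q)) ts n ts'
 branchˡ {j} {π} {p} {q} {i} {ts}(exit {as = as} e) = exit eq where
  eq : act(br1 j π p q)(suc(i ↑ˡ size q))(heads ts) ==(nothing , as)
  eq rewrite splitAt-↑ˡ(size p) i(size q) | e = refl
 branchˡ {j} {π} {p} {q} {i} {ts}(next {i' = i'} {as = as} e r) = next eq(branchˡ r) where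
  eq : act(br1 j π p q)(suc(i ↑ˡ size q))(heads ts) ==(just(suc(i' ↑ˡ size q)) , as)
  eq rewrite splitAt-↑ˡ(size p) i(size q) | e = refl

 branchʳ : ∀ {j π p q i ts n ts'} -> Run q i ts n ts' -> Run(br1 j π p q)(suc(size p ↑ʳ i)) ts n ts'
 branchʳ {j} {π} {p} {q} {i} {ts}(exit {as = as} e) = exit eq where
  eq : act(br1 j π p q)(suc(size p ↑ʳ i))(heads ts) ==(nothing , as)
  eq rewrite splitAt-↑ʳ(size p)(size q) i | e = refl
 branchʳ {j} {π} {p} {q} {i} {ts}(next {i' = i'} {as = as} e r) = next eq(branchʳ r) where
  eq : act(br1 j π p q)(suc(size p ↑ʳ i))(heads ts) ==(just(suc(size p ↑ʳ i')) , as)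
  eq rewrite splitAt-↑ʳ(size p)(size q) i | e = refl

 whileBody : ∀ {j π p i ts n ts' m ts''} -> Run p i ts n ts' -> Run(while j π p) zero ts' m ts'' -> Run(while j π p)(suc i) ts(n + m) ts''
 whileBody {j} {π} {p} {i} {ts}(exit {as = as} e) r = next eq r where
  eq : act(while j π p)(suc i)(heads ts) ==(just zero , as)
  eq rewrite e = refl
 whileBody {j} {π} {p} {i} {ts}(next {i' = i'} {as = as} e r) r' = next eq(whileBody r r') where
  eq : act(while j π p)(suc i)(heads ts) ==(just(suc i') , as)
  eq rewrite e = refl

 exit-keep : ∀ {p i ts} -> act p i(heads ts) ==(nothing , keep(heads ts)) -> Run p i ts 1 ts
 exit-keep {p} {i} {ts} e = tp(Run p i ts 1)(apply-keep ts)(exit e)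

 next-keep : ∀ {p i i' ts n ts'} -> act p i(heads ts) ==(just i' , keep(heads ts)) -> Run p i' ts n ts' -> Run p i ts(suc n) ts'
 next-keep {p} {i} {i'} {ts} {n} {ts'} e r = next e(tp(\ts -> Run p i' ts n ts')(sym(apply-keep ts)) r)

 sim : ∀ {p σ n σ'} -> p ⊢ σ ⇓[ n ] σ' -> ∀ {ts} -> Rep ts σ -> ∃[ ts' ] Run p(ent p) ts n ts' × Rep ts' σ'
 sim skip {ts} r = ts , exit-keep refl , r
 sim {push j x} {σ} push {ts} r = _ , next refl(exit refl) , tp(\ts -> Rep ts(σ [ j ]≔(x ∷ at σ j)))(sym eq)(rep-upd {ts} {σ} r(holds-push x(r j))) where
  t1 = writeMove(at ts j)(Tape.head(at ts j) , left)
  ts1 = apply ts(keep(heads ts) [ j ]≔(at(heads ts) j , left))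
  eq1 : ts1 ==(ts [ j ]≔ t1)
  eq1 = tr(apply-upd ts j _)(ap(\c -> ts [ j ]≔ writeMove(at ts j)(c , left))(lookup-map j Tape.head ts))
  upd-twice : ∀ {A : Set} {n}(v : Vec A n) j {a b} -> ((v [ j ]≔ a) [ j ]≔ b) ==(v [ j ]≔ b)
  upd-twice(_ ∷ v) zero = refl
  upd-twice(y ∷ v)(suc j) = ap(y ∷_)(upd-twice v j)
  eq : apply ts1(keep(heads ts1) [ j ]≔(symbol x , stay)) ==(ts [ j ]≔ writeMove t1(symbol x , stay))
  eq = tr(apply-upd ts1 j _)(tr(ap(\v -> v [ j ]≔ writeMove(at v j)(symbol x , stay)) eq1)(tr(upd-twice ts j)(ap(\t -> ts [ j ]≔ writeMove t(symbol x , stay))(lookup∘update j ts t1))))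
 sim {pop j} {σ} pop {ts} r = _ , exit refl , tp(\ts -> Rep ts(σ [ j ]≔ drop 1(at σ j)))(sym(apply-upd ts j _))(rep-upd {ts} {σ} r(holds-pop(r j)))
 sim(d ⨾ e) r with sim d r
 ... | _ , run1 , r1 with sim e r1
 ... | _ , run2 , r2 = _ , seqˡ run1 run2 , r2
 sim {br1 j π p q} {σ}(then t d) {ts} r with sim d r
 ... | _ , run , r' = _ , next-keep eq(branchˡ run) , r' where
  eq : act(br1 j π p q) zero(heads ts) ==(just(suc(ent p ↑ˡ size q)) , keep(heads ts))
  eq rewrite tr(ap π(rep-head {ts} {σ} j r)) t = refl
 sim {br1 j π p q} {σ}(else t d) {ts} r with sim d r
 ... | _ , run , r' = _ , next-keep eq(branchʳ run) , r' where
  eq : act(br1 j π p q) zero(heads ts) ==(just(suc(size p ↑ʳ ent q)) , keep(heads ts))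
  eq rewrite tr(ap π(rep-head {ts} {σ} j r)) t = refl
 sim {while j π p} {σ}(done t) {ts} r = ts , exit-keep eq , r where
  eq : act(while j π p) zero(heads ts) ==(nothing , keep(heads ts))
  eq rewrite tr(ap π(rep-head {ts} {σ} j r)) t = refl
 sim {while j π p} {σ}(loop t d e) {ts} r with sim d r
 ... | _ , run1 , r1 with sim e r1
 ... | _ , run2 , r2 = _ , next-keep eq(whileBody run1 run2) , r2 where
  eq : act(while j π p) zero(heads ts) ==(just(suc(ent p)) , keep(heads ts))
  eq rewrite tr(ap π(rep-head {ts} {σ} j r)) t = refl

 target : ∀ p -> Maybe(Fin(size p)) -> Fin(suc(size p))
 target p nothing = zero
 target p(just i) = suc i

 machine : Prog -> TM
 machine p = record
  { workSymbols = 0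
  ;extraTapes = 3
  ;states = suc(size p)
  ;start = suc(ent p)
  ;δ = δ
  } where
  δ : Fin(suc(size p)) -> Heads -> Maybe(Fin(suc(size p)) × Acts)
  δ zero _ = nothing
  δ(suc i) hs = just(target p(fst(act p i hs)) , snd(act p i hs))

 haltsWithin-step : ∀ M t {c c'} -> step M c == just c' -> haltsWithin M(suc t) c == haltsWithin M t c'
 haltsWithin-step M t {c} e with step M c | e
 ... | just _ | refl = refl

 haltsWithin-hltd : ∀ M t {c} -> step M c == nothing -> haltsWithin M t c == just c
 haltsWithin-hltd M t {c} e with step M c
 haltsWithin-hltd M zero {c} refl | nothing = refl
 haltsWithin-hltd M(suc _) {c} refl | nothing = refl

 step-act : ∀ p i ts {a as} -> act p i(heads ts) ==(a , as) -> step(machine p)(config(suc i) ts) == just(config(target p a)(apply ts as))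
 step-act p i ts = ap(\(a , as) -> just(config(target p a)(apply ts as)))

 run-halts : ∀ {p i ts n ts'} -> Run p i ts n ts' -> ∀ k -> haltsWithin(machine p)(n + k)(config(suc i) ts) == just(config zero ts')
 run-halts {p} {i} {ts}(exit e) k = tr(haltsWithin-step(machine p) k(step-act p i ts e))(haltsWithin-hltd(machine p) k refl)
 run-halts {p} {i} {ts}(next e r) k = tr(haltsWithin-step(machine p) _(step-act p i ts e))(run-halts r k)

 start-stacks : Word -> Stacks
 start-stacks w = w ∷ [] ∷ [] ∷ [] ∷ []

 init-rep : ∀ w -> Rep(inputTape w ∷ Vec.replicate 3 emptyTape)(start-stacks w)
 init-rep w zero = holds w where
  content : ∀ w -> Content(map symbol w) w
  content [] = blanks []
  content(x ∷ w) = x ∷ content w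
  holds : ∀ w -> Holds(inputTape w) w
  holds [] = [] , blanks(refl ∷ [])
  holds(x ∷ w) = [] , x ∷ content w
 init-rep w(suc zero) = [] , blanks(refl ∷ [])
 init-rep w(suc(suc zero)) = [] , blanks(refl ∷ [])
 init-rep w(suc(suc(suc zero))) = [] , blanks(refl ∷ [])

 holds-readWord : ∀ {t s} -> Holds t s -> readWord t == s
 holds-readWord {tape _ _ _}(_ , k) = content k where
  content : ∀ {cs s} -> Content cs s -> symbolPrefix cs == s
  content(blanks []) = refl
  content(blanks(refl ∷ _)) = refl
  content(x ∷ k) = ap(x ∷_)(content k)

 machine-outputs : ∀ {p w n σ t} -> p ⊢ start-stacks w ⇓[ n ] σ -> n ≤ t -> OutputsWithin(machine p) t w(at σ zero)
 machine-outputs {p} {w} {n} {σ} {t} d n≤t with sim d(init-rep w)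
 ... | ts' , run , r = config zero ts' , tp(\t -> haltsWithin(machine p) t(initial(machine p) w) == just(config zero ts'))(m+[n∸m]≡n n≤t)(run-halts run(t ∸ n)) , tr(ap readWord(head-at ts'))(holds-readWord(r zero)) where
  head-at : ∀ {A : Set} {n}(v : Vec A(suc n)) -> Vec.head v == at v zero
  head-at(_ ∷ _) = refl

module TreeOps where
 open N
 open import Defs
 open Machine
 open import Data.List using (drop; head)
 open import Data.Vec using (_[_]≔_)

 data Tree : Set where
  leaf : Tree
  node : Tree -> Tree -> Tree

 b0 b1 : Symbol
 b0 = bit zero
 b1 = bit(suc zero)

 code : Tree -> List Symbol
 code leaf = b0 ∷ []
 code(node l r) = b1 ∷ code l ++ code r

 sz : Tree -> ℕ
 sz leaf = 1
 sz(node l r) = suc(sz l + sz r)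

 len-code : ∀ t -> len(code t) == sz t
 len-code leaf = refl
 len-code(node l r) = ap suc(tr(length-++(code l))(ap2 _+_(len-code l)(len-code r)))

 _≟T_ : (t u : Tree) -> Dec(t == u)
 leaf ≟T leaf = yes refl
 leaf ≟T node _ _ = no \()
 node _ _ ≟T leaf = no \()
 node l r ≟T node l' r' with l ≟T l' | r ≟T r'
 ... | yes refl | yes refl = yes refl
 ... | no ¬p | _ = no \ { refl -> ¬p refl }
 ... | yes _ | no ¬p = no \ { refl -> ¬p refl }

 infix 4 _⊢_⇝[_]_

 _⊢_⇝[_]_ : Prog -> Stacks -> ℕ -> Stacks -> Set
 p ⊢ σ ⇝[ n ] σ' = ∃[ m ] m ≤ n ×(p ⊢ σ ⇓[ m ] σ')

 exl : ∀ {p σ n σ'} -> p ⊢ σ ⇓[ n ] σ' -> p ⊢ σ ⇝[ n ] σ'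
 exl d = _ , rfl , d

 wn : ∀ {p σ n m σ'} -> n ≤ m -> p ⊢ σ ⇝[ n ] σ' -> p ⊢ σ ⇝[ m ] σ'
 wn n≤m(_ , k≤n , d) = _ , via k≤n n≤m , d

 takes : ∀ {p σ n m σ'} -> n == m -> p ⊢ σ ⇝[ n ] σ' -> p ⊢ σ ⇝[ m ] σ'
 takes refl d = d

 ends : ∀ {p σ n σ' σ''} -> σ' == σ'' -> p ⊢ σ ⇝[ n ] σ' -> p ⊢ σ ⇝[ n ] σ''
 ends refl d = d

 infixr 5 _⨟_

 _⨟_ : ∀ {p q σ σ' σ'' n m} -> p ⊢ σ ⇝[ n ] σ' -> q ⊢ σ' ⇝[ m ] σ'' -> p ⨾ q ⊢ σ ⇝[ n + m ] σ''
 (_ , l , d) ⨟(_ , l' , d') = _ , +≤ l l' , d ⨾ d'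

 then≤ : ∀ {j π p q σ σ' n} -> π(head(at σ j)) == tt -> p ⊢ σ ⇝[ n ] σ' -> br1 j π p q ⊢ σ ⇝[ suc n ] σ'
 then≤ t(_ , l , d) = _ , s≤s l , then t d

 else≤ : ∀ {j π p q σ σ' n} -> π(head(at σ j)) == ff -> q ⊢ σ ⇝[ n ] σ' -> br1 j π p q ⊢ σ ⇝[ suc n ] σ'
 else≤ t(_ , l , d) = _ , s≤s l , else t d

 loop≤ : ∀ {j π p σ σ' σ'' n m} -> π(head(at σ j)) == tt -> p ⊢ σ ⇝[ n ] σ' -> while j π p ⊢ σ' ⇝[ m ] σ'' -> while j π p ⊢ σ ⇝[ suc(n + m) ] σ''
 loop≤ t(_ , l , d)(_ , l' , d') = _ , s≤s(+≤ l l') , loop t d d'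

 isB1 isB0 : Maybe Symbol -> Bool
 isB1(just(bit(suc zero))) = tt
 isB1 _ = ff
 isB0(just(bit zero)) = tt
 isB0 _ = ff

 ⟪_∣_∣_∣_⟫ : (a b c d : List Symbol) -> Stacks
 ⟪ a ∣ b ∣ c ∣ d ⟫ = a ∷ b ∷ c ∷ d ∷ []

 0F 1F 2F 3F : Fin 4
 0F = zero
 1F = suc zero
 2F = suc(suc zero)
 3F = suc(suc(suc zero))

 main : List Symbol -> Stacks
 main xs = ⟪ xs ∣ [] ∣ [] ∣ [] ⟫

 -- An operation applied to each symbol popped from stack i until it is empty.
 drain : Fin 4 -> (Symbol -> Prog) -> Prog
 drain i p = while i is-just(br1 i isB1(pop i ⨾ p b1)(br1 i isB0(pop i ⨾ p b0)(pop i ⨾ p #)))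

 drain-runs : ∀ {i p c}(S : List Symbol -> List Symbol -> Stacks) -> (∀ xs ys -> at(S xs ys) i == xs) -> (∀ x xs ys -> (S(x ∷ xs) ys [ i ]≔ xs) == S xs ys) -> (∀ x xs ys -> p x ⊢ S xs ys ⇝[ c ] S xs(x ∷ ys)) -> ∀ xs ys -> drain i p ⊢ S xs ys ⇝[ len xs *(4 + c) + 1 ] S [](xs ʳ++ ys)
 drain-runs {i} {p} {c} S look popped run = go where
  pop≤ : ∀ x xs ys -> pop i ⊢ S(x ∷ xs) ys ⇝[ 1 ] S xs ys
  pop≤ x xs ys = tp(pop i ⊢ S(x ∷ xs) ys ⇝[ 1 ]_)(tr(ap(\zs -> S(x ∷ xs) ys [ i ]≔ drop 1 zs)(look(x ∷ xs) ys))(popped x xs ys))(exl pop)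
  test : ∀(π : Maybe Symbol -> Bool) xs ys -> π(head(at(S xs ys) i)) == π(head xs)
  test π xs ys = ap(\zs -> π(head zs))(look xs ys)
  body : ∀ x xs ys -> br1 i isB1(pop i ⨾ p b1)(br1 i isB0(pop i ⨾ p b0)(pop i ⨾ p #)) ⊢ S(x ∷ xs) ys ⇝[ 3 + c ] S xs(x ∷ ys)
  body(bit zero) xs ys = else≤(test isB1 _ _)(then≤(test isB0 _ _)(pop≤ _ xs ys ⨟ run _ xs ys))
  body(bit(suc zero)) xs ys = wn(n≤1+n _)(then≤(test isB1 _ _)(pop≤ _ xs ys ⨟ run _ xs ys))
  body # xs ys = else≤(test isB1 _ _)(else≤(test isB0 _ _)(pop≤ _ xs ys ⨟ run _ xs ys))
  go : ∀ xs ys -> drain i p ⊢ S xs ys ⇝[ len xs *(4 + c) + 1 ] S [](xs ʳ++ ys)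
  go [] ys = exl(done(test is-just [] ys))
  go(x ∷ xs) ys = wn(eq≤(sym(+-assoc(4 + c)(len xs *(4 + c)) 1)))(loop≤(test is-just(x ∷ xs) ys)(body x xs ys)(go xs(x ∷ ys)))

 clear : Fin 4 -> Prog
 clear i = drain i(\_ -> skip)

 spill : Fin 4 -> Fin 4 -> Prog
 spill i k = drain i(push k)

 take : Prog
 take = push 3F b1 ⨾ while 3F is-just(br1 0F isB1(pop 0F ⨾ push 1F b1 ⨾ push 3F b1)(pop 0F ⨾ push 1F b0 ⨾ pop 3F))

 take-runs : ∀ t r b -> take ⊢ ⟪ code t ++ r ∣ [] ∣ b ∣ [] ⟫ ⇝[ 3 + 7 * sz t ] ⟪ r ∣ code t ʳ++ [] ∣ b ∣ [] ⟫
 take-runs t r b = wn(eq≤(lm(sz t)))(exl push ⨟ go t r [] [](exl(done refl))) where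
  lm : ∀ n -> 2 +(7 * n + 1) == 3 + 7 * n
  lm = ring
  body = br1 0F isB1(pop 0F ⨾ push 1F b1 ⨾ push 3F b1)(pop 0F ⨾ push 1F b0 ⨾ pop 3F)
  cost : ∀ x y m -> suc(6 +(7 * x +(7 * y + m))) == 7 * suc(x + y) + m
  cost = ring
  go : ∀ t r a c {m σ} -> while 3F is-just body ⊢ ⟪ r ∣ code t ʳ++ a ∣ b ∣ c ⟫ ⇝[ m ] σ -> while 3F is-just body ⊢ ⟪ code t ++ r ∣ a ∣ b ∣ b1 ∷ c ⟫ ⇝[ 7 * sz t + m ] σ
  go leaf r a c d = wn(n≤1+n _)(loop≤ refl(else≤ refl(exl pop ⨟ exl push ⨟ exl pop)) d)
  go(node x y) r a c {m} {σ} d = wn(eq≤(cost(sz x)(sz y) m))(loop≤ refl(then≤ refl(exl pop ⨟ exl push ⨟ exl push))( tp(\z -> while 3F is-just body ⊢ ⟪ z ∣ b1 ∷ a ∣ b ∣ b1 ∷ b1 ∷ c ⟫ ⇝[ _ ] σ)(sym(++-assoc(code x)(code y) r))(go x(code y ++ r)(b1 ∷ a)(b1 ∷ c)(go y r(code x ʳ++ b1 ∷ a) c(tp(\z -> while 3F is-just body ⊢ ⟪ r ∣ z ∣ b ∣ c ⟫ ⇝[ m ] σ)(++-ʳ++(code x) {code y} {b1 ∷ a}) d)))))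

 ʳ++-inv : ∀(xs : List Symbol) r -> (xs ʳ++ []) ʳ++ r == xs ++ r
 ʳ++-inv xs r = go xs [] where
  go : ∀ xs ys -> (xs ʳ++ ys) ʳ++ r == ys ʳ++(xs ++ r)
  go [] ys = refl
  go(x ∷ xs) ys = go xs(x ∷ ys)

 ʳ++[] : ∀(xs : List Symbol) -> (xs ʳ++ []) ʳ++ [] == xs
 ʳ++[] xs = tr(ʳ++-inv xs [])(++-identityʳ xs)

 len-rev : ∀ t -> len(code t ʳ++ []) == sz t
 len-rev t = tr(length-ʳ++(code t))(tr(+0 _)(len-code t))

 spill1 : ∀ {i k}(S : List Symbol -> List Symbol -> Stacks) -> (∀ xs ys -> at(S xs ys) i == xs) -> (∀ x xs ys -> (S(x ∷ xs) ys [ i ]≔ xs) == S xs ys) -> (∀ x xs ys -> (S xs ys [ k ]≔(x ∷ at(S xs ys) k)) == S xs(x ∷ ys)) -> ∀ xs ys -> spill i k ⊢ S xs ys ⇝[ len xs * 6 + 1 ] S [](xs ʳ++ ys)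
 spill1 {k = k} S look popped pushed = drain-runs S look popped(\x xs ys -> tp(push k x ⊢ S xs ys ⇝[ 2 ]_)(pushed x xs ys)(exl push))

 clear-runs : ∀ {i}(S : List Symbol -> Stacks) -> (∀ xs -> at(S xs) i == xs) -> (∀ x xs -> (S(x ∷ xs) [ i ]≔ xs) == S xs) -> ∀ xs -> clear i ⊢ S xs ⇝[ len xs * 5 + 1 ] S []
 clear-runs S look popped xs = drain-runs(\xs _ -> S xs)(\xs _ -> look xs)(\x xs _ -> popped x xs)(\_ _ _ -> exl skip) xs []

 abstract
  K : ℕ -> ℕ
  K n = 60 * n + 60

  K-def : ∀ n -> K n == 60 * n + 60
  K-def n = refl

  K-mono : ∀ {m n} -> m ≤ n -> K m ≤ K n
  K-mono m≤n = +≤ˡ 60(*≤ʳ 60 m≤n)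

 by-slack : ∀ {a b} c -> a + c == b -> a ≤ b
 by-slack {a} c refl = l≤ a c

 dup swap disc : Prog
 dup = take ⨾ drain 1F(\x -> push 0F x ⨾ push 2F x) ⨾ spill 2F 1F ⨾ spill 1F 0F
 swap = take ⨾ spill 1F 2F ⨾ take ⨾ spill 2F 3F ⨾ spill 3F 0F ⨾ spill 1F 0F
 disc = take ⨾ clear 1F

 dup-runs : ∀ t r -> dup ⊢ main(code t ++ r) ⇝[ K(sz t) ] main(code t ++ code t ++ r)
 dup-runs t r = wn(by-slack(33 * sz t + 54)(tr(lm(sz t))(sym(K-def _))))(ends(ap main(ʳ++-inv(code t) _))(take-runs t r [] ⨟ takes(ap(\n -> n * 8 + 1)(len-rev t))(ends(ap2(\x y -> ⟪ x ∣ [] ∣ y ∣ [] ⟫)(ʳ++-inv(code t) r)(ʳ++[](code t)))(two(code t ʳ++ []) r [])) ⨟ takes(ap(\n -> n * 6 + 1)(len-code t))(spill1(\xs ys -> ⟪ code t ++ r ∣ ys ∣ xs ∣ [] ⟫)(\_ _ -> refl)(\_ _ _ -> refl)(\_ _ _ -> refl)(code t) []) ⨟ takes(ap(\n -> n * 6 + 1)(len-rev t))(spill1(\xs ys -> ⟪ ys ∣ xs ∣ [] ∣ [] ⟫)(\_ _ -> refl)(\_ _ _ -> refl)(\_ _ _ -> refl)(code t ʳ++ [])(code t ++ r)))) where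
  lm : ∀ n -> (3 + 7 * n) +((n * 8 + 1) +((n * 6 + 1) +(n * 6 + 1))) +(33 * n + 54) == 60 * n + 60
  lm = ring
  two : ∀ xs y z -> drain 1F(\x -> push 0F x ⨾ push 2F x) ⊢ ⟪ y ∣ xs ∣ z ∣ [] ⟫ ⇝[ len xs * 8 + 1 ] ⟪ xs ʳ++ y ∣ [] ∣ xs ʳ++ z ∣ [] ⟫
  two [] y z = exl(done refl)
  two(bit zero ∷ xs) y z = loop≤ refl(else≤ refl(then≤ refl(exl pop ⨟ exl push ⨟ exl push)))(two xs(b0 ∷ y)(b0 ∷ z))
  two(bit(suc zero) ∷ xs) y z = wn(n≤1+n _)(loop≤ refl(then≤ refl(exl pop ⨟ exl push ⨟ exl push))(two xs(b1 ∷ y)(b1 ∷ z)))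
  two(# ∷ xs) y z = loop≤ refl(else≤ refl(else≤ refl(exl pop ⨟ exl push ⨟ exl push)))(two xs(# ∷ y)(# ∷ z))

 swap-runs : ∀ t u r -> swap ⊢ main(code t ++ code u ++ r) ⇝[ K(sz t + sz u) ] main(code u ++ code t ++ r)
 swap-runs t u r = wn(by-slack(35 * sz t + 47 * sz u + 50)(tr(lm(sz t)(sz u))(sym(K-def _))))(ends(ap main(ʳ++-inv(code u) _))(take-runs t(code u ++ r) [] ⨟ takes(ap(\n -> n * 6 + 1)(len-rev t))(ends(ap(\z -> ⟪ code u ++ r ∣ [] ∣ z ∣ [] ⟫)(ʳ++[](code t)))(spill1(\xs ys -> ⟪ code u ++ r ∣ xs ∣ ys ∣ [] ⟫)(\_ _ -> refl)(\_ _ _ -> refl)(\_ _ _ -> refl)(code t ʳ++ []) [])) ⨟ take-runs u r(code t) ⨟ takes(ap(\n -> n * 6 + 1)(len-code t))(spill1(\xs ys -> ⟪ r ∣ code u ʳ++ [] ∣ xs ∣ ys ⟫)(\_ _ -> refl)(\_ _ _ -> refl)(\_ _ _ -> refl)(code t) []) ⨟ takes(ap(\n -> n * 6 + 1)(len-rev t))(ends(ap(\z -> ⟪ z ∣ code u ʳ++ [] ∣ [] ∣ [] ⟫)(ʳ++-inv(code t) r))(spill1(\xs ys -> ⟪ ys ∣ code u ʳ++ [] ∣ [] ∣ xs ⟫)(\_ _ -> refl)(\_ _ _ -> refl)(\_ _ _ -> refl)(code t ʳ++ []) r)) ⨟ takes(ap(\n -> n * 6 + 1)(len-rev u))(spill1(\xs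 ys -> ⟪ ys ∣ xs ∣ [] ∣ [] ⟫)(\_ _ -> refl)(\_ _ _ -> refl)(\_ _ _ -> refl)(code u ʳ++ [])(code t ++ r)))) where
  lm : ∀ n m -> (3 + 7 * n) +((n * 6 + 1) +((3 + 7 * m) +((n * 6 + 1) +((n * 6 + 1) +(m * 6 + 1))))) +(35 * n + 47 * m + 50) == 60 *(n + m) + 60
  lm = ring

 disc-runs : ∀ t r -> disc ⊢ main(code t ++ r) ⇝[ K(sz t) ] main r
 disc-runs t r = wn(by-slack(48 * sz t + 56)(tr(lm(sz t))(sym(K-def _))))(take-runs t r [] ⨟ takes(ap(\n -> n * 5 + 1)(len-rev t))(clear-runs(\xs -> ⟪ r ∣ xs ∣ [] ∣ [] ⟫)(\_ -> refl)(\_ _ -> refl)(code t ʳ++ []))) where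
  lm : ∀ n -> (3 + 7 * n) +(n * 5 + 1) +(48 * n + 56) == 60 * n + 60
  lm = ring

 bool : Bool -> Tree
 bool tt = node leaf leaf
 bool ff = leaf

 data Differ : List Symbol -> List Symbol -> Set where
  here1 : ∀ {xs ys} -> Differ(b1 ∷ xs)(b0 ∷ ys)
  here2 : ∀ {xs ys} -> Differ(b0 ∷ xs)(b1 ∷ ys)
  there1 : ∀ {xs ys} -> Differ xs ys -> Differ(b1 ∷ xs)(b1 ∷ ys)
  there0 : ∀ {xs ys} -> Differ xs ys -> Differ(b0 ∷ xs)(b0 ∷ ys)

 code-dif : ∀ t u r r' -> t ≢ u -> Differ(code t ++ r)(code u ++ r')
 code-dif leaf leaf r r' t≢u = void(t≢u refl)
 code-dif leaf(node _ _) r r' t≢u = here2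
 code-dif(node _ _) leaf r r' t≢u = here1
 code-dif(node a b)(node a' b') r r' t≢u rewrite ++-assoc(code a)(code b) r | ++-assoc(code a')(code b') r' with a ≟T a'
 ... | no a≢a' = there1(code-dif a a' _ _ a≢a')
 ... | yes refl = there1(common a(code-dif b b' r r' \ { refl -> t≢u refl })) where
  common : ∀ a {xs ys} -> Differ xs ys -> Differ(code a ++ xs)(code a ++ ys)
  common leaf d = there0 d
  common(node a b) {xs} {ys} d rewrite ++-assoc(code a)(code b) xs | ++-assoc(code a)(code b) ys = there1(common a(common b d))

 compare : Prog
 compare = while 2F is-just(br1 2F isB1(br1 3F isB1(pop 2F ⨾ pop 3F)(clear 2F))(br1 3F isB1(clear 2F)(pop 2F ⨾ pop 3F)))

 cmp-same : ∀ t r xs ys {n σ} -> compare ⊢ ⟪ r ∣ [] ∣ xs ∣ ys ⟫ ⇝[ n ] σ -> compare ⊢ ⟪ r ∣ [] ∣ code t ++ xs ∣ code t ++ ys ⟫ ⇝[ 5 * sz t + n ] σ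
 cmp-same leaf r xs ys d = loop≤ refl(else≤ refl(else≤ refl(exl pop ⨟ exl pop))) d
 cmp-same(node a b) r xs ys {n} {σ} d = wn(eq≤(lm(sz a)(sz b) n))(loop≤ refl(then≤ refl(then≤ refl(exl pop ⨟ exl pop)))(subst2(\x y -> compare ⊢ ⟪ r ∣ [] ∣ x ∣ y ⟫ ⇝[ _ ] σ)(sym(++-assoc(code a)(code b) xs))(sym(++-assoc(code a)(code b) ys))(cmp-same a r _ _(cmp-same b r xs ys d)))) where
  lm : ∀ a b n -> suc(4 +(5 * a +(5 * b + n))) == 5 * suc(a + b) + n
  lm = ring

 cmp-dif : ∀ r {xs ys} -> Differ xs ys -> ∃[ y ] ∃[ ys' ] len(y ∷ ys') ≤ len ys ×(compare ⊢ ⟪ r ∣ [] ∣ xs ∣ ys ⟫ ⇝[ 5 * len xs + 9 ] ⟪ r ∣ [] ∣ [] ∣ y ∷ ys' ⟫)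
 cmp-dif r(here1 {xs} {ys}) = _ , _ , rfl , wn(by-slack 4(lm(len xs)))(loop≤ refl(then≤ refl(else≤ refl(clear-runs(\xs -> ⟪ r ∣ [] ∣ xs ∣ b0 ∷ ys ⟫)(\_ -> refl)(\_ _ -> refl)(b1 ∷ xs))))(exl(done refl))) where
  lm : ∀ n -> suc(2 +(suc n * 5 + 1) + 1) + 4 == 5 * suc n + 9
  lm = ring
 cmp-dif r(here2 {xs} {ys}) = _ , _ , rfl , wn(by-slack 4(lm(len xs)))(loop≤ refl(else≤ refl(then≤ refl(clear-runs(\xs -> ⟪ r ∣ [] ∣ xs ∣ b1 ∷ ys ⟫)(\_ -> refl)(\_ _ -> refl)(b0 ∷ xs))))(exl(done refl))) where
  lm : ∀ n -> suc(2 +(suc n * 5 + 1) + 1) + 4 == 5 * suc n + 9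
  lm = ring
 cmp-dif r(there1 {xs} d) with cmp-dif r d
 ... | y , ys' , l , e = y , ys' , m≤n⇒m≤1+n l , wn(eq≤(lm(len xs)))(loop≤ refl(then≤ refl(then≤ refl(exl pop ⨟ exl pop))) e) where
  lm : ∀ n -> suc(4 +(5 * n + 9)) == 5 * suc n + 9
  lm = ring
 cmp-dif r(there0 {xs} d) with cmp-dif r d
 ... | y , ys' , l , e = y , ys' , m≤n⇒m≤1+n l , wn(eq≤(lm(len xs)))(loop≤ refl(else≤ refl(else≤ refl(exl pop ⨟ exl pop))) e) where
  lm : ∀ n -> suc(4 +(5 * n + 9)) == 5 * suc n + 9
  lm = ring

 equal : Prog
 equal = take ⨾ spill 1F 2F ⨾ take ⨾ spill 1F 3F ⨾ compare ⨾ br1 3F is-just(clear 3F ⨾ push 0F b0)(push 0F b0 ⨾ push 0F b0 ⨾ push 0F b1)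

 equal-runs : ∀ t u r -> equal ⊢ main(code t ++ code u ++ r) ⇝[ K(sz t + sz u) ] main(code(bool(does(t ≟T u))) ++ r)
 equal-runs t u r = wn(by-slack(42 * sz t + 42 * sz u + 30)(tr(lm(sz t)(sz u))(sym(K-def _))))(take-runs t(code u ++ r) [] ⨟ takes(ap(\n -> n * 6 + 1)(len-rev t))(ends(ap(\z -> ⟪ code u ++ r ∣ [] ∣ z ∣ [] ⟫)(ʳ++[](code t)))(spill1(\xs ys -> ⟪ code u ++ r ∣ xs ∣ ys ∣ [] ⟫)(\_ _ -> refl)(\_ _ _ -> refl)(\_ _ _ -> refl)(code t ʳ++ []) [])) ⨟ take-runs u r(code t) ⨟ takes(ap(\n -> n * 6 + 1)(len-rev u))(ends(ap(\z -> ⟪ r ∣ [] ∣ code t ∣ z ⟫)(ʳ++[](code u)))(spill1(\xs ys -> ⟪ r ∣ xs ∣ code t ∣ ys ⟫)(\_ _ -> refl)(\_ _ _ -> refl)(\_ _ _ -> refl)(code u ʳ++ []) [])) ⨟ verdict) where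
  lm : ∀ n m -> (3 + 7 * n) +((n * 6 + 1) +((3 + 7 * m) +((m * 6 + 1) +(5 * n + 5 * m + 22)))) +(42 * n + 42 * m + 30) == 60 *(n + m) + 60
  lm = ring
  rest : Prog
  rest = br1 3F is-just(clear 3F ⨾ push 0F b0)(push 0F b0 ⨾ push 0F b0 ⨾ push 0F b1)
  verdict : compare ⨾ rest ⊢ ⟪ r ∣ [] ∣ code t ∣ code u ⟫ ⇝[ 5 * sz t + 5 * sz u + 22 ] main(code(bool(does(t ≟T u))) ++ r)
  verdict with t ≟T u
  ... | yes refl = wn(by-slack(5 * sz t + 14)(eq(sz t)))(tp(\z -> compare ⊢ ⟪ r ∣ [] ∣ z ∣ z ⟫ ⇝[ 5 * sz t + 1 ] main r)(++-identityʳ(code t))(cmp-same t r [] [](exl(done refl))) ⨟ else≤ refl(exl push ⨟ exl push ⨟ exl push)) where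
   eq : ∀ n -> 5 * n + 1 + 7 +(5 * n + 14) == 5 * n + 5 * n + 22
   eq = ring
  ... | no t≢u with subst2 Differ(++-identityʳ(code t))(++-identityʳ(code u))(code-dif t u [] [] t≢u)
  ... | d with cmp-dif r d
  ... | y , ys , l , e = wn(via(+≤ʳ(5 * len(code t) + 9)(+≤ʳ 1(+≤ˡ 2(+≤ˡ 1(*≤ˡ 5 l)))))(by(ap2(\a b -> 5 * a + 9 + suc(b * 5 + 1 + 2))(len-code t)(len-code u))(by-slack 9(eq(sz t)(sz u)))))(e ⨟ then≤ refl(clear-runs(\xs -> ⟪ r ∣ [] ∣ [] ∣ xs ⟫)(\_ -> refl)(\_ _ -> refl)(y ∷ ys) ⨟ exl push)) where
   eq : ∀ n m -> 5 * n + 9 + suc(m * 5 + 1 + 2) + 9 == 5 * n + 5 * m + 22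
   eq = ring

module Comp where
 open N
 open import Defs
 open Machine
 open TreeOps

 infixl 6 _⊕_
 infixl 7 _⊗_
 infixl 8 _∘P_

 data Pol : Set where
  con : ℕ -> Pol
  idP : Pol
  _⊕_ _⊗_ : Pol -> Pol -> Pol
  kP : Pol -> Pol

 ⟦_⟧ : Pol -> ℕ -> ℕ
 ⟦ con k ⟧ n = k
 ⟦ idP ⟧ n = n
 ⟦ p ⊕ q ⟧ n = ⟦ p ⟧ n + ⟦ q ⟧ n
 ⟦ kP p ⟧ n = K(⟦ p ⟧ n)
 ⟦ p ⊗ q ⟧ n = ⟦ p ⟧ n * ⟦ q ⟧ n

 ⟦_⟧-mn : ∀ p {m n} -> m ≤ n -> ⟦ p ⟧ m ≤ ⟦ p ⟧ n
 ⟦ con k ⟧-mn l = rfl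
 ⟦ idP ⟧-mn l = l
 ⟦ kP p ⟧-mn l = K-mono(⟦ p ⟧-mn l)
 ⟦ p ⊕ q ⟧-mn l = +≤(⟦ p ⟧-mn l)(⟦ q ⟧-mn l)
 ⟦ p ⊗ q ⟧-mn l = *≤(⟦ p ⟧-mn l)(⟦ q ⟧-mn l)

 _∘P_ : Pol -> Pol -> Pol
 con k ∘P r = con k
 idP ∘P r = r
 kP p ∘P r = kP(p ∘P r)
 (p ⊕ q) ∘P r = (p ∘P r) ⊕(q ∘P r)
 (p ⊗ q) ∘P r = (p ∘P r) ⊗(q ∘P r)

 ∘P-e : ∀ p r n -> ⟦ p ∘P r ⟧ n == ⟦ p ⟧(⟦ r ⟧ n)
 ∘P-e(con k) r n = refl
 ∘P-e idP r n = refl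
 ∘P-e(kP p) r n = ap K(∘P-e p r n)
 ∘P-e(p ⊕ q) r n = ap2 _+_(∘P-e p r n)(∘P-e q r n)
 ∘P-e(p ⊗ q) r n = ap2 _*_(∘P-e p r n)(∘P-e q r n)

 power-bd : ∀ p -> ∃[ c ] ∃[ d ] ∀ n -> ⟦ p ⟧ n ≤ c * suc n ^ d
 power-bd(con k) = k , 0 , \n -> eq≤(sym(*1 k))
 power-bd idP = 1 , 1 , \n -> to(n≤1+n n)(sym(tr(1* _)(*1(suc n))))
 power-bd(kP p) with power-bd p
 ... | c , d , l = 60 * c + 60 , d , \n -> by(K-def(⟦ p ⟧ n))(to(+≤(*≤ʳ 60(l n))(*≤ʳ 60(m^n>0(suc n) d)))(lm c(suc n ^ d))) where
  lm : ∀ c x -> 60 *(c * x) + 60 * x ==(60 * c + 60) * x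
  lm = ring
 power-bd(p ⊕ q) with power-bd p | power-bd q
 ... | c , d , l | c' , d' , l' = c + c' , d + d' , \n -> to(+≤(via(l n)(*≤ʳ c(^-monoʳ-≤(suc n)(l≤ d d'))))(via(l' n)(*≤ʳ c'(^-monoʳ-≤(suc n)(r≤ d' d)))))(sym(*-distribʳ-+(suc n ^(d + d')) c c'))
 power-bd(p ⊗ q) with power-bd p | power-bd q
 ... | c , d , l | c' , d' , l' = c * c' , d + d' , \n -> to(*≤(l n)(l' n))(tr(lm c(suc n ^ d) c'(suc n ^ d'))(ap((c * c') *_)(sym(^-distribˡ-+-*(suc n) d d')))) where
  lm : ∀ a x b y -> (a * x) *(b * y) ==(a * b) *(x * y)
  lm = ring

 polynomial-bd : ∀ p -> ∃[ c ] ∃[ d ] ∀ n -> ⟦ p ⟧ n ≤ c * n ^ d + c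
 polynomial-bd p with power-bd p
 ... | c , d , l = c * 2 ^ d , d , \n -> via(l n)(bd1 n) where
  bd1 : ∀ n -> c * suc n ^ d ≤ c * 2 ^ d * n ^ d + c * 2 ^ d
  bd1 zero = via(*≤ʳ c(by(^-zeroˡ d)(by(sym(^-zeroˡ d))(^-monoˡ-≤ d(s≤s z≤n)))))(r≤ _ _)
  bd1(suc n) = via(*≤ʳ c(^-monoˡ-≤ d(tp(suc(suc n) ≤_)(twice n)(s≤s(s≤s(l≤ n n))))))(by(tr(ap(c *_)(^-distribʳ-* d 2(suc n)))(sym(*-assoc c(2 ^ d)(suc n ^ d))))(l≤ _ _)) where
   twice : ∀ n -> 2 +(n + n) == 2 * suc n
   twice = ring
   ^-distribʳ-* : ∀ d a b -> (a * b) ^ d == a ^ d * b ^ d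
   ^-distribʳ-* zero a b = refl
   ^-distribʳ-*(suc d) a b = tr(ap((a * b) *_)(^-distribʳ-* d a b))(swp a b(a ^ d)(b ^ d)) where
    swp : ∀ a b x y -> (a * b) *(x * y) ==(a * x) *(b * y)
    swp = ring

 record Ctx : Set₁ where
  constructor ctx
  field
   Idx : Set
   env : Idx -> Tree

 open Ctx public

 infix 3 _⊩_

 record _⊩_(Γ : Ctx)(v : Idx Γ -> Tree) : Set where
  constructor computes
  field
   prog : Prog
   time : Pol
   out : Pol
   runs : ∀ γ rest -> prog ⊢ main(code(env Γ γ) ++ rest) ⇝[ ⟦ time ⟧(sz(env Γ γ)) ] main(code(v γ) ++ rest)
   sml : ∀ γ -> sz(v γ) ≤ ⟦ out ⟧(sz(env Γ γ))

 open _⊩_ public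

 conv : ∀ {Γ v w} -> (∀ γ -> v γ == w γ) -> Γ ⊩ v -> Γ ⊩ w
 conv {Γ} eq p = record
  { prog = prog p ;time = time p ;out = out p
  ;runs = \ γ rest -> ends(ap(\t -> main(code t ++ rest))(eq γ))(runs p γ rest)
  ;sml = \ γ -> tp(\t -> sz t ≤ ⟦ out p ⟧(sz(env Γ γ)))(eq γ)(sml p γ) }

 ridx : ∀ {Y Δ v}(σ : Y -> Idx Δ) -> Δ ⊩ v -> ctx Y(env Δ ∘ σ) ⊩ v ∘ σ
 ridx σ p = record
  { prog = prog p ;time = time p ;out = out p
  ;runs = \ γ -> runs p(σ γ) ;sml = \ γ -> sml p(σ γ) }

 whole : ∀ {Γ} -> Γ ⊩ env Γ
 whole = record { prog = skip ;time = con 1 ;out = idP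
         ;runs = \_ _ -> exl skip ;sml = \_ -> rfl }

 infixr 5 _⟫_

 _⟫_ : ∀ {Γ v w} -> Γ ⊩ v -> ctx(Idx Γ) v ⊩ w -> Γ ⊩ w
 _⟫_ {Γ} p q = record
  { prog = prog p ⨾ prog q
  ;time = time p ⊕(time q ∘P out p)
  ;out = out q ∘P out p
  ;runs = \ γ rest -> runs p γ rest ⨟ wn(to(⟦ time q ⟧-mn(sml p γ))(sym(∘P-e(time q)(out p) _)))(runs q γ rest)
  ;sml = \ γ -> via(sml q γ)(to(⟦ out q ⟧-mn(sml p γ))(sym(∘P-e(out q)(out p) _))) }

 pair : ∀ {Γ} {v w : Idx Γ -> Tree} -> Γ ⊩ v -> Γ ⊩ w -> Γ ⊩(\ γ -> node(v γ)(w γ))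
 pair {Γ} {v} {w} p q = record
  { prog = dup ⨾ prog q ⨾ swap ⨾ prog p ⨾ push 0F b1
  ;time = kP idP ⊕(time q ⊕(kP(out q ⊕ idP) ⊕(time p ⊕ con 2)))
  ;out = con 1 ⊕(out p ⊕ out q)
  ;runs = \ γ rest -> dup-runs(env Γ γ) rest ⨟ runs q γ _ ⨟ wn(K-mono(+≤ˡ(sz(env Γ γ))(sml q γ)))(swap-runs(w γ)(env Γ γ) rest) ⨟ runs p γ _ ⨟ ends(ap(\xs -> main(b1 ∷ xs))(sym(++-assoc(code(v γ))(code(w γ)) rest)))(exl push)
  ;sml = \ γ -> s≤s(+≤(sml p γ)(sml q γ)) }

 first : ∀ {Γ} {v w : Idx Γ -> Tree} -> Γ ⊩(\ γ -> node(v γ)(w γ)) -> Γ ⊩ v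
 first {Γ} {v} {w} p = record
  { prog = prog p ⨾ pop 0F ⨾ swap ⨾ disc
  ;time = time p ⊕(con 1 ⊕(kP(out p) ⊕ kP(out p)))
  ;out = out p
  ;runs = \ γ rest -> runs p γ rest ⨟ ends(ap main(++-assoc(code(v γ))(code(w γ)) rest))(exl pop) ⨟ wn(K-mono(via(n≤1+n _)(sml p γ)))(swap-runs(v γ)(w γ) rest) ⨟ wn(K-mono(via(via(r≤(sz(w γ))(sz(v γ)))(n≤1+n _))(sml p γ)))(disc-runs(w γ)(code(v γ) ++ rest))
  ;sml = \ γ -> via(via(l≤(sz(v γ))(sz(w γ)))(n≤1+n _))(sml p γ) }

 second : ∀ {Γ} {v w : Idx Γ -> Tree} -> Γ ⊩(\ γ -> node(v γ)(w γ)) -> Γ ⊩ w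
 second {Γ} {v} {w} p = record
  { prog = prog p ⨾ pop 0F ⨾ disc
  ;time = time p ⊕(con 1 ⊕ kP(out p))
  ;out = out p
  ;runs = \ γ rest -> runs p γ rest ⨟ ends(ap main(++-assoc(code(v γ))(code(w γ)) rest))(exl pop) ⨟ wn(K-mono(via(via(l≤(sz(v γ))(sz(w γ)))(n≤1+n _))(sml p γ)))(disc-runs(v γ)(code(w γ) ++ rest))
  ;sml = \ γ -> via(via(r≤(sz(w γ))(sz(v γ)))(n≤1+n _))(sml p γ) }

 leaf⊩ : ∀ {Γ} -> Γ ⊩(\_ -> leaf)
 leaf⊩ {Γ} = record
  { prog = disc ⨾ push 0F b0 ;time = kP idP ⊕ con 2 ;out = con 1
  ;runs = \ γ rest -> disc-runs(env Γ γ) rest ⨟ exl push ;sml = \_ -> rfl }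

 equal⊩ : ∀ {Γ} {v w : Idx Γ -> Tree} -> Γ ⊩ v -> Γ ⊩ w -> Γ ⊩(\ γ -> bool(does(v γ ≟T w γ)))
 equal⊩ {Γ} {v} {w} p q = record
  { prog = prog r ⨾ pop 0F ⨾ equal
  ;time = time r ⊕(con 1 ⊕ kP(out r))
  ;out = con 3
  ;runs = \ γ rest -> runs r γ rest ⨟ ends(ap main(++-assoc(code(v γ))(code(w γ)) rest))(exl pop) ⨟ wn(K-mono(via(n≤1+n _)(sml r γ)))(equal-runs(v γ)(w γ) rest)
  ;sml = \ γ -> bool-sml(does(v γ ≟T w γ)) } where
  r = pair p q
  bool-sml : ∀ b -> sz(bool b) ≤ 3
  bool-sml tt = rfl
  bool-sml ff = s≤s z≤n

 -- The two branches only have to be correct where they are taken.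
 by-cases : ∀ {Γ v} {c : Idx Γ -> Bool} -> Γ ⊩ bool ∘ c -> ctx(Σ[ γ ∈ Idx Γ ] c γ == tt)(env Γ ∘ fst) ⊩ v ∘ fst -> ctx(Σ[ γ ∈ Idx Γ ] c γ == ff)(env Γ ∘ fst) ⊩ v ∘ fst -> Γ ⊩ v
 by-cases {Γ} {v} {c} p q r = record
  { prog = dup ⨾ prog p ⨾ br1 0F isB1(disc ⨾ prog q)(disc ⨾ prog r)
  ;time = kP idP ⊕(time p ⊕(con 1 ⊕(con(K 3) ⊕(time q ⊕ time r))))
  ;out = out q ⊕ out r
  ;runs = \ γ rest -> dup-runs(env Γ γ) rest ⨟ runs p γ _ ⨟ decide γ rest(c γ) refl
  ;sml = \ γ -> smaller γ(c γ) refl } where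
  decide : ∀ γ rest b -> c γ == b -> br1 0F isB1(disc ⨾ prog q)(disc ⨾ prog r) ⊢ main(code(bool(c γ)) ++ code(env Γ γ) ++ rest) ⇝[ 1 +(K 3 +(⟦ time q ⟧(sz(env Γ γ)) + ⟦ time r ⟧(sz(env Γ γ)))) ] main(code(v γ) ++ rest)
  decide γ rest tt eq rewrite eq = then≤ refl(disc-runs(bool tt) _ ⨟ wn(l≤ _ _)(runs q(γ , eq) rest))
  decide γ rest ff eq rewrite eq = else≤ refl(wn {m = K 3}(K-mono {1} {3}(s≤s z≤n))(disc-runs leaf _) ⨟ wn(r≤ _ _)(runs r(γ , eq) rest))
  smaller : ∀ γ b -> c γ == b -> sz(v γ) ≤ ⟦ out q ⟧(sz(env Γ γ)) + ⟦ out r ⟧(sz(env Γ γ))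
  smaller γ tt eq = via(sml q(γ , eq))(l≤ _ _)
  smaller γ ff eq = via(sml r(γ , eq))(r≤ _ _)

 list : List Tree -> Tree
 list [] = leaf
 list(t ∷ ts) = node t(list ts)

 module Fold {Γ : Ctx} {A S : Idx Γ -> Set} (⌜_⌝ : ∀ {γ} -> A γ -> Tree) (⌞_⌟ : ∀ {γ} -> S γ -> Tree)
  (xs : ∀ γ -> List(A γ))(s0 : ∀ γ -> S γ)(step : ∀ γ -> A γ -> S γ -> S γ)
  (q : Pol)(grow : ∀ γ x s -> sz ⌞ step γ x s ⌟ ≤ sz ⌞ s ⌟ + ⟦ q ⟧(sz(env Γ γ) + sz ⌜ x ⌝)) where

  Body : Ctx
  Body = ctx(Σ[ γ ∈ Idx Γ ] A γ × S γ) \(γ , x , s) -> node ⌜ x ⌝(node ⌞ s ⌟(env Γ γ))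

  elements : ∀ {γ} -> List(A γ) -> Tree
  elements xs = list(List.map ⌜_⌝ xs)

  len≤ : ∀ {γ}(xs : List(A γ)) -> len xs ≤ sz(elements xs)
  len≤ [] = z≤n
  len≤(x ∷ xs) = s≤s(via(len≤ xs)(r≤ _(sz ⌜ x ⌝)))

  Big : Ctx
  Big = ctx(Σ[ γ ∈ Idx Γ ] A γ × List(A γ) × S γ) \(γ , x , xs , s) -> node(node ⌜ x ⌝(elements xs))(node ⌞ s ⌟(env Γ γ))

  abstract
   advance : Body ⊩(\(γ , x , s) -> ⌞ step γ x s ⌟) -> Big ⊩(\(γ , x , xs , s) -> node(elements xs)(node ⌞ step γ x s ⌟(env Γ γ)))
   advance p = pair(second(first whole))(pair(pair(first(first whole))(second whole) ⟫ ridx(\(γ , x , _ , s) -> γ , x , s) p)(second(second whole)))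

  iterate : Γ ⊩(\ γ -> elements(xs γ)) -> Γ ⊩(\ γ -> ⌞ s0 γ ⌟) -> Body ⊩(\(γ , x , s) -> ⌞ step γ x s ⌟) -> Γ ⊩(\ γ -> node ⌞ foldl(\s x -> step γ x s)(s0 γ)(xs γ) ⌟(env Γ γ))
  iterate pxs ps0 pstep = record
   { prog = prog start ⨾ pop 0F ⨾ while 0F isB1(push 0F b1 ⨾ prog body ⨾ pop 0F) ⨾ pop 0F
   ;time = time start ⊕(con 1 ⊕(out pxs ⊗((time body ∘P width) ⊕ con 4) ⊕ con 1 ⊕ con 1))
   ;out = con 1 ⊕(cap ⊕ idP)
   ;runs = \ γ rest -> runs start γ rest ⨟ ends(ap main(++-assoc(code(elements(xs γ)))(code(node ⌞ s0 γ ⌟(env Γ γ))) rest))(exl pop) ⨟(wn(+≤ˡ 1(*≤ˡ _(ℓ≤ γ)))(go γ rest(xs γ)(s0 γ)(sml pxs γ)(start≤ γ)) ⨟ exl pop)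
   ;sml = \ γ -> s≤s(+≤ˡ(sz(env Γ γ))(final γ(xs γ)(s0 γ)(sml pxs γ)(start≤ γ))) } where
   start = pair pxs(pair ps0 whole)
   body = advance pstep
   gain cap width : Pol
   gain = q ∘P(idP ⊕ out pxs)
   cap = out ps0 ⊕(out pxs ⊗ gain)
   width = con 1 ⊕(out pxs ⊕(con 1 ⊕(cap ⊕ idP)))
   ℓ≤ : ∀ γ -> len(xs γ) ≤ ⟦ out pxs ⟧(sz(env Γ γ))
   ℓ≤ γ = via(len≤(xs γ))(sml pxs γ)
   start≤ : ∀ γ -> sz ⌞ s0 γ ⌟ + len(xs γ) * ⟦ gain ⟧(sz(env Γ γ)) ≤ ⟦ cap ⟧(sz(env Γ γ))
   start≤ γ = +≤(sml ps0 γ)(*≤ˡ _(ℓ≤ γ))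
   gain≤ : ∀ γ x(xs : List(A γ)) s -> sz(elements(x ∷ xs)) ≤ ⟦ out pxs ⟧(sz(env Γ γ)) -> sz ⌞ s ⌟ + suc(len xs) * ⟦ gain ⟧(sz(env Γ γ)) ≤ ⟦ cap ⟧(sz(env Γ γ)) -> sz ⌞ step γ x s ⌟ + len xs * ⟦ gain ⟧(sz(env Γ γ)) ≤ ⟦ cap ⟧(sz(env Γ γ))
   gain≤ γ x xs s l c = via(+≤ˡ _(via(grow γ x s)(+≤ʳ(sz ⌞ s ⌟)(to(⟦ q ⟧-mn(+≤ʳ(sz(env Γ γ))(via(via(l≤(sz ⌜ x ⌝) _)(n≤1+n _)) l)))(sym(∘P-e q(idP ⊕ out pxs) _))))))(by(+-assoc(sz ⌞ s ⌟) _ _) c)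
   final : ∀ γ xs s -> sz(elements xs) ≤ ⟦ out pxs ⟧(sz(env Γ γ)) -> sz ⌞ s ⌟ + len xs * ⟦ gain ⟧(sz(env Γ γ)) ≤ ⟦ cap ⟧(sz(env Γ γ)) -> sz ⌞ foldl(\s x -> step γ x s) s xs ⌟ ≤ ⟦ cap ⟧(sz(env Γ γ))
   final γ [] s l c = m+n≤o⇒m≤o _ c
   final γ(x ∷ xs) s l c = final γ xs(step γ x s)(via(via(r≤ _(sz ⌜ x ⌝))(n≤1+n _)) l)(gain≤ γ x xs s l c)
   go : ∀ γ rest xs s -> sz(elements xs) ≤ ⟦ out pxs ⟧(sz(env Γ γ)) -> sz ⌞ s ⌟ + len xs * ⟦ gain ⟧(sz(env Γ γ)) ≤ ⟦ cap ⟧(sz(env Γ γ)) -> while 0F isB1(push 0F b1 ⨾ prog body ⨾ pop 0F) ⊢ main(code(elements xs) ++ code(node ⌞ s ⌟(env Γ γ)) ++ rest) ⇝[ len xs *(⟦ time body ∘P width ⟧(sz(env Γ γ)) + 4) + 1 ] main(code leaf ++ code(node ⌞ foldl(\s x -> step γ x s) s xs ⌟(env Γ γ)) ++ rest)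
   go γ rest [] s l c = exl(done refl)
   go γ rest(x ∷ xs) s l c = takes(lm T(len xs *(T + 4)))(loop≤ refl(ends(ap(\xs -> main(b1 ∷ xs))(sym(++-assoc(code(elements(x ∷ xs)))(code(node ⌞ s ⌟(env Γ γ))) rest)))(exl push) ⨟ wn(to(⟦ time body ⟧-mn(s≤s(+≤ l(s≤s(+≤ˡ(sz(env Γ γ))(m+n≤o⇒m≤o _ c))))))(sym(∘P-e(time body) width _)))(runs body(γ , x , xs , s) rest) ⨟ ends(ap main(++-assoc(code(elements xs))(code(node ⌞ step γ x s ⌟(env Γ γ))) rest))(exl pop))(go γ rest xs(step γ x s)(via(via(r≤ _(sz ⌜ x ⌝))(n≤1+n _)) l)(gain≤ γ x xs s l c))) where
    T = ⟦ time body ∘P width ⟧(sz(env Γ γ))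
    lm : ∀ T L -> suc(2 +(T + 1) +(L + 1)) == T + 4 + L + 1
    lm = ring

  fold : Γ ⊩(\ γ -> elements(xs γ)) -> Γ ⊩(\ γ -> ⌞ s0 γ ⌟) -> Body ⊩(\(γ , x , s) -> ⌞ step γ x s ⌟) -> Γ ⊩(\ γ -> ⌞ foldl(\s x -> step γ x s)(s0 γ)(xs γ) ⌟)
  fold pxs ps0 pstep = first(iterate pxs ps0 pstep)

module Typed where
 open N
 open TreeOps
 open Comp
 open import Data.Bool.Properties using (∧-assoc; ∨-assoc; if-float)
 open import Data.List using (cartesianProductWith; cartesianProduct) renaming (replicate to repl)
 open import Data.Bool.ListAction using (all)
 open import Data.Nat.ListAction using (sum)
 open import Data.Sum using (isInj₁)

 num : ℕ -> Tree
 num zero = leaf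
 num(suc n) = node leaf(num n)

 sz-num : ∀ n -> sz(num n) == suc(n + n)
 sz-num zero = refl
 sz-num(suc n) = ap suc(tr(ap suc(sz-num n))(ap suc(sym(+-suc n n))))

 sz-num-mono : ∀ {m n} -> m ≤ n -> sz(num m) ≤ sz(num n)
 sz-num-mono {m} {n} l rewrite sz-num m | sz-num n = s≤s(+≤ l l)

 does-≡ : ∀ {P Q : Set}(p : Dec P)(q : Dec Q) -> (P -> Q) -> (Q -> P) -> does p == does q
 does-≡(yes _)(yes _) f g = refl
 does-≡(yes p)(no ¬q) f g = void(¬q(f p))
 does-≡(no ¬p)(yes q) f g = void(¬p(g q))
 does-≡(no _)(no _) f g = refl

 num-inj : ∀ {m n} -> num m == num n -> m == n
 num-inj {zero} {zero} eq = refl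
 num-inj {suc m} {suc n} eq = ap suc(num-inj(node-injʳ eq)) where
  node-injʳ : ∀ {a b c d} -> node a b == node c d -> b == d
  node-injʳ refl = refl

 rept : {A : Set} -> ℕ -> (A -> A) -> A -> A
 rept zero f x = x
 rept(suc n) f x = rept n f(f x)

 least : ℕ -> (ℕ -> Bool) -> ℕ
 least n p = rept n(\k -> if p k then k else suc k) 0

 pick : {A : Set} -> (A -> Bool) -> A -> List A -> A
 pick p d xs = foldl(\y x -> if p x then x else y) d xs

 foldl-all : {A : Set}(p : A -> Bool)(b : Bool)(xs : List A) -> foldl(\s x -> s ∧ p x) b xs == b ∧ all p xs
 foldl-all p tt [] = refl
 foldl-all p ff [] = refl
 foldl-all p b(x ∷ xs) = tr(foldl-all p(b ∧ p x) xs)(∧-assoc b(p x) _)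

 foldl-any : {A : Set}(p : A -> Bool)(b : Bool)(xs : List A) -> foldl(\s x -> s ∨ p x) b xs == b ∨ any p xs
 foldl-any p tt [] = refl
 foldl-any p ff [] = refl
 foldl-any p b(x ∷ xs) = tr(foldl-any p(b ∨ p x) xs)(∨-assoc b(p x) _)

 foldl-sum : {A : Set}(f : A -> ℕ)(a : ℕ)(xs : List A) -> foldl(\s x -> s + f x) a xs == a + sum(map f xs)
 foldl-sum f a [] = sym(+0 a)
 foldl-sum f a(x ∷ xs) = tr(foldl-sum f(a + f x) xs)(+-assoc a(f x) _)

 foldl-repl : {A : Set}(f : A -> A)(n : ℕ)(a : A) -> foldl(\s _ -> f s) a(repl n unit) == rept n f a
 foldl-repl f zero a = refl
 foldl-repl f(suc n) a = foldl-repl f n(f a)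

 list-repl : ∀ n -> list(map(\_ -> leaf)(repl n unit)) == num n
 list-repl zero = refl
 list-repl(suc n) = ap(node leaf)(list-repl n)

 module Over (I : Set) (param : I -> Tree) where

  record Ty : Set₁ where
   constructor ty
   field
    El : I -> Set
    enc : ∀ {i} -> El i -> Tree
  open Ty public

  record FinTy : Set₁ where
   field
    base : Ty
    elems : ∀ i -> List(El base i)
    cpl : ∀ {i}(x : El base i) -> x ∈ elems i
    inj : ∀ {i} {x y : El base i} -> enc base x == enc base y -> x == y
    listed : ctx I param ⊩ \i -> list(map(enc base)(elems i))
  open FinTy public

  decEq : (X : FinTy) -> ∀ {i}(x y : El(base X) i) -> Dec(x == y)
  decEq X x y = map′(inj X)(ap(enc(base X)))(enc(base X) x ≟T enc(base X) y)

  infixl 5 _▹_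
  data Con : Set₁ where
   ε : Con
   _▹_ : Con -> Ty -> Con

  Env : Con -> I -> Set
  Env ε i = ⊤
  Env(Γ ▹ T) i = Env Γ i × El T i

  tree : ∀ Γ {i} -> Env Γ i -> Tree
  tree ε {i} _ = param i
  tree(Γ ▹ T)(γ , x) = node(enc T x)(tree Γ γ)

  ⌊_⌋ : Con -> Ctx
  ⌊ Γ ⌋ = ctx(Σ[ i ∈ I ] Env Γ i)(\(i , γ) -> tree Γ γ)

  record Tm(Γ : Con)(T : Ty) : Set where
   constructor tm
   field
    fn : ∀ i -> Env Γ i -> El T i
    ok : ⌊ Γ ⌋ ⊩ \(i , γ) -> enc T(fn i γ)
  open Tm public

  -- All values of the type are polynomially bounded in the instance.
  Bounded : Ty -> Set
  Bounded T = ∃[ q ] ∀ {i}(x : El T i) -> sz(enc T x) ≤ ⟦ q ⟧(sz(param i))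

  param≤ : ∀ Γ {i}(γ : Env Γ i) -> sz(param i) ≤ sz(tree Γ γ)
  param≤ ε γ = rfl
  param≤(Γ ▹ T)(γ , x) = via(param≤ Γ γ)(via(r≤ _(sz(enc T x)))(n≤1+n _))

  bdd≤ : ∀ {T}(b : Bounded T) Γ {i}(γ : Env Γ i)(x : El T i) -> sz(enc T x) ≤ ⟦ fst b ⟧(sz(tree Γ γ))
  bdd≤(q , b) Γ γ x = via(b x)(⟦ q ⟧-mn(param≤ Γ γ))

  as : ∀ {Γ T}(t : Tm Γ T)(f : ∀ i -> Env Γ i -> El T i) -> (∀ i γ -> enc T(fn t i γ) == enc T(f i γ)) -> Tm Γ T
  as t f eq = tm f(conv(\(i , γ) -> eq i γ)(ok t))

  param⊩ : ∀ Γ -> ⌊ Γ ⌋ ⊩ \(i , γ) -> param i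
  param⊩ ε = whole
  param⊩(Γ ▹ T) = second whole ⟫ ridx(\(i , γ , x) -> i , γ)(param⊩ Γ)

  v0 : ∀ {Γ T} -> Tm(Γ ▹ T) T
  v0 = tm(\i(γ , x) -> x)(first whole)

  wk : ∀ {Γ S T} -> Tm Γ T -> Tm(Γ ▹ S) T
  wk t = tm(\i(γ , x) -> fn t i γ)(second whole ⟫ ridx(\(i , γ , x) -> i , γ)(ok t))

  v1 : ∀ {Γ S T} -> Tm(Γ ▹ T ▹ S) T
  v1 = wk v0

  v2 : ∀ {Γ S T U} -> Tm(Γ ▹ T ▹ S ▹ U) T
  v2 = wk v1

  v3 : ∀ {Γ S T U W} -> Tm(Γ ▹ T ▹ S ▹ U ▹ W) T
  v3 = wk v2

  closed : ∀ {Γ T} -> Tm ε T -> Tm Γ T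
  closed {Γ} t = tm(\i _ -> fn t i unit)(param⊩ Γ ⟫ ridx(\(i , _) -> i , unit)(ok t))

  bind : ∀ {Γ S T} -> Tm Γ S -> Tm(Γ ▹ S) T -> Tm Γ T
  bind a t = tm(\i γ -> fn t i(γ , fn a i γ))(pair(ok a) whole ⟫ ridx(\(i , γ) -> i , γ , fn a i γ)(ok t))

  BoolT NatT : Ty
  BoolT = ty(\_ -> Bool) bool
  NatT = ty(\_ -> ℕ) num

  infixr 4 _×T_

  _×T_ : Ty -> Ty -> Ty
  S ×T T = ty(\i -> El S i × El T i)(\(x , y) -> node(enc S x)(enc T y))

  _,T_ : ∀ {Γ S T} -> Tm Γ S -> Tm Γ T -> Tm Γ(S ×T T)
  s ,T t = tm(\i γ -> fn s i γ , fn t i γ)(pair(ok s)(ok t))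

  fstT : ∀ {Γ S T} -> Tm Γ(S ×T T) -> Tm Γ S
  fstT t = tm(\i γ -> fst(fn t i γ))(first(ok t))

  sndT : ∀ {Γ S T} -> Tm Γ(S ×T T) -> Tm Γ T
  sndT t = tm(\i γ -> snd(fn t i γ))(second(ok t))

  trueT falseT : ∀ {Γ} -> Tm Γ BoolT
  trueT = tm(\_ _ -> tt)(pair leaf⊩ leaf⊩)
  falseT = tm(\_ _ -> ff) leaf⊩

  ite : ∀ {Γ T} -> Tm Γ BoolT -> Tm Γ T -> Tm Γ T -> Tm Γ T
  ite {Γ} {T} c t e = tm(\i γ -> if fn c i γ then fn t i γ else fn e i γ)(by-cases(ok c)(conv(\(γ , eq) -> sym(ap(\b -> enc T(if b then _ else _)) eq))(ridx fst(ok t)))(conv(\(γ , eq) -> sym(ap(\b -> enc T(if b then _ else _)) eq))(ridx fst(ok e))))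

  infixr 6 _∧T_
  infixr 5 _∨T_

  _∧T_ _∨T_ : ∀ {Γ} -> Tm Γ BoolT -> Tm Γ BoolT -> Tm Γ BoolT
  s ∧T t = as(ite s t falseT)(\i γ -> fn s i γ ∧ fn t i γ)(\i γ -> ap bool(lm(fn s i γ))) where
   lm : ∀ b {c} -> (if b then c else ff) == b ∧ c
   lm tt = refl
   lm ff = refl
  s ∨T t = as(ite s trueT t)(\i γ -> fn s i γ ∨ fn t i γ)(\i γ -> ap bool(lm(fn s i γ))) where
   lm : ∀ b {c} -> (if b then tt else c) == b ∨ c
   lm tt = refl
   lm ff = refl

  notT : ∀ {Γ} -> Tm Γ BoolT -> Tm Γ BoolT
  notT s = as(ite s falseT trueT)(\i γ -> not(fn s i γ))(\i γ -> ap bool(lm(fn s i γ))) where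
   lm : ∀ b -> (if b then ff else tt) == not b
   lm tt = refl
   lm ff = refl

  eqT : ∀ {Γ}(X : FinTy) -> Tm Γ(base X) -> Tm Γ(base X) -> Tm Γ BoolT
  eqT X s t = tm(\i γ -> does(decEq X(fn s i γ)(fn t i γ)))(equal⊩(ok s)(ok t))

  zeroT : ∀ {Γ} -> Tm Γ NatT
  zeroT = tm(\_ _ -> 0) leaf⊩

  sucT : ∀ {Γ} -> Tm Γ NatT -> Tm Γ NatT
  sucT t = tm(\i γ -> suc(fn t i γ))(pair leaf⊩(ok t))

  isZeroT : ∀ {Γ} -> Tm Γ NatT -> Tm Γ BoolT
  isZeroT t = tm(\i γ -> fn t i γ ≡ᵇ 0)(conv(\(i , γ) -> ap bool(lm(fn t i γ)))(equal⊩(ok t) leaf⊩)) where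
   lm : ∀ n -> does(num n ≟T leaf) ==(n ≡ᵇ 0)
   lm zero = refl
   lm(suc n) = refl

  predT : ∀ {Γ} -> Tm Γ NatT -> Tm Γ NatT
  predT t = tm(\i γ -> pred(fn t i γ))(by-cases(ok(isZeroT t))(conv(\((i , γ) , eq) -> ap num(zero-case(fn t i γ) eq)) leaf⊩)(second(conv {w = \((i , γ) , eq) -> node leaf(num(pred(fn t i γ)))}(\((i , γ) , eq) -> suc-case(fn t i γ) eq)(ridx fst(ok t))))) where
   zero-case : ∀ n -> (n ≡ᵇ 0) == tt -> 0 == pred n
   zero-case zero _ = refl
   suc-case : ∀ n -> (n ≡ᵇ 0) == ff -> num n == node leaf(num(pred n))
   suc-case(suc n) _ = refl

  -- Iteration with a bound on how much one step can enlarge the state.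
  reptT : ∀ {Γ S} -> Tm Γ NatT -> Tm Γ S -> (t : Tm(Γ ▹ S) S)(q : Pol) -> (∀ i γ s -> sz(enc S(fn t i(γ , s))) ≤ sz(enc S s) + ⟦ q ⟧(sz(tree Γ γ))) -> Tm Γ S
  reptT {Γ} {S} n s t q grow = tm(\i γ -> rept(fn n i γ)(\s -> fn t i(γ , s))(fn s i γ))(conv(\(i , γ) -> ap(enc S)(foldl-repl(\s -> fn t i(γ , s))(fn n i γ)(fn s i γ)))(F.fold(conv(\(i , γ) -> sym(list-repl(fn n i γ)))(ok n))(ok s)(second whole ⟫ ridx(\((i , γ) , _ , s) -> i , γ , s)(ok t)))) where
   module F = Fold {Γ = ⌊ Γ ⌋} {A = \ _ -> ⊤} {S = \ (i , _) -> El S i} (\ _ -> leaf) (enc S)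
    (\(i , γ) -> repl(fn n i γ) unit)(\(i , γ) -> fn s i γ)(\(i , γ) _ s -> fn t i(γ , s))
    q(\(i , γ) _ s -> via(grow i γ s)(+≤ʳ _(⟦ q ⟧-mn(l≤ _ 1))))

  loopT : ∀ {Γ S} -> Bounded S -> Tm Γ NatT -> Tm Γ S -> Tm(Γ ▹ S) S -> Tm Γ S
  loopT {Γ} {S} b n s t = reptT n s t(fst b) \i γ s -> via(bdd≤ {S} b Γ γ(fn t i(γ , s)))(r≤ _ _)

  -- The q-bounded growth per element is measured against environment and element.
  foldT : ∀ {Γ S}(X : FinTy) -> Tm Γ S -> (t : Tm(Γ ▹ S ▹ base X) S)(q : Pol) -> (∀ i γ s x -> sz(enc S(fn t i((γ , s) , x))) ≤ sz(enc S s) + ⟦ q ⟧(sz(tree Γ γ) + sz(enc(base X) x))) -> Tm Γ S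
  foldT {Γ} {S} X s t q grow = tm(\i γ -> foldl(\s x -> fn t i((γ , s) , x))(fn s i γ)(elems X i))(F.fold(param⊩ Γ ⟫ ridx fst(listed X))(ok s)(ridx(\((i , γ) , x , s) -> i ,(γ , s) , x)(ok t))) where
   module F = Fold {Γ = ⌊ Γ ⌋} {A = \ (i , _) -> El (base X) i} {S = \ (i , _) -> El S i} (enc (base X)) (enc S)
    (\(i , γ) -> elems X i)(\(i , γ) -> fn s i γ)(\(i , γ) x s -> fn t i((γ , s) , x))
    q(\(i , γ) x s -> grow i γ s x)

  foldBT : ∀ {Γ S}(X : FinTy) -> Bounded S -> Tm Γ S -> Tm(Γ ▹ S ▹ base X) S -> Tm Γ S
  foldBT {Γ} {S} X b s t = foldT X s t(fst b) \i γ s x -> via(via(bdd≤ {S} b Γ γ(fn t i((γ , s) , x)))(⟦ fst b ⟧-mn(l≤ _ _)))(r≤ _ _)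

  bool-bdd : Bounded BoolT
  bool-bdd = con 3 , \ { tt -> rfl ;ff -> s≤s z≤n }

  -- Reorders the state below the element so that the body does not see it.
  under : ∀ {Γ S X T} -> Tm(Γ ▹ X) T -> Tm(Γ ▹ S ▹ X) T
  under t = tm(\i((γ , s) , x) -> fn t i(γ , x))(pair(first whole)(second(second whole)) ⟫ ridx(\(i ,(γ , s) , x) -> i , γ , x)(ok t))

  allT anyT : ∀ {Γ}(X : FinTy) -> Tm(Γ ▹ base X) BoolT -> Tm Γ BoolT
  allT X t = as(foldBT X bool-bdd trueT(v1 ∧T under t))(\i γ -> all(\x -> fn t i(γ , x))(elems X i))(\i γ -> ap bool(foldl-all(\x -> fn t i(γ , x)) tt(elems X i)))
  anyT X t = as(foldBT X bool-bdd falseT(v1 ∨T under t))(\i γ -> any(\x -> fn t i(γ , x))(elems X i))(\i γ -> ap bool(foldl-any(\x -> fn t i(γ , x)) ff(elems X i)))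

  infixl 6 _+T_ _∸T_
  infixl 7 _*T_ _⊓T_
  infix 5 _≤T_

  _+T_ _∸T_ _*T_ _⊓T_ : ∀ {Γ} -> Tm Γ NatT -> Tm Γ NatT -> Tm Γ NatT
  s +T t = as(reptT s t(sucT v0)(con 2) \i γ n -> eq≤(+-comm 2(sz(num n))))(\i γ -> fn s i γ + fn t i γ)(\i γ -> ap num(lm(fn s i γ)(fn t i γ))) where
   lm : ∀ m n -> rept m suc n == m + n
   lm zero n = refl
   lm(suc m) n = tr(lm m(suc n))(+-suc m n)
  s ∸T t = as(reptT t s(predT v0)(con 0) \i γ n -> via(sz-num-mono(pred[n]≤n {n}))(l≤ _ 0))(\i γ -> fn s i γ ∸ fn t i γ)(\i γ -> ap num(lm(fn t i γ)(fn s i γ))) where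
   lm : ∀ m n -> rept m pred n == n ∸ m
   lm zero n = refl
   lm(suc m) zero = tr(lm m 0)(0∸n≡0 m)
   lm(suc m)(suc n) = lm m n
  _*T_ {Γ} s t = as(reptT s zeroT(wk t +T v0)(out(ok t)) grow)(\i γ -> fn s i γ * fn t i γ)(\i γ -> ap num(tr(lm(fn t i γ)(fn s i γ) 0)(+0 _))) where
   lm : ∀ n m a -> rept m(n +_) a == m * n + a
   lm n zero a = refl
   lm n(suc m) a = tr(lm n m(n + a))(tr(sym(+-assoc(m * n) n a))(ap(_+ a)(+-comm(m * n) n)))
   double : ∀ a b -> suc(a + b +(a + b)) ≤ suc(b + b) + suc(a + a)
   double a b = s≤s(by(tr(+-assoc a b(a + b))(tr(ap(a +_)(tr(sym(+-assoc b a b))(tr(ap(_+ b)(+-comm b a))(+-assoc a b b))))(tr(sym(+-assoc a a(b + b)))(+-comm(a + a)(b + b)))))(+≤ʳ(b + b)(n≤1+n _)))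
   grow : ∀ i γ a -> sz(num(fn t i γ + a)) ≤ sz(num a) + ⟦ out(ok t) ⟧(sz(tree Γ γ))
   grow i γ a = via(subst2 _≤_(sym(sz-num(fn t i γ + a)))(sym(ap2 _+_(sz-num a)(sz-num(fn t i γ))))(double(fn t i γ) a))(+≤ʳ(sz(num a))(sml(ok t)(i , γ)))
  s ⊓T t = as(s ∸T(s ∸T t))(\i γ -> fn s i γ ⊓ fn t i γ)(\i γ -> ap num(m∸[m∸n]≡m⊓n(fn s i γ)(fn t i γ))) where
   m∸[m∸n]≡m⊓n : ∀ m n -> m ∸(m ∸ n) == m ⊓ n
   m∸[m∸n]≡m⊓n m n with ≤-total m n
   ... | inl m≤n = tr(ap(m ∸_)(m≤n⇒m∸n≡0 m≤n))(sym(m≤n⇒m⊓n≡m m≤n))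
   ... | inr n≤m = tr(m∸[m∸n]≡n n≤m)(sym(m≥n⇒m⊓n≡n n≤m))

  _≤T_ : ∀ {Γ} -> Tm Γ NatT -> Tm Γ NatT -> Tm Γ BoolT
  s ≤T t = as(isZeroT(s ∸T t))(\i γ -> fn s i γ ≤ᵇ fn t i γ)(\i γ -> ap bool(lm(fn s i γ)(fn t i γ))) where
   lm : ∀ m n -> (m ∸ n ≡ᵇ 0) ==(m ≤ᵇ n)
   lm zero n = ap(_≡ᵇ 0)(0∸n≡0 n)
   lm(suc m) zero = refl
   lm(suc zero)(suc n) = ap(_≡ᵇ 0)(0∸n≡0 n)
   lm(suc(suc m))(suc zero) = refl
   lm(suc(suc m))(suc(suc n)) = lm(suc m)(suc n)

  sumT : ∀ {Γ}(X : FinTy) -> Tm(Γ ▹ base X) NatT -> Tm Γ NatT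
  sumT {Γ} X t = as(foldT X zeroT(under t +T v1)(out(ok t) ∘P(con 1 ⊕ X')) grow)(\i γ -> sum(map(\x -> fn t i(γ , x))(elems X i)))(\i γ -> ap num(tr(swap-args(\x -> fn t i(γ , x)) 0(elems X i))(foldl-sum(\x -> fn t i(γ , x)) 0(elems X i)))) where
   X' = idP
   swap-args : {A : Set}(f : A -> ℕ)(a : ℕ)(xs : List A) -> foldl(\s x -> f x + s) a xs == foldl(\s x -> s + f x) a xs
   swap-args f a [] = refl
   swap-args f a(x ∷ xs) = tr(ap(\b -> foldl(\s x -> f x + s) b xs)(+-comm(f x) a))(swap-args f(a + f x) xs)
   sz-add : ∀ a b -> sz(num(a + b)) ≤ sz(num b) + sz(num a)
   sz-add zero b = l≤ _ 1
   sz-add(suc a) b = to(s≤s(s≤s(sz-add a b)))(sym(tr(+-suc(sz(num b))(suc(sz(num a))))(ap suc(+-suc(sz(num b))(sz(num a))))))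
   grow : ∀ i γ s x -> sz(num(fn t i(γ , x) + s)) ≤ sz(num s) + ⟦ out(ok t) ∘P(con 1 ⊕ X') ⟧(sz(tree Γ γ) + sz(enc(base X) x))
   grow i γ s x = via(sz-add(fn t i(γ , x)) s)(+≤ʳ(sz(num s))(via(sml(ok t)(i , γ , x))(to(⟦ out(ok t) ⟧-mn(s≤s(eq≤(+-comm(sz(enc(base X) x))(sz(tree Γ γ))))))(sym(∘P-e(out(ok t))(con 1 ⊕ X') _)))))

  elem≤ : {A : Set}(f : A -> Tree) {x : A} {xs : List A} -> x ∈ xs -> sz(f x) ≤ sz(list(map f xs))
  elem≤ f {x}(hd refl) = via(l≤ _ _)(n≤1+n _)
  elem≤ f {x}(th {x = y} p) = via(elem≤ f p)(via(r≤ _(sz(f y)))(n≤1+n _))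

  fin-bdd : (X : FinTy) -> Bounded(base X)
  fin-bdd X = out(listed X) , \ {i} x -> via(elem≤(enc(base X))(cpl X x))(sml(listed X) i)

  pickT : ∀ {Γ}(X : FinTy) -> Tm(Γ ▹ base X) BoolT -> Tm Γ(base X) -> Tm Γ(base X)
  pickT X t d = as(foldBT X(fin-bdd X) d(ite(under t) v0 v1))(\i γ -> pick(\x -> fn t i(γ , x))(fn d i γ)(elems X i))(\_ _ -> refl)

  leastT : ∀ {Γ} -> Tm Γ NatT -> Tm(Γ ▹ NatT) BoolT -> Tm Γ NatT
  leastT n t = as(reptT n zeroT(ite t v0(sucT v0))(con 2) grow)(\i γ -> least(fn n i γ) \k -> fn t i(γ , k))(\_ _ -> refl) where
   grow' : ∀ b k -> sz(num(if b then k else suc k)) ≤ sz(num k) + 2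
   grow' tt k = l≤ _ 2
   grow' ff k = eq≤(+-comm 2(sz(num k)))
   grow : ∀ i γ k -> sz(num(if fn t i(γ , k) then k else suc k)) ≤ sz(num k) + 2
   grow i γ k = grow'(fn t i(γ , k)) k

module Tables where
 open N
 open TreeOps
 open Comp
 open Typed
 open import Data.Maybe using (maybe′)

 ∈-ʳ++ʳ : {A : Set} {y : A}(ys : List A) {acc : List A} -> y ∈ acc -> y ∈ ys ʳ++ acc
 ∈-ʳ++ʳ [] p = p
 ∈-ʳ++ʳ(x ∷ ys) p = ∈-ʳ++ʳ ys(th p)

 ∈-ʳ++ˡ : {A : Set} {y : A} {ys : List A} {acc : List A} -> y ∈ ys -> y ∈ ys ʳ++ acc
 ∈-ʳ++ˡ {ys = _ ∷ ys}(hd refl) = ∈-ʳ++ʳ ys(hd refl)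
 ∈-ʳ++ˡ {ys = _ ∷ ys}(th p) = ∈-ʳ++ˡ p

 gath : {A B : Set} -> (A -> List B) -> List B -> List A -> List B
 gath f = foldl(\acc x -> f x ʳ++ acc)

 ∈-gathʳ : {A B : Set}(f : A -> List B) {y : B}(xs : List A) {acc : List B} -> y ∈ acc -> y ∈ gath f acc xs
 ∈-gathʳ f [] p = p
 ∈-gathʳ f(x ∷ xs) p = ∈-gathʳ f xs(∈-ʳ++ʳ(f x) p)

 ∈-gath : {A B : Set}(f : A -> List B) {x : A} {y : B} {xs : List A} {acc : List B} -> x ∈ xs -> y ∈ f x -> y ∈ gath f acc xs
 ∈-gath f {xs = _ ∷ xs}(hd refl) q = ∈-gathʳ f xs(∈-ʳ++ˡ q)
 ∈-gath f {xs = _ ∷ xs}(th p) q = ∈-gath f p q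

 pairs : {A B : Set} -> List A -> List B -> List(A × B)
 pairs xs ys = gath(\x -> gath(\y -> [ x , y ]) [] ys) [] xs

 ∈-pairs : {A B : Set} {x : A} {y : B} {xs : List A} {ys : List B} -> x ∈ xs -> y ∈ ys -> (x , y) ∈ pairs xs ys
 ∈-pairs {x = x} {ys = ys} p q = ∈-gath(\x -> gath(\y -> [ x , y ]) [] ys) p(∈-gath(\y -> [ x , y ]) q(hd refl))

 either : {A B : Set} -> List A -> List B -> List(A ⊎ B)
 either xs ys = gath(\x -> [ inl x ])(gath(\y -> [ inr y ]) [] ys) xs

 ∈-either : {A B : Set} {xs : List A} {ys : List B} -> (∀ x -> x ∈ xs) -> (∀ y -> y ∈ ys) -> ∀ s -> s ∈ either xs ys
 ∈-either p q(inl x) = ∈-gath(\x -> [ inl x ])(p x)(hd refl)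
 ∈-either {xs = xs} p q(inr y) = ∈-gathʳ(\x -> [ inl x ]) xs(∈-gath(\y -> [ inr y ])(q y)(hd refl))

 clip : ∀ U -> ℕ -> Fin(suc U)
 clip U k = fromℕ<(s≤s(m⊓n≤n k U))

 toℕ-clip : ∀ U k -> toℕ(clip U k) == k ⊓ U
 toℕ-clip U k = toℕ-fromℕ<(s≤s(m⊓n≤n k U))

 ents : {A : Set} -> (A -> Tree) -> Tree -> List A -> Tree
 ents g = foldl(\acc x -> node(g x) acc)

 ents-list : {A : Set}(g : A -> Tree)(xs ys : List A) -> ents g(list(map g ys)) xs == list(map g(xs ʳ++ ys))
 ents-list g [] ys = refl
 ents-list g(x ∷ xs) ys = ents-list g xs(x ∷ ys)

 search : {A : Set} -> (A -> Bool) -> (A -> Tree) -> Tree -> List A -> Tree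
 search p v = foldl(\s x -> if p x then v x else s)

 search-keeps : {A : Set}(p : A -> Bool)(v : A -> Tree)(t : Tree) -> (∀ x -> p x == tt -> v x == t) -> (xs : List A) -> search p v t xs == t
 search-keeps p v t h [] = refl
 search-keeps p v t h(x ∷ xs) with p x in eq
 ... | tt rewrite h x eq = search-keeps p v t h xs
 ... | ff = search-keeps p v t h xs

 search-finds : {A : Set}(p : A -> Bool)(v : A -> Tree)(t s : Tree) -> (∀ x -> p x == tt -> v x == t) -> ∀ {x} {xs : List A} -> x ∈ xs -> p x == tt -> search p v s xs == t
 search-finds p v t s h {x} {_ ∷ xs}(hd refl) q rewrite q | h x q = search-keeps p v t h xs
 search-finds p v t s h {x} {y ∷ xs}(th m) q = search-finds p v t _ h m q

 module Over' (I : Set) (param : I -> Tree) where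
  open Over I param public

  RawT : Ty
  RawT = ty(\_ -> Tree)(\t -> t)

  ListT : Ty -> Ty
  ListT T = ty(\i -> List(El T i))(\xs -> list(map(enc T) xs))

  [_]T : ∀ {Γ T} -> Tm Γ T -> Tm Γ(ListT T)
  [ t ]T = tm(\i γ -> fn t i γ ∷ [])(pair(ok t) leaf⊩)

  nilT : ∀ {Γ T} -> Tm Γ(ListT T)
  nilT = tm(\i γ -> []) leaf⊩

  consT : ∀ {Γ T} -> Tm Γ T -> Tm Γ(ListT T) -> Tm Γ(ListT T)
  consT t ts = tm(\i γ -> fn t i γ ∷ fn ts i γ)(pair(ok t)(ok ts))

  sz-ʳ++ : ∀ {i} T(xs ys : List(El T i)) -> sz(enc(ListT T)(xs ʳ++ ys)) ≤ sz(enc(ListT T) ys) + sz(enc(ListT T) xs)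
  sz-ʳ++ T [] ys = l≤ _ 1
  sz-ʳ++ T(x ∷ xs) ys = to(sz-ʳ++ T xs(x ∷ ys))(lm(sz(enc T x))(sz(enc(ListT T) ys))(sz(enc(ListT T) xs))) where
   lm : ∀ a b c -> suc(a + b) + c == b + suc(a + c)
   lm = ring

  _ʳ++T_ : ∀ {Γ T} -> Tm Γ(ListT T) -> Tm Γ(ListT T) -> Tm Γ(ListT T)
  _ʳ++T_ {Γ} {T} xs ys = tm(\i γ -> fn xs i γ ʳ++ fn ys i γ)(conv(\(i , γ) -> ap(enc(ListT T))(lm(fn xs i γ)(fn ys i γ)))(F.fold(ok xs)(ok ys)(pair(first whole)(first(second whole))))) where
   grow : ∀(a b e : ℕ) -> suc(a + b) ≤ b +(1 +(e + a))
   grow a b e = to(s≤s(by(+-comm a b)(+≤ʳ b(r≤ a e))))(sym(+-suc b(e + a)))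
   module F = Fold {Γ = ⌊ Γ ⌋} {A = \ (i , _) -> El T i} {S = \ (i , _) -> List (El T i)} (enc T) (enc (ListT T))
    (\(i , γ) -> fn xs i γ)(\(i , γ) -> fn ys i γ)(\_ x s -> x ∷ s)(con 1 ⊕ idP)
    (\(i , γ) x s -> grow(sz(enc T x))(sz(enc(ListT T) s))(sz(tree Γ γ)))
   lm : {A : Set}(xs ys : List A) -> foldl(\s x -> x ∷ s) ys xs == xs ʳ++ ys
   lm [] ys = refl
   lm(x ∷ xs) ys = lm xs(x ∷ ys)

  gathT : ∀ {Γ T}(X : FinTy) -> Tm(Γ ▹ base X)(ListT T) -> Tm Γ(ListT T) -> Tm Γ(ListT T)
  gathT {Γ} {T} X t a = as(foldT X a(under t ʳ++T v1)(out(ok t) ∘P(con 1 ⊕ idP)) grow)(\i γ -> gath(\x -> fn t i(γ , x))(fn a i γ)(elems X i))(\_ _ -> refl) where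
   grow : ∀ i γ s x -> sz(enc(ListT T)(fn t i(γ , x) ʳ++ s)) ≤ sz(enc(ListT T) s) + ⟦ out(ok t) ∘P(con 1 ⊕ idP) ⟧(sz(tree Γ γ) + sz(enc(base X) x))
   grow i γ s x = via(sz-ʳ++ T(fn t i(γ , x)) s)(+≤ʳ(sz(enc(ListT T) s))(via(sml(ok t)(i , γ , x))(to(⟦ out(ok t) ⟧-mn(s≤s(eq≤(+-comm(sz(enc(base X) x))(sz(tree Γ γ))))))(sym(∘P-e(out(ok t))(con 1 ⊕ idP) _)))))

  infixr 4 _×F_
  infixr 3 _⊎F_
  infixr 3 _⊎T_

  _×F_ : FinTy -> FinTy -> FinTy
  X ×F Y = record
   { base = base X ×T base Y
   ;elems = \i -> pairs(elems X i)(elems Y i)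
   ;cpl = \(x , y) -> ∈-pairs(cpl X x)(cpl Y y)
   ;inj = \eq -> ap2 _,_(inj X(node-inj1 eq))(inj Y(node-inj2 eq))
   ;listed = ridx(\i -> i , _)(ok ts) } where
   ts : Tm ε(ListT(base X ×T base Y))
   ts = gathT X(gathT Y [ v1 ,T v0 ]T nilT) nilT
   node-inj1 : ∀ {a b c d} -> node a b == node c d -> a == c
   node-inj1 refl = refl
   node-inj2 : ∀ {a b c d} -> node a b == node c d -> b == d
   node-inj2 refl = refl

  tag : {A B : Set} -> A ⊎ B -> Tree
  tag(inl _) = leaf
  tag(inr _) = node leaf leaf

  _⊎T_ : Ty -> Ty -> Ty
  S ⊎T T = ty(\i -> El S i ⊎ El T i)(\s -> node(tag s)([ enc S , enc T ]′ s))

  inj1T : ∀ {Γ S T} -> Tm Γ S -> Tm Γ(S ⊎T T)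
  inj1T s = tm(\i γ -> inl(fn s i γ))(pair leaf⊩(ok s))

  inj2T : ∀ {Γ S T} -> Tm Γ T -> Tm Γ(S ⊎T T)
  inj2T s = tm(\i γ -> inr(fn s i γ))(pair(pair leaf⊩ leaf⊩)(ok s))

  case : ∀ {Γ S T U} -> Tm Γ(S ⊎T T) -> Tm(Γ ▹ S) U -> Tm(Γ ▹ T) U -> Tm Γ U
  case {Γ} {S} {T} {U} s f g = tm(\i γ -> [(\x -> fn f i(γ , x)) ,(\y -> fn g i(γ , y)) ]′(fn s i γ))(by-cases(conv(\(i , γ) -> ap bool(tag-left(fn s i γ)))(equal⊩(first(ok s)) leaf⊩))(conv(\((i , γ) , eq) -> sym(ap(enc U)(at-left i γ(fn s i γ) eq)))(pair(conv(\((i , γ) , eq) -> enc-left(fn s i γ) eq)(ridx fst(second(ok s)))) whole ⟫ ridx(\((i , γ) , eq) -> i , γ , left(fn s i γ) eq)(ok f)))(conv(\((i , γ) , eq) -> sym(ap(enc U)(at-right i γ(fn s i γ) eq)))(pair(conv(\((i , γ) , eq) -> enc-right(fn s i γ) eq)(ridx fst(second(ok s)))) whole ⟫ ridx(\((i , γ) , eq) -> i , γ , right(fn s i γ) eq)(ok g)))) where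
   isLeft : {A B : Set} -> A ⊎ B -> Bool
   isLeft(inl _) = tt
   isLeft(inr _) = ff
   tag-left : {A B : Set}(s : A ⊎ B) -> does(tag s ≟T leaf) == isLeft s
   tag-left(inl _) = refl
   tag-left(inr _) = refl
   left : {A B : Set}(s : A ⊎ B) -> isLeft s == tt -> A
   left(inl x) _ = x
   right : {A B : Set}(s : A ⊎ B) -> isLeft s == ff -> B
   right(inr y) _ = y
   enc-left : ∀ {i}(s : El S i ⊎ El T i)(eq : isLeft s == tt) -> [ enc S , enc T ]′ s == enc S(left s eq)
   enc-left(inl x) _ = refl
   enc-right : ∀ {i}(s : El S i ⊎ El T i)(eq : isLeft s == ff) -> [ enc S , enc T ]′ s == enc T(right s eq)
   enc-right(inr y) _ = refl
   at-left : ∀ i γ(s : El S i ⊎ El T i)(eq : isLeft s == tt) -> [(\x -> fn f i(γ , x)) ,(\y -> fn g i(γ , y)) ]′ s == fn f i(γ , left s eq)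
   at-left i γ(inl x) _ = refl
   at-right : ∀ i γ(s : El S i ⊎ El T i)(eq : isLeft s == ff) -> [(\x -> fn f i(γ , x)) ,(\y -> fn g i(γ , y)) ]′ s == fn g i(γ , right s eq)
   at-right i γ(inr y) _ = refl

  _⊎F_ : FinTy -> FinTy -> FinTy
  X ⊎F Y = record
   { base = base X ⊎T base Y
   ;elems = \i -> either(elems X i)(elems Y i)
   ;cpl = ∈-either(cpl X)(cpl Y)
   ;inj = injective
   ;listed = ridx(\i -> i , _)(ok ts) } where
   ts : Tm ε(ListT(base X ⊎T base Y))
   ts = gathT X [ inj1T v0 ]T(gathT Y [ inj2T v0 ]T nilT)
   node-inj2 : ∀ {a b c d} -> node a b == node c d -> b == d
   node-inj2 refl = refl
   injective : ∀ {i} {s t : El(base X) i ⊎ El(base Y) i} -> enc(base X ⊎T base Y) s == enc(base X ⊎T base Y) t -> s == t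
   injective {s = inl x} {inl x'} eq = ap inl(inj X(node-inj2 eq))
   injective {s = inl x} {inr y'}()
   injective {s = inr y} {inl x'}()
   injective {s = inr y} {inr y'} eq = ap inr(inj Y(node-inj2 eq))

  UnitF BoolF : FinTy
  UnitF = record
   { base = ty(\_ -> Data.Unit.⊤)(\_ -> leaf) ;elems = \_ -> _ ∷ [] ;cpl = \_ -> hd refl
   ;inj = \_ -> refl ;listed = pair leaf⊩ leaf⊩ }
   where import Data.Unit
  BoolF = record
   { base = BoolT ;elems = \_ -> tt ∷ ff ∷ []
   ;cpl = \ { tt -> hd refl ;ff -> th(hd refl) }
   ;inj = \ { {x = tt} {tt} _ -> refl ;{x = ff} {ff} _ -> refl ;{x = tt} {ff}() ;{x = ff} {tt}() }
   ;listed = pair(pair leaf⊩ leaf⊩)(pair leaf⊩ leaf⊩) }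

  Below : Tm ε NatT -> Ty
  Below U = ty(\i -> Fin(suc(fn U i _)))(num ∘ toℕ)

  below-bdd : (U : Tm ε NatT) -> Bounded(Below U)
  below-bdd U = out(ok U) , \ {i} x -> via(sz-num-mono(toℕ≤pred[n] x))(sml(ok U)(i , _))

  clipT : ∀ {Γ}(U : Tm ε NatT) -> Tm Γ NatT -> Tm Γ(Below U)
  clipT U t = tm(\i γ -> clip(fn U i _)(fn t i γ))(conv(\(i , γ) -> ap num(sym(toℕ-clip(fn U i _)(fn t i γ))))(ok(t ⊓T closed U)))

  toℕT : ∀ {Γ} {U : Tm ε NatT} -> Tm Γ(Below U) -> Tm Γ NatT
  toℕT t = tm(\i γ -> toℕ(fn t i γ))(ok t)

  Table : FinTy -> Ty -> Ty
  Table X T = ty(\i -> El(base X) i -> El T i)(\ {i} f -> ents(\x -> node(enc(base X) x)(enc T(f x))) leaf(elems X i))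

  table-bdd : (X : FinTy) {T : Ty} -> Bounded T -> Bounded(Table X T)
  table-bdd X {T}(q , b) = con 1 ⊕ out(listed X) ⊗(con 2 ⊕ q) , \ {i} f -> via(go f leaf(elems X i))(s≤s(*≤ˡ _(sml(listed X) i))) where
   step : ∀ a e f L B -> f ≤ B -> suc(suc(e + f) + a) + L *(2 + B) ≤ a + suc(e + L) *(2 + B)
   step a e f L B f≤B = subst2 _≤_(lhs a e f L B)(rhs a e f L B)(+≤ʳ(2 + e + a + L *(2 + B))(via f≤B(l≤ B(e + e * B)))) where
    lhs : ∀ a e f L B -> 2 + e + a + L *(2 + B) + f == suc(suc(e + f) + a) + L *(2 + B)
    lhs = ring
    rhs : ∀ a e f L B -> 2 + e + a + L *(2 + B) +(B +(e + e * B)) == a + suc(e + L) *(2 + B)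
    rhs = ring
   go : ∀ {i}(f : El(base X) i -> El T i) acc xs -> sz(ents(\x -> node(enc(base X) x)(enc T(f x))) acc xs) ≤ sz acc + sz(list(map(enc(base X)) xs)) *(2 + ⟦ q ⟧(sz(param i)))
   go f acc [] = l≤ _ _
   go f acc(x ∷ xs) = via(go f _ xs)(step(sz acc)(sz(enc(base X) x))(sz(enc T(f x)))(sz(list(map(enc(base X)) xs))) _(b(f x)))

  tab1 : ∀ {Γ T}(X : FinTy) -> Tm(Γ ▹ base X) T -> Tm Γ(Table X T)
  tab1 {Γ} {T} X t = tm(\i γ x -> fn t i(γ , x))(ok(foldT {S = RawT} X(tm(\_ _ -> leaf) leaf⊩)(tm(\i((γ , s) , x) -> node(node(enc(base X) x)(enc T(fn t i(γ , x)))) s)(pair(pair(first whole)(ok(under t)))(ok(v1 {Γ} {base X} {RawT}))))(con 2 ⊕(idP ⊕(out(ok t) ∘P(con 1 ⊕ idP)))) grow)) where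
   bd1 : ∀ e f s g F -> f ≤ F -> suc(suc(e + f) + s) ≤ s +(2 +(g + e + F))
   bd1 e f s g F f≤F = tp(_≤ s +(2 +(g + e + F)))(eq e f s)(+≤ʳ s(s≤s(s≤s(+≤(r≤ e g) f≤F)))) where
    eq : ∀ e f s -> s +(2 +(e + f)) == suc(suc(e + f) + s)
    eq = ring
   grow : ∀ i γ s x -> sz(node(node(enc(base X) x)(enc T(fn t i(γ , x)))) s) ≤ sz s + ⟦ con 2 ⊕(idP ⊕(out(ok t) ∘P(con 1 ⊕ idP))) ⟧(sz(tree Γ γ) + sz(enc(base X) x))
   grow i γ s x = bd1(sz(enc(base X) x)) _(sz s)(sz(tree Γ γ)) _(via(sml(ok t)(i , γ , x))(to(⟦ out(ok t) ⟧-mn(s≤s(eq≤(+-comm(sz(enc(base X) x))(sz(tree Γ γ))))))(sym(∘P-e(out(ok t))(con 1 ⊕ idP) _))))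

  infixl 8 _∙_

  _∙_ : ∀ {Γ X T} -> Tm Γ(Table X T) -> Tm Γ(base X) -> Tm Γ T
  _∙_ {Γ} {X} {T} f a = tm(\i γ -> fn f i γ(fn a i γ))(conv(\(i , γ) -> search-finds(\x -> does(enc(base X) x ≟T enc(base X)(fn a i γ)))(\x -> enc T(fn f i γ x))(enc T(fn f i γ(fn a i γ))) leaf(matches i γ)(∈-ʳ++ˡ(cpl X(fn a i γ)))(same(enc(base X)(fn a i γ))))(F.fold(conv(\(i , γ) -> ents-list _(elems X i) [])(ok f)) leaf⊩(by-cases(equal⊩(first(first whole))(second(second whole) ⟫ ridx fst(ok a)))(conv(\(_ , eq) -> sym(ap(if_then _ else _) eq))(ridx fst(second(first whole))))(conv(\(_ , eq) -> sym(ap(if_then _ else _) eq))(ridx fst(first(second whole))))))) where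
   same : ∀ t -> does(t ≟T t) == tt
   same t with t ≟T t
   ... | yes _ = refl
   ... | no ¬p = void(¬p refl)
   matches : ∀ i γ x -> does(enc(base X) x ≟T enc(base X)(fn a i γ)) == tt -> enc T(fn f i γ x) == enc T(fn f i γ(fn a i γ))
   matches i γ x eq with enc(base X) x ≟T enc(base X)(fn a i γ)
   ... | yes p = ap(\x -> enc T(fn f i γ x))(inj X p)
   grow : ∀ c e v s g -> sz(if c then v else s) ≤ sz s +(g + suc(sz e + sz v))
   grow tt e v s g = via(via(r≤(sz v)(suc(sz e)))(r≤ _ g))(r≤ _(sz s))
   grow ff e v s g = l≤ _ _
   ent : ∀ {p : Idx ⌊ Γ ⌋} -> El(base X)(fst p) -> Tree
   ent {i , γ} x = node(enc(base X) x)(enc T(fn f i γ x))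
   module F = Fold {Γ = ⌊ Γ ⌋} {A = \ (i , _) -> El (base X) i} {S = \ _ -> Tree}
    ent(\t -> t)
    (\(i , γ) -> rev(elems X i))(\_ -> leaf)
    (\(i , γ) x s -> if does(enc(base X) x ≟T enc(base X)(fn a i γ)) then enc T(fn f i γ x) else s)
    idP(\(i , γ) x s -> grow(does(enc(base X) x ≟T enc(base X)(fn a i γ)))(enc(base X) x) _ s(sz(tree Γ γ)))

module Cuts where
 open Int
 open Sums
 import Data.List.Relation.Unary.AllPairs.Properties as AllPairsₚ
 import Data.List.Relation.Unary.AllPairs as AllPairs
 open import Data.Vec using (zipWith) renaming (replicate to repl)
 open import Data.Vec.Properties using (≡-dec)

 VS : ℕ -> Set
 VS = Vec Bool

 cl : ∀ {b} {A : Set} -> b == tt -> b == ff -> A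
 cl p q with tr(sym p) q
 ... | ()

 module _ {n : ℕ} where

  infixl 7 _∩_ _∖_
  infixl 6 _∪_

  _∩_ _∪_ _∖_ : VS n -> VS n -> VS n
  _∩_ = zipWith _∧_
  _∪_ = zipWith _∨_
  _∖_ = zipWith(\a b -> a ∧ not b)

  full : VS n
  full = repl n tt

  infix 4 _∋_ _∌_ _⊆_

  _∋_ _∌_ : VS n -> Fin n -> Set
  S ∋ v = at S v == tt
  S ∌ v = at S v == ff

  ∋∨∌ : ∀ S v -> S ∋ v ⊎ S ∌ v
  ∋∨∌ S v with at S v
  ... | tt = inl refl
  ... | ff = inr refl

  ∋∩ : ∀ A C {v} -> A ∋ v -> C ∋ v -> A ∩ C ∋ v
  ∋∩ A C {v} p q = tr(at-zip _∧_ v A C)(ap2 _∧_ p q)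

  ∋∩⁻ : ∀ A C {v} -> A ∩ C ∋ v -> A ∋ v × C ∋ v
  ∋∩⁻ A C {v} p with at A v | at C v | tr(sym(at-zip _∧_ v A C)) p
  ... | tt | tt | _ = refl , refl

  ∌∩ˡ : ∀ A C {v} -> A ∌ v -> A ∩ C ∌ v
  ∌∩ˡ A C {v} p = tr(at-zip _∧_ v A C)(ap(_∧ at C v) p)

  ∌∩ʳ : ∀ A C {v} -> C ∌ v -> A ∩ C ∌ v
  ∌∩ʳ A C {v} p = tr(at-zip _∧_ v A C)(tr(ap(at A v ∧_) p)(Bool.∧-zeroʳ(at A v)))

  ∌∩⁻ : ∀ A C {v} -> A ∩ C ∌ v -> A ∌ v ⊎ C ∌ v
  ∌∩⁻ A C {v} p with at A v | at C v | tr(sym(at-zip _∧_ v A C)) p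
  ... | ff | _ | _ = inl refl
  ... | tt | ff | _ = inr refl

  ∋∪ˡ : ∀ A C {v} -> A ∋ v -> A ∪ C ∋ v
  ∋∪ˡ A C {v} p = tr(at-zip _∨_ v A C)(ap(_∨ at C v) p)

  ∋∪ʳ : ∀ A C {v} -> C ∋ v -> A ∪ C ∋ v
  ∋∪ʳ A C {v} p = tr(at-zip _∨_ v A C)(tr(ap(at A v ∨_) p)(Bool.∨-zeroʳ(at A v)))

  ∋∪⁻ : ∀ A C {v} -> A ∪ C ∋ v -> A ∋ v ⊎ C ∋ v
  ∋∪⁻ A C {v} p with at A v | at C v | tr(sym(at-zip _∨_ v A C)) p
  ... | tt | _ | _ = inl refl
  ... | ff | tt | _ = inr refl

  ∌∪ : ∀ A C {v} -> A ∌ v -> C ∌ v -> A ∪ C ∌ v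
  ∌∪ A C {v} p q = tr(at-zip _∨_ v A C)(ap2 _∨_ p q)

  ∌∪⁻ : ∀ A C {v} -> A ∪ C ∌ v -> A ∌ v × C ∌ v
  ∌∪⁻ A C {v} p with at A v | at C v | tr(sym(at-zip _∨_ v A C)) p
  ... | ff | ff | _ = refl , refl

  ∋∖ : ∀ A C {v} -> A ∋ v -> C ∌ v -> A ∖ C ∋ v
  ∋∖ A C {v} p q = tr(at-zip _ v A C)(ap2(\a b -> a ∧ not b) p q)

  ∋∖- : ∀ A C {v} -> A ∖ C ∋ v -> A ∋ v × C ∌ v
  ∋∖- A C {v} p with at A v | at C v | tr(sym(at-zip(\a b -> a ∧ not b) v A C)) p
  ... | tt | ff | _ = refl , refl

  ∌∖ˡ : ∀ A C {v} -> A ∌ v -> A ∖ C ∌ v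
  ∌∖ˡ A C {v} p = tr(at-zip _ v A C)(ap(_∧ not(at C v)) p)

  ∌∖ʳ : ∀ A C {v} -> C ∋ v -> A ∖ C ∌ v
  ∌∖ʳ A C {v} p = tr(at-zip _ v A C)(tr(ap(\b -> at A v ∧ not b) p)(Bool.∧-zeroʳ(at A v)))

  ∌∖⁻ : ∀ A C {v} -> A ∖ C ∌ v -> A ∌ v ⊎ C ∋ v
  ∌∖⁻ A C {v} p with at A v | at C v | tr(sym(at-zip(\a b -> a ∧ not b) v A C)) p
  ... | ff | _ | _ = inl refl
  ... | tt | tt | _ = inr refl

  _⊆_ : VS n -> VS n -> Set
  A ⊆ C = ∀ v -> A ∋ v -> C ∋ v

  Disjoint : VS n -> VS n -> Set
  Disjoint A C = ∀ v -> A ∋ v -> C ∌ v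

  Cross : VS n -> VS n -> Set
  Cross A C = (∃[ v ] A ∋ v × C ∋ v) ×(∃[ v ] A ∋ v × C ∌ v) ×(∃[ v ] A ∌ v × C ∋ v)

  _⊆?_ : ∀ A C -> Dec(A ⊆ C)
  A ⊆? C = Fin.all? \v -> implies?(at A v)(at C v) where
   implies? : ∀ a b -> Dec(a == tt -> b == tt)
   implies? ff _ = yes \()
   implies? tt tt = yes \_ -> refl
   implies? tt ff = no \f -> case(f refl) where
    case : ∀ {A : Set} -> ff == tt -> A
    case()

  cross? : ∀ A C -> Dec(Cross A C)
  cross? A C = Fin.any?(\v -> (at A v Bool.≟ tt) ×-dec(at C v Bool.≟ tt)) ×-dec(Fin.any?(\v -> (at A v Bool.≟ tt) ×-dec(at C v Bool.≟ ff)) ×-dec Fin.any? \v -> (at A v Bool.≟ ff) ×-dec(at C v Bool.≟ tt))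

  not-crs : ∀ {A C} -> ¬ Cross A C -> A ⊆ C ⊎ C ⊆ A ⊎ Disjoint A C
  not-crs {A} {C} h with Fin.any?(\v -> (at A v Bool.≟ tt) ×-dec(at C v Bool.≟ tt))
  ... | no ¬both = inr(inr \v p -> outside p) where
   outside : ∀ {v} -> A ∋ v -> C ∌ v
   outside {v} p with ∋∨∌ C v
   ... | inl q = void(¬both(v , p , q))
   ... | inr q = q
  ... | yes both with Fin.any?(\v -> (at A v Bool.≟ tt) ×-dec(at C v Bool.≟ ff))
  ... | no ¬left = inl \v p -> ins p where
   ins : ∀ {v} -> A ∋ v -> C ∋ v
   ins {v} p with ∋∨∌ C v
   ... | inl q = q
   ... | inr q = void(¬left(v , p , q))
  ... | yes left = inr(inl \v q -> ins q) where
   ins : ∀ {v} -> C ∋ v -> A ∋ v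
   ins {v} q with ∋∨∌ A v
   ... | inl p = p
   ... | inr p = void(h(both , left , v , p , q))

 allVS : ∀ n -> List(VS n)
 allVS zero = [] ∷ []
 allVS(suc n) = map(ff ∷_)(allVS n) ++ map(tt ∷_)(allVS n)

 ∈-allVS : ∀ {n}(S : VS n) -> S ∈ allVS n
 ∈-allVS [] = hd refl
 ∈-allVS(ff ∷ S) = ∈-++⁺ˡ(∈-map⁺(ff ∷_)(∈-allVS S))
 ∈-allVS {suc n}(tt ∷ S) = ∈-++⁺ʳ(map(ff ∷_)(allVS n))(∈-map⁺(tt ∷_)(∈-allVS S))

 -- A set is enumerated before all of its proper supersets.
 allVS-ordered : ∀ n -> AllPairs(\R S -> ¬ S ⊆ R)(allVS n)
 allVS-ordered zero = [] ∷ []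
 allVS-ordered(suc n) = AllPairsₚ.++⁺(AllPairsₚ.map⁺(AllPairs.map(\h s -> h \v -> s(suc v))(allVS-ordered n)))(AllPairsₚ.map⁺(AllPairs.map(\h s -> h \v -> s(suc v))(allVS-ordered n)))(All.tabulate \R∈ -> All.tabulate \S∈ s -> heads R∈ S∈(s zero)) where
  heads : ∀ {R S} -> R ∈ map(ff ∷_)(allVS n) -> S ∈ map(tt ∷_)(allVS n) -> ¬(at S zero == tt -> at R zero == tt)
  heads R∈ S∈ with ∈-map⁻(ff ∷_) R∈ | ∈-map⁻(tt ∷_) S∈
  ... | _ , _ , refl | _ , _ , refl = \f -> case(f refl) where
   case : ¬ ff == tt
   case()

module Links where
 open Int
 open Sums
 open Cuts
 open import Data.Vec using () renaming (tabulate to tab)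
 open import Relation.Nullary.Decidable using (¬¬-excluded-middle)

 infixl 1 _>>=_

 _>>=_ : {A B : Set} -> ¬ ¬ A -> (A -> ¬ ¬ B) -> ¬ ¬ B
 (m >>= f) k = m \a -> f a k

 pure : {A : Set} -> A -> ¬ ¬ A
 pure a k = k a

 em : (P : Set) -> ¬ ¬ Dec P
 em P = ¬¬-excluded-middle

 em-all : ∀ {n}(P : Fin n -> Set) -> ¬ ¬(∀ i -> Dec(P i))
 em-all {zero} P = pure \()
 em-all {suc n} P = em(P zero) >>= \d -> em-all(P ∘ suc) >>= \ds -> pure \ { zero -> d ;(suc i) -> ds i }

 ∧-T : ∀ {a b} -> a == tt -> b == tt -> a ∧ b == tt
 ∧-T refl refl = refl

 ∧-e : ∀ {a b} -> a ∧ b == tt -> a == tt × b == tt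
 ∧-e {tt} {tt} _ = refl , refl

 ∨-Fs : ∀ {a b} -> a == ff -> b == ff -> a ∨ b == ff
 ∨-Fs refl refl = refl

 ∨-F : ∀ {a b} -> a ∨ b == ff -> a == ff × b == ff
 ∨-F {ff} {ff} _ = refl , refl

 T∨F : ∀ b -> b == tt ⊎ b == ff
 T∨F tt = inl refl
 T∨F ff = inr refl

 ≢-true : ∀ {b} -> ¬ b == tt -> b == ff
 ≢-true {tt} h = void(h refl)
 ≢-true {ff} h = refl

 not-true : ∀ {b} -> not b == tt -> b == ff
 not-true {ff} _ = refl

 ∑-all : ∀ a j -> ∑(fins j)(\_ -> a) == + j * a
 ∑-all a j = tr(∑-const a(fins j))(ap(\l -> + l * a)(length-tabulate {n = j} id))

 +-error : ∀ l e m b k -> + l + + e + + m *(+ b * + k) == + l + +(e N.+ m N.*(b N.* k))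
 +-error l e m b k = tr(+-assoc(+ l)(+ e)(+ m *(+ b * + k)))(ap(\z -> + l +(+ e + z))(tr(ap(_*_(+ m))(sym(pos-* b k)))(sym(pos-* m(b N.* k)))))

module Perc where
 open Int
 open Sums
 open Typed using (rept; pick; least)
 open Tables using (clip; toℕ-clip)
 open import Data.Bool using (T)
 open import Data.Bool.ListAction using (all)
 open import Data.Nat using (_⊓_; _≤ᵇ_)
 open import Data.Nat.ListAction using (sum)

 all⁺ : {A : Set}(p : A -> Bool)(xs : List A) -> (∀ x -> x ∈ xs -> p x == tt) -> all p xs == tt
 all⁺ p [] h = refl
 all⁺ p(x ∷ xs) h rewrite h x(hd refl) = all⁺ p xs(\y -> h y ∘ th)

 all⁻ : {A : Set}(p : A -> Bool)(xs : List A) -> all p xs == tt -> ∀ x -> x ∈ xs -> p x == tt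
 all⁻ p(y ∷ xs) h x q with p y in eq
 all⁻ p(y ∷ xs) h x(hd refl) | tt = eq
 all⁻ p(y ∷ xs) h x(th q) | tt = all⁻ p xs h x q

 pick-false : {A : Set}(p : A -> Bool)(d : A)(xs : List A) -> p(pick p d xs) == ff -> p d == ff ×(∀ x -> x ∈ xs -> p x == ff)
 pick-false p d [] h = h , \_()
 pick-false p d(y ∷ xs) h with p y in eq
 ... | tt with tr(sym(fst(pick-false p y xs h))) eq
 ... | ()
 pick-false p d(y ∷ xs) h | ff with pick-false p d xs h
 ... | hd1 , hxs = hd1 , \ { x(hd refl) -> eq ;x(th q) -> hxs x q }

 pick-true : {A : Set}(p : A -> Bool)(d : A)(xs : List A) -> ∀ {x} -> x ∈ xs -> p x == tt -> p(pick p d xs) == tt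
 pick-true p d xs {x} x∈ h with p(pick p d xs) in eq
 ... | tt = refl
 ... | ff with tr(sym(snd(pick-false p d xs eq) x x∈)) h
 ... | ()

 ≤ᵇ-true : ∀ {a b} -> a N.≤ b -> (a ≤ᵇ b) == tt
 ≤ᵇ-true {a} {b} l with a ≤ᵇ b | N.≤⇒≤ᵇ l
 ... | tt | _ = refl

 true-≤ᵇ : ∀ {a b} -> (a ≤ᵇ b) == tt -> a N.≤ b
 true-≤ᵇ {a} {b} eq = N.≤ᵇ⇒≤ a b(tp T(sym eq) _)

 false-≤ᵇ : ∀ {a b} -> (a ≤ᵇ b) == ff -> b N.< a
 false-≤ᵇ {a} {b} eq = N.≰⇒> \l -> case(tr(sym(≤ᵇ-true l)) eq) where
  case : ¬ tt == ff
  case()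

 sum-∑ : {A : Set}(f : A -> ℕ)(xs : List A) -> + sum(map f xs) == ∑ xs(\x -> + f x)
 sum-∑ f [] = refl
 sum-∑ f(x ∷ xs) = ap(_+_(+ f x))(sum-∑ f xs)

 module Run {J R : Set} (js : List J) (rs : List R) (pos neg : R -> J -> ℕ) (lo hi : R -> ℕ) (ε U : ℕ) (r0 : R) where

  -- The inequality pos · z + hi ≥ neg · z + lo, up to ε.
  ok : (J -> Fin(suc U)) -> R -> Bool
  ok z r = (sum(map(\j -> neg r j N.* toℕ(z j)) js) N.+ lo r) ≤ᵇ(sum(map(\j -> pos r j N.* toℕ(z j)) js) N.+ hi r N.+ ε)

  upd : (J -> Fin(suc U)) -> R -> J -> Fin(suc U)
  upd z r j = clip U((toℕ(z j) N.+ pos r j) ∸ neg r j)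

  step : (J -> Fin(suc U)) -> J -> Fin(suc U)
  step z = if ok z(pick(\r -> not(ok z r)) r0 rs) then z else upd z(pick(\r -> not(ok z r)) r0 rs)

  start : J -> Fin(suc U)
  start _ = clip U 0

  final : ℕ -> J -> Fin(suc U)
  final T = rept T step start

  test : ℕ -> Bool
  test T = all(ok(final T)) rs

  module Complete (D : Z) (D>0 : 0# < D) (z* : J -> Z) (z*≥0 : ∀ j -> 0# ≤ z* j) (z*≤ : ∀ j -> z* j ≤ D * + U)
   (holds : ∀ r -> r ∈ rs -> ∑ js(\j -> + neg r j * z* j) + D * + lo r ≤ ∑ js(\j -> + pos r j * z* j) + D * + hi r)
   (norm : ∀ r -> r ∈ rs -> ∑ js(\j -> (+ pos r j - + neg r j) *(+ pos r j - + neg r j)) ≤ + ε)(r0∈ : r0 ∈ rs) where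

   sq : Z -> Z
   sq a = a * a

   sq≥0 : ∀ a -> 0# ≤ sq a
   sq≥0(+ a) = *≥0 {+ a} {+ a}(+≤+ z≤n)(+≤+ z≤n)
   sq≥0 Int.-[1+ a ] = +≤+ z≤n

   Φ : (J -> Z) -> Z
   Φ z = ∑ js(\j -> sq(D * z j - z* j))

   val : (J -> Fin(suc U)) -> J -> Z
   val z j = + toℕ(z j)

   D≥0 : 0# ≤ D
   D≥0 = lt D>0

   D*≤ : ∀ {a b} -> a ≤ b -> D * a ≤ D * b
   D*≤ = *≤ˡ D {{ℤ.nonNegative D≥0}}

   sq-mono : ∀ {x y} -> 0# ≤ x -> x ≤ y -> sq x ≤ sq y
   sq-mono {x} {y} p q = bd {sq x} {sq y} {(y - x) *(y + x)}(lm x y)(*≥0 {y - x} {y + x}(d≥0 q)(+≥0(via p q) p)) where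
    lm : ∀ x y -> y * y == x * x +(y - x) *(y + x)
    lm = ring

   -- Clipping to the box does not move away from a point of the box.
   clip-closer : ∀(p q : ℕ) {s} -> 0# ≤ s -> s ≤ D * + U -> sq(D * + toℕ(clip U(p ∸ q)) - s) ≤ sq(D *(+ p - + q) - s)
   clip-closer p q {s} s≥0 s≤ with N.≤-total q p
   ... | inr p≤q rewrite toℕ-clip U(p ∸ q) | N.m≤n⇒m∸n≡0 p≤q = subst2 _≤_(sym(neg-sq D s))(neg-sq'(D *(+ p - + q)) s)(sq-mono s≥0(bd(lm s(D *(+ p - + q)))(by(sym(*0 D))(to(D*≤(to(d≥0(+≤+ p≤q))(flip(+ p)(+ q))))(flip' D(+ p - + q)))))) where
    neg-sq : ∀ D s -> (D * 0# - s) *(D * 0# - s) == s * s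
    neg-sq = ring
    neg-sq' : ∀ x s -> (s - x) *(s - x) ==(x - s) *(x - s)
    neg-sq' = ring
    lm : ∀ s x -> s - x == s + - x
    lm = ring
    flip : ∀ p q -> q - p == -(p - q)
    flip = ring
    flip' : ∀ D x -> D *(- x) == -(D * x)
    flip' = ring
   ... | inl q≤p rewrite toℕ-clip U(p ∸ q) with N.≤-total(p ∸ q) U
   ... | inl l rewrite N.m≤n⇒m⊓n≡m l = eq≤(ap(\x -> sq(D * x - s))(tr(sym(⊖-≥ q≤p))(sym(m-n≡m⊖n p q))))
   ... | inr l rewrite N.m≥n⇒m⊓n≡n l = sq-mono(d≥0 s≤)(+≤ˡ(- s)(D*≤(to(+≤+ l)(tr(sym(⊖-≥ q≤p))(sym(m-n≡m⊖n p q))))))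

   prog1 : ∀ z r -> r ∈ rs -> ok z r == ff -> Φ(val(upd z r)) + sq D ≤ Φ(val z)
   prog1 z r r∈ bad = via(+≤ˡ(sq D)(∑≤ js \j _ -> each j))(by(ap(_+ sq D) expand)(bd(lm(Φ(val z)) D A N(+ ε)) rest≥0)) where
    a : J -> Z
    a j = + pos r j - + neg r j
    A N : Z
    A = ∑ js(\j -> a j *(D * val z j - z* j))
    N = ∑ js(\j -> a j * a j)
    each : ∀ j -> sq(D * val(upd z r) j - z* j) ≤ sq(D *(val z j + a j) - z* j)
    each j = to(clip-closer(toℕ(z j) N.+ pos r j)(neg r j)(z*≥0 j)(z*≤ j))(ap(\x -> sq(D * x - z* j))(+-assoc(+ toℕ(z j))(+ pos r j)(- + neg r j)))
    square : ∀ D v a s -> (D *(v + a) - s) *(D *(v + a) - s) ==(D * v - s) *(D * v - s) +((+ 2 * D) *(a *(D * v - s)) +(D * D) *(a * a))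
    square = ring
    expand : ∑ js(\j -> sq(D *(val z j + a j) - z* j)) == Φ(val z) +(+ 2 * D * A + D * D * N)
    expand = tr(∑≡ js \j _ -> square D(val z j)(a j)(z* j))(tr(∑-+(\j -> sq(D * val z j - z* j))(\j -> (+ 2 * D) *(a j *(D * val z j - z* j)) +(D * D) *(a j * a j)) js)(ap(_+_(Φ(val z)))(tr(∑-+(\j -> (+ 2 * D) *(a j *(D * val z j - z* j)))(\j -> (D * D) *(a j * a j)) js)(ap2 _+_(∑-*(+ 2 * D)(\j -> a j *(D * val z j - z* j)) js)(∑-*(D * D)(\j -> a j * a j) js)))))
    linear : ∀(y : J -> Z) -> ∑ js(\j -> a j * y j) == ∑ js(\j -> + pos r j * y j) - ∑ js(\j -> + neg r j * y j)
    linear y = tr(∑≡ js \j _ -> lm1(+ pos r j)(+ neg r j)(y j))(tr(∑-+(\j -> + pos r j * y j)(\j -> (- 1#) *(+ neg r j * y j)) js)(tr(ap(_+_(∑ js \j -> + pos r j * y j))(∑-*(- 1#)(\j -> + neg r j * y j) js))(lm2(∑ js \j -> + pos r j * y j)(∑ js \j -> + neg r j * y j)))) where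
     lm1 : ∀ p n y -> (p - n) * y == p * y +(- 1#) *(n * y)
     lm1 = ring
     lm2 : ∀ x y -> x +(- 1#) * y == x - y
     lm2 = ring
    A-split : A == D * ∑ js(\j -> a j * val z j) - ∑ js(\j -> a j * z* j)
    A-split = tr(∑≡ js \j _ -> lm1(a j) D(val z j)(z* j))(tr(∑-+(\j -> D *(a j * val z j))(\j -> (- 1#) *(a j * z* j)) js)(tr(ap2 _+_(∑-* D(\j -> a j * val z j) js)(∑-*(- 1#)(\j -> a j * z* j) js))(lm2(D * ∑ js \j -> a j * val z j)(∑ js \j -> a j * z* j)))) where
     lm1 : ∀ a D v s -> a *(D * v - s) == D *(a * v) +(- 1#) *(a * s)
     lm1 = ring
     lm2 : ∀ x y -> x +(- 1#) * y == x - y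
     lm2 = ring
    nat-sum : ∀(c : J -> ℕ) -> + sum(map(\j -> c j N.* toℕ(z j)) js) == ∑ js(\j -> + c j * val z j)
    nat-sum c = tr(sum-∑(\j -> c j N.* toℕ(z j)) js)(∑≡ js \j _ -> pos-*(c j)(toℕ(z j)))
    violated : ∑ js(\j -> + pos r j * val z j) + + hi r + + ε + 1# ≤ ∑ js(\j -> + neg r j * val z j) + + lo r
    violated = subst2 _≤_(tr(+-comm 1#(+(sum(map(\j -> pos r j N.* toℕ(z j)) js) N.+ hi r N.+ ε)))(ap(\s -> s + + hi r + + ε + 1#)(nat-sum(pos r))))(ap(_+ + lo r)(nat-sum(neg r)))(+≤+(false-≤ᵇ {sum(map(\j -> neg r j N.* toℕ(z j)) js) N.+ lo r} bad))
    az : ∑ js(\j -> a j * val z j) ≤ + lo r - + hi r - + ε - 1#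
    az = by(linear(val z))(bd(lm1(∑ js \j -> + pos r j * val z j)(∑ js \j -> + neg r j * val z j)(+ lo r)(+ hi r)(+ ε))(d≥0 violated)) where
     lm1 : ∀ p n l h e -> l - h - e - 1# == p - n +(n + l -(p + h + e + 1#))
     lm1 = ring
    az* : D *(+ lo r - + hi r) ≤ ∑ js(\j -> a j * z* j)
    az* = to(bd(lm1 D(∑ js \j -> + pos r j * z* j)(∑ js \j -> + neg r j * z* j)(+ lo r)(+ hi r))(d≥0(holds r r∈)))(sym(linear z*)) where
     lm1 : ∀ D p n l h -> p - n == D *(l - h) +(p + D * h -(n + D * l))
     lm1 = ring
    A≤ : A ≤ D *(-(+ ε) - 1#)
    A≤ = by A-split(to(+≤(D*≤ az)(neg-mono-≤ az*))(lm1 D(+ lo r)(+ hi r)(+ ε))) where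
     lm1 : ∀ D l h e -> D *(l - h - e - 1#) + -(D *(l - h)) == D *(- e - 1#)
     lm1 = ring
    lm : ∀ Φ D A N e -> Φ == Φ +(+ 2 * D * A + D * D * N) + D * D +((+ 2 * D) *(D *(- e - 1#) - A) +(D * D) *(e - N) +(D * D) *(e + 1#))
    lm = ring
    rest≥0 : 0# ≤(+ 2 * D) *(D *(-(+ ε) - 1#) - A) +(D * D) *(+ ε - N) +(D * D) *(+ ε + 1#)
    rest≥0 = +≥0(+≥0(*≥0 {+ 2 * D} {D *(-(+ ε) - 1#) - A}(*≥0 {+ 2} {D}(+≤+ z≤n) D≥0)(d≥0 A≤))(*≥0 {D * D} {+ ε - N}(sq≥0 D)(d≥0(norm r r∈))))(*≥0 {D * D} {+ ε + 1#}(sq≥0 D)(+≤+ z≤n))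

   pick∈ : ∀(p : R -> Bool) d xs -> d ∈ rs -> (∀ x -> x ∈ xs -> x ∈ rs) -> pick p d xs ∈ rs
   pick∈ p d [] h k = h
   pick∈ p d(y ∷ xs) h k with p y
   ... | tt = pick∈ p y xs(k y(hd refl))(\x -> k x ∘ th)
   ... | ff = pick∈ p d xs h(\x -> k x ∘ th)

   stays : ∀ {z} -> all(ok z) rs == tt -> step z == z
   stays {z} h rewrite all⁻(ok z) rs h(pick(\r -> not(ok z r)) r0 rs)(pick∈ _ r0 rs r0∈ \_ p -> p) = refl

   keeps : ∀ T {z} -> all(ok z) rs == tt -> all(ok(rept T step z)) rs == tt
   keeps zero h = h
   keeps(suc T) {z} h = keeps T(tp(\z -> all(ok z) rs == tt)(sym(stays {z} h)) h)

   not-false : ∀ {b} -> not b == ff -> b == tt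
   not-false {tt} _ = refl

   conv1 : ∀ T z -> Φ(val z) < + T * sq D -> all(ok(rept T step z)) rs == tt
   conv1 zero z l = void(<⇒≱(<≤ l(eq≤(0*(sq D))))(∑≥0 {f = \j -> sq(D * val z j - z* j)} js \j _ -> sq≥0(D * val z j - z* j)))
   conv1(suc T) z l = by-row(ok z r*) refl where
    r* = pick(\r -> not(ok z r)) r0 rs
    by-row : ∀ b -> ok z r* == b -> all(ok(rept T step(step z))) rs == tt
    by-row tt eq = keeps T(tp(\z -> all(ok z) rs == tt)(sym(stays fine)) fine) where
     fine : all(ok z) rs == tt
     fine = all⁺(ok z) rs(\r r∈ -> not-false(snd(pick-false(\r -> not(ok z r)) r0 rs(ap not eq)) r r∈))
    by-row ff eq = conv1 T(step z)(tp(\y -> Φ(val y) < + T * sq D)(sym(ap(\b -> if b then z else upd z r*) eq))(by-diff<(lm(Φ(val(upd z r*)))(+ T * sq D)(sq D))(≤<(eq≤(sym(+-inverseʳ(Φ(val(upd z r*)) + sq D))))(<≤(+-monoˡ-<(-(Φ(val(upd z r*)) + sq D))(≤<(prog1 z r*(pick∈ _ r0 rs r0∈ \_ p -> p) eq) l))(eq≤(ap(_-(Φ(val(upd z r*)) + sq D))(lm2(+ T)(sq D))))) ))) where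
     lm : ∀ p t s -> t == p +(t + s -(p + s))
     lm = ring
     lm2 : ∀ t s -> (1# + t) * s == t * s + s
     lm2 = ring

   cpl : test(suc(len js N.*(U N.* U))) == tt
   cpl = conv1(suc(len js N.*(U N.* U))) start(≤< bd1(≤<(eq≤(*-comm(D * D)(+ len js *(+ U * + U)))) grow)) where
    bd1 : Φ(val start) ≤ D * D *(+ len js *(+ U * + U))
    bd1 = to(∑≤ js \j _ -> each j)(tr(∑-const(D * + U *(D * + U)) js)(lm(+ len js) D(+ U))) where
     lm : ∀ l D U -> l *(D * U *(D * U)) == D * D *(l *(U * U))
     lm = ring
     each : ∀ j -> sq(D * val start j - z* j) ≤ D * + U *(D * + U)
     each j rewrite toℕ-clip U 0 = by(neg-sq D(z* j))(sq-mono(z*≥0 j)(z*≤ j)) where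
      neg-sq : ∀ D s -> (D * 0# - s) *(D * 0# - s) == s * s
      neg-sq = ring
    grow : + len js *(+ U * + U) *(D * D) < + suc(len js N.*(U N.* U)) * sq D
    grow = by-diff< {e = sq D}(tr(ap(\x -> (1# + x) * sq D)(tr(pos-*(len js)(U N.* U))(ap(_*_(+ len js))(pos-* U U))))(lm(+ len js *(+ U * + U))(D * D)))(*>0 {D} {D} D>0 D>0) where
     lm : ∀ x s -> (1# + x) * s == x * s + s
     lm = ring

module Rows where
 open Int
 open Sums
 open Cuts
 open Links
 open Tables using (gath; pairs; either; ∈-pairs; ∈-either; ∈-gath; ∈-gathʳ)

 ∑-ʳ++ : {A : Set}(h : A -> Z)(xs ys : List A) -> ∑(xs ʳ++ ys) h == ∑ xs h + ∑ ys h
 ∑-ʳ++ h [] ys = sym(0+ _)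
 ∑-ʳ++ h(x ∷ xs) ys = tr(∑-ʳ++ h xs(x ∷ ys))(lm(∑ xs h)(h x)(∑ ys h)) where
  lm : ∀ a b c -> a +(b + c) == b + a + c
  lm = ring

 ∑-gath : {A B : Set}(f : A -> List B)(h : B -> Z)(acc : List B)(xs : List A) -> ∑(gath f acc xs) h == ∑ xs(\x -> ∑(f x) h) + ∑ acc h
 ∑-gath f h acc [] = sym(0+ _)
 ∑-gath f h acc(x ∷ xs) = tr(∑-gath f h(f x ʳ++ acc) xs)(tr(ap(_+_(∑ xs \x -> ∑(f x) h))(∑-ʳ++ h(f x) acc))(lm(∑ xs \x -> ∑(f x) h)(∑(f x) h)(∑ acc h))) where
  lm : ∀ a b c -> a +(b + c) == b + a + c
  lm = ring

 ∑-pairs : {A B : Set}(h : A × B -> Z)(xs : List A)(ys : List B) -> ∑(pairs xs ys) h == ∑ xs(\x -> ∑ ys \y -> h(x , y))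
 ∑-pairs h xs ys = tr(∑-gath(\x -> gath(\y -> [ x , y ]) [] ys) h [] xs)(tr(+0 _)(∑≡ xs \x _ -> tr(∑-gath(\y -> [ x , y ]) h [] ys)(tr(+0 _)(∑≡ ys \y _ -> +0 _))))

 ∑-either : {A B : Set}(h : A ⊎ B -> Z)(xs : List A)(ys : List B) -> ∑(either xs ys) h == ∑ xs(\x -> h(inl x)) + ∑ ys(\y -> h(inr y))
 ∑-either h xs ys = tr(∑-gath(\x -> [ inl x ]) h _ xs)(ap2 _+_(∑≡ xs \x _ -> +0(h(inl x)))(tr(∑-gath(\y -> [ inr y ]) h [] ys)(tr(+0 _)(∑≡ ys \y _ -> +0(h(inr y))))))

 b2n : Bool -> ℕ
 b2n tt = 1
 b2n ff = 0

 +b2n : ∀ b -> + b2n b == χ b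
 +b2n tt = refl
 +b2n ff = refl

 χ-∧ : ∀ a b -> χ(a ∧ b) == χ a * χ b
 χ-∧ tt b = sym(1*(χ b))
 χ-∧ ff b = sym(0*(χ b))

 same : Bool -> Bool -> Bool
 same tt b = b
 same ff b = not b

 -- Two directed copies of every edge for every commodity.
 Arc Var Row : Set -> ℕ -> Set
 Arc C m = C ×(Fin m × Bool)
 Var C m = Fin m ⊎ Arc C m
 Row C m = ⊤ ⊎(Fin m ⊎ Arc C m)

 -- The linear program: edge variables x, arc variables y; capacity of an arc, balance at a vertex.
 module Program {n m : ℕ} (src tgt : Fin m -> Fin n) {C : Set} (cs : List C) (eqC : C -> C -> Bool)
  (forb : C -> Fin m -> Bool)(s t : C -> Fin n)(need : C -> ℕ)(B : Fin m -> Bool)(c : Fin m -> ℕ)(N ℓ : ℕ) where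

  AllRow : Set
  AllRow = Row C m ⊎(C × Fin n)

  dirs : List Bool
  dirs = tt ∷ ff ∷ []

  arcs : List(Arc C m)
  arcs = pairs cs(pairs(fins m) dirs)

  vars : List(Var C m)
  vars = either(fins m) arcs

  rows : List AllRow
  rows = either(either(unit ∷ [])(either(fins m) arcs))(pairs cs(fins n))

  tailOf headOf : Fin m -> Bool -> Fin n
  tailOf e d = if d then src e else tgt e
  headOf e d = if d then tgt e else src e

  eqE : Fin m -> Fin m -> Bool
  eqE e e' = does(e Fin.≟ e')

  eqV : Fin n -> Fin n -> Bool
  eqV v v' = does(v Fin.≟ v')

  eqArc : Arc C m -> Arc C m -> Bool
  eqArc(k , e , d)(k' , e' , d') = eqC k k' ∧(eqE e e' ∧ same d d')

  pos neg : AllRow -> Var C m -> ℕ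
  pos(inl(inl _)) _ = 0
  pos(inl(inr(inl e))) _ = 0
  pos(inl(inr(inr(k , e , d))))(inl e') = b2n(not(forb k e) ∧(not(B e) ∧ eqE e e'))
  pos(inl(inr(inr(k , e , d))))(inr _) = 0
  pos(inr(k , v))(inl _) = 0
  pos(inr(k , v))(inr(k' , e , d)) = b2n(eqC k k' ∧(not(eqV v(t k)) ∧ eqV(tailOf e d) v))
  neg(inl(inl _))(inl e) = c e
  neg(inl(inl _))(inr _) = 0
  neg(inl(inr(inl e)))(inl e') = b2n(eqE e e')
  neg(inl(inr(inl e)))(inr _) = 0
  neg(inl(inr(inr(k , e , d))))(inl _) = 0
  neg(inl(inr(inr(k , e , d))))(inr a) = b2n(not(not(forb k e) ∧ B e) ∧ eqArc(k , e , d) a)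
  neg(inr(k , v))(inl _) = 0
  neg(inr(k , v))(inr(k' , e , d)) = b2n(eqC k k' ∧(not(eqV v(t k)) ∧ eqV(headOf e d) v))

  lo hi : AllRow -> ℕ
  lo(inl _) = 0
  lo(inr(k , v)) = if eqV v(s k) ∧ not(eqV v(t k)) then N N.* need k else 0
  hi(inl(inl _)) = ℓ
  hi(inl(inr(inl _))) = N
  hi(inl(inr(inr _))) = 0
  hi(inr _) = 0

  ∑-vars : ∀ h -> ∑ vars h == ∑(fins m)(\e -> h(inl e)) + ∑ cs(\k -> ∑(fins m) \e -> ∑ dirs \d -> h(inr(k , e , d)))
  ∑-vars h = tr(∑-either h(fins m) arcs)(ap(_+_(∑(fins m) \e -> h(inl e)))(tr(∑-pairs(\a -> h(inr a)) cs(pairs(fins m) dirs))(∑≡ cs \k _ -> ∑-pairs(\a -> h(inr(k , a)))(fins m) dirs)))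

  ∑-vars-x : ∀ h -> (∀ a -> h(inr a) == 0#) -> ∑ vars h == ∑(fins m)(\e -> h(inl e))
  ∑-vars-x h z = tr(∑-vars h)(tr(ap(_+_(∑(fins m) \e -> h(inl e)))(∑-0 cs \k _ -> ∑-0(fins m) \e _ -> ∑-0 dirs \d _ -> z(k , e , d)))(+0 _))

  ∑-vars-y : ∀ h -> (∀ e -> h(inl e) == 0#) -> ∑ vars h == ∑ cs(\k -> ∑(fins m) \e -> ∑ dirs \d -> h(inr(k , e , d)))
  ∑-vars-y h z = tr(∑-vars h)(tr(ap(_+ ∑ cs \k -> ∑(fins m) \e -> ∑ dirs \d -> h(inr(k , e , d)))(∑-0(fins m) \e _ -> z e))(0+ _))

  ∑-vars-0 : ∀ h -> (∀ j -> h j == 0#) -> ∑ vars h == 0#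
  ∑-vars-0 h z = ∑-0 vars(\j _ -> z j)

  module Values (point : ∀ (h : C -> Z) k -> k ∈ cs -> ∑ cs (\ k' -> χ (eqC k k') * h k') == h k) (w : Var C m -> Z) where

   P M : AllRow -> Z
   P r = ∑ vars(\j -> + pos r j * w j)
   M r = ∑ vars(\j -> + neg r j * w j)

   x : Fin m -> Z
   x e = w(inl e)

   y : C -> Fin m -> Bool -> Z
   y k e d = w(inr(k , e , d))

   guarded : ∀(g : Bool)(q : Fin m -> Bool)(h : Fin m -> Z) -> ∑(fins m)(\e -> + b2n(g ∧ q e) * h e) == χ g * ∑(fins m)(\e -> χ(q e) * h e)
   guarded g q h = tr(∑≡(fins m) \e _ -> tr(ap(_* h e)(tr(+b2n(g ∧ q e))(χ-∧ g(q e))))(*-assoc(χ g)(χ(q e))(h e)))(∑-*(χ g)(\e -> χ(q e) * h e)(fins m))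

   P-cost : P(inl(inl unit)) == 0#
   P-cost = ∑-vars-0 _(\j -> 0*(w j))

   M-cost : M(inl(inl unit)) == ∑(fins m)(\e -> + c e * x e)
   M-cost = ∑-vars-x _(\a -> 0*(w(inr a)))

   P-box : ∀ e -> P(inl(inr(inl e))) == 0#
   P-box e = ∑-vars-0 _(\j -> 0*(w j))

   M-box : ∀ e -> M(inl(inr(inl e))) == x e
   M-box e = tr(∑-vars-x _ \a -> 0*(w(inr a)))(tr(∑≡(fins m) \e' _ -> ap(_* x e')(+b2n(eqE e e')))(∑pt x e))

   P-cap : ∀ k e d -> P(inl(inr(inr(k , e , d)))) == χ(not(forb k e) ∧ not(B e)) * x e
   P-cap k e d = tr(∑-vars-x _ \a -> 0*(w(inr a)))(tr(∑≡(fins m) \e' _ -> ap(\b -> + b2n b * x e')(sym(∧-assoc(not(forb k e))(not(B e))(eqE e e'))))(tr(guarded(not(forb k e) ∧ not(B e))(eqE e) x)(ap(_*_(χ(not(forb k e) ∧ not(B e))))(∑pt x e))))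
    where open import Data.Bool.Properties using(∧-assoc)

   inner : ∀(g : C -> Bool)(q : Fin m -> Bool -> Bool) -> ∑ cs(\k' -> ∑(fins m) \e -> ∑ dirs \d -> + b2n(g k' ∧ q e d) * y k' e d) == ∑ cs(\k' -> χ(g k') * ∑(fins m) \e -> ∑ dirs \d -> χ(q e d) * y k' e d)
   inner g q = ∑≡ cs \k' _ -> tr(∑≡(fins m) \e _ -> tr(∑≡ dirs \d _ -> tr(ap(_* y k' e d)(tr(+b2n(g k' ∧ q e d))(χ-∧(g k')(q e d))))(*-assoc(χ(g k'))(χ(q e d))(y k' e d)))(∑-*(χ(g k'))(\d -> χ(q e d) * y k' e d) dirs))(∑-*(χ(g k'))(\e -> ∑ dirs \d -> χ(q e d) * y k' e d)(fins m))

   M-cap : ∀ k e d -> k ∈ cs -> M(inl(inr(inr(k , e , d)))) == χ(not(not(forb k e) ∧ B e)) * y k e d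
   M-cap k e d k∈ = tr(∑-vars-y _ \e -> 0*(w(inl e)))(tr(∑≡ cs \k' _ -> ∑≡(fins m) \e' _ -> ∑≡ dirs \d' _ -> ap(\b -> + b2n b * y k' e' d')(reorder(not(not(forb k e) ∧ B e))(eqC k k')(eqE e e' ∧ same d d')))(tr(inner(\k' -> eqC k k') \e' d' -> not(not(forb k e) ∧ B e) ∧(eqE e e' ∧ same d d'))(tr(point(\k' -> ∑(fins m) \e' -> ∑ dirs \d' -> χ(not(not(forb k e) ∧ B e) ∧(eqE e e' ∧ same d d')) * y k' e' d') k k∈)(tr(∑≡(fins m) \e' _ -> dir(not(not(forb k e) ∧ B e))(eqE e e') d(y k e'))(tr(∑≡(fins m) \e' _ -> *-assoc-comm(χ(not(not(forb k e) ∧ B e)))(χ(eqE e e'))(y k e' d))(tr(∑-*(χ(not(not(forb k e) ∧ B e)))(\e' -> χ(eqE e e') * y k e' d)(fins m))(ap(_*_(χ(not(not(forb k e) ∧ B e))))(∑pt(\e' -> y k e' d) e)))))))) where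
    reorder : ∀ a b c -> a ∧(b ∧ c) == b ∧(a ∧ c)
    reorder tt tt c = refl
    reorder tt ff c = refl
    reorder ff tt c = refl
    reorder ff ff c = refl
    *-assoc-comm : ∀ a b c -> a * b * c == a *(b * c)
    *-assoc-comm = ring
    dir : ∀ a b d(f : Bool -> Z) -> ∑ dirs(\d' -> χ(a ∧(b ∧ same d d')) * f d') == χ a * χ b * f d
    dir ff b d f = ap2 _+_(0*(f tt))(ap(_+ 0#)(0*(f ff)))
    dir tt ff d f = ap2 _+_(0*(f tt))(ap(_+ 0#)(0*(f ff)))
    dir tt tt tt f = tr(ap2 _+_(1*(f tt))(ap(_+ 0#)(0*(f ff))))(tr(+0 _)(sym(1*(f tt))))
    dir tt tt ff f = tr(ap2 _+_(0*(f tt))(tr(+0 _)(1*(f ff))))(tr(0+ _)(sym(1*(f ff))))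

   at-vx : C -> Fin n -> (Fin m -> Bool -> Fin n) -> Z
   at-vx k v f = ∑(fins m)(\e -> ∑ dirs \d -> χ(not(eqV v(t k)) ∧ eqV(f e d) v) * y k e d)

   P-bal : ∀ k v -> k ∈ cs -> P(inr(k , v)) == at-vx k v tailOf
   P-bal k v k∈ = tr(∑-vars-y _ \e -> 0*(w(inl e)))(tr(inner(eqC k) \e d -> not(eqV v(t k)) ∧ eqV(tailOf e d) v)(point(\k' -> ∑(fins m) \e -> ∑ dirs \d -> χ(not(eqV v(t k)) ∧ eqV(tailOf e d) v) * y k' e d) k k∈))

   M-bal : ∀ k v -> k ∈ cs -> M(inr(k , v)) == at-vx k v headOf
   M-bal k v k∈ = tr(∑-vars-y _ \e -> 0*(w(inl e)))(tr(inner(eqC k) \e d -> not(eqV v(t k)) ∧ eqV(headOf e d) v)(point(\k' -> ∑(fins m) \e -> ∑ dirs \d -> χ(not(eqV v(t k)) ∧ eqV(headOf e d) v) * y k' e d) k k∈))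

   out-flow : C -> Fin n -> Z
   out-flow k v = ∑(fins m)(\e -> (χ(eqV(src e) v) - χ(eqV(tgt e) v)) *(y k e tt - y k e ff))

   bal : ∀ k v -> eqV v(t k) == ff -> at-vx k v tailOf - at-vx k v headOf == out-flow k v
   bal k v v≢t = tr(diffn(\e -> ∑ dirs \d -> χ(not(eqV v(t k)) ∧ eqV(tailOf e d) v) * y k e d)(\e -> ∑ dirs \d -> χ(not(eqV v(t k)) ∧ eqV(headOf e d) v) * y k e d)(fins m))(∑≡(fins m) \e _ -> tr(ap(\b -> ∑ dirs(\d -> χ(not b ∧ eqV(tailOf e d) v) * y k e d) - ∑ dirs \d -> χ(not b ∧ eqV(headOf e d) v) * y k e d) v≢t)(lm(χ(eqV(src e) v))(χ(eqV(tgt e) v))(y k e tt)(y k e ff))) where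
    lm : ∀ a b p q -> a * p +(b * q + 0#) -(b * p +(a * q + 0#)) ==(a - b) *(p - q)
    lm = ring
    diffn : ∀ {A : Set}(f g : A -> Z) xs -> ∑ xs f - ∑ xs g == ∑ xs(\x -> f x - g x)
    diffn f g [] = refl
    diffn f g(x ∷ xs) = tr(lm2(f x)(∑ xs f)(g x)(∑ xs g))(ap(_+_(f x - g x))(diffn f g xs)) where
     lm2 : ∀ a b c d -> a + b -(c + d) == a - c +(b - d)
     lm2 = ring

module Algorithm {n m L : ℕ} (src tgt : Fin m -> Fin n) (ds dt : Fin L -> Fin n) (dk : Fin L -> ℕ) (leq : ℕ -> ℕ -> Fin m -> Fin m -> Bool) where
 open N
 open Rows
 open Perc
 open Typed using (pick; least; rept)
 open Tables using (pairs; either)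
 open import Data.Bool.ListAction using (all)
 open import Data.Nat.ListAction using (sum)

 -- At most two failing edges.
 Slot Comm : Set
 Slot = ⊤ ⊎ Fin m
 Comm = Fin L ×(Slot × Slot)

 _≟ˢ_ : DecEq Slot
 _≟ˢ_ = ⊎.≡-dec ⊤._≟_ Fin._≟_

 _≟ᶜ_ : DecEq Comm
 _≟ᶜ_ = ×.≡-dec Fin._≟_(×.≡-dec _≟ˢ_ _≟ˢ_)

 slts : List Slot
 slts = either(unit ∷ [])(fins m)

 comms : List Comm
 comms = pairs(fins L)(pairs slts slts)

 hit : Slot -> Fin m -> Bool
 hit a e = [(\_ -> ff) ,(\f -> does(f Fin.≟ e)) ]′ a

 used : Slot -> ℕ
 used a = [(\_ -> 0) ,(\_ -> 1) ]′ a

 forb : Comm -> Fin m -> Bool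
 forb(d ,(a , b)) e = hit a e ∨ hit b e

 fails1 : Comm -> ℕ
 fails1(d ,(a , b)) = used a + used b

 source target : Comm -> Fin n
 source(d , _) = ds d
 target(d , _) = dt d

 merge : (Fin m -> Bool) -> (Fin n -> Fin n) -> Fin m -> Fin n -> Fin n
 merge F l e v = if not(F e) ∧ does(l v Fin.≟ l(src e)) then l(tgt e) else l v

 labs : (Fin m -> Bool) -> Fin n -> Fin n
 labs F = foldl(merge F)(\v -> v)(fins m)

 conn : (Fin m -> Bool) -> Fin n -> Fin n -> Bool
 conn F s t = does(labs F s Fin.≟ labs F t)

 active : Comm -> Bool
 active k@(d , _) = (suc(fails1 k) ≤ᵇ dk d) ∧ conn(forb k)(source k)(target k)

 need : Comm -> ℕ
 need k@(d , _) = if active k then dk d ∸ fails1 k else 0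

 -- Abstract, since the type checker would otherwise evaluate these functions and numbers.
 abstract
  feas : (Fin m -> Bool) -> Bool
  feas H = all(\k -> not(active k) ∨ conn(\e -> not(H e) ∨ forb k e)(source k)(target k)) comms

  feas≡ : ∀ H -> feas H == all(\k -> not(active k) ∨ conn(\e -> not(H e) ∨ forb k e)(source k)(target k)) comms
  feas≡ H = refl

  K BIG nVar ε κ err M N : ℕ
  K = suc(m + m)
  BIG = suc(suc(m * K + m * K))
  nVar = len(either(fins m)(pairs comms(pairs(fins m)(tt ∷ ff ∷ []))))
  ε = nVar *(BIG * BIG)
  κ = (n + m + m) * ε
  err = ε + m *(BIG * κ)
  M = suc(m * err + κ)
  N = M + M

  K≡ : K == suc(m + m)
  K≡ = refl

  BIG≡ : BIG == suc(suc(m * K + m * K))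
  BIG≡ = refl

  nVar≡ : nVar == len(either(fins m)(pairs comms(pairs(fins m)(tt ∷ ff ∷ []))))
  nVar≡ = refl

  ε≡ : ε == nVar *(BIG * BIG)
  ε≡ = refl

  κ≡ : κ ==(n + m + m) * ε
  κ≡ = refl

  err≡ : err == ε + m *(BIG * κ)
  err≡ = refl

  M≡ : M == suc(m * err + κ)
  M≡ = refl

  N≡ : N == M + M
  N≡ = refl

 module _ (c : Fin m -> ℕ) where

  module _ (B : Fin m -> Bool) (ℓ : ℕ) where

   open Program src tgt comms (\ k k' -> does (k ≟ᶜ k')) forb source target need B c N ℓ public using (pos; neg; lo; hi)
   open Run (either (fins m) (pairs comms (pairs (fins m) (tt ∷ ff ∷ []))))
    (either(either(unit ∷ [])(either(fins m)(pairs comms(pairs(fins m)(tt ∷ ff ∷ [])))))(pairs comms(fins n)))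
    pos neg lo hi ε(3 * N)(inl(inl unit)) public using(ok;step;start;final;test)

   abstract
    acc1 : Bool
    acc1 = test(suc(nVar *(3 * N *(3 * N))))

    acc≡ : acc1 == test(suc(nVar *(3 * N *(3 * N))))
    acc≡ = refl

  abstract
   val1 : (Fin m -> Bool) -> ℕ
   val1 B = least(N *(m * BIG))(acc1 B)

   val≡ : ∀ B -> val1 B == least(N *(m * BIG))(acc1 B)
   val≡ B = refl

  add : (Fin m -> Bool) -> Fin m -> Fin m -> Bool
  add B e f = B f ∨ does(e Fin.≟ f)

  pays : (Fin m -> Bool) -> Fin m -> Bool
  pays B e = not(B e) ∧(val1(add B e) + M * c e ≤ᵇ val1 B + err)

  grow : Fin m -> (Fin m -> Bool) -> Fin m -> Bool
  grow e0 B = if feas B then B else add B(pick(pays B) e0(fins m))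

 rwt : Fin m -> Fin m -> ℕ
 rwt e0 e = least BIG(\j -> leq K j e e0)

 unav : Fin m -> Bool
 unav e = not(feas \f -> not(does(e Fin.≟ f)))

 abstract
  -- The solution built on the guess that e₀ is a heaviest edge of an optimal one.
  guess : Fin m -> Fin m -> Bool
  guess e0 = rept m(grow(rwt e0) e0)(\e -> unav e ∨ does(e0 Fin.≟ e))

  guess≡ : ∀ e0 -> guess e0 == rept m(grow(rwt e0) e0)(\e -> unav e ∨ does(e0 Fin.≟ e))
  guess≡ e0 = refl

  tot : Fin m -> ℕ
  tot e0 = sum(map(\e -> if guess e0 e then rwt e0 e else 0)(fins m))

  tot≡ : ∀ e0 -> tot e0 == sum(map(\e -> if guess e0 e then rwt e0 e else 0)(fins m))
  tot≡ e0 = refl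

  valid : Fin m -> Bool
  valid e0 = feas(guess e0) ∧(suc(tot e0) ≤ᵇ BIG)

  valid≡ : ∀ e0 -> valid e0 == feas(guess e0) ∧(suc(tot e0) ≤ᵇ BIG)
  valid≡ e0 = refl

 best : Slot -> Bool
 best a = [(\_ -> ff) ,(\e -> valid e ∧ all(\f -> not(valid f) ∨ leq(tot e)(tot f) e f)(fins m)) ]′ a

 result : Fin m -> Bool
 result e = not(feas \_ -> ff) ∧ [(\_ -> ff) ,(\e0 -> guess e0 e) ]′(pick best(inl unit) slts)

module Greedy where
 open Int
 open Sums
 open Cuts using (cl)
 open Links using (T∨F)
 open Typed using (rept)

 rept-suc : {A : Set}(i : ℕ)(f : A -> A)(x : A) -> rept(suc i) f x == f(rept i f x)
 rept-suc zero f x = refl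
 rept-suc(suc i) f x = rept-suc i f(f x)

 ∑-all : ∀ a j -> ∑(fins j)(\_ -> a) == + j * a
 ∑-all a j = tr(∑-const a(fins j))(ap(\l -> + l * a)(length-tabulate {n = j} id))

 module Greedy {m : ℕ} (ok : (Fin m -> Bool) -> Bool) (val1 : (Fin m -> Bool) -> ℕ) (next : (Fin m -> Bool) -> Fin m)
  (c : Fin m -> ℕ)(M err : ℕ)(B1 : Fin m -> Bool)(V top : ℕ) where

  add : (Fin m -> Bool) -> Fin m -> Fin m -> Bool
  add B e f = B f ∨ does(e Fin.≟ f)

  state : ℕ -> Fin m -> Bool
  state i = rept i(\B -> if ok B then B else add B(next B)) B1

  price left : (Fin m -> Bool) -> Z
  price B = ∑(fins m)(\e -> χ(B e) * + c e)
  left B = ∑(fins m)(\e -> χ(not(B e)))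

  split : ∀(B : Fin m -> Bool) e -> B e == ff -> ∀ f -> (does(e Fin.≟ f) == tt × B f == ff) ⊎ does(e Fin.≟ f) == ff
  split B e new f with e Fin.≟ f
  ... | yes refl = inl(refl , new)
  ... | no _ = inr refl

  add-price : ∀(B : Fin m -> Bool) {e} -> B e == ff -> price(add B e) == price B + + c e
  add-price B {e} new = tr(∑≡(fins m) \f _ -> each f(split B e new f))(tr(∑-+(\f -> χ(B f) * + c f)(\f -> χ(does(e Fin.≟ f)) * + c f)(fins m))(ap(_+_(price B))(∑pt(\f -> + c f) e))) where
   each : ∀ f -> (does(e Fin.≟ f) == tt × B f == ff) ⊎ does(e Fin.≟ f) == ff -> χ(B f ∨ does(e Fin.≟ f)) * + c f == χ(B f) * + c f + χ(does(e Fin.≟ f)) * + c f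
   each f(inl(p , q)) rewrite p | q = sym(0+(1# * + c f))
   each f(inr p) rewrite p | Bool.∨-identityʳ(B f) = sym(+0(χ(B f) * + c f))

  add-left : ∀(B : Fin m -> Bool) {e} -> B e == ff -> left B == 1# + left(add B e)
  add-left B {e} new = tr(∑≡(fins m) \f _ -> each f(split B e new f))(tr(∑-+(\f -> χ(does(e Fin.≟ f)) * 1#)(\f -> χ(not(add B e f)))(fins m))(ap(_+ left(add B e))(∑pt(\_ -> 1#) e))) where
   each : ∀ f -> (does(e Fin.≟ f) == tt × B f == ff) ⊎ does(e Fin.≟ f) == ff -> χ(not(B f)) == χ(does(e Fin.≟ f)) * 1# + χ(not(B f ∨ does(e Fin.≟ f)))
   each f(inl(p , q)) rewrite p | q = refl
   each f(inr p) rewrite p | Bool.∨-identityʳ(B f) = sym(0+(χ(not(B f))))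

  Has : (Fin m -> Bool) -> Set
  Has B = ∀ e -> B1 e == tt -> B e == tt

  record Rchd(i : ℕ)(B : Fin m -> Bool) : Set where
   field
    has : Has B
    pot : + val1 B + + M * price B ≤ + V + + M * price B1 + + i * + err
    prog1 : ok B == tt ⊎ left B + + i ≤ + m

  price-mono : ∀ {B} -> Has B -> price B1 ≤ price B
  price-mono {B} h = ∑≤(fins m) \e _ -> each e(B1 e) refl where
   each : ∀ e b -> B1 e == b -> χ b * + c e ≤ χ(B e) * + c e
   each e tt p rewrite h e p = rfl
   each e ff _ = *≥0 {χ(B e)} {+ c e}(χ≥0(B e))(+≤+ z≤n)

  module _ (V≤ : val1 B1 N.≤ V) (sml : V N.+ m N.* err N.< top)
   (pick1 : ∀ B -> Has B -> ok B == ff -> val1 B N.< top -> B(next B) == ff × val1(add B(next B)) N.+ M N.* c(next B) N.≤ val1 B N.+ err) where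

   rchd : ∀ i -> i N.≤ m -> Rchd i(state i)
   rchd zero _ = record { has = \_ p -> p ;pot = to(+≤ˡ(+ M * price B1)(+≤+ V≤))(sym(+0 _))
    ;prog1 = inr(by(+0 _)(to(∑≤ {g = \_ -> 1#}(fins m) \e _ -> ≤1(not(B1 e)))(tr(∑-all 1# m)(*1(+ m))))) } where
    ≤1 : ∀ b -> χ b ≤ 1#
    ≤1 tt = rfl
    ≤1 ff = +≤+ z≤n
   rchd(suc i) i<m = tp(Rchd(suc i))(sym(rept-suc i(\B -> if ok B then B else add B(next B)) B1))(by-ok(ok B) refl) where
    B = state i
    open Rchd (rchd i (N.lt i<m))
    by-ok : ∀ b -> ok B == b -> Rchd(suc i)(if b then B else add B(next B))
    by-ok tt eq = record { has = has ;pot = via pot(bd(lm(+ V + + M * price B1)(+ i)(+ err))(+≤+(z≤n {err}))) ;prog1 = inl eq }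
     where
     lm : ∀ p i e -> p +(1# + i) * e == p + i * e + e
     lm = ring
    by-ok ff eq = record
     { has = \e p -> tr(ap(_∨ does(next B Fin.≟ e))(has e p)) refl
     ;pot = by(tr(ap(\z -> + val1(add B(next B)) + + M * z)(add-price B(fst chosen)))(lm1(+ val1(add B(next B)))(+ M)(price B)(+ c(next B))))(via(+≤ˡ(+ M * price B) paid)(by(lm2(+ val1 B)(+ err)(+ M * price B))(to(+≤ˡ(+ err) pot)(lm3(+ V + + M * price B1)(+ i)(+ err)))))
     ;prog1 = inr(fewer prog1) } where
     lm1 : ∀ v M b c -> v + M *(b + c) == v + M * c + M * b
     lm1 = ring
     lm2 : ∀ v e b -> v + e + b == v + b + e
     lm2 = ring
     lm3 : ∀ p i e -> p + i * e + e == p +(1# + i) * e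
     lm3 = ring
     val< : val1 B N.< top
     val< = N.≤<(drop‿+≤+(to(bd(lm(+ val1 B)(+ M)(price B)(price B1)(+ V)(+ i)(+ m)(+ err))(+≥0(d≥0 pot)(+≥0(*≥0 {+ M} {price B - price B1}(+≤+ z≤n)(d≥0(price-mono has)))(*≥0 {+ m - + i} {+ err}(d≥0(+≤+(N.lt i<m)))(+≤+ z≤n)))))(ap(_+_(+ V))(sym(pos-* m err))))) sml where
      lm : ∀ v M b s V i m e -> V + m * e == v +((V + M * s + i * e -(v + M * b)) +(M *(b - s) +(m - i) * e))
      lm = ring
     chosen = pick1 B has eq val<
     paid : + val1(add B(next B)) + + M * + c(next B) ≤ + val1 B + + err
     paid = by(ap(_+_(+ val1(add B(next B))))(sym(pos-* M(c(next B)))))(+≤+(snd chosen))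
     fewer : ok B == tt ⊎ left B + + i ≤ + m -> left(add B(next B)) + + suc i ≤ + m
     fewer(inl p) = cl p eq
     fewer(inr l) = by(tr(lm(left(add B(next B)))(+ i))(ap(_+ + i)(sym(add-left B(fst chosen))))) l where
      lm : ∀ s i -> s +(1# + i) == 1# + s + i
      lm = ring

   finished : ok(state m) == tt ⊎(∀ e -> state m e == tt)
   finished = by-prog(Rchd.prog1(rchd m N.rfl)) where
    by-prog : ok(state m) == tt ⊎ left(state m) + + m ≤ + m -> ok(state m) == tt ⊎(∀ e -> state m e == tt)
    by-prog(inl p) = inl p
    by-prog(inr l) = inr \e -> all1 e(T∨F(state m e)) where
     lm : ∀ s m -> 0# == s +(m -(s + m))
     lm = ring
     all1 : ∀ e -> state m e == tt ⊎ state m e == ff -> state m e == tt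
     all1 e(inl p) = p
     all1 e(inr p) = void(<⇒≱(+<+(s≤s z≤n))(by(sym(ap(χ ∘ not) p))(via(term≤∑ {f = \e -> χ(not(state m e))}(fins m)(\e _ -> χ≥0(not(state m e)))(∈-fins e))(bd(lm(left(state m))(+ m))(d≥0 l)))))

   final-price : + M * price(state m) ≤ + V + + M * price B1 + + m * + err
   final-price = via(bd(+-comm(+ val1(state m))(+ M * price(state m)))(+≤+ z≤n))(Rchd.pot(rchd m N.rfl))

module Feasible where
 open Int
 open Sums
 open Cuts
 open Links
 open Rows
 open Perc
 open Typed using (does-≡)
 open Tables using (gath; pairs; either; ∈-pairs; ∈-either)

 Sels : {A : Set} -> DecEq A -> List A -> Set
 Sels {A} _≟_ xs = ∀(h : A -> Z) x -> ∑ xs(\x' -> χ(does(x ≟ x')) * h x') == h x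

 sels-pairs : {A B : Set}(_≟1_ : DecEq A)(_≟2_ : DecEq B)(xs : List A)(ys : List B) -> Sels _≟1_ xs -> Sels _≟2_ ys -> Sels(×.≡-dec _≟1_ _≟2_)(pairs xs ys)
 sels-pairs _≟1_ _≟2_ xs ys p q h(x , y) = tr(∑-pairs(\z -> χ(does(×.≡-dec _≟1_ _≟2_(x , y) z)) * h z) xs ys)(tr(∑≡ xs \x' _ -> tr(∑≡ ys \y' _ -> tr(ap(_* h(x' , y'))(tr(ap χ(split x' y'))(χ-∧(does(x ≟1 x'))(does(y ≟2 y')))))(*-assoc(χ(does(x ≟1 x')))(χ(does(y ≟2 y')))(h(x' , y'))))(tr(∑-*(χ(does(x ≟1 x')))(\y' -> χ(does(y ≟2 y')) * h(x' , y')) ys)(ap(_*_(χ(does(x ≟1 x'))))(q(\y' -> h(x' , y')) y))))(p(\x' -> h(x' , y)) x)) where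
  split : ∀ x' y' -> does(×.≡-dec _≟1_ _≟2_(x , y)(x' , y')) == does(x ≟1 x') ∧ does(y ≟2 y')
  split x' y' = does-≡(×.≡-dec _≟1_ _≟2_(x , y)(x' , y'))((x ≟1 x') ×-dec(y ≟2 y'))(\ { refl -> refl , refl })(\ { (refl , refl) -> refl })

module Correct where
 open Int
 open Sums
 open Cuts
 open Links
 open Rows hiding (same)
 open Perc
 open Typed using (least; rept; pick)
 open Tables using (pairs; either)
 open import Data.Bool.ListAction using (all)
 open import Data.Nat.ListAction using (sum)

 module Least (p : ℕ -> Bool) where

  next : ℕ -> ℕ
  next k = if p k then k else suc k

  stays : ∀ j k -> p k == tt -> rept j next k == k
  stays zero k h = refl
  stays(suc j) k h = tr(ap(rept j next)(ap(\b -> if b then k else suc k) h))(stays j k h)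

  record From(k j r : ℕ) : Set where
   field
    upper : r N.≤ k N.+ j
    holds : r N.< k N.+ j -> p r == tt
    fails : ∀ i -> k N.≤ i -> i N.< r -> p i == ff

  from : ∀ j k -> From k j(rept j next k)
  from zero k = record { upper = N.eq≤(sym(N.+0 k)) ;holds = \l -> void(N.<-irrefl(sym(N.+0 k)) l)
              ;fails = \i k≤i i<k -> void(N.<⇒≱ i<k k≤i) }
  from(suc j) k = by-val(p k) refl where
   by-val : ∀ b -> p k == b -> From k(suc j)(rept j next(if p k then k else suc k))
   by-val tt eq = tp(From k(suc j))(sym(stays(suc j) k eq)) record { upper = N.l≤ k(suc j) ;holds = \_ -> eq ;fails = \i k≤i i<k -> void(N.<⇒≱ i<k k≤i) }
   by-val ff eq = tp(From k(suc j))(ap(\b -> rept j next(if b then k else suc k))(sym eq)) record { upper = N.to upper(sym(N.+-suc k j)) ;holds = \l -> holds(N.<≤ l(N.eq≤(N.+-suc k j))) ;fails = fails' }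
    where
    open From (from j (suc k))
    fails' : ∀ i -> k N.≤ i -> i N.< rept j next(suc k) -> p i == ff
    fails' i k≤i i< with N.m≤n⇒m<n∨m≡n k≤i
    ... | inl k<i = fails i k<i i<
    ... | inr refl = eq

  least-holds : ∀ {j} -> least j p N.< j -> p(least j p) == tt
  least-holds {j} = From.holds(from j 0)

  least-≤ : ∀ j {i} -> p i == tt -> least j p N.≤ i
  least-≤ j {i} h = N.≮⇒≥ \l -> cl h(From.fails(from j 0) i z≤n l)

  least-bd : ∀ j -> least j p N.≤ j
  least-bd j = From.upper(from j 0)

  least-fails : ∀ j {i} -> i N.< least j p -> p i == ff
  least-fails j {i} l = From.fails(from j 0) i z≤n l

module Ratio where
 open Int
 open Sums
 open Cuts
 open Links
 open Rows hiding (same)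
 open Perc
 open Typed using (least; rept; pick)
 open Tables using (pairs; either)
 open import Data.Bool.ListAction using (all)
 open import Data.Nat.ListAction using (sum)

 minl : {A : Set}(P : A -> Bool)(key : A -> Z)(xs : List A) {x0 : A} -> P x0 == tt -> ∃[ x ] P x == tt ×(∀ y -> y ∈ x0 ∷ xs -> P y == tt -> key x ≤ key y)
 minl P key [] {x0} v = x0 , v , \ { y(hd refl) _ -> rfl }
 minl P key(z ∷ xs) {x0} v with minl P key xs v | P z in eq
 ... | x , w , least | ff = x , w , \ { y(hd p) q -> least y(hd p) q ;y(th(hd refl)) q -> cl q eq ;y(th(th p)) q -> least y(th p) q }
 ... | x , w , least | tt with ≤-total(key x)(key z)
 ... | inl l = x , w , \ { y(hd p) q -> least y(hd p) q ;y(th(hd refl)) q -> l ;y(th(th p)) q -> least y(th p) q }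
 ... | inr l = z , eq , \ { y(hd p) q -> via l(least y(hd p) q) ;y(th(hd refl)) q -> rfl ;y(th(th p)) q -> via l(least y(th p) q) }

module Network {n m : ℕ} (src tgt : Fin m -> Fin n) where
 open Int
 open Sums
 open Cuts
 open Links
 import Data.List.Relation.Unary.AllPairs.Properties as AllPairsₚ
 import Data.List.Relation.Unary.AllPairs as AllPairs
 open import Data.Vec using (zipWith) renaming (replicate to repl)
 open import Data.Vec.Properties using (≡-dec)
 open import Data.Vec using () renaming (tabulate to tab)
 open import Relation.Nullary.Decidable using (¬¬-excluded-middle)

 Es : List(Fin m)
 Es = fins m

 cut ins : VS n -> Fin m -> Bool
 cut S e = at S(src e) xor at S(tgt e)
 ins S e = at S(src e) ∧ at S(tgt e)

 -- e runs between A and C.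
 btw : VS n -> VS n -> Fin m -> Bool
 btw A C e = (at A(src e) ∧ at C(tgt e)) ∨(at A(tgt e) ∧ at C(src e))

 δ : List(Fin m) -> (Fin m -> Z) -> VS n -> Z
 δ E w S = ∑ E(\e -> χ(cut S e) * w e)

 combine : ∀ E(w : Fin m -> Z)(a b c d f : Fin m -> Bool) -> (∀ e -> χ(a e) + χ(b e) == χ(c e) + χ(d e) + + 2 * χ(f e)) -> ∑ E(\e -> χ(a e) * w e) + ∑ E(\e -> χ(b e) * w e) == ∑ E(\e -> χ(c e) * w e) + ∑ E(\e -> χ(d e) * w e) + + 2 * ∑ E(\e -> χ(f e) * w e)
 combine [] w a b c d f h = refl
 combine(e ∷ E) w a b c d f h = tr(lm1(χ(a e))(χ(b e))(w e) _ _)(tr(ap2(\p q -> p * w e + q)(h e)(combine E w a b c d f h))(lm2(χ(c e))(χ(d e))(χ(f e))(w e) _ _ _)) where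
  lm1 : ∀ a b w s t -> (a * w + s) +(b * w + t) ==(a + b) * w +(s + t)
  lm1 = ring
  lm2 : ∀ c d f w s t u -> (c + d + + 2 * f) * w +(s + t + + 2 * u) ==(c * w + s) +(d * w + t) + + 2 *(f * w + u)
  lm2 = ring

 -- e runs between A ∩ C and the complement of A ∪ C.
 outer : VS n -> VS n -> Fin m -> Bool
 outer A C e = (inA u ∧ inC u ∧ not(inA v) ∧ not(inC v)) ∨(inA v ∧ inC v ∧ not(inA u) ∧ not(inC u)) where
  u = src e
  v = tgt e
  inA = at A
  inC = at C

 uncr-∩∪ : ∀ E w A C -> δ E w A + δ E w C == δ E w(A ∩ C) + δ E w(A ∪ C) + + 2 * ∑ E(\e -> χ(btw(A ∖ C)(C ∖ A) e) * w e)
 uncr-∩∪ E w A C = combine E w(cut A)(cut C)(cut(A ∩ C))(cut(A ∪ C))(btw(A ∖ C)(C ∖ A)) \e -> identity(src e)(tgt e) where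
  bits : ∀ a b c d -> χ(a xor c) + χ(b xor d) == χ((a ∧ b) xor(c ∧ d)) + χ((a ∨ b) xor(c ∨ d)) + + 2 * χ(((a ∧ not b) ∧(d ∧ not c)) ∨((c ∧ not d) ∧(b ∧ not a)))
  bits ff ff ff ff = refl
  bits ff ff ff tt = refl
  bits ff ff tt ff = refl
  bits ff ff tt tt = refl
  bits ff tt ff ff = refl
  bits ff tt ff tt = refl
  bits ff tt tt ff = refl
  bits ff tt tt tt = refl
  bits tt ff ff ff = refl
  bits tt ff ff tt = refl
  bits tt ff tt ff = refl
  bits tt ff tt tt = refl
  bits tt tt ff ff = refl
  bits tt tt ff tt = refl
  bits tt tt tt ff = refl
  bits tt tt tt tt = refl
  identity : ∀ u v -> χ(at A u xor at A v) + χ(at C u xor at C v) == χ(at(A ∩ C) u xor at(A ∩ C) v) + χ(at(A ∪ C) u xor at(A ∪ C) v) + + 2 * χ((at(A ∖ C) u ∧ at(C ∖ A) v) ∨(at(A ∖ C) v ∧ at(C ∖ A) u))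
  identity u v rewrite at-zip _∧_ u A C | at-zip _∧_ v A C | at-zip _∨_ u A C | at-zip _∨_ v A C | at-zip(\a b -> a ∧ not b) u A C | at-zip(\a b -> a ∧ not b) v A C | at-zip(\a b -> a ∧ not b) u C A | at-zip(\a b -> a ∧ not b) v C A = bits(at A u)(at C u)(at A v)(at C v)

 uncr-∖ : ∀ E w A C -> δ E w A + δ E w C == δ E w(A ∖ C) + δ E w(C ∖ A) + + 2 * ∑ E(\e -> χ(outer A C e) * w e)
 uncr-∖ E w A C = combine E w(cut A)(cut C)(cut(A ∖ C))(cut(C ∖ A))(outer A C) \e -> identity(src e)(tgt e) where
  bits : ∀ a b c d -> χ(a xor c) + χ(b xor d) == χ((a ∧ not b) xor(c ∧ not d)) + χ((b ∧ not a) xor(d ∧ not c)) + + 2 * χ((a ∧ b ∧ not c ∧ not d) ∨(c ∧ d ∧ not a ∧ not b))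
  bits ff ff ff ff = refl
  bits ff ff ff tt = refl
  bits ff ff tt ff = refl
  bits ff ff tt tt = refl
  bits ff tt ff ff = refl
  bits ff tt ff tt = refl
  bits ff tt tt ff = refl
  bits ff tt tt tt = refl
  bits tt ff ff ff = refl
  bits tt ff ff tt = refl
  bits tt ff tt ff = refl
  bits tt ff tt tt = refl
  bits tt tt ff ff = refl
  bits tt tt ff tt = refl
  bits tt tt tt ff = refl
  bits tt tt tt tt = refl
  identity : ∀ u v -> χ(at A u xor at A v) + χ(at C u xor at C v) == χ(at(A ∖ C) u xor at(A ∖ C) v) + χ(at(C ∖ A) u xor at(C ∖ A) v) + + 2 * χ((at A u ∧ at C u ∧ not(at A v) ∧ not(at C v)) ∨(at A v ∧ at C v ∧ not(at A u) ∧ not(at C u)))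
  identity u v rewrite at-zip(\a b -> a ∧ not b) u A C | at-zip(\a b -> a ∧ not b) v A C | at-zip(\a b -> a ∧ not b) u C A | at-zip(\a b -> a ∧ not b) v C A = bits(at A u)(at C u)(at A v)(at C v)

 -- Splitting a set U into its subset A and the rest.
 split-cut : ∀ {A U} -> A ⊆ U -> ∀ e -> χ(cut U e) == χ(cut A e) + χ(cut(U ∖ A) e) - + 2 * χ(btw A(U ∖ A) e)
 split-in : ∀ {A U} -> A ⊆ U -> ∀ e -> χ(ins U e) == χ(ins A e) + χ(ins(U ∖ A) e) + χ(btw A(U ∖ A) e)
 split-cut {A} {U} s e rewrite at-zip(\a b -> a ∧ not b)(src e) U A | at-zip(\a b -> a ∧ not b)(tgt e) U A = bits(at A(src e))(at A(tgt e))(at U(src e))(at U(tgt e))(s(src e))(s(tgt e)) where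
  bits : ∀ a c u v -> (a == tt -> u == tt) -> (c == tt -> v == tt) -> χ(u xor v) == χ(a xor c) + χ((u ∧ not a) xor(v ∧ not c)) - + 2 * χ((a ∧(v ∧ not c)) ∨(c ∧(u ∧ not a)))
  bits ff ff ff ff f g = refl
  bits ff ff ff tt f g = refl
  bits ff ff tt ff f g = refl
  bits ff ff tt tt f g = refl
  bits ff tt ff tt f g = refl
  bits ff tt tt tt f g = refl
  bits ff tt ff ff f g with g refl
  ... | ()
  bits ff tt tt ff f g with g refl
  ... | ()
  bits tt ff tt ff f g = refl
  bits tt ff tt tt f g = refl
  bits tt ff ff v f g with f refl
  ... | ()
  bits tt tt tt tt f g = refl
  bits tt tt tt ff f g with g refl
  ... | ()
  bits tt tt ff v f g with f refl
  ... | ()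
 split-in {A} {U} s e rewrite at-zip(\a b -> a ∧ not b)(src e) U A | at-zip(\a b -> a ∧ not b)(tgt e) U A = bits(at A(src e))(at A(tgt e))(at U(src e))(at U(tgt e))(s(src e))(s(tgt e)) where
  bits : ∀ a c u v -> (a == tt -> u == tt) -> (c == tt -> v == tt) -> χ(u ∧ v) == χ(a ∧ c) + χ((u ∧ not a) ∧(v ∧ not c)) + χ((a ∧(v ∧ not c)) ∨(c ∧(u ∧ not a)))
  bits ff ff ff ff f g = refl
  bits ff ff ff tt f g = refl
  bits ff ff tt ff f g = refl
  bits ff ff tt tt f g = refl
  bits ff tt ff tt f g = refl
  bits ff tt tt tt f g = refl
  bits ff tt ff ff f g with g refl
  ... | ()
  bits ff tt tt ff f g with g refl
  ... | ()
  bits tt ff tt ff f g = refl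
  bits tt ff tt tt f g = refl
  bits tt ff ff v f g with f refl
  ... | ()
  bits tt tt tt tt f g = refl
  bits tt tt tt ff f g with g refl
  ... | ()
  bits tt tt ff v f g with f refl
  ... | ()

 module Direction (req : VS n -> Z)
  (supmod : ∀ A C -> req A + req C ≤ req(A ∩ C) + req(A ∪ C) ⊎ req A + req C ≤ req(A ∖ C) + req(C ∖ A))
  (E : List(Fin m))(unique : Unique E)(x : Fin m -> Z)(D : Z)(D>0 : 0# < D)
  (x>0 : ∀ e -> e ∈ E -> 0# < x e)(half : ∀ e -> e ∈ E -> + 2 * x e < D)
  (feas : ∀ S -> D * req S ≤ δ E x S) where
  open import Data.List.Membership.Propositional using (find; lose)
  import Data.List.Relation.Unary.All.Properties as Allₚ
  open import Data.List.Relation.Unary.Any using (Any; any?)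

  Tight : VS n -> Set
  Tight S = δ E x S == D * req S

  Ann : (Fin m -> Z) -> VS n -> Set
  Ann d S = δ E d S == 0#

  -- d does not leave the edges E.
  Supported : (Fin m -> Z) -> Set
  Supported d = ∀ e -> ¬ e ∈ E -> d e == 0#

  Good : VS n -> Set
  Good S = Tight S × 0# < δ E x S

  good? : ∀ S -> Dec(Good S)
  good? S = (δ E x S ℤ.≟ D * req S) ×-dec(0# <? δ E x S)

  NonEmpty : VS n -> Set
  NonEmpty S = ∃[ v ] S ∋ v

  good⇒ne : ∀ {S} -> Good S -> NonEmpty S
  good⇒ne {S}(_ , pos) with Fin.any?(\v -> at S v Bool.≟ tt)
  ... | yes p = p
  ... | no ¬p = void(<-irrefl(sym(∑-0 E \e _ -> tr(ap(\b -> χ b * x e)(ap2 _xor_(out(src e))(out(tgt e))))(0*(x e)))) pos) where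
   out : ∀ v -> S ∌ v
   out v with ∋∨∌ S v
   ... | inl q = void(¬p(v , q))
   ... | inr q = q

  -- Later sets of a laminar list are below or beside earlier ones.
  data Lam : List(VS n) -> Set where
   [] : Lam []
   add : ∀ {S L} -> Good S -> (∀ R -> R ∈ L -> R ⊆ S ⊎ Disjoint R S) -> Lam L -> Lam(S ∷ L)

  disj-sym : ∀ {A C : VS n} -> Disjoint A C -> Disjoint C A
  disj-sym {A} h v p with ∋∨∌ A v
  ... | inl q = cl p(h v q)
  ... | inr q = q

  Blkd : List(VS n) -> VS n -> Set
  Blkd L S = Any(\R -> Cross R S) L

  greedy : ∀ Ss L -> Lam L -> (∀ R -> R ∈ L -> ∀ S -> S ∈ Ss -> ¬ S ⊆ R) -> AllPairs(\R S -> ¬ S ⊆ R) Ss -> ∃[ L' ] Lam L' ×(∀ R -> R ∈ L -> R ∈ L') ×(∀ S -> S ∈ Ss -> Good S -> S ∈ L' ⊎ Blkd L' S)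
  greedy [] L lam before [] = L , lam ,(\_ p -> p) , \_()
  greedy(S ∷ Ss) L lam before(o ∷ ord) with good? S | any?(\R -> cross? R S) L
  ... | no ¬good | _ with greedy Ss L lam(\R p T q -> before R p T(th q)) ord
  ... | L' , lam' , sub , max = L' , lam' , sub , \ { T(hd refl) g -> void(¬good g) ;T(th p) g -> max T p g }
  greedy(S ∷ Ss) L lam before(o ∷ ord) | yes good | yes blkd with greedy Ss L lam(\R p T q -> before R p T(th q)) ord
  ... | L' , lam' , sub , max = L' , lam' , sub , \ { T(hd refl) g -> inr(wid blkd sub) ;T(th p) g -> max T p g } where
   wid : ∀ {L L' : List(VS n)} {P : VS n -> Set} -> Any P L -> (∀ R -> R ∈ L -> R ∈ L') -> Any P L'
   wid(hd p) sub = Data.List.Membership.Propositional.lose(sub _(hd refl)) p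
    where import Data.List.Membership.Propositional
   wid(th p) sub = wid p(\R q -> sub R(th q))
  greedy(S ∷ Ss) L lam before(o ∷ ord) | yes good | no free with greedy Ss(S ∷ L)(add good nested lam)(\ { R(hd refl) T q -> All.lookup o q ;R(th p) T q -> before R p T(th q) }) ord where
   nested : ∀ R -> R ∈ L -> R ⊆ S ⊎ Disjoint R S
   nested R p with not-crs {A = R} {S}(\c -> free(Data.List.Membership.Propositional.lose p c))
    where import Data.List.Membership.Propositional
   ... | inl sub = inl sub
   ... | inr(inl sup) = void(before R p S(hd refl) sup)
   ... | inr(inr disj) = inr disj
  ... | L' , lam' , sub , max = L' , lam' ,(\R p -> sub R(th p)) , \ { T(hd refl) g -> inl(sub T(hd refl)) ;T(th p) g -> max T p g }

  cnt : List(VS n) -> VS n -> Z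
  cnt Q U = ∑ Q(\R -> χ(does(R ⊆? U)))

  cnt-split : ∀ {S U} Q -> S ⊆ U -> (∀ R -> R ∈ Q -> NonEmpty R ×(R ⊆ S ⊎ Disjoint R S)) -> cnt Q U == cnt Q S + cnt Q(U ∖ S)
  cnt-split {S} {U} Q S⊆U h = tr(∑≡ Q \R p -> each R(h R p))(∑-+(\R -> χ(does(R ⊆? S)))(\R -> χ(does(R ⊆?(U ∖ S)))) Q) where
   each : ∀ R -> NonEmpty R ×(R ⊆ S ⊎ Disjoint R S) -> χ(does(R ⊆? U)) == χ(does(R ⊆? S)) + χ(does(R ⊆?(U ∖ S)))
   each R((v , v∈) , inl R⊆S) rewrite dec-tt(R ⊆? S) R⊆S | dec-tt(R ⊆? U)(\v -> S⊆U v ∘ R⊆S v) | dec-ff(R ⊆?(U ∖ S))(\s -> cl(R⊆S v v∈)(snd(∋∖- U S(s v v∈)))) = refl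
   each R((v , v∈) , inr disj) rewrite dec-ff(R ⊆? S)(\s -> cl(s v v∈)(disj v v∈)) with R ⊆? U
   ... | yes R⊆U rewrite dec-tt(R ⊆? U) R⊆U | dec-tt(R ⊆?(U ∖ S))(\w w∈ -> ∋∖ U S(R⊆U w w∈)(disj w w∈)) = refl
   ... | no R⊈U rewrite dec-ff(R ⊆? U) R⊈U | dec-ff(R ⊆?(U ∖ S))(\s -> R⊈U \w w∈ -> fst(∋∖- U S(s w w∈))) = refl

  gain : VS n -> Fin m -> Z
  gain U e = χ(ins U e) * D + χ(cut U e) * x e

  g : VS n -> Z
  g U = ∑ E(gain U)

  gap : VS n -> VS n -> Fin m -> Z
  gap A C e = χ(btw A C e) *(D - + 2 * x e)

  slackE>0 : ∀ e -> e ∈ E -> 0# < D - + 2 * x e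
  slackE>0 e p = tp(_< D - + 2 * x e)(+-inverseʳ(+ 2 * x e))(+-monoˡ-<(-(+ 2 * x e))(half e p))

  gap≥0 : ∀ A C e -> e ∈ E -> 0# ≤ gap A C e
  gap≥0 A C e p = *≥0(χ≥0(btw A C e))(lt(slackE>0 e p))

  g-split : ∀ {A U} -> A ⊆ U -> g U == g A + g(U ∖ A) + ∑ E(gap A(U ∖ A))
  g-split {A} {U} s = tr(∑≡ E \e _ -> each e)(tr(∑-+(\e -> gain A e + gain(U ∖ A) e)(gap A(U ∖ A)) E)(ap(\z -> z + ∑ E(gap A(U ∖ A)))(∑-+(gain A)(gain(U ∖ A)) E))) where
   lm : ∀ i1 i2 b c1 c2 D x -> (i1 + i2 + b) * D +(c1 + c2 - + 2 * b) * x ==(i1 * D + c1 * x) +(i2 * D + c2 * x) + b *(D - + 2 * x)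
   lm = ring
   each : ∀ e -> gain U e == gain A e + gain(U ∖ A) e + gap A(U ∖ A) e
   each e rewrite split-cut {A} {U} s e | split-in {A} {U} s e = lm(χ(ins A e))(χ(ins(U ∖ A) e))(χ(btw A(U ∖ A) e))(χ(cut A e))(χ(cut(U ∖ A) e)) D(x e)

  gain≥0 : ∀ U e -> e ∈ E -> 0# ≤ gain U e
  gain≥0 U e p = +≥0(*≥0(χ≥0(ins U e))(lt D>0))(*≥0(χ≥0(cut U e))(lt(x>0 e p)))

  g-good : ∀ {S} -> Tight S -> g S == D *(∑ E(\e -> χ(ins S e)) + req S)
  g-good {S} t = tr(∑-+(\e -> χ(ins S e) * D)(\e -> χ(cut S e) * x e) E)(tr(ap2 _+_(tr(∑≡ E \e _ -> *-comm(χ(ins S e)) D)(∑-* D(\e -> χ(ins S e)) E)) t)(sym(*-distribˡ-+ D _ _)))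

  next-multiple : ∀ {a b} -> D * a < D * b -> D *(1# + a) ≤ D * b
  next-multiple {a} {b} l = *≤ˡ D {{nonNegative(lt D>0)}}(i<j⇒suc[i]≤j(*-cancelˡ-<-nonNeg D {{nonNegative(lt D>0)}} l))
   where open import Data.Integer using(nonNegative)

  -- The equations that matter: a set is dropped when its equation follows from those of its subsets.
  Eq : List(VS n) -> List(VS n)
  Eq [] = []
  Eq(S ∷ L) with g S ℤ.≟ D * cnt(Eq L) S
  ... | yes _ = Eq L
  ... | no _ = S ∷ Eq L

  Eq⊆ : ∀ L {R} -> R ∈ Eq L -> R ∈ L
  Eq⊆(S ∷ L) p with g S ℤ.≟ D * cnt(Eq L) S
  Eq⊆(S ∷ L) p | yes _ = th(Eq⊆ L p)
  Eq⊆(S ∷ L)(hd refl) | no _ = hd refl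
  Eq⊆(S ∷ L)(th p) | no _ = th(Eq⊆ L p)

  Satd : List(VS n) -> VS n -> Set
  Satd L U = ∀ R -> R ∈ L -> R ⊆ U ⊎ Disjoint R U

  lam-good : ∀ {L} -> Lam L -> ∀ R -> R ∈ L -> Good R
  lam-good(add good _ lam) R(hd refl) = good
  lam-good(add _ _ lam) R(th p) = lam-good lam R p

  satd-∖ : ∀ {L S U} -> Satd L U -> (∀ R -> R ∈ L -> R ⊆ S ⊎ Disjoint R S) -> Satd L(U ∖ S)
  satd-∖ {L} {S} {U} sat nest R p with nest R p | sat R p
  ... | inl R⊆S | _ = inr \v q -> ∌∖ʳ U S(R⊆S v q)
  ... | inr disj | inl R⊆U = inl \v q -> ∋∖ U S(R⊆U v q)(disj v q)
  ... | inr disj | inr disU = inr \v q -> ∌∖ˡ U S(disU v q)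

  cnt-L : ∀ {S L U} -> Lam L -> (∀ R -> R ∈ L -> R ⊆ S ⊎ Disjoint R S) -> S ⊆ U -> cnt(Eq L) U == cnt(Eq L) S + cnt(Eq L)(U ∖ S)
  cnt-L {S} {L} {U} lam nest S⊆U = cnt-split {S} {U}(Eq L) S⊆U(\R p -> good⇒ne(lam-good lam R(Eq⊆ L p)) , nest R(Eq⊆ L p))

  not-in : ∀ {S U} -> Good S -> Disjoint S U -> ¬ S ⊆ U
  not-in {S} good disj s with good⇒ne {S} good
  ... | v , p = cl(s v p)(disj v p)

  cnt-disj : ∀ {S L U} -> Good S -> Disjoint S U -> cnt(Eq(S ∷ L)) U == cnt(Eq L) U
  cnt-disj {S} {L} {U} good disj with g S ℤ.≟ D * cnt(Eq L) S
  ... | yes _ = refl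
  ... | no _ rewrite dec-ff(S ⊆? U)(not-in {S} {U} good disj) = 0+ _

  own : List(VS n) -> VS n -> Z
  own L S with g S ℤ.≟ D * cnt(Eq L) S
  ... | yes _ = 0#
  ... | no _ = 1#

  cnt-in : ∀ {S L U} -> S ⊆ U -> cnt(Eq(S ∷ L)) U == own L S + cnt(Eq L) U
  cnt-in {S} {L} {U} s with g S ℤ.≟ D * cnt(Eq L) S
  ... | yes _ = sym(0+ _)
  ... | no _ rewrite dec-tt(S ⊆? U) s = refl

  cnt≤g : ∀ {L U} -> Lam L -> Satd L U -> D * cnt(Eq L) U ≤ g U
  own≤g : ∀ {S L} -> Good S -> (∀ R -> R ∈ L -> R ⊆ S ⊎ Disjoint R S) -> Lam L -> D *(own L S + cnt(Eq L) S) ≤ g S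

  cnt≤g {U = U} [] sat = by(*0 D)(∑≥0 E(gain≥0 U))
  cnt≤g {S ∷ L} {U}(add good nest lam) sat with sat S(hd refl)
  ... | inr disj = by(ap(_*_ D)(cnt-disj {S} {L} {U} good disj))(cnt≤g {L} {U} lam \R p -> sat R(th p))
  ... | inl S⊆U = by(tr(ap(_*_ D)(tr(cnt-in {S} {L} {U} S⊆U)(ap(_+_(own L S))(cnt-L {S} {L} {U} lam nest S⊆U))))(lm D(own L S)(cnt(Eq L) S)(cnt(Eq L)(U ∖ S))))(via(+≤(own≤g {S} {L} good nest lam)(cnt≤g {L} {U ∖ S} lam(satd-∖ {L} {S} {U}(\R p -> sat R(th p)) nest)))(bd(g-split {S} {U} S⊆U)(∑≥0 E(gap≥0 S(U ∖ S))))) where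
   lm : ∀ D o a b -> D *(o +(a + b)) == D *(o + a) + D * b
   lm = ring

  own≤g {S} {L}(tight , _) nest lam with g S ℤ.≟ D * cnt(Eq L) S
  ... | yes eq = eq≤(tr(ap(_*_ D)(0+ _))(sym eq))
  ... | no neq = to(next-multiple(<≤(≤∧≢⇒<(cnt≤g {L} {S} lam nest)(neq ∘ sym))(eq≤(g-good tight))))(sym(g-good tight))

  squeeze : ∀ {a b c a' b'} -> a' ≤ a -> b' ≤ b -> 0# ≤ c -> a + b + c == a' + b' -> a == a' × b == b' × c == 0#
  squeeze {a} {b} {c} {a'} {b'} p q r eq = equal(sum≡0ˡ(d≥0 p)(+≥0(d≥0 q) r) tot) , equal(sum≡0ˡ(d≥0 q) r rest) , sum≡0ʳ(d≥0 q) r rest where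
   lm : ∀ a b c a' b' -> (a - a') +((b - b') + c) ==(a + b + c) -(a' + b')
   lm = ring
   tot : (a - a') +((b - b') + c) == 0#
   tot = tr(lm a b c a' b')(tr(ap(\z -> z -(a' + b')) eq)(+-inverseʳ(a' + b')))
   rest : (b - b') + c == 0#
   rest = sum≡0ʳ(d≥0 p)(+≥0(d≥0 q) r) tot
   equal : ∀ {a b} -> a - b == 0# -> a == b
   equal {a} {b} = Int.i-j≡0⇒i≡j a b

  δ-split : ∀ d {A U} -> A ⊆ U -> δ E d U == δ E d A + δ E d(U ∖ A) + -(+ 2) * ∑ E(\e -> χ(btw A(U ∖ A) e) * d e)
  δ-split d {A} {U} s = tr(∑≡ E \e _ -> tr(ap(_* d e)(split-cut {A} {U} s e))(lm(χ(cut A e))(χ(cut(U ∖ A) e))(χ(btw A(U ∖ A) e))(d e)))(tr(∑-+(\e -> χ(cut A e) * d e + χ(cut(U ∖ A) e) * d e)(\e -> -(+ 2) *(χ(btw A(U ∖ A) e) * d e)) E)(ap2 _+_(∑-+(\e -> χ(cut A e) * d e)(\e -> χ(cut(U ∖ A) e) * d e) E)(∑-*(-(+ 2))(\e -> χ(btw A(U ∖ A) e) * d e) E))) where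
   lm : ∀ a b c d -> (a + b - + 2 * c) * d == a * d + b * d + -(+ 2) *(c * d)
   lm = ring

  0*≡0 : ∀ a b -> a == 0# -> a * b == 0#
  0*≡0 _ b refl = 0* b

  factor≡0 : ∀ {a b} -> 0# < b -> a * b == 0# -> a == 0#
  factor≡0 {a} {b} p eq with i*j≡0⇒i≡0∨j≡0 a eq
  ... | inl q = q
  ... | inr q = void(<-irrefl(sym q) p)

  dependent : ∀ d -> ∀ {L U} -> Lam L -> Satd L U -> (∀ R -> R ∈ L -> Ann d R) -> g U == D * cnt(Eq L) U -> Ann d U
  dependent d {U = U} [] sat ann eq = ∑-0 E \e p -> 0*≡0(χ(cut U e))(d e)(uncut e p) where
   uncut : ∀ e -> e ∈ E -> χ(cut U e) == 0#
   uncut e p = factor≡0 {χ(cut U e)} {x e}(x>0 e p)(sum≡0ʳ {χ(ins U e) * D} {χ(cut U e) * x e}(*≥0 {χ(ins U e)} {D}(χ≥0(ins U e))(lt D>0))(*≥0 {χ(cut U e)} {x e}(χ≥0(cut U e))(lt(x>0 e p)))(∑≡0 {f = gain U} E(gain≥0 U)(tr eq(*0 D)) e p))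
  dependent d {S ∷ L} {U}(add good nest lam) sat ann eq with sat S(hd refl)
  ... | inr disj = dependent d {L} {U} lam(\R p -> sat R(th p))(\R p -> ann R(th p))(tr eq(ap(_*_ D)(cnt-disj {S} {L} {U} good disj)))
  ... | inl S⊆U = concl(squeeze {g S} {g(U ∖ S)} {∑ E(gap S(U ∖ S))} {D *(own L S + cnt(Eq L) S)} {D * cnt(Eq L)(U ∖ S)}(own≤g {S} {L} good nest lam)(cnt≤g {L} {U ∖ S} lam sat')(∑≥0 E(gap≥0 S(U ∖ S))) sums) where
   sat' : Satd L(U ∖ S)
   sat' = satd-∖ {L} {S} {U}(\R p -> sat R(th p)) nest
   lm : ∀ D o a b -> D *(o +(a + b)) == D *(o + a) + D * b
   lm = ring
   sums : g S + g(U ∖ S) + ∑ E(gap S(U ∖ S)) == D *(own L S + cnt(Eq L) S) + D * cnt(Eq L)(U ∖ S)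
   sums = tr(sym(g-split {S} {U} S⊆U))(tr eq(tr(ap(_*_ D)(tr(cnt-in {S} {L} {U} S⊆U)(ap(_+_(own L S))(cnt-L {S} {L} {U} lam nest S⊆U))))(lm D(own L S)(cnt(Eq L) S)(cnt(Eq L)(U ∖ S)))))
   concl : g S == D *(own L S + cnt(Eq L) S) × g(U ∖ S) == D * cnt(Eq L)(U ∖ S) × ∑ E(gap S(U ∖ S)) == 0# -> Ann d U
   concl(_ , rest , none) = tr(δ-split d {S} {U} S⊆U)(ap2 _+_(ap2 _+_(ann S(hd refl))(dependent d {L} {U ∖ S} lam sat'(\R p -> ann R(th p)) rest))(ap(_*_(-(+ 2)))(∑-0 E \e p -> 0*≡0(χ(btw S(U ∖ S) e))(d e)(factor≡0 {χ(btw S(U ∖ S) e)} {D - + 2 * x e}(slackE>0 e p)(∑≡0 {f = gap S(U ∖ S)} E(gap≥0 S(U ∖ S)) none e p)))))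

  ann-all : ∀ d {L} -> Lam L -> (∀ R -> R ∈ Eq L -> Ann d R) -> ∀ R -> R ∈ L -> Ann d R
  ann-all d {S ∷ L}(add good nest lam) ann R p with g S ℤ.≟ D * cnt(Eq L) S
  ann-all d {S ∷ L}(add good nest lam) ann R(hd refl) | no _ = ann S(hd refl)
  ann-all d {S ∷ L}(add good nest lam) ann R(th p) | no _ = ann-all d {L} lam(\R q -> ann R(th q)) R p
  ann-all d {S ∷ L}(add good nest lam) ann R(th p) | yes _ = ann-all d {L} lam ann R p
  ann-all d {S ∷ L}(add good nest lam) ann R(hd refl) | yes eq = dependent d {L} {S} lam nest(ann-all d {L} lam ann) eq

  ∋full : ∀ v -> full {n} ∋ v
  ∋full v = lookup-replicate v tt

  g-full : g full == + len E * D
  g-full = tr(∑≡ E \e _ -> each e)(∑-const D E) where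
   each : ∀ e -> gain full e == D
   each e = tr(ap2(\a b -> χ(a ∧ b) * D + χ(a xor b) * x e)(∋full(src e))(∋full(tgt e)))(tr(+0 _)(1* D))

  cnt-full : ∀ Q -> cnt Q full == + len Q
  cnt-full Q = tr(∑≡ Q \R _ -> ap χ(dec-tt(R ⊆? full) \v _ -> ∋full v))(tr(∑-const 1# Q)(*1 _))

  pos-term : ∀ {f : Fin m -> Z} xs -> (∀ e -> e ∈ xs -> 0# ≤ f e) -> 0# < ∑ xs f -> ∃[ e ] e ∈ xs × 0# < f e
  pos-term [] h pos = void(<-irrefl refl pos)
  pos-term {f}(e ∷ xs) h pos with 0# <? f e
  ... | yes p = e , hd refl , p
  ... | no ¬p with pos-term xs(\e -> h e ∘ th)(<≤ pos(to(+≤ˡ(∑ xs f)(≮⇒≥ ¬p))(0+ _)))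
  ... | e' , p , q = e' , th p , q

  few-equations : ∀ {e L} -> e ∈ E -> Lam L -> len(Eq L) N.< len E
  few-equations {e} {[]} e∈ [] = inhabited e∈ where
   inhabited : ∀ {xs : List(Fin m)} -> e ∈ xs -> 0 N.< len xs
   inhabited(hd _) = s≤s z≤n
   inhabited(th _) = s≤s z≤n
  few-equations {_} {S ∷ L} _ lam@(add good nest lam') = drop‿+<+(*-cancelˡ-<-nonNeg D {{nonNegative(lt D>0)}}(subst2(\a b -> D * a < b)(cnt-full(Eq(S ∷ L)))(tr g-full(*-comm(+ len E) D)) str)) where
   open import Data.Integer using (nonNegative)
   S⊆full : S ⊆ full
   S⊆full v _ = ∋full v
   crs : ∃[ e ] e ∈ E × 0# < χ(cut S e) * x e
   crs = pos-term E(\e p -> *≥0(χ≥0(cut S e))(lt(x>0 e p)))(snd good)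
   is-cut : ∀ {b w} -> 0# < χ b * w -> b == tt
   is-cut {tt} p = refl
   is-cut {ff} {w} p = void(<-irrefl(sym(0* w)) p)
   cut⇒between : ∀ e -> cut S e == tt -> btw S(full ∖ S) e == tt
   cut⇒between e c with ∋∨∌ S(src e) | ∋∨∌ S(tgt e)
   ... | inl p | inr q = ap2(\a b -> a ∧ b ∨ at S(tgt e) ∧ at(full ∖ S)(src e)) p(∋∖ full S(∋full(tgt e)) q)
   ... | inr p | inl q = tr(ap2(\a b -> at S(src e) ∧ at(full ∖ S)(tgt e) ∨ a ∧ b) q(∋∖ full S(∋full(src e)) p))(Bool.∨-zeroʳ _)
   ... | inl p | inl q = case(tr(sym(ap2 _xor_ p q)) c) where
    case : ∀ {A : Set} -> ff == tt -> A
    case()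
   ... | inr p | inr q = case(tr(sym(ap2 _xor_ p q)) c) where
    case : ∀ {A : Set} -> ff == tt -> A
    case()
   gap>0 : 0# < ∑ E(gap S(full ∖ S))
   gap>0 with crs
   ... | e , p , pos = <≤(tp(\b -> 0# < χ b *(D - + 2 * x e))(sym(cut⇒between e(is-cut pos)))(tp(0# <_)(sym(1* _))(slackE>0 e p)))(term≤∑ E(gap≥0 S(full ∖ S)) p)
   lm : ∀ D o a b -> D *(o +(a + b)) == D *(o + a) + D * b
   lm = ring
   str : D * cnt(Eq(S ∷ L)) full < g full
   str = ≤<(eq≤(tr(ap(_*_ D)(tr(cnt-in {S} {L} {full} S⊆full)(ap(_+_(own L S))(cnt-L {S} {L} {full} lam' nest S⊆full))))(lm D(own L S)(cnt(Eq L) S)(cnt(Eq L)(full ∖ S)))))(≤<(+≤(own≤g {S} {L} good nest lam')(cnt≤g {L} {full ∖ S} lam'(satd-∖ {L} {S} {full}(\R _ -> inl \v _ -> ∋full v) nest)))(by-diff<(g-split {S} {full} S⊆full) gap>0))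

  cr : List(VS n) -> VS n -> ℕ
  cr [] S = 0
  cr(R ∷ L) S with cross? R S
  ... | yes _ = suc(cr L S)
  ... | no _ = cr L S

  cr-mono : ∀ L {S P} -> (∀ R -> R ∈ L -> Cross R P -> Cross R S) -> cr L P N.≤ cr L S
  cr-mono [] h = z≤n
  cr-mono(R ∷ L) {S} {P} h with cross? R P | cross? R S
  ... | yes _ | yes _ = s≤s(cr-mono L \R -> h R ∘ th)
  ... | yes c | no ¬c = void(¬c(h R(hd refl) c))
  ... | no _ | yes _ = N.m≤n⇒m≤1+n(cr-mono L \R -> h R ∘ th)
  ... | no _ | no _ = cr-mono L(\R -> h R ∘ th)

  cr-str : ∀ L {S P T} -> (∀ R -> R ∈ L -> Cross R P -> Cross R S) -> T ∈ L -> Cross T S -> ¬ Cross T P -> cr L P N.< cr L S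
  cr-str(R ∷ L) {S} {P} h(hd refl) c ¬c with cross? R P | cross? R S
  ... | yes c' | _ = void(¬c c')
  ... | no _ | yes _ = s≤s(cr-mono L \R -> h R ∘ th)
  ... | no _ | no ¬c' = void(¬c' c)
  cr-str(R ∷ L) {S} {P} h(th t) c ¬c with cross? R P | cross? R S
  ... | yes _ | yes _ = s≤s(cr-str L(\R -> h R ∘ th) t c ¬c)
  ... | yes c' | no ¬c' = void(¬c'(h R(hd refl) c'))
  ... | no _ | yes _ = N.m≤n⇒m≤1+n(cr-str L(\R -> h R ∘ th) t c ¬c)
  ... | no _ | no _ = cr-str L(\R -> h R ∘ th) t c ¬c

  Compat : VS n -> VS n -> Set
  Compat R T = R ⊆ T ⊎ T ⊆ R ⊎ Disjoint R T

  lam-compat : ∀ {L} -> Lam L -> ∀ R T -> R ∈ L -> T ∈ L -> Compat R T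
  lam-compat(add _ nest lam) R T(hd refl)(hd refl) = inl(\_ p -> p)
  lam-compat(add _ nest lam) R T(hd refl)(th q) with nest T q
  ... | inl s = inr(inl s)
  ... | inr d = inr(inr(disj-sym {T} {R} d))
  lam-compat(add _ nest lam) R T(th p)(hd refl) with nest R p
  ... | inl s = inl s
  ... | inr d = inr(inr d)
  lam-compat(add _ nest lam) R T(th p)(th q) = lam-compat lam R T p q

  module _ {R T S : VS n} (c : Cross T S) where

   private
    both = fst c
    left = fst(snd c)
    right = snd(snd c)

   cross-∩ : Compat R T -> Cross R(T ∩ S) -> Cross R S
   cross-∩ comp((u , u∈R , u∈) ,(v , v∈R , v∉) ,(w , w∉R , w∈)) with comp
   ... | inr(inl T⊆R) = cl(T⊆R w(fst(∋∩⁻ T S w∈))) w∉R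
   ... | inr(inr d) = cl(fst(∋∩⁻ T S u∈))(d u u∈R)
   ... | inl R⊆T with ∌∩⁻ T S v∉
   ... | inl v∉T = cl(R⊆T v v∈R) v∉T
   ... | inr v∉S = (u , u∈R , snd(∋∩⁻ T S u∈)) ,(v , v∈R , v∉S) ,(w , w∉R , snd(∋∩⁻ T S w∈))

   cross-∪ : Compat R T -> Cross R(T ∪ S) -> Cross R S
   cross-∪ comp((u , u∈R , u∈) ,(v , v∈R , v∉) ,(w , w∉R , w∈)) with comp
   ... | inl R⊆T = cl(R⊆T v v∈R)(fst(∌∪⁻ T S v∉))
   ... | inr(inl T⊆R) = (fst both , T⊆R _(fst(snd both)) , snd(snd both)) ,(v , v∈R , snd(∌∪⁻ T S v∉)) ,(w , w∉R , w∈S) where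
    w∈S : S ∋ w
    w∈S with ∋∪⁻ T S w∈
    ... | inl p = cl(T⊆R w p) w∉R
    ... | inr p = p
   ... | inr(inr d) = (u , u∈R , u∈S) ,(v , v∈R , snd(∌∪⁻ T S v∉)) ,(fst both , disj-sym {R} {T} d _(fst(snd both)) , snd(snd both)) where
    u∈S : S ∋ u
    u∈S with ∋∪⁻ T S u∈
    ... | inl p = cl p(d u u∈R)
    ... | inr p = p

   cross-T∖S : Compat R T -> Cross R(T ∖ S) -> Cross R S
   cross-T∖S comp((u , u∈R , u∈) ,(v , v∈R , v∉) ,(w , w∉R , w∈)) with comp
   ... | inr(inl T⊆R) = cl(T⊆R w(fst(∋∖- T S w∈))) w∉R
   ... | inr(inr d) = cl(fst(∋∖- T S u∈))(d u u∈R)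
   ... | inl R⊆T with ∌∖⁻ T S v∉
   ... | inl v∉T = cl(R⊆T v v∈R) v∉T
   ... | inr v∈S = (v , v∈R , v∈S) ,(u , u∈R , snd(∋∖- T S u∈)) ,(fst right , notR , snd(snd right)) where
    notR : R ∌ fst right
    notR with ∋∨∌ R(fst right)
    ... | inl p = cl(R⊆T _ p)(fst(snd right))
    ... | inr p = p

   cross-S∖T : Compat R T -> Cross R(S ∖ T) -> Cross R S
   cross-S∖T comp((u , u∈R , u∈) ,(v , v∈R , v∉) ,(w , w∉R , w∈)) with comp
   ... | inl R⊆T = cl(R⊆T u u∈R)(snd(∋∖- S T u∈))
   ... | inr(inl T⊆R) = (u , u∈R , fst(∋∖- S T u∈)) ,(fst left , T⊆R _(fst(snd left)) , snd(snd left)) ,(w , w∉R , fst(∋∖- S T w∈))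
   ... | inr(inr d) with ∌∖⁻ S T v∉
   ... | inl v∉S = (u , u∈R , fst(∋∖- S T u∈)) ,(v , v∈R , v∉S) ,(w , w∉R , fst(∋∖- S T w∈))
   ... | inr v∈T = cl v∈T(d v v∈R)

  no-self-∩ : ∀ {T S : VS n} -> ¬ Cross T(T ∩ S)
  no-self-∩ {T} {S}(_ , _ , w , w∉ , w∈) = cl(fst(∋∩⁻ T S w∈)) w∉

  no-self-∪ : ∀ {T S : VS n} -> ¬ Cross T(T ∪ S)
  no-self-∪ {T} {S}(_ ,(v , v∈ , v∉) , _) = cl v∈(fst(∌∪⁻ T S v∉))

  no-self-T∖S : ∀ {T S : VS n} -> ¬ Cross T(T ∖ S)
  no-self-T∖S {T} {S}(_ , _ , w , w∉ , w∈) = cl(fst(∋∖- T S w∈)) w∉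

  no-self-S∖T : ∀ {T S : VS n} -> ¬ Cross T(S ∖ T)
  no-self-S∖T {T} {S}((u , u∈ , u∈') , _) = cl u∈(snd(∋∖- S T u∈'))

  x≥0 : ∀ e -> e ∈ E -> 0# ≤ x e
  x≥0 e p = lt(x>0 e p)

  -- Both uncrossing identities have this shape; the third term vanishes for tight sets.
  uncr : ∀ {A C P Q}(f : Fin m -> Bool) -> (∀ w -> δ E w A + δ E w C == δ E w P + δ E w Q + + 2 * ∑ E \e -> χ(f e) * w e) -> req A + req C ≤ req P + req Q -> Tight A -> Tight C -> Tight P × Tight Q ×(∀ d -> δ E d A + δ E d C == δ E d P + δ E d Q)
  uncr {A} {C} {P} {Q} f identity sup tA tC = concl(squeeze {δ E x P} {δ E x Q} {+ 2 * third} {D * req P} {D * req Q}(feas P)(feas Q)(*≥0 {+ 2} {third}(+≤+ z≤n) third≥0)(tr(sym(identity x)) tot)) where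
   third : Z
   third = ∑ E(\e -> χ(f e) * x e)
   third≥0 : 0# ≤ third
   third≥0 = ∑≥0 {f = \e -> χ(f e) * x e} E(\e p -> *≥0 {χ(f e)} {x e}(χ≥0(f e))(x≥0 e p))
   tot : δ E x A + δ E x C == D * req P + D * req Q
   tot = ≤-antisym(by(tr(ap2 _+_ tA tC)(sym(*-distribˡ-+ D(req A)(req C))))(to(*≤ˡ D {{ℤ.nonNegative(lt D>0)}} sup)(*-distribˡ-+ D(req P)(req Q))))(via(+≤(feas P)(feas Q))(bd(identity x)(*≥0 {+ 2} {third}(+≤+ z≤n) third≥0)))
   half≡0 : + 2 * third == 0# -> third == 0#
   half≡0 eq with i*j≡0⇒i≡0∨j≡0(+ 2) {third} eq
   ... | inr q = q
   concl : Tight P × Tight Q × + 2 * third == 0# -> Tight P × Tight Q ×(∀ d -> δ E d A + δ E d C == δ E d P + δ E d Q)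
   concl(tP , tQ , none) = tP , tQ , \d -> tr(identity d)(tr(ap(\z -> δ E d P + δ E d Q + + 2 * z)(∑-0 E \e p -> 0*≡0(χ(f e))(d e)(factor≡0 {χ(f e)} {x e}(x>0 e p)(∑≡0 {f = \e -> χ(f e) * x e} E(\e p -> *≥0 {χ(f e)} {x e}(χ≥0(f e))(x≥0 e p))(half≡0 none) e p))))(+0 _))

  module _ {L : List (VS n)} (lam : Lam L) (maximal : ∀ S -> Good S -> S ∈ L ⊎ Blkd L S)
   (d : Fin m -> Z)(ann : ∀ R -> R ∈ L -> Ann d R) where

   flat1 : ∀ {S} -> ¬ 0# < δ E x S -> Ann d S
   flat1 {S} ¬pos = ∑-0 E \e p -> 0*≡0(χ(cut S e))(d e)(factor≡0 {χ(cut S e)} {x e}(x>0 e p)(∑≡0 {f = \e -> χ(cut S e) * x e} E nn δ≡0 e p)) where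
    nn : ∀ e -> e ∈ E -> 0# ≤ χ(cut S e) * x e
    nn e p = *≥0 {χ(cut S e)} {x e}(χ≥0(cut S e))(x≥0 e p)
    δ≡0 : δ E x S == 0#
    δ≡0 = ≤-antisym(≮⇒≥ ¬pos)(∑≥0 {f = \e -> χ(cut S e) * x e} E nn)

   from-halves : ∀ {a b c d} -> a + b == c + d -> a == 0# -> c == 0# -> d == 0# -> b == 0#
   from-halves {b = b} eq refl refl refl = tr(sym(0+ b)) eq

   module _ (k : ℕ) (IH : ∀ {S} -> cr L S N.< k -> Tight S -> Ann d S) {S : VS n} (l : cr L S N.< suc k)
    {T : VS n}(T∈ : T ∈ L)(c : Cross T S) where

    fewer : ∀ {P} -> (∀ {R} -> Cross T S -> Compat R T -> Cross R P -> Cross R S) -> ¬ Cross T P -> cr L P N.< k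
    fewer {P} h ¬self = N.<≤(cr-str L {S} {P} {T}(\R R∈ -> h {R} c(lam-compat lam R T R∈ T∈)) T∈ c ¬self)(ℕ.s≤s⁻¹ l)

    by-halves : ∀ {P Q} -> cr L P N.< k -> cr L Q N.< k -> Tight P × Tight Q ×(∀ d -> δ E d T + δ E d S == δ E d P + δ E d Q) -> Ann d S
    by-halves {P} {Q} lP lQ(tP , tQ , eq) = from-halves {δ E d T} {δ E d S} {δ E d P} {δ E d Q}(eq d)(ann T T∈)(IH lP tP)(IH lQ tQ)

    by-uncrossing : Tight S -> Ann d S
    by-uncrossing t = pick1(supmod T S) where
     tT : Tight T
     tT = fst(lam-good lam T T∈)
     pick1 : req T + req S ≤ req(T ∩ S) + req(T ∪ S) ⊎ req T + req S ≤ req(T ∖ S) + req(S ∖ T) -> Ann d S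
     pick1(inl sup) = by-halves {T ∩ S} {T ∪ S}(fewer {T ∩ S}(\ {R} -> cross-∩ {R} {T} {S})(no-self-∩ {T} {S}))(fewer {T ∪ S}(\ {R} -> cross-∪ {R} {T} {S})(no-self-∪ {T} {S}))(uncr {T} {S} {T ∩ S} {T ∪ S}(btw(T ∖ S)(S ∖ T))(\w -> uncr-∩∪ E w T S) sup tT t)
     pick1(inr sup) = by-halves {T ∖ S} {S ∖ T}(fewer {T ∖ S}(\ {R} -> cross-T∖S {R} {T} {S})(no-self-T∖S {T} {S}))(fewer {S ∖ T}(\ {R} -> cross-S∖T {R} {T} {S})(no-self-S∖T {T} {S}))(uncr {T} {S} {T ∖ S} {S ∖ T}(outer T S)(\w -> uncr-∖ E w T S) sup tT t)

   tight⇒ann'd : ∀ k {S} -> cr L S N.< k -> Tight S -> Ann d S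
   tight⇒ann'd(suc k) {S} l t = decide(0# <? δ E x S) where
    decide : Dec(0# < δ E x S) -> Ann d S
    decide(no ¬pos) = flat1 {S} ¬pos
    decide(yes pos) = search(maximal S(t , pos)) where
     search : S ∈ L ⊎ Blkd L S -> Ann d S
     search(inl S∈) = ann S S∈
     search(inr blkd) = let(T , T∈ , c) = find blkd in by-uncrossing k(tight⇒ann'd k) {S} l {T} T∈ c t

  record Free : Set where
   field
    d : Fin m -> Z
    off : Supported d
    e : Fin m
    e∈ : e ∈ E
    nz1 : d e ≢ 0#
    tight : ∀ S -> Tight S -> Ann d S

  free : ∀ {e} -> e ∈ E -> Free
  free e∈ with greedy(allVS n) [] [](\_())(allVS-ordered n)
  ... | L , lam , _ , max with Homog.sol1 Fin._≟_ E unique(map(\S e -> χ(cut S e))(Eq L))(tp(N._< len E)(sym(length-map(\S e -> χ(cut S e))(Eq L)))(few-equations e∈ lam))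
   where open import Data.List.Properties using(length-map)
  ... | sol = record
   { d = d ;off = off ;e = var ;e∈ = var∈ ;nz1 = nz1
   ;tight = \S t -> tight⇒ann'd {L} lam(\S good -> max S(∈-allVS S) good) d(ann-all d {L} lam \R R∈ -> All.lookup(Allₚ.map⁻ solves) R∈)(suc(cr L S)) {S}(N.n<1+n(cr L S)) t }
   where open Homog.Solution sol

 module Halves (req : VS n -> Z)
  (supmod : ∀ A C -> req A + req C ≤ req(A ∩ C) + req(A ∪ C) ⊎ req A + req C ≤ req(A ∖ C) + req(C ∖ A))
  (w : Fin m -> Z) where
  open import Data.Integer using (nonNegative; positive)
  open import Data.List using (filter)

  edges : List(Fin m)
  edges = fins m

  cost : (Fin m -> Z) -> Z
  cost x = ∑ edges(\e -> w e * x e)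

  *0≡0 : ∀ a b -> b == 0# -> a * b == 0#
  *0≡0 a _ refl = *0 a

  -- x / D lies in the cut polytope.
  record Frac(x : Fin m -> Z)(D : Z) : Set where
   constructor frac1
   field
    D>0 : 0# < D
    x≥0 : ∀ e -> 0# ≤ x e
    feas : ∀ S -> D * req S ≤ δ edges x S

  cancel≤ : ∀ {c a b} -> 0# < c -> c * a ≤ c * b -> a ≤ b
  cancel≤ {c} {a} {b} p = *-cancelˡ-≤-pos a b c {{positive p}}

  scale≤ : ∀ {c a b} -> 0# ≤ c -> a ≤ b -> c * a ≤ c * b
  scale≤ {c} p = *≤ˡ c {{nonNegative p}}

  module MinRatio {K : Set} (a b : K -> Z) where

   -- k attains the minimum of a / (- b) over the constraints with b < 0.
   Least : List K -> K -> Set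
   Least ks k = ∀ j -> j ∈ ks -> b j < 0# -> a k *(- b j) ≤ a j *(- b k)

   least : ∀ ks -> (∃[ k ] k ∈ ks × b k < 0#) -> ∃[ k ] k ∈ ks × b k < 0# × Least ks k
   least(k ∷ ks)(j , j∈ , bj) with b k <? 0# | Data.List.Relation.Unary.Any.any?(\j -> b j <? 0#) ks
    where import Data.List.Relation.Unary.Any
   ... | no ¬bk | _ with least ks(below j∈) where
    below : j ∈ k ∷ ks -> ∃[ j ] j ∈ ks × b j < 0#
    below(hd refl) = void(¬bk bj)
    below(th p) = j , p , bj
   ... | i , i∈ , bi , min = i , th i∈ , bi , \ { j(hd refl) bj -> void(¬bk bj) ;j(th p) bj -> min j p bj }
   least(k ∷ ks) _ | yes bk | no none = k , hd refl , bk , \ { j(hd refl) _ -> rfl ;j(th p) bj -> void(none(Data.List.Membership.Propositional.lose p bj)) }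
    where import Data.List.Membership.Propositional
   least(k ∷ ks) _ | yes bk | yes some with least ks(Data.List.Membership.Propositional.find some)
    where import Data.List.Membership.Propositional
   ... | i , i∈ , bi , min with a k *(- b i) ≤? a i *(- b k)
   ... | no k≰i = i , th i∈ , bi , \ { j(hd refl) _ -> lt(≰⇒> k≰i) ;j(th p) bj -> min j p bj }
   ... | yes k≤i = k , hd refl , bk , \ { j(hd refl) _ -> rfl ;j(th p) bj -> chain {a k} {a i} {a j} { - b k} { - b i} { - b j}(neg-mono-< bi)(neg-mono-< bj)(neg-mono-< bk) k≤i(min j p bj) } where
    chain : ∀ {a1 a2 a3 q1 q2 q3} -> 0# < q2 -> 0# < q3 -> 0# < q1 -> a1 * q2 ≤ a2 * q1 -> a2 * q3 ≤ a3 * q2 -> a1 * q3 ≤ a3 * q1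
    chain {a1} {a2} {a3} {q1} {q2} {q3} p2 p3 p1 l l' = cancel≤ {q2} {a1 * q3} {a3 * q1} p2(subst2 _≤_(e1 q3 a1 q2)(e2 q1 a3 q2)(via(scale≤ {q3} {a1 * q2} {a2 * q1}(lt p3) l)(by(e3 q3 a2 q1)(scale≤ {q1} {a2 * q3} {a3 * q2}(lt p1) l')))) where
     e1 : ∀ q a r -> q *(a * r) == r *(a * q)
     e1 = ring
     e2 : ∀ q a r -> q *(a * r) == r *(a * q)
     e2 = ring
     e3 : ∀ q a r -> q *(a * r) == r *(a * q)
     e3 = ring

  Con1 : Set
  Con1 = Fin m ⊎ VS n

  cons : List Con1
  cons = map inl Es ++ map inr(allVS n)

  ∈-cons : ∀ c -> c ∈ cons
  ∈-cons(inl e) = ∈-++⁺ˡ(∈-map⁺ inl(∈-fins e))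
  ∈-cons(inr S) = ∈-++⁺ʳ(map inl Es)(∈-map⁺ inr(∈-allVS S))

  slack : (Fin m -> Z) -> Z -> Con1 -> Z
  slack x D(inl e) = x e
  slack x D(inr S) = δ edges x S - D * req S

  loose : (Con1 -> Z) -> List Con1 -> ℕ
  loose s [] = 0
  loose s(c ∷ cs) with s c ℤ.≟ 0#
  ... | yes _ = loose s cs
  ... | no _ = suc(loose s cs)

  loose-mono : ∀ {s t} cs -> (∀ c -> s c == 0# -> t c == 0#) -> loose t cs N.≤ loose s cs
  loose-mono [] h = z≤n
  loose-mono {s} {t}(c ∷ cs) h with s c ℤ.≟ 0# | t c ℤ.≟ 0#
  ... | yes _ | yes _ = loose-mono cs h
  ... | yes p | no ¬q = void(¬q(h c p))
  ... | no _ | yes _ = N.m≤n⇒m≤1+n(loose-mono cs h)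
  ... | no _ | no _ = s≤s(loose-mono cs h)

  loose-str : ∀ {s t} cs -> (∀ c -> s c == 0# -> t c == 0#) -> ∀ {c} -> c ∈ cs -> s c ≢ 0# -> t c == 0# -> loose t cs N.< loose s cs
  loose-str {s} {t}(c ∷ cs) h(hd refl) p q with s c ℤ.≟ 0# | t c ℤ.≟ 0#
  ... | yes p' | _ = void(p p')
  ... | no _ | yes _ = s≤s(loose-mono cs h)
  ... | no _ | no ¬q = void(¬q q)
  loose-str {s} {t}(c ∷ cs) h(th c∈) p q with s c ℤ.≟ 0# | t c ℤ.≟ 0#
  ... | yes _ | yes _ = loose-str cs h c∈ p q
  ... | yes p' | no ¬q = void(¬q(h c p'))
  ... | no _ | yes _ = N.m≤n⇒m≤1+n(loose-str cs h c∈ p q)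
  ... | no _ | no _ = s≤s(loose-str cs h c∈ p q)

  record Outc(x : Fin m -> Z)(D : Z) : Set where
   field
    x' : Fin m -> Z
    D' : Z
    poly1 : Frac x' D'
    support : ∀ e -> x e == 0# -> x' e == 0#
    cheap : D * cost x' ≤ D' * cost x
    box : ∀ e -> x' e ≤ D'
    result : (∃[ e ] D' ≤ + 2 * x' e) ⊎(∀ e -> x' e == 0#)

  linear : ∀(f : Fin m -> Z) q p(x d : Fin m -> Z) -> ∑ edges(\e -> f e *(q * x e + p * d e)) == q * ∑ edges(\e -> f e * x e) + p * ∑ edges(\e -> f e * d e)
  linear f q p x d = tr(∑≡ edges \e _ -> lm(f e) q p(x e)(d e))(tr(∑-+(\e -> q *(f e * x e))(\e -> p *(f e * d e)) edges)(ap2 _+_(∑-* q(\e -> f e * x e) edges)(∑-* p(\e -> f e * d e) edges))) where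
   lm : ∀ f q p x d -> f *(q * x + p * d) == q *(f * x) + p *(f * d)
   lm = ring

  ∑-filter : ∀ {P : Fin m -> Set}(P? : ∀ e -> Dec(P e))(f : Fin m -> Z) xs -> (∀ e -> ¬ P e -> f e == 0#) -> ∑(filter P? xs) f == ∑ xs f
  ∑-filter P? f [] h = refl
  ∑-filter P? f(e ∷ xs) h with P? e
  ... | yes _ = ap(_+_(f e))(∑-filter P? f xs h)
  ... | no ¬p = tr(∑-filter P? f xs h)(sym(tr(ap(\z -> z + ∑ xs f)(h e ¬p))(0+ _)))

  -- Moving along a free direction until the first constraint becomes tight.
  module Move (x : Fin m -> Z) (D : Z) (frac : Frac x D) (sml : ∀ e -> + 2 * x e < D) (e0 : Fin m) (e0>0 : 0# < x e0) where
   open Frac frac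

   E : List(Fin m)
   E = filter(\e -> 0# <? x e) edges

   unique : Unique E
   unique = Uniqueₚ.filter⁺(\e -> 0# <? x e)(Uniqueₚ.allFin⁺ m)

   off≡0 : ∀ e -> ¬ 0# < x e -> x e == 0#
   off≡0 e ¬p = ≤-antisym(≮⇒≥ ¬p)(x≥0 e)

   δ-restrict : ∀(y : Fin m -> Z) -> (∀ e -> ¬ 0# < x e -> y e == 0#) -> ∀ S -> δ E y S == δ edges y S
   δ-restrict y h S = ∑-filter(\e -> 0# <? x e)(\e -> χ(cut S e) * y e) edges(\e ¬p -> *0≡0(χ(cut S e))(y e)(h e ¬p))

   dir = Direction.free req supmod E unique x D D>0(\e p -> snd(∈-filter⁻(\e -> 0# <? x e) {xs = edges} p))(\e _ -> sml e)(\S -> to(feas S)(sym(δ-restrict x off≡0 S)))(∈-filter⁺(\e -> 0# <? x e)(∈-fins e0) e0>0)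

   open Direction.Free dir using (e; e∈; nz1) renaming (d to d0; off to off0; tight to tight0)

   record Downhill : Set where
    field
     d : Fin m -> Z
     off : ∀ e -> x e == 0# -> d e == 0#
     nz : d e ≢ 0#
     tight : ∀ S -> slack x D(inr S) == 0# -> δ edges d S == 0#
     descent : cost d ≤ 0#

   neg : ∀(f d : Fin m -> Z) -> ∑ edges(\e -> f e *(- d e)) == - ∑ edges(\e -> f e * d e)
   neg f d = tr(∑≡ edges \e _ -> lm(f e)(d e))(tr(∑-*(- 1#)(\e -> f e * d e) edges)(lm2 _)) where
    lm : ∀ f d -> f *(- d) ==(- 1#) *(f * d)
    lm = ring
    lm2 : ∀ a -> (- 1#) * a == - a
    lm2 = ring

   off1 : ∀ e -> ¬ 0# < x e -> d0 e == 0#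
   off1 e ¬p = off0 e(\q -> ¬p(snd(∈-filter⁻(\e -> 0# <? x e) {xs = edges} q)))

   tight1 : ∀ S -> slack x D(inr S) == 0# -> δ edges d0 S == 0#
   tight1 S eq = tr(sym(δ-restrict d0 off1 S))(tight0 S(tr(δ-restrict x off≡0 S)(i-j≡0⇒i≡j _ _ eq)))

   irrefl : ∀ {a} -> a == 0# -> ¬ 0# < a
   irrefl refl p = <-irrefl refl p

   backwards : 0# < cost d0 -> Downhill
   backwards pos = record
    { d = \e -> - d0 e ;off = \e eq -> ap -_(off1 e(irrefl eq)) ;nz = \eq -> nz1(tr(sym(neg-involutive(d0 e)))(ap -_ eq))
    ;tight = tight' ;descent = by(neg w d0)(lt(neg-mono-< pos)) } where
    tight' : ∀ S -> slack x D(inr S) == 0# -> δ edges(\e -> - d0 e) S == 0#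
    tight' S eq = tr(neg(\e -> χ(cut S e)) d0)(ap -_(tight1 S eq))

   downhill : Downhill
   downhill = pick1(cost d0 ≤? 0#) where
    pick1 : Dec(cost d0 ≤ 0#) -> Downhill
    pick1(yes p) = record { d = d0 ;off = \e eq -> off1 e(irrefl eq) ;nz = nz1 ;tight = tight1 ;descent = p }
    pick1(no ¬p) = backwards(≰⇒> ¬p)

   open Downhill downhill

   a b : Con1 ⊎ Fin m -> Z
   a(inl c) = slack x D c
   a(inr e) = D - + 2 * x e
   b(inl(inl e)) = d e
   b(inl(inr S)) = δ edges d S
   b(inr e) = -(+ 2 * d e)

   a≥0 : ∀ k -> 0# ≤ a k
   a≥0(inl(inl e)) = x≥0 e
   a≥0(inl(inr S)) = d≥0(feas S)
   a≥0(inr e) = d≥0(lt(sml e))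

   a≡0⇒b≡0 : ∀ k -> a k == 0# -> b k == 0#
   a≡0⇒b≡0(inl(inl e)) eq = off e eq
   a≡0⇒b≡0(inl(inr S)) eq = tight S eq
   a≡0⇒b≡0(inr e) eq = void(<-irrefl(sym(i-j≡0⇒i≡j D _ eq))(sml e))

   all : List(Con1 ⊎ Fin m)
   all = map inl cons ++ map inr Es

   ∈-all : ∀ k -> k ∈ all
   ∈-all(inl c) = ∈-++⁺ˡ(∈-map⁺ inl(∈-cons c))
   ∈-all(inr e) = ∈-++⁺ʳ(map inl cons)(∈-map⁺ inr(∈-fins e))

   some-negative : ∃[ k ] k ∈ all × b k < 0#
   some-negative with d e <? 0#
   ... | yes p = inl(inl e) , ∈-all _ , p
   ... | no ¬p = inr e , ∈-all _ , neg-mono-<(*>0 {+ 2} {d e}(+<+(s≤s z≤n))(≢0⇒>0(≮⇒≥ ¬p) nz))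

   module Step (k : Con1 ⊎ Fin m) (bk<0 : b k < 0#) (q p : Z) (q-def : q == - b k) (p-def : p == a k)
    (bd1 : ∀ j -> j ∈ all -> b j < 0# -> p *(- b j) ≤ a j * q) where

    q>0 : 0# < q
    q>0 = tp(0# <_)(sym q-def)(neg-mono-< bk<0)

    p≥0 : 0# ≤ p
    p≥0 = tp(0# ≤_)(sym p-def)(a≥0 k)

    x⁺ : Fin m -> Z
    x⁺ e = q * x e + p * d e

    D⁺ : Z
    D⁺ = q * D

    a⁺ : Con1 ⊎ Fin m -> Z
    a⁺(inl c) = slack x⁺ D⁺ c
    a⁺(inr e) = D⁺ - + 2 * x⁺ e

    a⁺-eq : ∀ j -> a⁺ j == q * a j + p * b j
    a⁺-eq(inl(inl e)) = refl
    a⁺-eq(inl(inr S)) = tr(ap(_- D⁺ * req S)(linear(\e -> χ(cut S e)) q p x d))(lm q D(req S) p(δ edges x S)(δ edges d S)) where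
     lm : ∀ q D r p s t -> q * s + p * t - q * D * r == q *(s - D * r) + p * t
     lm = ring
    a⁺-eq(inr e) = lm q D p(x e)(d e) where
     lm : ∀ q D p x d -> q * D - + 2 *(q * x + p * d) == q *(D - + 2 * x) + p *(-(+ 2 * d))
     lm = ring

    a⁺≥0 : ∀ j -> 0# ≤ a⁺ j
    a⁺≥0 j with b j <? 0#
    ... | yes bj = to(d≥0(bd1 j(∈-all j) bj))(tr(lm(a j) q p(b j))(sym(a⁺-eq j))) where
     lm : ∀ a q p b -> a * q - p *(- b) == q * a + p * b
     lm = ring
    ... | no ¬bj = to(+≥0(*≥0(lt q>0)(a≥0 j))(*≥0 p≥0(≮⇒≥ ¬bj)))(sym(a⁺-eq j))

    zeros : ∀ j -> a j == 0# -> a⁺ j == 0#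
    zeros j eq = tr(a⁺-eq j)(tr(ap2(\s t -> q * s + p * t) eq(a≡0⇒b≡0 j eq))(ap2 _+_(*0 q)(*0 p)))

    blkd : a⁺ k == 0#
    blkd = tr(a⁺-eq k)(tr(ap2(\q p -> q * a k + p * b k) q-def p-def)(lm(b k)(a k))) where
     lm : ∀ b a -> - b * a + a * b == 0#
     lm = ring

    p≢0 : a k ≢ 0#
    p≢0 eq = <-irrefl(a≡0⇒b≡0 k eq) bk<0

    frac⁺ : Frac x⁺ D⁺
    frac⁺ = frac1(*>0 q>0 D>0)(\e -> a⁺≥0(inl(inl e)))(\S -> via(bd(lm(D⁺ * req S)(δ edges x⁺ S))(a⁺≥0(inl(inr S)))) rfl) where
     lm : ∀ a b -> b == a +(b - a)
     lm = ring

    cheap⁺ : D * cost x⁺ ≤ D⁺ * cost x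
    cheap⁺ = bd(tr(sym(lm q D p(cost x)(cost d)))(ap(\z -> D * z + -(D *(p * cost d)))(sym(linear w q p x d))))(tp(0# ≤_)(lm2 D p(cost d))(*≥0(lt D>0)(*≥0 p≥0(neg-mono-≤ descent)))) where
     lm : ∀ q D p c t -> D *(q * c + p * t) + -(D *(p * t)) == q * D * c
     lm = ring
     lm2 : ∀ D p c -> D *(p *(- c)) == -(D *(p * c))
     lm2 = ring

    box⁺ : ∀ e -> + 2 * x⁺ e ≤ D⁺
    box⁺ e = bd(lm(+ 2 * x⁺ e) D⁺)(a⁺≥0(inr e)) where
     lm : ∀ a b -> b == a +(b - a)
     lm = ring

    prog1 : (∀ e -> + 2 * x⁺ e < D⁺) -> loose(slack x⁺ D⁺) cons N.< loose(slack x D) cons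
    prog1 str = at1 k p≢0 blkd where
     at1 : ∀ k -> a k ≢ 0# -> a⁺ k == 0# -> loose(slack x⁺ D⁺) cons N.< loose(slack x D) cons
     at1(inl c) nz z = loose-str cons(\c -> zeros(inl c))(∈-cons c) nz z
     at1(inr e) nz z = void(<-irrefl(sym(i-j≡0⇒i≡j D⁺ _ z))(str e))

  half≤ : ∀ {y D} -> 0# ≤ y -> + 2 * y ≤ D -> y ≤ D
  half≤ {y} {D} y≥0 l = via(bd(lm y) y≥0) l where
   lm : ∀ y -> + 2 * y == y + y
   lm = ring

  round : ∀ k x D -> loose(slack x D) cons N.< k -> Frac x D -> (∀ e -> x e ≤ D) -> Outc x D
  round(suc k) x D l frac box with Fin.any?(\e -> D ≤? + 2 * x e)
  ... | yes half = record { x' = x ;D' = D ;poly1 = frac ;support = \_ eq -> eq ;cheap = rfl ;box = box ;result = inl half }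
  ... | no ¬half with Fin.any?(\e -> 0# <? x e)
  ... | no ¬pos = record { x' = x ;D' = D ;poly1 = frac ;support = \_ eq -> eq ;cheap = rfl ;box = box
               ;result = inr \e -> ≤-antisym(≮⇒≥ \p -> ¬pos(e , p))(Frac.x≥0 frac e) }
  ... | yes(e0 , e0>0) = move(MinRatio.least a b all some-negative) where
   sml : ∀ e -> + 2 * x e < D
   sml e = ≰⇒>(\p -> ¬half(e , p))
   open Move x D frac sml e0 e0>0
   module Moved {κ} (bk<0 : b κ < 0#) (bd1 : MinRatio.Least a b all κ) where
    open Step κ bk<0 (- b κ) (a κ) refl refl bd1
    support⁺ : ∀ e -> x e == 0# -> x⁺ e == 0#
    support⁺ e = zeros(inl(inl e))
    box' : ∀ e -> x⁺ e ≤ D⁺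
    box' e = half≤(Frac.x≥0 frac⁺ e)(box⁺ e)
    continue : Dec(∃[ e ] D⁺ ≤ + 2 * x⁺ e) -> Outc x D
    continue(yes half) = record { x' = x⁺ ;D' = D⁺ ;poly1 = frac⁺ ;support = support⁺ ;cheap = cheap⁺ ;box = box' ;result = inl half }
    continue(no ¬half') = record
     { x' = x' ;D' = D' ;poly1 = poly1 ;support = \e eq -> support e(support⁺ e eq) ;box = box'' ;result = result
     ;cheap = cancel≤(Frac.D>0 frac⁺)(by(e1 D⁺ D(cost x'))(via(scale≤(lt(Frac.D>0 frac)) cheap)(by(e1 D D'(cost x⁺))(to(scale≤(lt(Frac.D>0 poly1)) cheap⁺)(e1 D' D⁺(cost x)))))) } where
     rec : Outc x⁺ D⁺
     rec = round k x⁺ D⁺(N.<≤(prog1 \e -> ≰⇒> \p -> ¬half'(e , p))(ℕ.s≤s⁻¹ l)) frac⁺ box'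
     open Outc rec renaming (box to box'')
     e1 : ∀ a b c -> a *(b * c) == b *(a * c)
     e1 = ring
   move : ∃[ κ ] κ ∈ all × b κ < 0# × MinRatio.Least a b all κ -> Outc x D
   move(κ , _ , bk<0 , bd1) = continue(Fin.any? \e -> Step.D⁺ κ bk<0(- b κ)(a κ) refl refl bd1 ≤? + 2 * Step.x⁺ κ bk<0(- b κ)(a κ) refl refl bd1 e)
    where open Moved {κ} bk<0 bd1

  half-integral : ∀ {x D} -> Frac x D -> (∀ e -> x e ≤ D) -> Outc x D
  half-integral = round _ _ _(N.n<1+n _)

 module Gale (u : Fin m -> Z) (u≥0 : ∀ e -> 0# ≤ u e) (t : Fin n) where

  inc : Fin m -> Fin n -> Z
  inc e v = χ(does(src e Fin.≟ v)) - χ(does(tgt e Fin.≟ v))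

  net : List(Fin m) -> (Fin m -> Z) -> Fin n -> Z
  net E y v = ∑ E(\e -> inc e v * y e)

  tot : (Fin n -> Z) -> VS n -> Z
  tot b S = ∑(fins n)(\v -> χ(at S v) * b v)

  largest : {A : Set}(P : A -> Set) -> (∀ x -> Dec(P x)) -> (L : A -> Z)(l : Z)(xs : List A) -> ∃[ α ] l ≤ α ×(∀ x -> x ∈ xs -> P x -> L x ≤ α) ×(α == l ⊎ ∃[ x ] P x × α == L x)
  largest P P? L l [] = l , rfl ,(\_()) , inl refl
  largest P P? L l(x ∷ xs) with largest P P? L l xs | P? x
  ... | α , l≤1 , all , att | no ¬p = α , l≤1 ,(\ { y(hd refl) p -> void(¬p p) ;y(th q) p -> all y q p }) , att
  ... | α , l≤1 , all , att | yes p with L x ≤? α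
  ... | yes Lx≤ = α , l≤1 ,(\ { y(hd refl) _ -> Lx≤ ;y(th q) p -> all y q p }) , att
  ... | no ¬Lx≤ = L x , via l≤1(lt(≰⇒> ¬Lx≤)) ,(\ { y(hd refl) _ -> rfl ;y(th q) p -> via(all y q p)(lt(≰⇒> ¬Lx≤)) }) , inr(x , p , refl)

  tot-modular : ∀ b A C -> tot b A + tot b C == tot b(A ∩ C) + tot b(A ∪ C)
  tot-modular b A C = tr(sym(∑-+(\v -> χ(at A v) * b v)(\v -> χ(at C v) * b v)(fins n)))(tr(∑≡(fins n) \v _ -> each v)(∑-+(\v -> χ(at(A ∩ C) v) * b v)(\v -> χ(at(A ∪ C) v) * b v)(fins n))) where
   each : ∀ v -> χ(at A v) * b v + χ(at C v) * b v == χ(at(A ∩ C) v) * b v + χ(at(A ∪ C) v) * b v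
   each v with ∋∨∌ A v | ∋∨∌ C v
   ... | inl p | inl q rewrite p | q | ∋∩ A C {v} p q | ∋∪ˡ A C {v} p = refl
   ... | inl p | inr q rewrite p | q | ∌∩ʳ A C {v} q | ∋∪ˡ A C {v} p = +-comm(1# * b v)(0# * b v)
   ... | inr p | inl q rewrite p | q | ∌∩ˡ A C {v} p | ∋∪ʳ A C {v} q = refl
   ... | inr p | inr q rewrite p | q | ∌∩ˡ A C {v} p | ∌∪ A C {v} p q = refl

  tot-point : ∀ c v S -> tot(\x -> c * χ(does(v Fin.≟ x))) S == c * χ(at S v)
  tot-point c v S = tr(∑≡(fins n) \x _ -> lm(χ(at S x)) c(χ(does(v Fin.≟ x))))(∑pt(\x -> c * χ(at S x)) v) where
   lm : ∀ s c d -> s *(c * d) == d *(c * s)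
   lm = ring

  Supply : List(Fin m) -> (Fin n -> Z) -> Set
  Supply E b = ∀ S -> S ∌ t -> tot b S ≤ δ E u S

  shift : Z -> Fin m -> (Fin n -> Z) -> Fin n -> Z
  shift α e b v = b v - inc e v * α

  tot-shift : ∀ α e b S -> tot(shift α e b) S == tot b S -(χ(at S(src e)) - χ(at S(tgt e))) * α
  tot-shift α e b S = tr(∑≡(fins n) \v _ -> lm(χ(at S v))(b v)(χ(does(src e Fin.≟ v)))(χ(does(tgt e Fin.≟ v))) α)(tr(∑-+(\v -> χ(at S v) * b v)(\v -> χ(at S v) *((- α) * χ(does(src e Fin.≟ v))) + χ(at S v) *(α * χ(does(tgt e Fin.≟ v))))(fins n))(tr(ap(_+_(tot b S))(tr(∑-+(\v -> χ(at S v) *((- α) * χ(does(src e Fin.≟ v))))(\v -> χ(at S v) *(α * χ(does(tgt e Fin.≟ v))))(fins n))(ap2 _+_(tot-point(- α)(src e) S)(tot-point α(tgt e) S))))(lm2(tot b S) α(χ(at S(src e)))(χ(at S(tgt e)))))) where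
   lm : ∀ s b p q α -> s *(b -(p - q) * α) == s * b +(s *((- α) * p) + s *(α * q))
   lm = ring
   lm2 : ∀ b α p q -> b +((- α) * p + α * q) == b -(p - q) * α
   lm2 = ring

  record Flow(E : List(Fin m))(b : Fin n -> Z) : Set where
   field
    y : Fin m -> Z
    upper : ∀ e -> e ∈ E -> y e ≤ u e
    lower : ∀ e -> e ∈ E -> - u e ≤ y e
    meet : ∀ v -> v ≢ t -> b v ≤ net E y v

  flow : ∀ E -> Unique E -> ∀ b -> Supply E b -> Flow E b
  flow [] _ b sup1 = record { y = \_ -> 0# ;upper = \_() ;lower = \_() ;meet = \v v≢t ->
   by(sym(tr(∑≡(fins n) \x _ -> ap(\c -> χ c * b x)(at-tab(\x -> does(v Fin.≟ x)) x))(∑pt b v)))(sup1(tab \x -> does(v Fin.≟ x))(tr(at-tab _ t)(dec-ff(v Fin.≟ t) v≢t))) }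
  flow(e ∷ E)(e∉ ∷ uniq) b sup1 = extend(flow E uniq(shift α e b) sup') where
   a1 = src e
   a2 = tgt e
   P : VS n -> Set
   P S = at S t == ff × at S a1 == tt × at S a2 == ff
   P? : ∀ S -> Dec(P S)
   P? S = (at S t Bool.≟ ff) ×-dec((at S a1 Bool.≟ tt) ×-dec(at S a2 Bool.≟ ff))
   L : VS n -> Z
   L S = tot b S - δ E u S
   best = largest P P? L(- u e)(allVS n)
   α = fst best
   l≤α : - u e ≤ α
   l≤α = fst(snd best)
   L≤α : ∀ S -> P S -> L S ≤ α
   L≤α S = fst(snd(snd best)) S(∈-allVS S)
   demand : ∀ S {p q} -> S ∌ t -> at S a1 == p -> at S a2 == q -> tot b S ≤ χ(p xor q) * u e + δ E u S
   demand S t∉ refl refl = sup1 S t∉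
   L≤u : ∀ S {p q} -> S ∌ t -> at S a1 == p -> at S a2 == q -> p xor q == tt -> L S ≤ u e
   L≤u S {p} {q} t∉ x y cross = bd(lm(tot b S)(u e)(δ E u S))(d≥0(to(demand S t∉ x y)(ap(\c -> χ c * u e + δ E u S) cross))) where
    lm : ∀ b u d -> u == b - d +(1# * u + d - b)
    lm = ring
   uncr'd : ∀ S {p q} -> S ∌ t -> at S a1 == p -> at S a2 == q -> p xor q == ff -> tot b S ≤ δ E u S
   uncr'd S t∉ x y same = to(demand S t∉ x y)(tr(ap(\c -> χ c * u e + δ E u S) same)(0+ _))
   α≤u : α ≤ u e
   α≤u with snd(snd(snd best))
   ... | inl eq = by eq(via(neg-mono-≤(u≥0 e))(u≥0 e))
   ... | inr(S ,(t∉ , p , q) , eq) = by eq(L≤u S t∉ p q refl)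
   α≤-L : ∀ S -> S ∌ t -> S ∌ a1 -> S ∋ a2 -> α ≤ - L S
   α≤-L S t∉ p q with snd(snd(snd best))
   ... | inl eq = by eq(neg-mono-≤(L≤u S t∉ p q refl))
   ... | inr(R ,(t∉R , p' , q') , eq) = by eq(bd(lm(tot b R)(tot b S)(δ E u R)(δ E u S))(d≥0 uncr)) where
    lm : ∀ r s x y -> -(s - y) == r - x +(x + y -(r + s))
    lm = ring
    uncr : tot b R + tot b S ≤ δ E u R + δ E u S
    uncr = by(tot-modular b R S)(via(+≤(uncr'd(R ∩ S)(∌∩ˡ R S t∉R)(∌∩ʳ R S p)(∌∩ˡ R S q') refl)(uncr'd(R ∪ S)(∌∪ R S t∉R t∉)(∋∪ˡ R S p')(∋∪ʳ R S q) refl))(bd(uncr-∩∪ E u R S)(*≥0 {+ 2} {∑ E(\e -> χ(btw(R ∖ S)(S ∖ R) e) * u e)}(+≤+ z≤n)(∑≥0 {f = \e -> χ(btw(R ∖ S)(S ∖ R) e) * u e} E \e _ -> *≥0 {χ(btw(R ∖ S)(S ∖ R) e)} {u e}(χ≥0(btw(R ∖ S)(S ∖ R) e))(u≥0 e)))))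
   sup' : Supply E(shift α e b)
   sup' S t∉ = by(tot-shift α e b S)(sides(∋∨∌ S a1)(∋∨∌ S a2)) where
    stay : ∀ {x y} -> x ≤ y -> ∀ a -> x -(a - a) * α ≤ y
    stay {x} h a = by(lm x a α) h where
     lm : ∀ x a α -> x -(a - a) * α == x
     lm = ring
    sides : S ∋ a1 ⊎ S ∌ a1 -> S ∋ a2 ⊎ S ∌ a2 -> tot b S -(χ(at S a1) - χ(at S a2)) * α ≤ δ E u S
    sides(inl p)(inl q) = by(ap2(\x y -> tot b S -(χ x - χ y) * α) p q)(stay(uncr'd S t∉ p q refl) 1#)
    sides(inr p)(inr q) = by(ap2(\x y -> tot b S -(χ x - χ y) * α) p q)(stay(uncr'd S t∉ p q refl) 0#)
    sides(inl p)(inr q) = by(ap2(\x y -> tot b S -(χ x - χ y) * α) p q)(bd(lm(tot b S) α(δ E u S))(d≥0(L≤α S(t∉ , p , q)))) where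
     lm : ∀ b α d -> d == b -(1# - 0#) * α +(α -(b - d))
     lm = ring
    sides(inr p)(inl q) = by(ap2(\x y -> tot b S -(χ x - χ y) * α) p q)(bd(lm(tot b S) α(δ E u S))(d≥0(α≤-L S t∉ p q))) where
     lm : ∀ b α d -> d == b -(0# - 1#) * α +(-(b - d) - α)
     lm = ring
   extend : Flow E(shift α e b) -> Flow(e ∷ E) b
   extend f = record { y = y⁺ ;upper = upper⁺ ;lower = lower⁺ ;meet = meet⁺ }
    where
    open Flow f
    y⁺ : Fin m -> Z
    y⁺ x = if does(e Fin.≟ x) then α else y x
    y-e : y⁺ e == α
    y-e = ap(\b -> if b then α else y e)(dec-tt(e Fin.≟ e) refl)
    y-E : ∀ x -> x ∈ E -> y⁺ x == y x
    y-E x p = ap(\b -> if b then α else y x)(dec-ff(e Fin.≟ x)(All.lookup e∉ p))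
    upper⁺ : ∀ x -> x ∈ e ∷ E -> y⁺ x ≤ u x
    upper⁺ x(hd refl) = by y-e α≤u
    upper⁺ x(th p) = by(y-E x p)(upper x p)
    lower⁺ : ∀ x -> x ∈ e ∷ E -> - u x ≤ y⁺ x
    lower⁺ x(hd refl) = to l≤α(sym y-e)
    lower⁺ x(th p) = to(lower x p)(sym(y-E x p))
    meet⁺ : ∀ v -> v ≢ t -> b v ≤ net(e ∷ E) y⁺ v
    meet⁺ v v≢t = bd(tr(ap2(\p q -> inc e v * p + q) y-e(∑≡ E \x p -> ap(_*_(inc x v))(y-E x p)))(lm(b v)(inc e v) α(net E y v)))(d≥0(meet v v≢t)) where
     lm : ∀ b i α n -> i * α + n == b +(n -(b - i * α))
     lm = ring

 Joins : Fin m -> Fin n -> Fin n -> Set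
 Joins e u v = (src e == u × tgt e == v) ⊎(src e == v × tgt e == u)

 join-sym : ∀ {e u v} -> Joins e u v -> Joins e v u
 join-sym(inl p) = inr p
 join-sym(inr p) = inl p

 ES : Set
 ES = Fin m -> Bool

 -- Walks that avoid the edges of F.
 data Lnk(F : ES) : Fin n -> Fin n -> Set where
  stop : ∀ {u} -> Lnk F u u
  step : ∀ {u v w} e -> F e == ff -> Joins e u v -> Lnk F v w -> Lnk F u w

 len1 : ∀ {F u v} -> Lnk F u v -> ℕ
 len1 stop = 0
 len1(step _ _ _ p) = suc(len1 p)

 infixr 5 _⁀_

 _⁀_ : ∀ {F u v w} -> Lnk F u v -> Lnk F v w -> Lnk F u w
 stop ⁀ q = q
 step e f j p ⁀ q = step e f j(p ⁀ q)

 edge : ∀ {F u v} e -> F e == ff -> Joins e u v -> Lnk F u v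
 edge e f j = step e f j stop

 back : ∀ {F u v} -> Lnk F u v -> Lnk F v u
 back stop = stop
 back(step e f j p) = back p ⁀ edge e f(join-sym j)

 wid : ∀ {F F' : ES} {u v} -> (∀ e -> F e == ff -> F' e == ff) -> Lnk F u v -> Lnk F' u v
 wid h stop = stop
 wid h(step e f j p) = step e(h e f) j(wid h p)

 cut-join : ∀ S {e u v} -> Joins e u v -> cut S e == at S u xor at S v
 cut-join S(inl(refl , refl)) = refl
 cut-join S {e}(inr(refl , refl)) = Bool.xor-comm(at S(src e))(at S(tgt e))

 in-join : ∀ S {e u v} -> Joins e u v -> S ∋ u -> S ∋ v -> ins S e == tt
 in-join S(inl(refl , refl)) p q = ∧-T p q
 in-join S(inr(refl , refl)) p q = ∧-T q p

 uncut : ∀ S {e u v} -> Joins e u v -> cut S e == ff -> at S u == at S v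
 uncut S {e} {u} {v} j c = xor-false(tr(sym(cut-join S j)) c) where
  xor-false : ∀ {a b} -> a xor b == ff -> a == b
  xor-false {tt} {tt} _ = refl
  xor-false {ff} {ff} _ = refl

 cut-true : ∀ S {e u v} -> Joins e u v -> S ∋ u -> S ∌ v -> cut S e == tt
 cut-true S j p q = tr(cut-join S j)(ap2 _xor_ p q)

 cut-true' : ∀ S {e u v} -> Joins e u v -> S ∌ u -> S ∋ v -> cut S e == tt
 cut-true' S j p q = tr(cut-join S j)(ap2 _xor_ p q)

 cut-false : ∀ S {e u v} -> Joins e u v -> at S u == at S v -> cut S e == ff
 cut-false S {u = u} j eq = tr(cut-join S j)(tr(ap(at S u xor_)(sym eq))(Bool.xor-same(at S u)))

 ends : ∀ e -> Joins e(src e)(tgt e)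
 ends e = inl(refl , refl)

 -- Avoiding F and staying inside T, respectively outside T.
 wn : VS n -> ES -> ES
 wn T F e = F e ∨ not(ins T e)

 co : VS n -> VS n
 co T = full ∖ T

 co-∋ : ∀ T {v} -> T ∌ v -> co T ∋ v
 co-∋ T {v} p = ∋∖ full T(lookup-replicate v tt) p

 co-∌ : ∀ T {v} -> T ∋ v -> co T ∌ v
 co-∌ T {v} p = ∌∖ʳ full T p

 at-co : ∀ T v -> at(co T) v == not(at T v)
 at-co T v with ∋∨∌ T v
 ... | inl p = tr(co-∌ T p)(sym(ap not p))
 ... | inr p = tr(co-∋ T p)(sym(ap not p))

 cut-co : ∀ T e -> cut(co T) e == cut T e
 cut-co T e = tr(ap2 _xor_(at-co T(src e))(at-co T(tgt e)))(bits(at T(src e))(at T(tgt e))) where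
  bits : ∀ a b -> not a xor not b == a xor b
  bits tt tt = refl
  bits tt ff = refl
  bits ff tt = refl
  bits ff ff = refl

 record Exit(T : VS n)(F : ES)(u v : Fin n)(ℓ : ℕ) : Set where
  field
   {e} : Fin m
   {a} {b} : Fin n
   joins : Joins e a b
   a∈ : T ∋ a
   b∉ : T ∌ b
   e∉F : F e == ff
   before : Lnk(wn T F) u a
   after : Lnk F b v
   shorter : suc(len1 before N.+ len1 after) == ℓ

 exit : ∀ T {F u v}(p : Lnk F u v) -> T ∋ u -> (T ∋ v × Lnk(wn T F) u v) ⊎ Exit T F u v(len1 p)
 exit T stop u∈ = inl(u∈ , stop)
 exit T {F}(step {v = w} e0 f j p) u∈ with ∋∨∌ T w
 ... | inr w∉ = inr record { joins = j ;a∈ = u∈ ;b∉ = w∉ ;e∉F = f ;before = stop ;after = p ;shorter = refl }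
 ... | inl w∈ with exit T p w∈
 ... | inl(v∈ , q) = inl(v∈ , step e0(∨-Fs f(ap not(in-join T j u∈ w∈))) j q)
 ... | inr x = inr record { joins = joins ;a∈ = a∈ ;b∉ = b∉ ;e∉F = e∉F ;after = after ;shorter = ap suc shorter
                ;before = step e0(∨-Fs f(ap not(in-join T j u∈ w∈))) j before }
  where open Exit x

 exits : ∀ T {F u v}(p : Lnk F u v) -> T ∋ u -> T ∌ v -> Exit T F u v(len1 p)
 exits T p u∈ v∉ with exit T p u∈
 ... | inl(v∈ , _) = cl v∈ v∉
 ... | inr x = x

 unin : ∀ {T F u v} -> Lnk(wn T F) u v -> Lnk F u v
 unin = wid \e p -> fst(∨-F p)

 -- An edge of the cut has only one endpoint on each side.
 same-end : ∀ T {e a b a' b'} -> Joins e a b -> Joins e a' b' -> T ∋ a -> T ∌ b -> T ∋ a' -> T ∌ b' -> a == a' × b == b'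
 same-end T(inl(refl , refl))(inl(refl , refl)) p q p' q' = refl , refl
 same-end T(inl(refl , refl))(inr(refl , refl)) p q p' q' = cl p q'
 same-end T(inr(refl , refl))(inl(refl , refl)) p q p' q' = cl p q'
 same-end T(inr(refl , refl))(inr(refl , refl)) p q p' q' = refl , refl

 -- A set closed under the edges outside F contains everything linked to it.
 closed-set : ∀ {F}(P : Fin n -> Set) -> (∀ {u v} e -> F e == ff -> Joins e u v -> P u -> P v) -> ∀ {u v} -> Lnk F u v -> P u -> P v
 closed-set P h stop pu = pu
 closed-set P h(step e f j p) pu = closed-set P h p(h e f j pu)

 Cmpt : ES -> Fin n -> VS n -> Set
 Cmpt F s U = (∀ v -> U ∋ v -> Lnk F s v) ×(∀ v -> Lnk F s v -> U ∋ v)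

 cmpt : ∀ F s -> ¬ ¬(∃[ U ] Cmpt F s U)
 cmpt F s = em-all(Lnk F s) >>= \d -> pure(tab(does ∘ d) ,(\v p -> does-true(d v)(tr(sym(at-tab(does ∘ d) v)) p)) , \v p -> tr(at-tab(does ∘ d) v)(dec-tt(d v) p)) where
  does-true : ∀ {P : Set}(d : Dec P) -> does d == tt -> P
  does-true(yes p) _ = p

 cmpt-cut : ∀ {F s U} -> Cmpt F s U -> ∀ e -> cut U e == tt -> F e == tt
 cmpt-cut {F} {s} {U}(to , from) e c with T∨F(F e)
 ... | inl p = p
 ... | inr p with ∋∨∌ U(src e) | ∋∨∌ U(tgt e)
 ... | inl x | inr y = cl(from _(to _ x ⁀ edge e p(ends e))) y
 ... | inr x | inl y = cl(from _(to _ y ⁀ edge e p(join-sym(ends e)))) x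
 ... | inl x | inl y = cl c(ap2 _xor_ x y)
 ... | inr x | inr y = cl c(ap2 _xor_ x y)

 wt : (Fin m -> Z) -> ES -> Z
 wt g p = ∑ Es(\f -> χ(p f) * g f)

 is : Fin m -> ES
 is e f = does(e Fin.≟ f)

 isT : ∀ {e f} -> is e f == tt -> e == f
 isT {e} {f} p with e Fin.≟ f
 ... | yes eq = eq

 is-refl : ∀ e -> is e e == tt
 is-refl e = dec-tt(e Fin.≟ e) refl

 module _ (g : Fin m -> Z) (g≥0 : ∀ e -> 0# ≤ g e) where

  term≥0 : ∀(p : ES) f -> 0# ≤ χ(p f) * g f
  term≥0 p f = *≥0 {χ(p f)} {g f}(χ≥0(p f))(g≥0 f)

  pointwise : ∀ {p q : ES} -> (∀ f -> χ(p f) ≤ χ(q f)) -> wt g p ≤ wt g q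
  pointwise {p} {q} h = ∑≤ Es \f _ -> *≤ʳ(g f) {{Data.Integer.nonNegative(g≥0 f)}}(h f)
   where import Data.Integer

  wt-mono : ∀ {p q : ES} -> (∀ f -> p f == tt -> q f == tt) -> wt g p ≤ wt g q
  wt-mono {p} {q} h = pointwise {p} {q} \f -> bits(p f)(q f)(h f) where
   bits : ∀ a b -> (a == tt -> b == tt) -> χ a ≤ χ b
   bits tt b h rewrite h refl = rfl
   bits ff b h = χ≥0 b

  wt-+ : ∀ {p q r : ES} -> (∀ f -> χ(p f) + χ(q f) ≤ χ(r f)) -> wt g p + wt g q ≤ wt g r
  wt-+ {p} {q} {r} h = by(sym(∑-+(\f -> χ(p f) * g f)(\f -> χ(q f) * g f) Es))(∑≤ Es \f _ -> by(sym(*-distribʳ-+(g f)(χ(p f))(χ(q f))))(*≤ʳ(g f) {{Data.Integer.nonNegative(g≥0 f)}}(h f)))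
   where import Data.Integer

  wt-disj : ∀ {p q r : ES} -> (∀ f -> p f == tt -> r f == tt × q f == ff) -> (∀ f -> q f == tt -> r f == tt) -> wt g p + wt g q ≤ wt g r
  wt-disj {p} {q} {r} h k = wt-+ {p} {q} {r} \f -> bits(p f)(q f)(r f)(h f)(k f) where
   bits : ∀ a b c -> (a == tt -> c == tt × b == ff) -> (b == tt -> c == tt) -> χ a + χ b ≤ χ c
   bits tt b c h k rewrite fst(h refl) | snd(h refl) = rfl
   bits ff tt c h k rewrite k refl = rfl
   bits ff ff c h k = χ≥0 c

  wt-is : ∀ e -> wt g(is e) == g e
  wt-is = ∑pt g

  wt-cover : ∀ {p q : ES} e -> (∀ f -> p f == tt -> q f == tt ⊎ f == e) -> wt g p ≤ wt g q + g e
  wt-cover {p} {q} e h = to(∑≤ Es \f _ -> to(*≤ʳ(g f) {{Data.Integer.nonNegative(g≥0 f)}}(each f))(*-distribʳ-+(g f)(χ(q f))(χ(is e f))))(tr(∑-+(\f -> χ(q f) * g f)(\f -> χ(is e f) * g f) Es)(ap(_+_(wt g q))(wt-is e))) where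
   import Data.Integer
   each : ∀ f -> χ(p f) ≤ χ(q f) + χ(is e f)
   each f with T∨F(p f)
   ... | inr eq rewrite eq = +≥0(χ≥0(q f))(χ≥0(is e f))
   ... | inl eq with h f eq
   ... | inl qf rewrite eq | qf = bd refl(χ≥0(is e f))
   ... | inr refl rewrite eq | is-refl e = bd(+-comm(χ(q e)) 1#)(χ≥0(q e))

  wt-elem : ∀ {p : ES} e -> p e == tt -> g e ≤ wt g p
  wt-elem {p} e h = by(sym(wt-is e))(wt-mono {is e} {p} \f eq -> tp(\f -> p f == tt)(isT eq) h)

 Sep : VS n -> Fin n -> Fin n -> Set
 Sep S s t = at S s ≢ at S t

 none : ES
 none _ = ff

 -- A minimal cut with at most two edges, marked at one of them.
 record SCut(s t : Fin n)(k : ℕ) : Set where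
  field
   T : VS n
   s∈ : T ∋ s
   t∉ : T ∌ t
   minl : ∀ f -> cut T f == tt -> Lnk(\x -> cut T x ∧ not(is f x)) s t
   e : Fin m
   {a} {b} : Fin n
   joins : Joins e a b
   a∈ : T ∋ a
   b∉ : T ∌ b
   size : (2 Data.Nat.≤ k ×(∀ f -> cut T f == tt -> f == e)) ⊎(k == 3 × ∃[ e' ] e' ≢ e × cut T e' == tt ×(∀ f -> cut T f == tt -> f == e ⊎ f == e'))

  e-cut : cut T e == tt
  e-cut = cut-true T joins a∈ b∉

 flip : ∀ {s t k} -> SCut s t k -> SCut t s k
 flip c = record
  { T = co T ;s∈ = co-∋ T t∉ ;t∉ = co-∌ T s∈ ;e = e ;joins = join-sym joins ;a∈ = co-∋ T b∉ ;b∉ = co-∌ T a∈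
  ;minl = \f p -> wid(\x q -> tr(ap(_∧ not(is f x))(cut-co T x)) q)(back(minl f(tr(sym(cut-co T f)) p)))
  ;size = co-size size } where
  open SCut c
  co-size : ∀ {k} -> (2 Data.Nat.≤ k ×(∀ f -> cut T f == tt -> f == e)) ⊎(k == 3 × ∃[ e' ] e' ≢ e × cut T e' == tt ×(∀ f -> cut T f == tt -> f == e ⊎ f == e')) -> (2 Data.Nat.≤ k ×(∀ f -> cut(co T) f == tt -> f == e)) ⊎(k == 3 × ∃[ e' ] e' ≢ e × cut(co T) e' == tt ×(∀ f -> cut(co T) f == tt -> f == e ⊎ f == e'))
  co-size(inl(2≤k , only)) = inl(2≤k , \f p -> only f(tr(sym(cut-co T f)) p))
  co-size(inr(k≡3 , e' , ne , c' , only)) = inr(k≡3 , e' , ne , tr(cut-co T e') c' , \f p -> only f(tr(sym(cut-co T f)) p))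

 in-join1 : ∀ T {f u v} -> Joins f u v -> ins T f == tt -> T ∋ u × T ∋ v
 in-join1 T(inl(refl , refl)) p = ∧-e p
 in-join1 T(inr(refl , refl)) p = snd(∧-e p) , fst(∧-e p)

 in-ends : ∀ T f -> ins T f == tt -> T ∋ src f × T ∋ tgt f
 in-ends T f p = ∧-e p

 wn-in : ∀ T {F f} -> wn T F f == ff -> ins T f == tt
 wn-in T {F} {f} p with F f | ins T f | p
 ... | ff | tt | _ = refl

 cut-ends : ∀ T f -> cut T f == tt -> ∃[ a ] ∃[ b ] Joins f a b × T ∋ a × T ∌ b
 cut-ends T f c with ∋∨∌ T(src f) | ∋∨∌ T(tgt f)
 ... | inl p | inr q = _ , _ , ends f , p , q
 ... | inr p | inl q = _ , _ , join-sym(ends f) , q , p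
 ... | inl p | inl q = cl c(ap2 _xor_ p q)
 ... | inr p | inr q = cl c(ap2 _xor_ p q)

 data Position(T : VS n)(f : Fin m) : Set where
  in-T : T ∋ src f -> T ∋ tgt f -> Position T f
  out-T : T ∌ src f -> T ∌ tgt f -> Position T f
  on-T : cut T f == tt -> Position T f

 position : ∀ T f -> Position T f
 position T f with ∋∨∌ T(src f) | ∋∨∌ T(tgt f)
 ... | inl p | inl q = in-T p q
 ... | inr p | inr q = out-T p q
 ... | inl p | inr q = on-T(ap2 _xor_ p q)
 ... | inr p | inl q = on-T(ap2 _xor_ p q)

 inner : ∀ {s t k}(c : SCut s t k) {f a b} -> Joins f a b -> SCut.T c ∋ a -> SCut.T c ∌ b -> Lnk(wn(SCut.T c) none) s a
 inner {s} c {f} j a∈ b∉ = found(exits T(minl f(cut-true T j a∈ b∉)) s∈ t∉) where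
  open SCut c using (T; minl; s∈; t∉)
  found : ∀ {ℓ} -> Exit T(\x -> cut T x ∧ not(is f x)) s _ ℓ -> Lnk(wn T none) s _
  found x with T∨F(is f(Exit.e x))
  ... | inr p = cl(∧-T(cut-true T(Exit.joins x)(Exit.a∈ x)(Exit.b∉ x))(ap not p))(Exit.e∉F x)
  ... | inl p with isT {f} p
  ... | refl with same-end T j(Exit.joins x) a∈ b∉(Exit.a∈ x)(Exit.b∉ x)
  ... | refl , refl = wid(\x q -> snd(∨-F q))(Exit.before x)

 out-pos : ∀ T {f} -> T ∌ src f -> T ∌ tgt f -> ins(co T) f == tt
 out-pos T p q = ∧-T(co-∋ T p)(co-∋ T q)

 out-ends : ∀ T {f} -> ins(co T) f == tt -> T ∌ src f × T ∌ tgt f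
 out-ends T p with ∧-e p
 ... | x , y = snd(∋∖- full T x) , snd(∋∖- full T y)

 co-co : ∀ T {v} -> co(co T) ∋ v -> T ∋ v
 co-co T {v} p with ∋∨∌ T v
 ... | inl q = q
 ... | inr q = cl p(co-∌(co T)(co-∋ T q))

 module Caps (B : ES) (g : Fin m -> Z) (D : Z) (g≥0 : ∀ e -> 0# ≤ g e) (g-B : ∀ e -> B e == tt -> g e == D) (D≥0 : 0# ≤ D) where

  Sat : Fin n -> Fin n -> ℕ -> Set
  Sat s t k = ∀ S -> Sep S s t -> Lnk(\e -> B e ∧ cut S e) s t -> D * + k ≤ wt g(cut S)

  sep-sym : ∀ {S s t} -> Sep S s t -> Sep S t s
  sep-sym h eq = h(sym eq)

  sat-sym : ∀ {s t k} -> Sat s t k -> Sat t s k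
  sat-sym h S sep p = h S(sep ∘ sym)(back p)

  sep1 : ∀ S {u v} -> S ∋ u -> S ∌ v -> Sep S u v
  sep1 S p q eq = cl p(tr eq q)

  module Cut {s t k} (c : SCut s t k) (forc : ∀ f -> cut (SCut.T c) f == tt -> B f == tt) (sat : Sat s t k)
   (S : VS n)(s∈S : S ∋ s)(a∉S : S ∌ SCut.a c)(L : Lnk(\e -> B e ∧ cut S e) s(SCut.a c)) where
   open SCut c

   F : ES
   F f = B f ∧ cut S f

   inC outC : ES
   inC f = ins T f ∧ cut S f
   outC f = ins(co T) f ∧ cut S f

   in+out : wt g inC + wt g outC ≤ wt g(cut S)
   in+out = wt-disj g g≥0 {inC} {outC} {cut S}(\f p -> snd(∧-e p) , notout f(fst(∧-e p)))(\f p -> snd(∧-e p)) where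
    notout : ∀ f -> ins T f == tt -> ins(co T) f ∧ cut S f == ff
    notout f p = ap(\b -> b ∧ cut S f)(ap2 _∧_(co-∌ T(fst(∧-e p))) refl)

   wt≥0 : ∀(p : ES) -> 0# ≤ wt g p
   wt≥0 p = ∑≥0 {f = \f -> χ(p f) * g f} Es(\f _ -> term≥0 g g≥0 p f)

   S1 : VS n
   S1 = S ∩ T

   agree : ∀ {u} -> T ∋ u -> at S1 u == at S u
   agree {u} p with ∋∨∌ S u
   ... | inl q = tr(∋∩ S T q p)(sym q)
   ... | inr q = tr(∌∩ˡ S T q)(sym q)

   cut-S1-in : ∀ f -> ins T f == tt -> cut S1 f == cut S f
   cut-S1-in f p = ap2 _xor_(agree(fst(∧-e p)))(agree(snd(∧-e p)))

   cut-S1-out : ∀ f -> ins(co T) f == tt -> cut S1 f == ff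
   cut-S1-out f p = ap2 _xor_(∌∩ʳ S T(fst(out-ends T p)))(∌∩ʳ S T(snd(out-ends T p)))

   cut-S1 : ∀ f -> cut S1 f == tt -> inC f == tt ⊎ cut T f == tt
   cut-S1 f p with position T f
   ... | on-T q = inr q
   ... | in-T x y = inl(∧-T(∧-T x y)(tr(sym(cut-S1-in f(∧-T x y))) p))
   ... | out-T x y = cl p(cut-S1-out f(out-pos T x y))

   F1 : ES
   F1 f = B f ∧ cut S1 f

   through : ∀ {f c d} -> Joins f c d -> T ∋ c -> T ∌ d -> cut S1 f == ff ⊎ F f == ff × S1 ∌ c -> Lnk(wn T F) s c -> Lnk F1 s t
   through {f} {c'} {d} j c∈ d∉ h p = wid inward p ⁀ edge f(passable h) j ⁀ back(wid outward(inner(flip c)(join-sym j)(co-∋ T d∉)(co-∌ T c∈))) where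
    inward : ∀ f -> wn T F f == ff -> F1 f == ff
    inward f p = tr(ap(B f ∧_)(cut-S1-in f(wn-in T {F} p)))(fst(∨-F p))
    outward : ∀ f -> wn(co T) none f == ff -> F1 f == ff
    outward f p = tr(ap(B f ∧_)(cut-S1-out f(wn-in(co T) {none} p)))(Bool.∧-zeroʳ(B f))
    passable : cut S1 f == ff ⊎ F f == ff × S1 ∌ c' -> F1 f == ff
    passable(inl q) = tr(ap(B f ∧_) q)(Bool.∧-zeroʳ(B f))
    passable(inr(_ , q)) = tr(ap(B f ∧_)(cut-false S1 j(tr q(sym(∌∩ʳ S T d∉)))))(Bool.∧-zeroʳ(B f))

   dem1 : S1 ∋ s -> Lnk F1 s t -> D * + k ≤ wt g(cut S1)
   dem1 s∈1 = sat S1(sep1 S1 s∈1(∌∩ʳ S T t∉))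

   s∈S1 : S1 ∋ s
   s∈S1 = ∋∩ S T s∈S s∈

   e-uncut : cut S1 e == ff
   e-uncut = cut-false S1 joins(tr(∌∩ˡ S T a∉S)(sym(∌∩ʳ S T b∉)))

   -- A path that leaves T only through uncut edges of its boundary.
   narrow : (∀ f -> cut T f == tt -> cut S1 f == tt -> cut S f == tt) -> wt g(cut S1) ≤ wt g(cut S)
   narrow h = wt-mono g g≥0 {cut S1} {cut S} \f p -> pick f p(cut-S1 f p) where
    pick : ∀ f -> cut S1 f == tt -> inC f == tt ⊎ cut T f == tt -> cut S f == tt
    pick f p(inl q) = snd(∧-e q)
    pick f p(inr q) = h f q p

   single : (∀ f -> cut T f == tt -> f == e) -> D * + k ≤ wt g(cut S)
   single only = via(dem1 s∈S1(through joins a∈ b∉(inl e-uncut)(reach(exit T L s∈))))(narrow absurd) where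
    absurd : ∀ f -> cut T f == tt -> cut S1 f == tt -> cut S f == tt
    absurd f p q with only f p
    ... | refl = cl q e-uncut
    reach : ∀ {ℓ} -> (T ∋ a × Lnk(wn T F) s a) ⊎ Exit T F s a ℓ -> Lnk(wn T F) s a
    reach(inl(_ , p)) = p
    reach(inr x) with only(Exit.e x)(cut-true T(Exit.joins x)(Exit.a∈ x)(Exit.b∉ x))
    ... | refl with same-end T joins(Exit.joins x) a∈ b∉(Exit.a∈ x)(Exit.b∉ x)
    ... | refl , refl = Exit.before x

   module Double (k≡3 : k == 3) (e' : Fin m) (e'≢e : e' ≢ e) {a' b' : Fin n} (j' : Joins e' a' b') (a'∈ : T ∋ a') (b'∉ : T ∌ b')
    (only : ∀ f -> cut T f == tt -> f == e ⊎ f == e') where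

    Goal : Set
    Goal = D * + 3 ≤ wt g(cut S)

    sat3 : Sat s t 3
    sat3 = tp(Sat s t) k≡3 sat

    D3 : ∀ {x} -> D * + 3 ≤ x + D -> D + D ≤ x
    D3 {x} l = bd(lm x D)(d≥0 l) where
     lm : ∀ x D -> x == D + D +(x + D - D * + 3)
     lm = ring

    three : ∀ {x y} -> D ≤ x -> D + D ≤ y -> D * + 3 ≤ x + y
    three l l' = by(lm D)(+≤ l l') where
     lm : ∀ D -> D * + 3 == D +(D + D)
     lm = ring

    g-e : g e == D
    g-e = g-B e(forc e e-cut)

    g-e' : g e' == D
    g-e' = g-B e'(forc e'(cut-true T j' a'∈ b'∉))

    -- The cut around T ∪ W, where W contains the outer₀ endpoint of ě but not that of the other boundary edge.
    module Around (W : VS n) (t∉W : W ∌ t) (ê ě : Fin m) {c' d : Fin n} (only' : ∀ f -> cut T f == tt -> f == ê ⊎ f == ě) (g-ê : g ê == D)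
     (jě : Joins ě c' d)(c∈ : T ∋ c')(d∉ : T ∌ d)(d∈W : W ∋ d)
     (out : Lnk(wn(co T) \f -> B f ∧ cut W f) d t) where

     outW : ES
     outW f = ins(co T) f ∧ cut W f

     S2 : VS n
     S2 = T ∪ W

     beyond : ∀ {u} -> T ∌ u -> at S2 u == at W u
     beyond {u} p with ∋∨∌ W u
     ... | inl q = tr(∋∪ʳ T W q)(sym q)
     ... | inr q = tr(∌∪ T W p q)(sym q)

     cut-S2-in : ∀ f -> ins T f == tt -> cut S2 f == ff
     cut-S2-in f p = ap2 _xor_(∋∪ˡ T W(fst(∧-e p)))(∋∪ˡ T W(snd(∧-e p)))

     cut-S2-out : ∀ f -> ins(co T) f == tt -> cut S2 f == cut W f
     cut-S2-out f p = ap2 _xor_(beyond(fst(out-ends T p)))(beyond(snd(out-ends T p)))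

     ě-uncut : cut S2 ě == ff
     ě-uncut = cut-false S2 jě(tr(∋∪ˡ T W c∈)(sym(∋∪ʳ T W d∈W)))

     cover : ∀ f -> cut S2 f == tt -> outW f == tt ⊎ f == ê
     cover f p with position T f
     ... | in-T x y = cl p(cut-S2-in f(∧-T x y))
     ... | out-T x y = inl(∧-T(out-pos T x y)(tr(sym(cut-S2-out f(out-pos T x y))) p))
     ... | on-T q with only' f q
     ... | inl eq = inr eq
     ... | inr refl = cl p ě-uncut

     lnk : Lnk(\f -> B f ∧ cut S2 f) s t
     lnk = wid inward(inner c jě c∈ d∉) ⁀ edge ě(tr(ap(B ě ∧_) ě-uncut)(Bool.∧-zeroʳ(B ě))) jě ⁀ wid outward out where
      inward : ∀ f -> wn T none f == ff -> B f ∧ cut S2 f == ff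
      inward f p = tr(ap(B f ∧_)(cut-S2-in f(wn-in T {none} p)))(Bool.∧-zeroʳ(B f))
      outward : ∀ f -> wn(co T)(\f -> B f ∧ cut W f) f == ff -> B f ∧ cut S2 f == ff
      outward f p = tr(ap(B f ∧_)(cut-S2-out f(wn-in(co T) {\f -> B f ∧ cut W f} p)))(fst(∨-F p))

     bd1 : D + D ≤ wt g outW
     bd1 = D3(via(sat3 S2(sep1 S2(∋∪ˡ T W s∈)(∌∪ T W t∉ t∉W)) lnk)(to(wt-cover g g≥0 {cut S2} {outW} ê cover)(ap(_+_(wt g outW)) g-ê)))

    only-swap : ∀ f -> cut T f == tt -> f == e' ⊎ f == e
    only-swap f p with only f p
    ... | inl x = inr x
    ... | inr x = inl x

    outer0 : Lnk(wn(co T) none) b t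
    outer0 = back(inner(flip c)(join-sym joins)(co-∋ T b∉)(co-∌ T a∈))

    outer' : Lnk(wn(co T) none) b' t
    outer' = back(inner(flip c)(join-sym j')(co-∋ T b'∉)(co-∌ T a'∈))

    S-co : ∀ f -> ins(co T) f ∧ cut(co S) f == tt -> outC f == tt
    S-co f p = ∧-T(fst(∧-e p))(tr(sym(cut-co S f))(snd(∧-e p)))

    -- Both boundary edges are uncut by S and S lies differently at their ends.
    around-S : S ∌ b -> S ∋ b' -> Lnk(wn(co T) F) b t -> Lnk(wn(co T) F) b' t -> D + D ≤ wt g outC
    around-S b∉S b'∈S p p' with ∋∨∌ S t
    ... | inr t∉S = Around.bd1 S t∉S e e' only g-e j' a'∈ b'∉ b'∈S p'
    ... | inl t∈S = via(Around.bd1(co S)(co-∌ S t∈S) e' e only-swap g-e' joins a∈ b∉(co-∋ S b∉S)(wid(\f q -> ∨-Fs(tr(ap(B f ∧_)(cut-co S f))(fst(∨-F q)))(snd(∨-F q))) p))(wt-mono g g≥0 {\f -> ins(co T) f ∧ cut(co S) f} {outC} S-co)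

    out-B : Fin m -> Set
    out-B f = outC f == tt × B f == tt

    out-B? : Dec(∃[ f ] out-B f)
    out-B? = Fin.any? \f -> (outC f Bool.≟ tt) ×-dec(B f Bool.≟ tt)

    free-out : ¬(∃[ f ] out-B f) -> ∀ {u v} -> Lnk(wn(co T) none) u v -> Lnk(wn(co T) F) u v
    free-out h = wid \f p -> ∨-Fs(avoid f p)(snd(∨-F p)) where
     avoid : ∀ f -> wn(co T) none f == ff -> F f == ff
     avoid f p with T∨F(F f)
     ... | inr q = q
     ... | inl q = void(h(f , ∧-T(wn-in(co T) {none} p)(snd(∧-e q)) , fst(∧-e q)))

    from-parts : ∀ {x y} -> x ≤ wt g inC -> y ≤ wt g outC -> D * + 3 ≤ x + y -> Goal
    from-parts l l' h = via h(via(+≤ l l') in+out)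

    -- s and a stay linked inside T.
    in-case : Lnk(wn T F) s a -> Goal
    in-case p with ∋∨∌ S a'
    ... | inr a'∉S = via(tp(\k -> D * + k ≤ wt g(cut S1)) k≡3(dem1 s∈S1(through joins a∈ b∉(inl e-uncut) p)))(narrow absurd) where
     absurd : ∀ f -> cut T f == tt -> cut S1 f == tt -> cut S f == tt
     absurd f x q with only f x
     ... | inl refl = cl q e-uncut
     ... | inr refl = cl q(cut-false S1 j'(tr(∌∩ˡ S T a'∉S)(sym(∌∩ʳ S T b'∉))))
    ... | inl a'∈S with T∨F(cut S e')
    ... | inl e'-cut = via demand(narrow only-e') where
     demand : D * + 3 ≤ wt g(cut S1)
     demand = tp(\k -> D * + k ≤ wt g(cut S1)) k≡3(dem1 s∈S1(through joins a∈ b∉(inl e-uncut) p))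
     only-e' : ∀ f -> cut T f == tt -> cut S1 f == tt -> cut S f == tt
     only-e' f x q with only f x
     ... | inl refl = cl q e-uncut
     ... | inr refl = e'-cut
    ... | inr e'-uncut = decide(∋∨∌ S b) where
     in-bd : D + D ≤ wt g inC
     in-bd = D3(via(tp(\k -> D * + k ≤ wt g(cut S1)) k≡3(dem1 s∈S1(through joins a∈ b∉(inl e-uncut) p)))(to(wt-cover g g≥0 {cut S1} {inC} e' covered)(ap(_+_(wt g inC)) g-e'))) where
      covered : ∀ f -> cut S1 f == tt -> inC f == tt ⊎ f == e'
      covered f q with cut-S1 f q
      ... | inl x = inl x
      ... | inr x with only f x
      ... | inl refl = cl q e-uncut
      ... | inr eq = inr eq
     b'∈S : S ∋ b'
     b'∈S = tr(sym(uncut S j' e'-uncut)) a'∈S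
     tot : D * + 3 == D + D + D
     tot = lm D where
      lm : ∀ D -> D * + 3 == D + D + D
      lm = ring
     decide : S ∋ b ⊎ S ∌ b -> Goal
     decide(inl b∈S) = by tot(via(+≤ in-bd(eq≤(sym(tr(wt-is g g≥0 e) g-e))))(wt-disj g g≥0 {inC} {is e} {cut S}(\f q -> snd(∧-e q) , other f q) \f q -> tp(\f -> cut S f == tt)(isT q)(cut-true' S joins a∉S b∈S))) where
      other : ∀ f -> inC f == tt -> is e f == ff
      other f q = dec-ff(e Fin.≟ f) \ { refl -> cl(snd(in-join1 T joins(fst(∧-e q)))) b∉ }
     decide(inr b∉S) with out-B?
     ... | yes(f , f-out , Bf) = from-parts {D + D} {D} in-bd(by(sym(g-B f Bf))(wt-elem g g≥0 {outC} f f-out))(eq≤ tot)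
     ... | no free = from-parts {D + D} {D} in-bd(via(bd {D} {D + D} refl D≥0)(around-S b∉S b'∈S(free-out free outer0)(free-out free outer')))(eq≤ tot)

    module Outside (¬in : ¬ Lnk (wn T F) s a) where

     -- Whatever s reaches avoiding F lies in T linked inside, or beyond e′.
     Rchd : Fin n -> Set
     Rchd v = (T ∋ v × Lnk(wn T F) s v) ⊎(T ∌ v × Lnk(wn(co T) F) b' v × Lnk(wn T F) s a')

     spread : (F e == tt ⊎ ¬ Lnk(wn(co T) F) b' b) -> ∀ {u v} f -> F f == ff -> Joins f u v -> Rchd u -> Rchd v
     spread h {u} {v} f p j(inl(u∈ , q)) with ∋∨∌ T v
     ... | inl v∈ = inl(v∈ , q ⁀ edge f(∨-Fs p(ap not(in-join T j u∈ v∈))) j)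
     ... | inr v∉ with only f(cut-true T j u∈ v∉)
     ... | inl refl = void(¬in(tp(Lnk(wn T F) s)(fst(same-end T j joins u∈ v∉ a∈ b∉)) q))
     ... | inr refl with same-end T j j' u∈ v∉ a'∈ b'∉
     ... | refl , refl = inr(v∉ , stop , q)
     spread h {u} {v} f p j(inr(u∉ , q , r)) with ∋∨∌ T v
     ... | inr v∉ = inr(v∉ , q ⁀ edge f(∨-Fs p(ap not(in-join(co T) j(co-∋ T u∉)(co-∋ T v∉)))) j , r)
     ... | inl v∈ with only f(cut-true' T j u∉ v∈)
     ... | inr refl with same-end T(join-sym j) j' v∈ u∉ a'∈ b'∉
     ... | refl , refl = inl(v∈ , r)
     spread(inl e∈F) f p j(inr(u∉ , q , r)) | inl v∈ | inl refl = cl e∈F p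
     spread(inr apart) f p j(inr(u∉ , q , r)) | inl v∈ | inl refl with same-end T(join-sym j) joins v∈ u∉ a∈ b∉
     ... | refl , refl = void(apart q)

     contradiction : ¬(F e == tt ⊎ ¬ Lnk(wn(co T) F) b' b)
     contradiction h with closed-set Rchd(spread h) L(inl(s∈ , stop))
     ... | inl(_ , p) = ¬in p
     ... | inr(a∉ , _) = cl a∈ a∉

     e-passable : F e == ff
     e-passable = ≢-true(\p -> contradiction(inl p))

     b'-b : ¬ ¬ Lnk(wn(co T) F) b' b
     b'-b h = contradiction(inr h)

     leaves : Lnk(wn T F) s a' × F e' == ff
     leaves with exit T L s∈
     ... | inl(_ , p) = void(¬in p)
     ... | inr x with only(Exit.e x)(cut-true T(Exit.joins x)(Exit.a∈ x)(Exit.b∉ x))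
     ... | inl refl = void(¬in(tp(Lnk(wn T F) s)(fst(same-end T(Exit.joins x) joins(Exit.a∈ x)(Exit.b∉ x) a∈ b∉))(Exit.before x)))
     ... | inr refl = tp(Lnk(wn T F) s)(fst(same-end T(Exit.joins x) j'(Exit.a∈ x)(Exit.b∉ x) a'∈ b'∉))(Exit.before x) , Exit.e∉F x

     uncut-by : ∀ f -> cut T f == tt -> F f == ff -> cut S f == ff
     uncut-by f p q with T∨F(cut S f)
     ... | inr r = r
     ... | inl r = cl(∧-T(forc f p) r) q

     e-uncut-S : cut S e == ff
     e-uncut-S = uncut-by e e-cut e-passable

     e'-uncut-S : cut S e' == ff
     e'-uncut-S = uncut-by e'(cut-true T j' a'∈ b'∉)(snd leaves)

     b∉S : S ∌ b
     b∉S = tr(sym(uncut S joins e-uncut-S)) a∉S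

     in-edge : ∃[ f ] inC f == tt × B f == tt
     in-edge with Fin.any?(\f -> (inC f Bool.≟ tt) ×-dec(B f Bool.≟ tt))
     ... | yes p = p
     ... | no h = void(¬in(wid(\f p -> ∨-Fs(avoid f p)(snd(∨-F p)))(inner c joins a∈ b∉))) where
      avoid : ∀ f -> wn T none f == ff -> F f == ff
      avoid f p with T∨F(F f)
      ... | inr q = q
      ... | inl q = void(h(f , ∧-T(wn-in T {none} p)(snd(∧-e q)) , fst(∧-e q)))

     in-bd : D ≤ wt g inC
     in-bd = by(sym(g-B(fst in-edge)(snd(snd in-edge))))(wt-elem g g≥0 {inC}(fst in-edge)(fst(snd in-edge)))

     all-out : D * + 3 ≤ wt g outC -> Goal
     all-out h = via h(via(bd(+-comm(wt g inC)(wt g outC))(wt≥0 inC)) in+out)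

     module Bridge (b'∈S : S ∋ b') (link : Lnk (wn (co T) F) b' b) (U : VS n) (comp : Cmpt (wn (co T) F) b U)
      (t∉U : U ∌ t)(f2 : Fin m) {c2 d2 : Fin n}(j2 : Joins f2 c2 d2)(c2∈ : U ∋ c2)(d2∉ : U ∌ d2)(f2-out : ins(co T) f2 == tt)
      (f2-F : F f2 == tt)(unique : ∀ f -> outC f == tt -> B f == tt -> f == f2) where

      b∈U : U ∋ b
      b∈U = snd comp b stop

      b'∈U : U ∋ b'
      b'∈U = snd comp b'(back link)

      leav : ∀ f -> ins(co T) f == tt -> cut U f == tt -> f == f2
      leav f p q with T∨F(F f)
      ... | inl r = unique f(∧-T p(snd(∧-e r)))(fst(∧-e r))
      ... | inr r = cl(cmpt-cut {U = U} comp f q)(∨-Fs r(ap not p))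

      module Around' (W : VS n) (W⊆U : W ⊆ U) (c2∉W : W ∌ c2) (agreeS : ∀ f -> ins U f == tt -> cut W f == cut S f) where

       f2-uncut : cut W f2 == ff
       f2-uncut = cut-false W j2(tr c2∉W(sym d2∉W)) where
        d2∉W : W ∌ d2
        d2∉W with ∋∨∌ W d2
        ... | inl p = cl(W⊆U d2 p) d2∉
        ... | inr p = p

       W-cut : ∀ f -> ins(co T) f == tt -> cut W f == tt -> outC f == tt × is f2 f == ff
       W-cut f p q with position U f
       ... | in-T x y = ∧-T p(tr(sym(agreeS f(∧-T x y))) q) , dec-ff(f2 Fin.≟ f) \ { refl -> cl q f2-uncut }
       ... | on-T x with leav f p x
       ... | refl = cl q f2-uncut
       W-cut f p q | out-T x y = cl q(ap2 _xor_(beyond x)(beyond y)) where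
        beyond : ∀ {v} -> U ∌ v -> W ∌ v
        beyond {v} x with ∋∨∌ W v
        ... | inl w = cl(W⊆U v w) x
        ... | inr w = w

       clear : ∀ {u v} -> Lnk(wn(co T) none) u v -> Lnk(wn(co T) \f -> B f ∧ cut W f) u v
       clear = wid \f p -> ∨-Fs(avoid f p)(snd(∨-F p)) where
        avoid : ∀ f -> wn(co T) none f == ff -> B f ∧ cut W f == ff
        avoid f p with T∨F(B f ∧ cut W f)
        ... | inr q = q
        ... | inl q with W-cut f(wn-in(co T) {none} p)(snd(∧-e q))
        ... | x , y = cl(tp(\f' -> is f2 f' == tt)(sym(unique f x(fst(∧-e q))))(is-refl f2)) y

       finish : D + D ≤ wt g(\f -> ins(co T) f ∧ cut W f) -> Goal
       finish l = all-out(by(lm D)(via(+≤ l(eq≤(sym(tr(wt-is g g≥0 f2)(g-B f2(fst(∧-e f2-F)))))))(wt-disj g g≥0 {\f -> ins(co T) f ∧ cut W f} {is f2} {outC}(\f p -> W-cut f(fst(∧-e p))(snd(∧-e p))) \f p -> tp(\f -> outC f == tt)(isT p)(∧-T f2-out(snd(∧-e f2-F)))))) where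
        lm : ∀ D -> D * + 3 == D + D + D
        lm = ring

      ∌-sub : ∀ {W} -> W ⊆ U -> W ∌ t
      ∌-sub {W} h with ∋∨∌ W t
      ... | inl p = cl(h t p) t∉U
      ... | inr p = p

      goal : Goal
      goal with ∋∨∌ S c2
      ... | inl c2∈S = A.finish(Around.bd1(U ∖ S)(∌-sub {U ∖ S} sub) e' e only-swap g-e' joins a∈ b∉(∋∖ U S b∈U b∉S)(A.clear outer0)) where
       sub : U ∖ S ⊆ U
       sub v p = fst(∋∖- U S p)
       flipped : ∀ {u} -> U ∋ u -> at(U ∖ S) u == at(co S) u
       flipped {u} p with ∋∨∌ S u
       ... | inl q = tr(∌∖ʳ U S q)(sym(co-∌ S q))
       ... | inr q = tr(∋∖ U S p q)(sym(co-∋ S q))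
       module A = Around' (U ∖ S) sub (∌∖ʳ U S c2∈S)
        (\f p -> tr(ap2 _xor_(flipped(fst(in-ends U f p)))(flipped(snd(in-ends U f p))))(cut-co S f))
      ... | inr c2∉S = A.finish(Around.bd1(U ∩ S)(∌-sub {U ∩ S} sub) e e' only g-e j' a'∈ b'∉(∋∩ U S b'∈U b'∈S)(A.clear outer')) where
       sub : U ∩ S ⊆ U
       sub v p = fst(∋∩⁻ U S p)
       same : ∀ {u} -> U ∋ u -> at(U ∩ S) u == at S u
       same {u} p with ∋∨∌ S u
       ... | inl q = tr(∋∩ U S p q)(sym q)
       ... | inr q = tr(∌∩ʳ U S q)(sym q)
       module A = Around' (U ∩ S) sub (∌∩ʳ U S c2∉S) (\ f p -> ap2 _xor_ (same (fst (in-ends U f p))) (same (snd (in-ends U f p))))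

     both-sides : S ∋ a' -> ¬ ¬ Goal
     both-sides a'∈S = b'-b >>= \link -> cmpt(wn(co T) F) b >>= \(U , comp) -> pure(split link U comp(∋∨∌ U t)) where
      b'∈S : S ∋ b'
      b'∈S = tr(sym(uncut S j' e'-uncut-S)) a'∈S
      split : Lnk(wn(co T) F) b' b -> ∀ U -> Cmpt(wn(co T) F) b U -> U ∋ t ⊎ U ∌ t -> Goal
      split link U comp(inl t∈U) = from-parts {D} {D + D} in-bd(around-S b∉S b'∈S(fst comp t t∈U)(link ⁀ fst comp t t∈U))(three rfl rfl)
      split link U comp(inr t∉U) = bridge(exits U outer0(snd comp b stop) t∉U) where
       bridge : ∀ {ℓ} -> Exit U(wn(co T) none) b t ℓ -> Goal
       bridge x = decide(Fin.any? \f -> ((outC f Bool.≟ tt) ×-dec(B f Bool.≟ tt)) ×-dec ¬?(f Fin.≟ f2)) where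
        f2 = Exit.e x
        f2-out : ins(co T) f2 == tt
        f2-out = wn-in(co T) {none}(Exit.e∉F x)
        f2-F : F f2 == tt
        f2-F with T∨F(F f2)
        ... | inl p = p
        ... | inr p = cl(cmpt-cut {U = U} comp f2(cut-true U(Exit.joins x)(Exit.a∈ x)(Exit.b∉ x)))(∨-Fs p(ap not f2-out))
        f2-outC : outC f2 == tt
        f2-outC = ∧-T f2-out(snd(∧-e f2-F))
        decide : Dec(∃[ f ](outC f == tt × B f == tt) × f ≢ f2) -> Goal
        decide(no h) = Bridge.goal b'∈S link U comp t∉U f2(Exit.joins x)(Exit.a∈ x)(Exit.b∉ x) f2-out f2-F(\f p q -> stable(f Fin.≟ f2) \ne -> h(f ,(p , q) , ne))
        decide(yes(f ,(p , q) , ne)) = from-parts {D} {D + D} in-bd(by(ap2 _+_(sym(tr(wt-is g g≥0 f)(g-B f q)))(sym(tr(wt-is g g≥0 f2)(g-B f2(fst(∧-e f2-F))))))(wt-disj g g≥0 {is f} {is f2} {outC}(\f' r -> tp(\f -> outC f == tt)(isT r) p , dec-ff(f2 Fin.≟ f') \eq -> ne(tr(isT r)(sym eq))) \f' r -> tp(\f -> outC f == tt)(isT r) f2-outC))(three rfl rfl)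

     goal : ¬ ¬ Goal
     goal with ∋∨∌ S a'
     ... | inl a'∈S = both-sides a'∈S
     ... | inr a'∉S = pure(via(tp(\k -> D * + k ≤ wt g(cut S1)) k≡3(dem1 s∈S1(through j' a'∈ b'∉(inr(snd leaves , ∌∩ˡ S T a'∉S))(fst leaves))))(narrow absurd)) where
      absurd : ∀ f -> cut T f == tt -> cut S1 f == tt -> cut S f == tt
      absurd f x q with only f x
      ... | inl refl = cl q e-uncut
      ... | inr refl = cl q(cut-false S1 j'(tr(∌∩ˡ S T a'∉S)(sym(∌∩ʳ S T b'∉))))

    goal : Goal
    goal = stable(D * + 3 ≤? wt g(cut S))(em(Lnk(wn T F) s a) >>= \ { (yes p) -> pure(in-case p) ;(no ¬p) -> Outside.goal ¬p })

   concl : D * + k ≤ wt g(cut S)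
   concl with size
   ... | inl(_ , only) = single only
   ... | inr(k≡3 , e' , ne , e'-cut , only) with cut-ends T e' e'-cut
   ... | _ , _ , j' , a'∈ , b'∉ = tp(\k -> D * + k ≤ wt g(cut S))(sym k≡3)(Double.goal k≡3 e' ne j' a'∈ b'∉ only)

  der1-head : ∀ {s t k}(c : SCut s t k) -> (∀ f -> cut(SCut.T c) f == tt -> B f == tt) -> Sat s t k -> Sat s(SCut.a c) k
  der1-head {s} {t} {k} c forc sat S sep L with ∋∨∌ S s | ∋∨∌ S(SCut.a c)
  ... | inl p | inr q = Cut.concl c forc sat S p q L
  ... | inl p | inl q = void(sep(tr p(sym q)))
  ... | inr p | inr q = void(sep(tr p(sym q)))
  ... | inr p | inl q = via(Cut.concl c forc sat(co S)(co-∋ S p)(co-∌ S q)(wid(\e r -> tr(ap(B e ∧_)(cut-co S e)) r) L))(wt-mono g g≥0 {cut(co S)} {cut S} \f r -> tr(sym(cut-co S f)) r)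

  der1-tail : ∀ {s t k}(c : SCut s t k) -> (∀ f -> cut(SCut.T c) f == tt -> B f == tt) -> Sat s t k -> Sat(SCut.b c) t k
  der1-tail c forc sat = sat-sym(der1-head(flip c)(\f p -> forc f(tr(sym(cut-co(SCut.T c) f)) p))(sat-sym sat))

 module Closure (Dem : Fin n -> Fin n -> ℕ -> Set)
  (dem≤3 : ∀ {s t k} -> Dem s t k -> k N.≤ 3) where

  -- The demands that follow from the given ones by splitting them at small cuts.
  data Der : Fin n -> Fin n -> ℕ -> Set where
   given : ∀ {s t k} -> Dem s t k -> Der s t k
   head : ∀ {s t k} -> Der s t k -> (c : SCut s t k) -> Der s(SCut.a c) k
   tail : ∀ {s t k} -> Der s t k -> (c : SCut s t k) -> Der(SCut.b c) t k

  der≤3 : ∀ {s t k} -> Der s t k -> k N.≤ 3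
  der≤3(given d) = dem≤3 d
  der≤3(head d _) = der≤3 d
  der≤3(tail d _) = der≤3 d

  CutsIn : ES -> ∀ {s t k} -> Der s t k -> Set
  CutsIn B(given _) = ⊤
  CutsIn B(head d c) = CutsIn B d ×(∀ f -> cut(SCut.T c) f == tt -> B f == tt)
  CutsIn B(tail d c) = CutsIn B d ×(∀ f -> cut(SCut.T c) f == tt -> B f == tt)

  cuts-mono : ∀ {B B' : ES} -> (∀ f -> B f == tt -> B' f == tt) -> ∀ {s t k}(d : Der s t k) -> CutsIn B d -> CutsIn B' d
  cuts-mono h(given _) _ = unit
  cuts-mono h(head d c)(p , q) = cuts-mono h d p , \f -> h f ∘ q f
  cuts-mono h(tail d c)(p , q) = cuts-mono h d p , \f -> h f ∘ q f

  wo : Fin m -> ES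
  wo f x = not(is f x)

  one : Fin m -> Z
  one _ = 1#

  size : ES -> Z
  size p = wt one p

  0≤1 : 0# ≤ 1#
  0≤1 = +≤+ z≤n

  one≥0 : ∀ e -> 0# ≤ one e
  one≥0 _ = 0≤1

  -- Integral solutions, as capacities.
  module Integral (H : ES) = Caps H (χ ∘ H) 1# (χ≥0 ∘ H) (\ e -> ap χ) 0≤1

  Solves : ES -> Set
  Solves H = ∀ {s t k} -> Dem s t k -> Integral.Sat H s t k

  -- Every edge outside B can be deleted without violating a demand.
  Forced : ES -> Set
  Forced B = ∀ e -> B e == ff -> Solves(wo e)

  module _ (B : ES) (g : Fin m -> Z) (D : Z) (g≥0 : ∀ e -> 0# ≤ g e) (g-B : ∀ e -> B e == tt -> g e == D) (D≥0 : 0# ≤ D) where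
   open Caps B g D g≥0 g-B D≥0

   der-sat'd : (∀ {s t k} -> Dem s t k -> Sat s t k) -> ∀ {s t k}(d : Der s t k) -> CutsIn B d -> Sat s t k
   der-sat'd h(given d) _ = h d
   der-sat'd h(head d c)(p , q) = der1-head c q(der-sat'd h d p)
   der-sat'd h(tail d c)(p , q) = der1-tail c q(der-sat'd h d p)

  cut-forc : ∀ {B} -> Forced B -> ∀ {s t k}(d : Der s t k) -> CutsIn B d -> (c : SCut s t k) -> ∀ f -> cut(SCut.T c) f == tt -> B f == tt
  cut-forc {B} forc {k = k} d cuts c f f-cut with T∨F(B f)
  ... | inl p = p
  ... | inr p = void(few size') where
   open SCut c renaming (size to size')
   open Integral (wo f)
   sat : 1# * + k ≤ wt(χ ∘ wo f)(cut T)
   sat = der-sat'd(wo f)(χ ∘ wo f) 1#(χ≥0 ∘ wo f)(\e -> ap χ) 0≤1(forc f p) d(cuts-mono(\x q -> keeps x q) d cuts) T(sep1 T s∈ t∉)(wid(\x q -> tr(Bool.∧-comm(wo f x)(cut T x)) q)(minl f f-cut)) where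
    keeps : ∀ x -> B x == tt -> wo f x == tt
    keeps x q = ap not(dec-ff(f Fin.≟ x) \ { refl -> cl q p })
   g-f : χ(wo f f) == 0#
   g-f = ap(χ ∘ not)(is-refl f)
   g≤1 : ∀ x -> χ(wo f x) ≤ 1#
   g≤1 x with wo f x
   ... | tt = rfl
   ... | ff = 0≤1
   cover : ∀ {p q : ES} e -> (∀ f -> p f == tt -> q f == tt ⊎ f == e) -> wt(χ ∘ wo f) p ≤ wt(χ ∘ wo f) q + χ(wo f e)
   cover {p} {q} = wt-cover(χ ∘ wo f)(χ≥0 ∘ wo f) {p} {q}
   empty : wt(χ ∘ wo f) none == 0#
   empty = ∑-0 Es(\x _ -> 0*(χ(wo f x)))
   k≤ : ∀ {a b} -> a ≤ 1# -> wt(χ ∘ wo f)(cut T) ≤ 0# + a + b -> b == 0# -> k N.≤ 1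
   k≤ {a} l h refl = drop‿+≤+(by(sym(1*(+ k)))(via sat(via h(by(tr(+0(0# + a))(0+ a)) l))))
   few : ¬((2 N.≤ k ×(∀ f -> cut T f == tt -> f == e)) ⊎(k == 3 × ∃[ e' ] e' ≢ e × cut T e' == tt ×(∀ f -> cut T f == tt -> f == e ⊎ f == e')))
   few(inl(2≤k , only)) with only f f-cut
   ... | refl = N.<⇒≱ 2≤k(k≤ {0#} 0≤1(to(cover {cut T} {none} e \x q -> inr(only x q))(ap(_+ χ(wo f e)) empty)) g-f)
   few(inr(refl , e' , _ , _ , only)) = N.<⇒≱(s≤s(s≤s z≤n))(split(only f f-cut)) where
    both : wt(χ ∘ wo f)(cut T) ≤ 0# + χ(wo f e) + χ(wo f e')
    both = via(cover {cut T} {is e} e' \x q -> either x(only x q))(+≤ˡ(χ(wo f e'))(eq≤(tr(wt-is(χ ∘ wo f)(χ≥0 ∘ wo f) e)(sym(0+ _))))) where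
     either : ∀ x -> x == e ⊎ x == e' -> is e x == tt ⊎ x == e'
     either x(inl refl) = inl(is-refl x)
     either x(inr q) = inr q
    split : f == e ⊎ f == e' -> 3 N.≤ 1
    split(inr refl) = k≤ {χ(wo f e)} {χ(wo f f)}(g≤1 e) both g-f
    split(inl refl) = k≤ {χ(wo f e')} {χ(wo f f)}(g≤1 e')(to both(swap(χ(wo f f))(χ(wo f e')))) g-f where
     swap : ∀ a b -> 0# + a + b == 0# + b + a
     swap = ring

  all-cuts : ∀ {B} -> Forced B -> ∀ {s t k}(d : Der s t k) -> CutsIn B d
  all-cuts forc(given _) = unit
  all-cuts forc(head d c) = all-cuts forc d , cut-forc forc d(all-cuts forc d) c
  all-cuts forc(tail d c) = all-cuts forc d , cut-forc forc d(all-cuts forc d) c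

  Full : Fin n -> Fin n -> ℕ -> Set
  Full s t k = ∀ T -> Sep T s t -> + k ≤ size(cut T)

  record MinCut(s t : Fin n)(k : ℕ) : Set where
   field
    T : VS n
    s∈ : T ∋ s
    t∉ : T ∌ t
    sml : size(cut T) < + k
    minl : ∀ f -> cut T f == tt -> Lnk(\x -> cut T x ∧ not(is f x)) s t

  min-cut : ∀ {s t k} -> ¬ Full s t k -> ¬ ¬ MinCut s t k
  min-cut {s} {t} {k} ¬full ¬min = ¬full \T sep -> stable(+ k ≤? size(cut T)) \k≰ -> oriented T sep(≰⇒> k≰) ¬min where
   shrink : ∀ N T -> T ∋ s -> T ∌ t -> size(cut T) < + k -> size(cut T) < + N -> ¬ ¬ MinCut s t k
   shrink zero T s∈ t∉ sml l = void(<⇒≱ l(∑≥0 {f = \f -> χ(cut T f) * 1#} Es \f _ -> term≥0 one one≥0(cut T) f))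
   shrink(suc N) T s∈ t∉ sml l = em-all(\f -> Lnk(\x -> cut T x ∧ not(is f x)) s t) >>= \lnk? -> pick1 lnk?(Fin.any? \f -> (cut T f Bool.≟ tt) ×-dec ¬?(lnk? f)) where
    pick1 : (lnk? : ∀ f -> Dec(Lnk(\x -> cut T x ∧ not(is f x)) s t)) -> Dec(∃[ f ] cut T f == tt × ¬ Lnk(\x -> cut T x ∧ not(is f x)) s t) -> ¬ ¬ MinCut s t k
    pick1 lnk?(no h) = pure record { T = T ;s∈ = s∈ ;t∉ = t∉ ;sml = sml
     ;minl = \f p -> stable(lnk? f)(\ ¬l -> h(f , p , ¬l)) }
    pick1 lnk?(yes(f , p , ¬l)) = cmpt(\x -> cut T x ∧ not(is f x)) s >>= \(U , comp) -> shrink N U(snd comp s stop)(outside U comp)(≤<(smaller' U comp) sml)(<≤(suc-≤(smaller U comp))(drop-suc l)) where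
     outside : ∀ U -> Cmpt(\x -> cut T x ∧ not(is f x)) s U -> U ∌ t
     outside U comp with ∋∨∌ U t
     ... | inl q = void(¬l(fst comp t q))
     ... | inr q = q
     smaller : ∀ U -> Cmpt(\x -> cut T x ∧ not(is f x)) s U -> size(cut U) + 1# ≤ size(cut T)
     smaller U comp = via(+≤ʳ(size(cut U))(eq≤(sym(wt-is one one≥0 f))))(wt-disj one one≥0 {cut U} {is f} {cut T}(\x q -> fst(∧-e(cmpt-cut {U = U} comp x q)) , not-true(snd(∧-e(cmpt-cut {U = U} comp x q)))) \x q -> tp(\x -> cut T x == tt)(isT q) p)
     smaller' : ∀ U -> Cmpt(\x -> cut T x ∧ not(is f x)) s U -> size(cut U) ≤ size(cut T)
     smaller' U comp = via(bd {size(cut U)} refl 0≤1)(smaller U comp)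
     suc-≤ : ∀ {a b} -> a + 1# ≤ b -> a < b
     suc-≤ {a} h = <≤(by-diff< {a} refl(+<+(s≤s z≤n))) h
     drop-suc : ∀ {a} -> a < + suc N -> a ≤ + N
     drop-suc h = i<j⇒i≤pred[j] h
   bd1 : ∀ T -> ∃[ N ] size(cut T) < + N
   bd1 T with size(cut T)
   ... | + z = suc z , +<+ N.rfl
   ... | Int.-[1+ _ ] = 0 , ℤ.-<+
   oriented : ∀ T -> Sep T s t -> size(cut T) < + k -> ¬ ¬ MinCut s t k
   oriented T sep sml with ∋∨∌ T s | ∋∨∌ T t
   ... | inl p | inl q = void(sep(tr p(sym q)))
   ... | inr p | inr q = void(sep(tr p(sym q)))
   ... | inl p | inr q = shrink(fst(bd1 T)) T p q sml(snd(bd1 T))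
   ... | inr p | inl q = shrink(fst(bd1(co T)))(co T)(co-∋ T p)(co-∌ T q)(≤<(wt-mono one one≥0 {cut(co T)} {cut T} \f r -> tr(sym(cut-co T f)) r) sml)(snd(bd1(co T)))

  mark : ∀ {s t k} -> k N.≤ 3 -> (M : MinCut s t k) -> ∀ e {a b} -> Joins e a b -> MinCut.T M ∋ a -> MinCut.T M ∌ b -> SCut s t k
  mark {k = k} k≤3 M e j a∈ b∉ = record { T = T ;s∈ = s∈ ;t∉ = t∉ ;minl = minl ;e = e ;joins = j ;a∈ = a∈ ;b∉ = b∉ ;size = decide(Fin.any? \f -> (cut T f Bool.≟ tt) ×-dec ¬?(f Fin.≟ e)) }
   where
   open MinCut M
   e-in : cut T e == tt
   e-in = cut-true T j a∈ b∉
   two : ∀ {f} -> cut T f == tt -> f ≢ e -> + 2 ≤ size(\x -> is e x ∨ is f x)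
   two {f} p ne = by(ap2 _+_(sym(wt-is one one≥0 e))(sym(wt-is one one≥0 f)))(wt-disj one one≥0 {is e} {is f} {\x -> is e x ∨ is f x}(\x q -> ap(_∨ is f x) q , dec-ff(f Fin.≟ x) \eq -> ne(tr eq(sym(isT {e} {x} q)))) \x q -> tr(ap(is e x ∨_) q)(Bool.∨-zeroʳ(is e x)))
   pair-in : ∀ {f} -> cut T f == tt -> ∀ x -> is e x ∨ is f x == tt -> cut T x == tt
   pair-in {f} p x q with T∨F(is e x) | T∨F(is f x)
   ... | inl r | _ = tp(\x -> cut T x == tt)(isT r) e-in
   ... | inr _ | inl r = tp(\x -> cut T x == tt)(isT r) p
   ... | inr r | inr r' = cl q(∨-Fs r r')
   decide : Dec(∃[ f ] cut T f == tt × f ≢ e) -> (2 N.≤ k ×(∀ f -> cut T f == tt -> f == e)) ⊎(k == 3 × ∃[ e' ] e' ≢ e × cut T e' == tt ×(∀ f -> cut T f == tt -> f == e ⊎ f == e'))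
   decide(no h) = inl(drop‿+<+(≤<(by(sym(wt-is one one≥0 e))(wt-mono one one≥0 {is e} {cut T} \x q -> tp(\x -> cut T x == tt)(isT q) e-in)) sml) , \f p -> stable(f Fin.≟ e) \ne -> h(f , p , ne))
   decide(yes(f , p , ne)) = inr(N.≤-antisym k≤3(drop‿+<+(≤<(via(two p ne)(wt-mono one one≥0 {\x -> is e x ∨ is f x} {cut T}(pair-in p))) sml)) , f , ne , p , rest) where
    rest : ∀ x -> cut T x == tt -> x == e ⊎ x == f
    rest x q with x Fin.≟ e | x Fin.≟ f
    ... | yes r | _ = inl r
    ... | no _ | yes r = inr r
    ... | no r | no r' = void(<⇒≱ sml(via(+≤+ k≤3)(via(+≤ʳ 1#(two p ne))(via(+≤ˡ(size \x -> is e x ∨ is f x)(eq≤(sym(wt-is one one≥0 x))))(wt-disj one one≥0 {is x} {\x -> is e x ∨ is f x} {cut T}(\y s -> tp(\x -> cut T x == tt)(isT s) q , ∨-Fs(dec-ff(e Fin.≟ y) \eq -> r(tr(isT s)(sym eq)))(dec-ff(f Fin.≟ y) \eq -> r'(tr(isT s)(sym eq))))(pair-in p))))))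

  len-wid : ∀ {F F' : ES} {u v}(h : ∀ e -> F e == ff -> F' e == ff)(p : Lnk F u v) -> len1(wid h p) == len1 p
  len-wid h stop = refl
  len-wid h(step _ _ _ p) = ap suc(len-wid h p)

  -- A demand separated by A can be replaced by a derived one without small cuts.
  sep'd-full : ∀ {B} -> Forced B -> ∀ A ℓ {s t k} -> Der s t k -> (p : Lnk(\e -> B e ∧ cut A e) s t) -> len1 p N.< ℓ -> Sep A s t -> ¬ ¬(∃[ u ] ∃[ v ] Der u v k × Full u v k × Sep A u v)
  sep'd-full {B} forc A(suc ℓ) {s} {t} {k} d p l sep = em(Full s t k) >>= \ { (yes full) -> pure(s , t , d , full , sep) ;(no ¬full) -> min-cut ¬full >>= \M -> at1 M(exits(MinCut.T M) p(MinCut.s∈ M)(MinCut.t∉ M)) } where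
   at1 : (M : MinCut s t k) -> Exit(MinCut.T M)(\e -> B e ∧ cut A e) s t(len1 p) -> ¬ ¬(∃[ u ] ∃[ v ] Der u v k × Full u v k × Sep A u v)
   at1 M x = pick1(at A s Bool.≟ at A a) where
    open Exit x
    c : SCut s t k
    c = mark(der≤3 d) M e joins a∈ b∉
    same : at A a == at A b
    same = uncut A joins(tr(ap(_∧ cut A e)(sym(cut-forc forc d(all-cuts forc d) c e(cut-true(MinCut.T M) joins a∈ b∉)))) e∉F)
    before' : Lnk(\e -> B e ∧ cut A e) s a
    before' = wid(\e p -> fst(∨-F p)) before
    tot : suc(len1 before N.+ len1 after) N.≤ ℓ
    tot = N.by shorter(ℕ.s≤s⁻¹ l)
    pick1 : Dec(at A s == at A a) -> ¬ ¬(∃[ u ] ∃[ v ] Der u v k × Full u v k × Sep A u v)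
    pick1(yes eq) = sep'd-full forc A ℓ(tail d c) after(N.via(s≤s(N.r≤(len1 after)(len1 before))) tot)(\eq' -> sep(tr eq(tr same eq')))
    pick1(no ne) = sep'd-full forc A ℓ(head d c) before'(N.via(s≤s(N.by(len-wid(\e p -> fst(∨-F p)) before)(N.l≤(len1 before)(len1 after)))) tot) ne

  maximum : (P : ℕ -> Set) -> (∀ k -> Dec(P k)) -> ∀ N -> ∃[ k ](k == 0 ⊎ P k) ×(∀ j -> j N.≤ N -> P j -> j N.≤ k)
  maximum P P? zero = 0 , inl refl , \j j≤0 _ -> j≤0
  maximum P P?(suc N) with P?(suc N)
  ... | yes p = suc N , inr p , \j l _ -> l
  ... | no ¬p with maximum P P? N
  ... | k , attd , max = k , attd , \j l pj -> max j(N.≤-pred(N.≤∧≢⇒< l \ { refl -> ¬p pj })) pj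

  -- The requirement function of full pairs is skew supermodular.
  module Reqm (Pair : Fin n -> Fin n -> ℕ -> Set) (pair? : ∀ u v k -> k N.≤ 3 -> Dec (Pair u v k)) (pair≤3 : ∀ {u v k} -> Pair u v k -> k N.≤ 3) where

   Level : VS n -> ℕ -> Set
   Level S k = k N.≤ 3 × ∃[ u ] ∃[ v ] Pair u v k × Sep S u v

   level? : ∀ S k -> Dec(Level S k)
   level? S k with k ℕ.≤? 3
   ... | no ¬p = no(¬p ∘ fst)
   ... | yes p with Fin.any?(\u -> Fin.any? \v -> pair? u v k p ×-dec ¬?(at S u Bool.≟ at S v))
   ... | yes q = yes(p , q)
   ... | no ¬q = no(¬q ∘ snd)

   abstract
    rank : VS n -> ℕ
    rank S = fst(maximum(Level S)(level? S) 3)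

    rank≥ : ∀ S {u v k} -> Pair u v k -> Sep S u v -> k N.≤ rank S
    rank≥ S {u} {v} {k} p sep = snd(snd(maximum(Level S)(level? S) 3)) k(pair≤3 p)(pair≤3 p , u , v , p , sep)

    attd : ∀ S -> rank S == 0 ⊎ Level S(rank S)
    attd S = fst(snd(maximum(Level S)(level? S) 3))

   -- A pair separated by A, oriented from the inside, that forces α wherever it is separated.
   Witness : VS n -> ℕ -> Set
   Witness A α = ∃[ u ] ∃[ v ] A ∋ u × A ∌ v ×(∀ X -> Sep X u v -> α N.≤ rank X)

   witness : ∀ A -> rank A == 0 ⊎ Witness A(rank A)
   witness A with attd A
   ... | inl eq = inl eq
   ... | inr(_ , u , v , p , sep) with ∋∨∌ A u | ∋∨∌ A v
   ... | inl x | inl y = void(sep(tr x(sym y)))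
   ... | inr x | inr y = void(sep(tr x(sym y)))
   ... | inl x | inr y = inr(u , v , x , y , \X s -> rank≥ X p s)
   ... | inr x | inl y = inr(v , u , y , x , \X s -> rank≥ X p(s ∘ sym))

   sep : ∀ S {u v} -> S ∋ u -> S ∌ v -> Sep S u v
   sep S p q eq = cl p(tr eq q)

   sep' : ∀ S {u v} -> S ∌ u -> S ∋ v -> Sep S u v
   sep' S p q eq = cl q(tr(sym eq) p)

   Skew : (VS n -> ℕ) -> VS n -> VS n -> Set
   Skew f A C = f A N.+ f C N.≤ f(A ∩ C) N.+ f(A ∪ C) ⊎ f A N.+ f C N.≤ f(A ∖ C) N.+ f(C ∖ A)

   at-∩ : ∀ A C {α}(w : Witness A α) -> C ∋ fst w -> α N.≤ rank(A ∩ C)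
   at-∩ A C(u , v , u∈ , v∉ , up) p = up(A ∩ C)(sep(A ∩ C)(∋∩ A C u∈ p)(∌∩ˡ A C v∉))

   at-∪ : ∀ A C {α}(w : Witness A α) -> C ∌ fst(snd w) -> α N.≤ rank(A ∪ C)
   at-∪ A C(u , v , u∈ , v∉ , up) p = up(A ∪ C)(sep(A ∪ C)(∋∪ˡ A C u∈)(∌∪ A C v∉ p))

   at-A∖C : ∀ A C {α}(w : Witness A α) -> C ∌ fst w -> α N.≤ rank(A ∖ C)
   at-A∖C A C(u , v , u∈ , v∉ , up) p = up(A ∖ C)(sep(A ∖ C)(∋∖ A C u∈ p)(∌∖ˡ A C v∉))

   at-C∖A : ∀ A C {α}(w : Witness A α) -> C ∋ fst(snd w) -> α N.≤ rank(C ∖ A)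
   at-C∖A A C(u , v , u∈ , v∉ , up) p = up(C ∖ A)(sep'(C ∖ A)(∌∖ʳ C A u∈)(∋∖ C A p v∉))

   at-∩' : ∀ A C {β}(w : Witness C β) -> A ∋ fst w -> β N.≤ rank(A ∩ C)
   at-∩' A C(p , q , p∈ , q∉ , up) x = up(A ∩ C)(sep(A ∩ C)(∋∩ A C x p∈)(∌∩ʳ A C q∉))

   at-∪' : ∀ A C {β}(w : Witness C β) -> A ∌ fst(snd w) -> β N.≤ rank(A ∪ C)
   at-∪' A C(p , q , p∈ , q∉ , up) x = up(A ∪ C)(sep(A ∪ C)(∋∪ʳ A C p∈)(∌∪ A C x q∉))

   skew : ∀ A C -> Skew rank A C
   skew A C with witness A | witness C
   ... | inl a≡0 | inl c≡0 = inl(N.by(ap2 N._+_ a≡0 c≡0) z≤n)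
   ... | inl a≡0 | inr w@(p , _) with ∋∨∌ A p
   ... | inl x = inl(N.by(ap(N._+ rank C) a≡0)(N.via(at-∩' A C w x)(N.l≤ _ _)))
   ... | inr x = inr(N.by(ap(N._+ rank C) a≡0)(N.via(at-A∖C C A w x)(N.r≤ _ _)))
   skew A C | inr w@(u , _) | inl c≡0 with ∋∨∌ C u
   ... | inl x = inl(N.by(tr(ap(rank A N.+_) c≡0)(N.+0 _))(N.via(at-∩ A C w x)(N.l≤ _ _)))
   ... | inr x = inr(N.by(tr(ap(rank A N.+_) c≡0)(N.+0 _))(N.via(at-A∖C A C w x)(N.l≤ _ _)))
   skew A C | inr w@(u , v , _) | inr w'@(p , q , _) with ∋∨∌ C u | ∋∨∌ C v | ∋∨∌ A p | ∋∨∌ A q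
   ... | inl Cu | _ | _ | inr Aq = inl(N.+≤(at-∩ A C w Cu)(at-∪' A C w' Aq))
   ... | _ | inr Cv | inl Ap | _ = inl(N.to(N.+≤(at-∪ A C w Cv)(at-∩' A C w' Ap))(N.+-comm(rank(A ∪ C)) _))
   ... | inr Cu | _ | inr Ap | _ = inr(N.+≤(at-A∖C A C w Cu)(at-A∖C C A w' Ap))
   ... | _ | inl Cv | _ | inl Aq = inr(N.to(N.+≤(at-C∖A A C w Cv)(at-C∖A C A w' Aq))(N.+-comm(rank(C ∖ A)) _))
   ... | inl Cu | inr Cv | inr Ap | inl Aq with N.≤-total(rank A)(rank C)
   ... | inl l = inr(N.+≤(N.via l(at-C∖A C A w' Aq))(at-A∖C C A w' Ap))
   ... | inr l = inl(N.+≤(at-∩ A C w Cu)(N.via l(at-∪ A C w Cv)))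
   skew A C | inr w@(u , v , _) | inr w'@(p , q , _) | inr Cu | inl Cv | inl Ap | inr Aq with N.≤-total(rank A)(rank C)
   ... | inl l = inl(N.+≤(N.via l(at-∩' A C w' Ap))(at-∪' A C w' Aq))
   ... | inr l = inr(N.+≤(at-A∖C A C w Cu)(N.via l(at-C∖A A C w Cv)))

   module Resid (B : ES) where

    bt : VS n -> Z
    bt S = wt(χ ∘ B)(cut S)

    resid : VS n -> Z
    resid S = + rank S - bt S

    third≥0 : ∀(f : ES) -> 0# ≤ ∑ Es(\e -> χ(f e) * χ(B e))
    third≥0 f = ∑≥0 {f = \e -> χ(f e) * χ(B e)} Es(\e _ -> *≥0 {χ(f e)} {χ(B e)}(χ≥0(f e))(χ≥0(B e)))

    bal : ∀ {a c p q a' c' p' q' r} -> a + c ≤ p + q -> a' + c' == p' + q' + + 2 * r -> 0# ≤ r -> (a - a') +(c - c') ≤(p - p') +(q - q')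
    bal {a} {c} {p} {q} {a'} {c'} {p'} {q'} {r} h eq r≥0 = bd {e = (p + q -(a + c)) +(+ 2 * r)}(tr(lm a c p q a' c' p' q')(tr(ap(\z -> (a - a') +(c - c') +((p + q -(a + c)) +(z -(p' + q')))) eq)(lm2 a c p q a' c' p' q' r)))(+≥0(d≥0 h)(*≥0 {+ 2} {r}(+≤+ z≤n) r≥0)) where
     lm : ∀ a c p q a' c' p' q' -> (p - p') +(q - q') ==(a - a') +(c - c') +((p + q -(a + c)) +((a' + c') -(p' + q')))
     lm = ring
     lm2 : ∀ a c p q a' c' p' q' r -> (a - a') +(c - c') +((p + q -(a + c)) +((p' + q' + + 2 * r) -(p' + q'))) ==(a - a') +(c - c') +((p + q -(a + c)) +(+ 2 * r))
     lm2 = ring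

    resid-skew : ∀ A C -> resid A + resid C ≤ resid(A ∩ C) + resid(A ∪ C) ⊎ resid A + resid C ≤ resid(A ∖ C) + resid(C ∖ A)
    resid-skew A C with skew A C
    ... | inl l = inl(bal {+ rank A} {+ rank C} {+ rank(A ∩ C)} {+ rank(A ∪ C)} {bt A} {bt C} {bt(A ∩ C)} {bt(A ∪ C)} {∑ Es(\e -> χ(btw(A ∖ C)(C ∖ A) e) * χ(B e))}(+≤+ l)(uncr-∩∪ Es(χ ∘ B) A C)(third≥0(btw(A ∖ C)(C ∖ A))))
    ... | inr l = inr(bal {+ rank A} {+ rank C} {+ rank(A ∖ C)} {+ rank(C ∖ A)} {bt A} {bt C} {bt(A ∖ C)} {bt(C ∖ A)} {∑ Es(\e -> χ(outer A C e) * χ(B e))}(+≤+ l)(uncr-∖ Es(χ ∘ B) A C)(third≥0(outer A C)))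

 module Buying (Dem : Fin n -> Fin n -> ℕ -> Set)
  (dem≤3 : ∀ {s t k} -> Dem s t k -> k N.≤ 3)(w : Fin m -> Z)(w≥0 : ∀ e -> 0# ≤ w e) where

  open Closure Dem dem≤3 public

  cap : ES -> (Fin m -> Z) -> Z -> Fin m -> Z
  cap B x D e = if B e then D else x e

  cost : (Fin m -> Z) -> Z
  cost x = ∑ Es(\e -> w e * x e)

  -- x / D, supported outside B, together with B satisfies every demand fractionally.
  record LP(B : ES)(x : Fin m -> Z)(D : Z) : Set where
   field
    D>0 : 0# < D
    x≥0 : ∀ e -> 0# ≤ x e
    x≤D : ∀ e -> x e ≤ D
    off : ∀ e -> B e == tt -> x e == 0#
    meet : ∀ {s t k} -> Dem s t k -> ∀ S -> Sep S s t -> Lnk(\e -> B e ∧ cut S e) s t -> D * + k ≤ wt(cap B x D)(cut S)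

   cap≥0 : ∀ e -> 0# ≤ cap B x D e
   cap≥0 e with B e
   ... | tt = lt D>0
   ... | ff = x≥0 e

   cap-B : ∀ e -> B e == tt -> cap B x D e == D
   cap-B e p rewrite p = refl

  _∪ᵉ_ : ES -> Fin m -> ES
  (B ∪ᵉ e) f = B f ∨ is e f

  all-¬¬ : ∀ {k} {Q : Fin k -> Set} -> (∀ i -> ¬ ¬ Q i) -> ¬ ¬(∀ i -> Q i)
  all-¬¬ {zero} h = pure \()
  all-¬¬ {suc k} h = h zero >>= \q -> all-¬¬(h ∘ suc) >>= \qs -> pure \ { zero -> q ;(suc i) -> qs i }

  module Step {B : ES} (forc : Forced B) where

   Pair : Fin n -> Fin n -> ℕ -> Set
   Pair u v k = Der u v k × Full u v k

   decide-pairs : ¬ ¬(∀ u v k -> k N.≤ 3 -> Dec(Pair u v k))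
   decide-pairs = all-¬¬(\u -> all-¬¬ \v -> all-¬¬ \(k : Fin 4) -> em(Pair u v(toℕ k))) >>= \d -> pure \u v k k≤3 -> tp(\k -> Dec(Pair u v k))(Fin.toℕ-fromℕ<(s≤s k≤3))(d u v(fromℕ<(s≤s k≤3)))

   module _ (pair? : ∀ u v k -> k N.≤ 3 -> Dec (Pair u v k)) where
    open Reqm Pair pair? (der≤3 ∘ fst)
    open Resid B

    wt-cap : ∀ x D -> (∀ e -> B e == tt -> x e == 0#) -> ∀ S -> wt(cap B x D)(cut S) == D * bt S + wt x(cut S)
    wt-cap x D off S = tr(∑≡ Es \e _ -> each e)(tr(∑-+(\e -> D *(χ(cut S e) * χ(B e)))(\e -> χ(cut S e) * x e) Es)(ap(_+ wt x(cut S))(∑-* D(\e -> χ(cut S e) * χ(B e)) Es))) where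
     lm1 : ∀ c D -> c * D == D *(c * 1#) + c * 0#
     lm1 = ring
     lm2 : ∀ c D x -> c * x == D *(c * 0#) + c * x
     lm2 = ring
     each : ∀ e -> χ(cut S e) * cap B x D e == D *(χ(cut S e) * χ(B e)) + χ(cut S e) * x e
     each e with B e in eq
     ... | tt rewrite off e eq = lm1(χ(cut S e)) D
     ... | ff = lm2(χ(cut S e)) D(x e)

    -- Both polytopes agree: demands around small cuts and derived demands without them.
    to-resid : ∀ {x D} -> LP B x D -> Halves.Frac resid resid-skew w x D
    to-resid {x} {D} lp = record { D>0 = D>0 ;x≥0 = x≥0 ;feas = feas }
     where
     open LP lp
     open Caps B (cap B x D) D cap≥0 cap-B (lt D>0)
     rank≤ : ∀ S -> D * + rank S ≤ wt(cap B x D)(cut S)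
     rank≤ S = from-level(attd S) where
      pos : 0# ≤ wt(cap B x D)(cut S)
      pos = ∑≥0 {f = \f -> χ(cut S f) * cap B x D f} Es(\f _ -> term≥0(cap B x D) cap≥0(cut S) f)
      from-level : rank S == 0 ⊎ Level S(rank S) -> D * + rank S ≤ wt(cap B x D)(cut S)
      from-level(inl eq) = by(tr(ap(\k -> D * + k) eq)(*0 D)) pos
      from-level(inr(_ , u , v ,(d , full) , sep)) = stable(_ ≤? _)(em(Lnk(\e -> B e ∧ cut S e) u v) >>= \ { (yes p) -> pure(der-sat'd B(cap B x D) D cap≥0 cap-B(lt D>0) meet d(all-cuts forc d) S sep p) ;(no ¬p) -> cmpt(\e -> B e ∧ cut S e) u >>= \(U , comp) -> pure(blkd U comp ¬p) }) where
       blkd : ∀ U -> Cmpt(\e -> B e ∧ cut S e) u U -> ¬ Lnk(\e -> B e ∧ cut S e) u v -> D * + rank S ≤ wt(cap B x D)(cut S)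
       blkd U comp ¬p = via(*≤ˡ D {{ℤ.nonNegative(lt D>0)}}(full U apart))(by(sym(∑-* D(\e -> χ(cut U e) * 1#) Es))(∑≤ Es \e _ -> each e)) where
        apart : Sep U u v
        apart eq = ¬p(fst comp v(tr(sym eq)(snd comp u stop)))
        each : ∀ e -> D *(χ(cut U e) * 1#) ≤ χ(cut S e) * cap B x D e
        each e with T∨F(cut U e)
        ... | inr q rewrite q = by(*0 D)(term≥0(cap B x D) cap≥0(cut S) e)
        ... | inl q rewrite q | cap-B e(fst(∧-e {B e} {cut S e}(cmpt-cut {U = U} comp e q))) | snd(∧-e {B e} {cut S e}(cmpt-cut {U = U} comp e q)) = eq≤(*-comm D 1#)
     feas : ∀ S -> D * resid S ≤ wt x(cut S)
     feas S = bd(lm D(+ rank S)(bt S)(wt x(cut S)))(d≥0(to(rank≤ S)(wt-cap x D off S))) where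
      lm : ∀ D r b x -> x == D *(r - b) +(D * b + x - D * r)
      lm = ring

    from-resid : ∀ {x D} -> (∀ e -> B e == tt -> x e == 0#) -> 0# < D -> (∀ S -> D * resid S ≤ wt x(cut S)) -> ∀ {s t k} -> Dem s t k -> ∀ S -> Sep S s t -> Lnk(\e -> B e ∧ cut S e) s t -> D * + k ≤ wt(cap B x D)(cut S)
    from-resid {x} {D} off D>0 feas {s} {t} {k} dem S sep p = stable(D * + k ≤? wt(cap B x D)(cut S))(sep'd-full forc S(suc(len1 p))(given dem) p N.rfl sep >>= \(u , v , d , full , sep') -> pure(bd1(rank≥ S(d , full) sep'))) where
     bd1 : k N.≤ rank S -> D * + k ≤ wt(cap B x D)(cut S)
     bd1 l = via(*≤ˡ D {{ℤ.nonNegative(lt D>0)}}(+≤+ l))(to(bd(lm D(+ rank S)(bt S)(wt x(cut S)))(d≥0(feas S)))(sym(wt-cap x D off S))) where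
      lm : ∀ D r b x -> D * b + x == D * r +(x - D *(r - b))
      lm = ring

    record Bought(x : Fin m -> Z)(D : Z) : Set where
     field
      e : Fin m
      new : B e == ff
      x' : Fin m -> Z
      D' : Z
      lp : LP(B ∪ᵉ e) x' D'
      cheap : D *(+ 2 * cost x' + w e * D') ≤ + 2 *(D' * cost x)

    buy : ∀ {x D} -> LP B x D -> ¬ Solves B -> Bought x D
    buy {x} {D} lp ¬solved = pick1 result where
     open LP lp using (D>0)
     open Halves.Outc (Halves.half-integral resid resid-skew w (to-resid lp) (LP.x≤D lp)) renaming (x' to y; D' to C)
     open Halves.Frac poly1 renaming (D>0 to C>0; x≥0 to y≥0)
     off' : ∀ e -> B e == tt -> y e == 0#
     off' e p = support e(LP.off lp e p)
     meet-y : ∀ {s t k} -> Dem s t k -> ∀ S -> Sep S s t -> Lnk(\e -> B e ∧ cut S e) s t -> C * + k ≤ wt(cap B y C)(cut S)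
     meet-y = from-resid off' C>0 feas
     cap-y≥0 : ∀ e -> 0# ≤ cap B y C e
     cap-y≥0 e with B e
     ... | tt = lt C>0
     ... | ff = y≥0 e
     pick1 : (∃[ e ] C ≤ + 2 * y e) ⊎(∀ e -> y e == 0#) -> Bought x D
     pick1(inr empty) = void(¬solved \ {s} {t} {k} dem S sep p -> Halves.cancel≤ resid resid-skew w C>0(by(ap(_*_ C)(1*(+ k)))(to(meet-y dem S sep p)(tr(wt-cap y C off' S)(tr(ap(_+_(C * bt S))(∑-0 Es \e _ -> Halves.*0≡0 resid resid-skew w(χ(cut S e))(y e)(empty e)))(+0 _))))))
     pick1(inl(e , half)) = record
      { e = e ;new = new ;x' = z ;D' = C
      ;lp = record { D>0 = C>0 ;x≥0 = z≥0 ;x≤D = z≤C ;off = z-off ;meet = meet-z }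
      ;cheap = via(Halves.scale≤ resid resid-skew w(lt D>0) saving)(by(lm D(cost y))(Halves.scale≤ resid resid-skew w {+ 2}(+≤+ z≤n) cheap)) } where
      new : B e == ff
      new = ≢-true \p -> <⇒≱ C>0(to half(tr(ap(_*_(+ 2))(off' e p))(*0(+ 2))))
      z : Fin m -> Z
      z f = if is e f then 0# else y f
      z≥0 : ∀ f -> 0# ≤ z f
      z≥0 f with is e f
      ... | tt = rfl
      ... | ff = y≥0 f
      z≤C : ∀ f -> z f ≤ C
      z≤C f with is e f
      ... | tt = lt C>0
      ... | ff = box f
      z-off : ∀ f -> (B ∪ᵉ e) f == tt -> z f == 0#
      z-off f p with is e f
      ... | tt = refl
      ... | ff = off' f(tr(sym(Bool.∨-identityʳ(B f))) p)
      cap≤ : ∀ f -> cap B y C f ≤ cap(B ∪ᵉ e) z C f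
      cap≤ f with B f | is e f
      ... | tt | _ = rfl
      ... | ff | tt = box f
      ... | ff | ff = rfl
      meet-z : ∀ {s t k} -> Dem s t k -> ∀ S -> Sep S s t -> Lnk(\f -> (B ∪ᵉ e) f ∧ cut S f) s t -> C * + k ≤ wt(cap(B ∪ᵉ e) z C)(cut S)
      meet-z dem S sep p = via(meet-y dem S sep(wid fewer p))(∑≤ Es \f _ -> *≤ˡ(χ(cut S f)) {{ℤ.nonNegative(χ≥0(cut S f))}}(cap≤ f)) where
       fewer : ∀ f -> (B f ∨ is e f) ∧ cut S f == ff -> B f ∧ cut S f == ff
       fewer f q with B f
       ... | tt = q
       ... | ff = refl
      cost-split : cost y == cost z + w e * y e
      cost-split = tr(∑≡ Es \f _ -> each f)(tr(∑-+(\f -> w f * z f)(\f -> χ(is e f) *(w f * y f)) Es)(ap(_+_(cost z))(wt-is(\f -> w f * y f)(\f -> *≥0 {w f} {y f}(w≥0 f)(y≥0 f)) e))) where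
       lm1 : ∀ w y -> w * y == w * 0# + 1# *(w * y)
       lm1 = ring
       lm2 : ∀ w y -> w * y == w * y + 0# *(w * y)
       lm2 = ring
       each : ∀ f -> w f * y f == w f * z f + χ(is e f) *(w f * y f)
       each f with is e f
       ... | tt = lm1(w f)(y f)
       ... | ff = lm2(w f)(y f)
      saving : + 2 * cost z + w e * C ≤ + 2 * cost y
      saving = bd(tr(ap(_*_(+ 2)) cost-split)(lm3(cost z)(w e)(y e) C))(*≥0 {w e} {+ 2 * y e - C}(w≥0 e)(d≥0 half)) where
       lm3 : ∀ c w y C -> + 2 *(c + w * y) == + 2 * c + w * C + w *(+ 2 * y - C)
       lm3 = ring
      lm : ∀ D c -> D *(+ 2 * c) == + 2 *(D * c)
      lm = ring

 module Relax (Dem : Fin n -> Fin n -> ℕ -> Set)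
  (dem≤3 : ∀ {s t k} -> Dem s t k -> k N.≤ 3)(c : Fin m -> ℕ) where
  open Rows
  open Perc
  open Typed using (pick)
  open Tables using (pairs; either; ∈-pairs; ∈-either)
  open import Data.Bool.ListAction using (all)
  open import Data.Integer using (_⊔_; _⊓_)

  open Buying Dem dem≤3 (\ e -> + c e) (\ e -> +≤+ z≤n) public

  size≥0 : ∀ F -> 0# ≤ size F
  size≥0 F = ∑≥0 {f = \f -> χ(F f) * 1#} Es(\f _ -> term≥0 one one≥0 F f)

  part : Bool -> Z -> Z
  part tt y = 0# ⊔ y
  part ff y = 0# ⊔(- y)

  part≥0 : ∀ d y -> 0# ≤ part d y
  part≥0 tt y = i≤i⊔j 0# y
  part≥0 ff y = i≤i⊔j 0#(- y)

  part≤ : ∀ d {y u} -> 0# ≤ u -> y ≤ u -> - u ≤ y -> part d y ≤ u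
  part≤ tt p q r = ⊔-lub p q
  part≤ ff {y} {u} p q r = ⊔-lub p(to(neg-mono-≤ r)(neg-involutive u))

  part-diff : ∀ y -> part tt y - part ff y == y
  part-diff(+ zero) = refl
  part-diff(+ suc y) = ap +_(N.+0(suc y))
  part-diff Int.-[1+ y ] = refl

  -- A commodity asks for need k units of flow from s k to t k that avoid the edges forb k.
  module Comms {C : Set} (cs : List C) (cs-all : ∀ k -> k ∈ cs) (eqC : C -> C -> Bool)
   (point : ∀(h : C -> Z) k -> k ∈ cs -> ∑ cs(\k' -> χ(eqC k k') * h k') == h k)
   (forb : C -> Fin m -> Bool)(s t : C -> Fin n)(need : C -> ℕ)(N ε BIG : ℕ) where

   module _ (B : ES) (ℓ : ℕ) where

    open Program src tgt cs eqC forb s t need B c N ℓ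

    rows-all : ∀ r -> r ∈ rows
    rows-all = ∈-either {xs = either(unit ∷ [])(either Es arcs)} {pairs cs(fins n)}(∈-either {xs = unit ∷ []} {either Es arcs}(\ { unit -> hd refl })(∈-either {xs = fins m} {arcs} ∈-fins \(k , e , d) -> ∈-pairs(cs-all k)(∈-pairs(∈-fins e)(dirs-all d)))) \(k , v) -> ∈-pairs(cs-all k)(∈-fins v) where
     dirs-all : ∀ d -> d ∈ dirs
     dirs-all tt = hd refl
     dirs-all ff = th(hd refl)

    module R = Run vars rows pos neg lo hi ε (3 N.* N) (inl (inl unit))

    steps : ℕ
    steps = suc(len vars N.*(3 N.* N N.*(3 N.* N)))

    acc1 : Bool
    acc1 = R.test steps

    module Accepts (meant : ∀ k -> need k == 0 ⊎ ∃[ r ] Dem (s k) (t k) r × Lnk (forb k) (s k) (t k) × + need k + size (forb k) ≤ + r)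
     (c≤ : ∀ e -> c e N.≤ BIG)(1≤BIG : 1 N.≤ BIG)(ε≥ : len vars N.*(BIG N.* BIG) N.≤ ε) {x D}(lp : LP B x D)(budget : + N * cost x ≤ D * + ℓ) where
     open LP lp

     D≥0 = lt D>0

     u : C -> Fin m -> Z
     u k e = if forb k e then 0# else(if B e then + 3 * D else x e)

     u≥0 : ∀ k e -> 0# ≤ u k e
     u≥0 k e with forb k e | B e
     ... | tt | _ = rfl
     ... | ff | tt = *≥0 {+ 3} {D}(+≤+ z≤n) D≥0
     ... | ff | ff = x≥0 e

     u≤3D : ∀ k e -> u k e ≤ + 3 * D
     u≤3D k e with forb k e | B e
     ... | tt | _ = *≥0 {+ 3} {D}(+≤+ z≤n) D≥0
     ... | ff | tt = rfl
     ... | ff | ff = bd(lm D(x e))(+≥0(d≥0(x≤D e))(*≥0 {+ 2} {D}(+≤+ z≤n) D≥0)) where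
      lm : ∀ D x -> + 3 * D == x +(D - x + + 2 * D)
      lm = ring

     cut-sup : ∀ k S -> S ∋ s k -> S ∌ t k -> D * + need k ≤ wt(u k)(cut S)
     cut-sup k S s∈ t∉ = from(meant k) where
      pos-cut : 0# ≤ wt(u k)(cut S)
      pos-cut = ∑≥0 {f = \f -> χ(cut S f) * u k f} Es(\f _ -> term≥0(u k)(u≥0 k)(cut S) f)
      from : (need k == 0 ⊎ ∃[ r ] Dem(s k)(t k) r × Lnk(forb k)(s k)(t k) × + need k + size(forb k) ≤ + r) -> D * + need k ≤ wt(u k)(cut S)
      from(inl eq) = by(tr(ap(\r -> D * + r) eq)(*0 D)) pos-cut
      from(inr(r , dem , link , need≤)) = by-bt(Fin.any? \e -> (cut S e ∧(B e ∧ not(forb k e))) Bool.≟ tt) where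
       need≤3 : + need k ≤ + 3
       need≤3 = via(bd refl(size≥0(forb k)))(via need≤(+≤+(dem≤3 dem)))
       by-bt : Dec(∃[ e ](cut S e ∧(B e ∧ not(forb k e))) == tt) -> D * + need k ≤ wt(u k)(cut S)
       by-bt(yes(e , q)) with ∧-e {cut S e} q
       ... | e-cut , q' with ∧-e {B e} q'
       ... | e∈B , e∉F = via(*≤ˡ D {{ℤ.nonNegative D≥0}} need≤3)(by(tr(*-comm D(+ 3))(sym(ap2(\a b -> if a then 0# else(if b then + 3 * D else x e))(not-true e∉F) e∈B)))(wt-elem(u k)(u≥0 k) {cut S} e e-cut))
       by-bt(no none) = via(to(*≤ˡ D {{ℤ.nonNegative D≥0}}(via(bd(lm(+ need k)(size(forb k))(+ r))(d≥0 need≤)) rfl))(distrib D(+ r)(size(forb k))))(bd(lm2(D * size(forb k))(wt(u k)(cut S))(D * + r))(d≥0 tot≤)) where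
        lm : ∀ a f r -> r - f == a +(r -(a + f))
        lm = ring
        lm2 : ∀ f w r -> w == r - f +(f + w - r)
        lm2 = ring
        distrib : ∀ D r f -> D *(r - f) == D * r - D * f
        distrib = ring
        free : ∀ e -> forb k e == ff -> B e ∧ cut S e == ff
        free e p with T∨F(B e ∧ cut S e)
        ... | inr q = q
        ... | inl q with ∧-e {B e} q
        ... | b , c' = void(none(e , ∧-T c'(∧-T b(ap not p))))
        tot≤ : D * + r ≤ D * size(forb k) + wt(u k)(cut S)
        tot≤ = via(meet dem S(\eq -> cl s∈(tr eq t∉))(wid free link))(to(∑≤ Es \e _ -> each e)(tr(∑-+(\e -> D *(χ(forb k e) * 1#))(\e -> χ(cut S e) * u k e) Es)(ap(_+ wt(u k)(cut S))(∑-* D(\e -> χ(forb k e) * 1#) Es)))) where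
         each : ∀ e -> χ(cut S e) * cap B x D e ≤ D *(χ(forb k e) * 1#) + χ(cut S e) * u k e
         each e with T∨F(cut S e)
         ... | inr q rewrite q = +≥0 {D *(χ(forb k e) * 1#)}(*≥0 {D} {χ(forb k e) * 1#} D≥0(*≥0 {χ(forb k e)} {1#}(χ≥0(forb k e))(+≤+ z≤n)))(rfl {0#})
         ... | inl q rewrite q with forb k e in eqF
         ... | tt = by(1*(cap B x D e))(to cap≤(lm3 D)) where
          lm3 : ∀ D -> D == D *(1# * 1#) + 1# * 0#
          lm3 = ring
          cap≤ : cap B x D e ≤ D
          cap≤ with B e
          ... | tt = rfl
          ... | ff = x≤D e
         ... | ff with B e in eqB
         ... | tt = cl(∧-T eqB q)(free e eqF)
         ... | ff = eq≤(lm3 D(x e)) where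
          lm3 : ∀ D x -> 1# * x == D *(0# * 1#) + 1# * x
          lm3 = ring

     suppd : C -> Fin n -> Z
     suppd k v = D * + need k * χ(does(s k Fin.≟ v))

     sup1 : ∀ k -> Gale.Supply(u k)(u≥0 k)(t k) Es(suppd k)
     sup1 k S t∉ = by(Gale.tot-point(u k)(u≥0 k)(t k)(D * + need k)(s k) S)(side(∋∨∌ S(s k))) where
      side : S ∋ s k ⊎ S ∌ s k -> D * + need k * χ(at S(s k)) ≤ wt(u k)(cut S)
      side(inl p) = by(tr(ap(\b -> D * + need k * χ b) p)(*1(D * + need k)))(cut-sup k S p t∉)
      side(inr p) = by(tr(ap(\b -> D * + need k * χ b) p)(*0(D * + need k)))(∑≥0 {f = \f -> χ(cut S f) * u k f} Es \f _ -> term≥0(u k)(u≥0 k)(cut S) f)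

     the-flow : ∀ k -> Gale.Flow(u k)(u≥0 k)(t k) Es(suppd k)
     the-flow k = Gale.flow(u k)(u≥0 k)(t k) Es(Uniqueₚ.allFin⁺ m)(suppd k)(sup1 k)

     module F k = Gale.Flow (the-flow k)

     z* : Var C m -> Z
     z*(inl e) = + N * x e
     z*(inr(k , e , d)) = + N * part d(F.y k e)

     N≥0 : 0# ≤ + N
     N≥0 = +≤+ z≤n

     y≤u : ∀ k e d -> part d(F.y k e) ≤ u k e
     y≤u k e d = part≤ d(u≥0 k e)(F.upper k e(∈-fins e))(F.lower k e(∈-fins e))

     z*≥0 : ∀ j -> 0# ≤ z* j
     z*≥0(inl e) = *≥0 {+ N} {x e} N≥0(x≥0 e)
     z*≥0(inr(k , e , d)) = *≥0 {+ N} {part d(F.y k e)} N≥0(part≥0 d(F.y k e))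

     z*≤ : ∀ j -> z* j ≤ D * +(3 N.* N)
     z*≤ j = to(bd1 j)(tr(lm(+ N) D)(ap(_*_ D)(sym(pos-* 3 N)))) where
      lm : ∀ N D -> N *(+ 3 * D) == D *(+ 3 * N)
      lm = ring
      lm2 : ∀ D x -> + 3 * D == x +(D - x + + 2 * D)
      lm2 = ring
      bd1 : ∀ j -> z* j ≤ + N *(+ 3 * D)
      bd1(inl e) = *≤ˡ(+ N)(bd(lm2 D(x e))(+≥0(d≥0(x≤D e))(*≥0 {+ 2} {D}(+≤+ z≤n) D≥0)))
      bd1(inr(k , e , d)) = *≤ˡ(+ N)(via(y≤u k e d)(u≤3D k e))

     open Values point z* hiding (x; y)

     holds : ∀ r -> M r + D * + lo r ≤ P r + D * + hi r
     holds(inl(inl unit)) = by(tr(ap2 _+_(tr M-cost(tr(∑≡ Es \e _ -> lm(+ c e)(+ N)(x e))(∑-*(+ N)(\e -> + c e * x e) Es)))(*0 D))(+0 _))(to budget(sym(tr(ap(_+ D * + ℓ) P-cost)(0+ _)))) where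
      lm : ∀ c N x -> c *(N * x) == N *(c * x)
      lm = ring
     holds(inl(inr(inl e))) = by(tr(ap2 _+_(M-box e)(*0 D))(+0 _))(to(*≤ˡ(+ N)(x≤D e))(sym(tr(ap(_+ D * + N)(P-box e))(tr(0+ _)(*-comm D(+ N))))))
     holds(inl(inr(inr(k , e , d)))) = subst2 _≤_(sym(tr(ap2 _+_(M-cap k e d(cs-all k))(*0 D))(+0 _)))(sym(tr(ap2 _+_(P-cap k e d)(*0 D))(+0 _)))(cap1(forb k e)(B e)(y≤u k e d)) where
      cap1 : ∀ f b -> part d(F.y k e) ≤(if f then 0# else(if b then + 3 * D else x e)) -> χ(not(not f ∧ b)) *(+ N * part d(F.y k e)) ≤ χ(not f ∧ not b) *(+ N * x e)
      cap1 tt b h = by(1*(+ N * part d(F.y k e)))(to(*≤ˡ(+ N) h)(*0(+ N)))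
      cap1 ff tt h = rfl {0#}
      cap1 ff ff h = *≤ˡ 1#(*≤ˡ(+ N) h)
     holds(inr(k , v)) = subst2 _≤_(sym(ap(_+ D * + lo(inr(k , v)))(M-bal k v(cs-all k))))(sym(tr(ap2 _+_(P-bal k v(cs-all k))(*0 D))(+0 _)))(vx(T∨F(eqV v(t k)))) where
      vx : eqV v(t k) == tt ⊎ eqV v(t k) == ff -> at-vx k v headOf + D * + lo(inr(k , v)) ≤ at-vx k v tailOf
      vx(inl p) = eq≤(tr(ap2 _+_(blank headOf)(tr(ap(\l -> D * + l) lo≡0)(*0 D)))(tr(+0 0#)(sym(blank tailOf)))) where
       blank : ∀ f -> at-vx k v f == 0#
       blank f = ∑-0 Es(\e _ -> ∑-0 dirs \d _ -> ap(\b -> χ(not b ∧ eqV(f e d) v) * z*(inr(k , e , d))) p)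
       lo≡0 : lo(inr(k , v)) == 0
       lo≡0 = ap(\b -> if b then N N.* need k else 0)(tr(ap(\b -> eqV v(s k) ∧ not b) p)(Bool.∧-zeroʳ(eqV v(s k))))
      vx(inr p) = bd(lm(at-vx k v tailOf)(at-vx k v headOf)(D * + lo(inr(k , v))))(via(d≥0(via lo≤(to(*≤ˡ(+ N)(F.meet k v \eq -> cl(dec-tt(v Fin.≟ t k) eq) p))(tr(sym net≡)(sym(bal k v p)))))) rfl) where
       lm : ∀ a h l -> a == h + l +(a - h - l)
       lm = ring
       net≡ : out-flow k v == + N * Gale.net(u k)(u≥0 k)(t k) Es(F.y k) v
       net≡ = tr(∑≡ Es \e _ -> tr(lm2(χ(eqV(src e) v) - χ(eqV(tgt e) v))(+ N)(part tt(F.y k e))(part ff(F.y k e)))(ap(\y -> + N *((χ(eqV(src e) v) - χ(eqV(tgt e) v)) * y))(part-diff(F.y k e))))(∑-*(+ N)(\e -> (χ(eqV(src e) v) - χ(eqV(tgt e) v)) * F.y k e) Es) where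
        lm2 : ∀ i N p q -> i *(N * p - N * q) == N *(i *(p - q))
        lm2 = ring
       lo≤ : D * + lo(inr(k , v)) ≤ + N * suppd k v
       lo≤ = at-source(v Fin.≟ s k)(s k Fin.≟ v) where
        at-source : (d : Dec(v == s k))(d' : Dec(s k == v)) -> D * +(if does d ∧ not(eqV v(t k)) then N N.* need k else 0) ≤ + N *(D * + need k * χ(does d'))
        at-source(yes eq)(no ¬eq) = void(¬eq(sym eq))
        at-source(no ¬eq) d' = by(*0 D)(*≥0 {+ N} {D * + need k * χ(does d')} N≥0(*≥0 {D * + need k} {χ(does d')}(*≥0 {D} {+ need k} D≥0(+≤+ z≤n))(χ≥0(does d'))))
        at-source(yes eq)(yes _) = eq≤(tr(ap(\b -> D * +(if not b then N N.* need k else 0)) p)(tr(ap(_*_ D)(pos-* N(need k)))(lm3 D(+ N)(+ need k)))) where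
         lm3 : ∀ D N r -> D *(N * r) == N *(D * r * 1#)
         lm3 = ring

     norm : ∀ r -> ∑ vars(\j -> (+ pos r j - + neg r j) *(+ pos r j - + neg r j)) ≤ + ε
     norm r = via(∑≤ vars \j _ -> square(pos≤ r j)(neg≤ r j))(by(tr(∑-const(+(BIG N.* BIG)) vars)(sym(pos-*(len vars)(BIG N.* BIG))))(+≤+ ε≥)) where
      bit≤ : ∀ b -> b2n b N.≤ BIG
      bit≤ tt = 1≤BIG
      bit≤ ff = z≤n
      pos≤ : ∀ r j -> pos r j N.≤ BIG
      pos≤(inl(inl _)) _ = z≤n
      pos≤(inl(inr(inl e))) _ = z≤n
      pos≤(inl(inr(inr _)))(inl _) = bit≤ _
      pos≤(inl(inr(inr _)))(inr _) = z≤n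
      pos≤(inr _)(inl _) = z≤n
      pos≤(inr _)(inr _) = bit≤ _
      neg≤ : ∀ r j -> neg r j N.≤ BIG
      neg≤(inl(inl _))(inl e) = c≤ e
      neg≤(inl(inl _))(inr _) = z≤n
      neg≤(inl(inr(inl e)))(inl _) = bit≤ _
      neg≤(inl(inr(inl e)))(inr _) = z≤n
      neg≤(inl(inr(inr _)))(inl _) = z≤n
      neg≤(inl(inr(inr _)))(inr _) = bit≤ _
      neg≤(inr _)(inl _) = z≤n
      neg≤(inr _)(inr _) = bit≤ _
      square : ∀ {p q} -> p N.≤ BIG -> q N.≤ BIG -> (+ p - + q) *(+ p - + q) ≤ +(BIG N.* BIG)
      square {p} {q} hp hq = bd {e = (+ BIG - + p + + q) *(+ BIG + + p - + q)}(tr(pos-* BIG BIG)(lm(+ BIG)(+ p)(+ q)))(*≥0 {+ BIG - + p + + q} {+ BIG + + p - + q}(+≥0(d≥0(+≤+ hp))(+≤+ z≤n))(to(+≥0(d≥0(+≤+ hq))(+≤+(z≤n {p})))(lm2(+ BIG)(+ q)(+ p)))) where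
       lm : ∀ b p q -> b * b ==(p - q) *(p - q) +(b - p + q) *(b + p - q)
       lm = ring
       lm2 : ∀ b q p -> b - q + p == b + p - q
       lm2 = ring

     acc'd : acc1 == tt
     acc'd = R.Complete.cpl D D>0 z* z*≥0 z*≤(\r _ -> holds r)(\r _ -> norm r)(rows-all(inl(inl unit)))

    module Solution (cover : ∀ {a b r} -> Dem a b r -> ∀ F -> Lnk F a b -> size F < + r ->
      ∃[ k ] s k == a × t k == b ×(∀ e -> forb k e == F e) × + r ≤ + need k + size F)
     (c≤ : ∀ e -> c e N.≤ BIG)(κ : ℕ)(κ≥ : (n N.+ m N.+ m) N.* ε N.≤ κ)(κ<N : κ N.< N)
     (z : Var C m -> Z)(z≥0 : ∀ j -> 0# ≤ z j) where

     open Values point z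

     module _ (ok-row : ∀ r -> M r + + lo r ≤ P r + + hi r + + ε) where

      in-box : ∀ e -> x e ≤ + N + + ε
      in-box e = by(sym(tr(+0 _)(M-box e)))(to(ok-row(inl(inr(inl e))))(ap(_+ + ε)(tr(ap(_+ + N)(P-box e))(0+(+ N)))))

      rnd : Fin m -> Z
      rnd e = if B e then 0# else + N ⊓(x e + + κ)

      module _ (S : VS n) (k : C) (s∈ : S ∋ s k) (t∉ : S ∌ t k) (forb≡ : ∀ e -> forb k e == B e ∧ cut S e) where

       ocut : ES
       ocut e = cut S e ∧ not(B e)

       along : ∀ e d -> cut S e == tt -> y k e d ≤ χ(ocut e) * x e + + ε
       along e d e-cut = subst2 _≤_(tr(+0 _)(tr(M-cap k e d(cs-all k))(tr(ap(\f -> χ(not(not f ∧ B e)) * y k e d) f≡)(left(B e)(y k e d)))))(tr(ap(_+ + ε)(tr(+0 _)(tr(P-cap k e d)(ap2(\f g -> χ(not f ∧ not(B e)) * g) f≡ refl))))(ap(\a -> χ a * x e + + ε)(tr(right(B e))(ap(_∧ not(B e))(sym e-cut)))))(ok-row(inl(inr(inr(k , e , d))))) where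
        f≡ : forb k e == B e
        f≡ = tr(forb≡ e)(tr(ap(B e ∧_) e-cut)(Bool.∧-identityʳ(B e)))
        left : ∀ b y -> χ(not(not b ∧ b)) * y == y
        left tt y = 1* y
        left ff y = 1* y
        right : ∀ b -> not b ∧ not b == tt ∧ not b
        right tt = refl
        right ff = refl

       leav : Fin m -> Z
       leav e = (χ(at S(src e)) - χ(at S(tgt e))) *(y k e tt - y k e ff)

       leav≤ : ∀ e -> leav e ≤ χ(ocut e) * x e + + ε
       leav≤ e = by-side(∋∨∌ S(src e))(∋∨∌ S(tgt e)) where
        uncut≤ : ∀ b -> (χ b - χ b) *(y k e tt - y k e ff) ≤ χ(ocut e) * x e + + ε
        uncut≤ b = by(lm(χ b)(y k e tt - y k e ff))(+≥0 {χ(ocut e) * x e}(*≥0 {χ(ocut e)} {x e}(χ≥0(ocut e))(z≥0(inl e)))(+≤+ z≤n)) where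
         lm : ∀ b y -> (b - b) * y == 0#
         lm = ring
        by-side : S ∋ src e ⊎ S ∌ src e -> S ∋ tgt e ⊎ S ∌ tgt e -> leav e ≤ χ(ocut e) * x e + + ε
        by-side(inl p)(inl q) = by(ap2(\a b -> (χ a - χ b) *(y k e tt - y k e ff)) p q)(uncut≤ tt)
        by-side(inr p)(inr q) = by(ap2(\a b -> (χ a - χ b) *(y k e tt - y k e ff)) p q)(uncut≤ ff)
        by-side(inl p)(inr q) = by(ap2(\a b -> (χ a - χ b) *(y k e tt - y k e ff)) p q)(via(bd(lm(y k e tt)(y k e ff))(z≥0(inr(k , e , ff))))(along e tt(ap2 _xor_ p q))) where
         lm : ∀ a b -> a ==(1# - 0#) *(a - b) + b
         lm = ring
        by-side(inr p)(inl q) = by(ap2(\a b -> (χ a - χ b) *(y k e tt - y k e ff)) p q)(via(bd(lm(y k e tt)(y k e ff))(z≥0(inr(k , e , tt))))(along e ff(ap2 _xor_ p q))) where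
         lm : ∀ a b -> b ==(0# - 1#) *(a - b) + a
         lm = ring

       tot-leav : ∑(fins n)(\v -> χ(at S v) * out-flow k v) == ∑ Es leav
       tot-leav = tr(∑≡(fins n) \v _ -> sym(∑-*(χ(at S v))(\e -> (χ(eqV(src e) v) - χ(eqV(tgt e) v)) *(y k e tt - y k e ff)) Es))(tr(∑-swap(\v e -> χ(at S v) *((χ(eqV(src e) v) - χ(eqV(tgt e) v)) *(y k e tt - y k e ff)))(fins n) Es)(∑≡ Es \e _ -> each e)) where
        g : Fin m -> Fin n -> Z
        g e v = χ(at S v) *(y k e tt - y k e ff)
        lm : ∀ s a b y -> s *((a - b) * y) == a *(s * y) + b *((- 1#) *(s * y))
        lm = ring
        lm2 : ∀ a b y -> a * y +(- 1#) *(b * y) ==(a - b) * y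
        lm2 = ring
        each : ∀ e -> ∑(fins n)(\v -> χ(at S v) *((χ(eqV(src e) v) - χ(eqV(tgt e) v)) *(y k e tt - y k e ff))) == leav e
        each e = tr(∑≡(fins n) \v _ -> lm(χ(at S v))(χ(eqV(src e) v))(χ(eqV(tgt e) v))(y k e tt - y k e ff))(tr(∑-+(\v -> χ(eqV(src e) v) * g e v)(\v -> χ(eqV(tgt e) v) *((- 1#) * g e v))(fins n))(tr(ap2 _+_(∑pt(g e)(src e))(∑pt(\v -> (- 1#) * g e v)(tgt e)))(lm2(χ(at S(src e)))(χ(at S(tgt e)))(y k e tt - y k e ff))))

       at-least : ∀ v -> S ∋ v -> + lo(inr(k , v)) ≤ out-flow k v + + ε
       at-least v v∈ = bd(tr(ap(_+ + ε)(sym(bal k v v≢t)))(lm(at-vx k v tailOf)(at-vx k v headOf)(+ lo(inr(k , v)))(+ ε)))(d≥0(subst2 _≤_(ap(_+ + lo(inr(k , v)))(M-bal k v(cs-all k)))(ap(_+ + ε)(tr(+0 _)(P-bal k v(cs-all k))))(ok-row(inr(k , v))))) where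
        v≢t : eqV v(t k) == ff
        v≢t = dec-ff(v Fin.≟ t k) \ { refl -> cl v∈ t∉ }
        lm : ∀ a h l e -> a - h + e == l +(a + e -(h + l))
        lm = ring

       open-wgt : (Fin m -> Z) -> Z
       open-wgt f = ∑ Es (\ e -> χ (ocut e) * f e)

       ∑ε : ∀ j -> ∑(fins j)(\_ -> + ε) == + j * + ε
       ∑ε = ∑-all(+ ε)

       carried : + N * + need k ≤ open-wgt x +(+ n + + m) * + ε
       carried = via source(via(∑≤(fins n) \v _ -> each v(∋∨∌ S v))(by(tr(∑-+(\v -> χ(at S v) * out-flow k v)(\_ -> + ε)(fins n))(ap2 _+_ tot-leav(∑ε n)))(to(+≤ˡ(+ n * + ε)(to(∑≤ Es \e _ -> leav≤ e)(tr(∑-+(\e -> χ(ocut e) * x e)(\_ -> + ε) Es)(ap(_+_(open-wgt x))(∑ε m)))))(lm(open-wgt x)(+ n)(+ m)(+ ε))))) where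
        lm : ∀ w n m e -> w + m * e + n * e == w +(n + m) * e
        lm = ring
        lo-s : lo(inr(k , s k)) == N N.* need k
        lo-s = ap2(\a b -> if a ∧ not b then N N.* need k else 0)(dec-tt(s k Fin.≟ s k) refl)(dec-ff(s k Fin.≟ t k) \eq -> cl s∈(tr(ap(at S) eq) t∉))
        source : + N * + need k ≤ ∑(fins n)(\v -> χ(at S v) * + lo(inr(k , v)))
        source = by(tr(sym(pos-* N(need k)))(tr(ap +_(sym lo-s))(sym(tr(ap(\b -> χ b * + lo(inr(k , s k))) s∈)(1*(+ lo(inr(k , s k))))))))(term≤∑ {f = \v -> χ(at S v) * + lo(inr(k , v))}(fins n)(\v _ -> *≥0 {χ(at S v)} {+ lo(inr(k , v))}(χ≥0(at S v))(+≤+ z≤n))(∈-fins(s k)))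
        each : ∀ v -> S ∋ v ⊎ S ∌ v -> χ(at S v) * + lo(inr(k , v)) ≤ χ(at S v) * out-flow k v + + ε
        each v(inl p) = subst2 _≤_(sym(tr(ap(\b -> χ b * + lo(inr(k , v))) p)(1* _)))(ap(_+ + ε)(sym(tr(ap(\b -> χ b * out-flow k v) p)(1* _))))(at-least v p)
        each v(inr p) = subst2 _≤_(sym(ap(\b -> χ b * + lo(inr(k , v))) p))(ap(\b -> χ b * out-flow k v + + ε)(sym p))(+≤+ z≤n)

       -- Adding κ to one edge pays for all errors, unless every edge of the cut is full.
       enough : + N * + need k ≤ open-wgt rnd
       enough = by-room(Fin.any? \e -> (ocut e ∧ does((x e + + κ) ≤? + N)) Bool.≟ tt) where
        κ≥ℤ : (+ n + + m + + m) * + ε ≤ + κ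
        κ≥ℤ = by(sym(pos-*(n N.+ m N.+ m) ε))(+≤+ κ≥)
        off-rnd : ∀ e -> ocut e == tt -> rnd e == + N ⊓(x e + + κ)
        off-rnd e p = ap(\b -> if b then 0# else + N ⊓(x e + + κ))(not-true(snd(∧-e {cut S e} p)))
        by-room : Dec(∃[ e ](ocut e ∧ does((x e + + κ) ≤? + N)) == tt) -> + N * + need k ≤ open-wgt rnd
        by-room(yes(e0 , p)) with ∧-e {ocut e0} p
        ... | open0 , room = via carried(via(bd(lm(open-wgt x)(+ n)(+ m)(+ ε)(+ κ))(d≥0 κ≥ℤ))(by(sym(tr(∑-+(\e -> χ(ocut e) * x e + χ(is e0 e) * + κ)(\_ -> (- 1#) * + ε) Es)(ap2 _+_(tr(∑-+(\e -> χ(ocut e) * x e)(\e -> χ(is e0 e) * + κ) Es)(ap(_+_(open-wgt x))(∑pt(\_ -> + κ) e0)))(tr(∑-*(- 1#)(\_ -> + ε) Es)(ap(_*_(- 1#))(∑ε m))))))(∑≤ Es \e _ -> each e(T∨F(ocut e))))) where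
         lm : ∀ w n m e κ -> w + κ +(- 1#) *(m * e) == w +(n + m) * e +(κ -(n + m + m) * e)
         lm = ring
         from-does : ∀ {P : Set}(d : Dec P) -> does d == tt -> P
         from-does(yes p) _ = p
         fits : x e0 + + κ ≤ + N
         fits = from-does((x e0 + + κ) ≤? + N) room
         each : ∀ e -> ocut e == tt ⊎ ocut e == ff -> χ(ocut e) * x e + χ(is e0 e) * + κ +(- 1#) * + ε ≤ χ(ocut e) * rnd e
         each e(inr q) = by(ap2(\a b -> χ a * x e + χ b * + κ +(- 1#) * + ε) q(≢-true \i -> cl open0(tr(ap ocut(isT {e0} {e} i)) q)))(to(bd(lm2(x e)(+ κ)(+ ε))(+≤+ z≤n))(sym(ap(\b -> χ b * rnd e) q))) where
          lm2 : ∀ x κ ε -> 0# == 0# * x + 0# * κ +(- 1#) * ε + ε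
          lm2 = ring
         each e(inl q) with T∨F(is e0 e)
         ... | inr i = subst2 _≤_(sym(ap2(\a b -> χ a * x e + χ b * + κ +(- 1#) * + ε) q i))(sym(tr(ap(\b -> χ b * rnd e) q)(tr(1* _)(off-rnd e q))))(⊓-glb(bd(lm2(x e)(+ κ)(+ ε)(+ N))(d≥0(in-box e)))(bd(lm3(x e)(+ κ)(+ ε))(+≥0 {+ ε} {+ κ}(+≤+ z≤n)(+≤+ z≤n)))) where
          lm2 : ∀ x κ ε N -> N == 1# * x + 0# * κ +(- 1#) * ε +(N + ε - x)
          lm2 = ring
          lm3 : ∀ x κ ε -> x + κ == 1# * x + 0# * κ +(- 1#) * ε +(ε + κ)
          lm3 = ring
         ... | inl i with isT {e0} {e} i
         ... | refl = subst2 _≤_(sym(ap2(\a b -> χ a * x e + χ b * + κ +(- 1#) * + ε) q i))(sym(tr(ap(\b -> χ b * rnd e) q)(tr(1* _)(off-rnd e q))))(⊓-glb(via below fits) below) where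
          lm3 : ∀ x κ ε -> x + κ == 1# * x + 1# * κ +(- 1#) * ε + ε
          lm3 = ring
          below : 1# * x e + 1# * + κ +(- 1#) * + ε ≤ x e + + κ
          below = bd(lm3(x e)(+ κ)(+ ε))(+≤+ z≤n)
        by-room(no none) = via(*≤ˡ(+ N) need≤)(by(sym(∑-*(+ N)(\e -> χ(ocut e)) Es))(∑≤ Es \e _ -> filled e(T∨F(ocut e)))) where
         r' : Z
         r' = ∑ Es(\e -> χ(ocut e))
         filled : ∀ e -> ocut e == tt ⊎ ocut e == ff -> + N * χ(ocut e) ≤ χ(ocut e) * rnd e
         filled e(inr q) = eq≤(tr(ap(\b -> + N * χ b) q)(tr(*0(+ N))(sym(ap(\b -> χ b * rnd e) q))))
         filled e(inl q) = eq≤(tr(ap(\b -> + N * χ b) q)(tr(*1(+ N))(sym(tr(ap(\b -> χ b * rnd e) q)(tr(1* _)(tr(off-rnd e q)(i≤j⇒i⊓j≡i(lt(≰⇒> \fits -> none(e , ∧-T q(dec-tt((x e + + κ) ≤? + N) fits)))))))))))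
         sum≤ : open-wgt x ≤ + N * r' + + m * + ε
         sum≤ = to(∑≤ Es \e _ -> each e(T∨F(ocut e)))(tr(∑-+(\e -> + N * χ(ocut e))(\_ -> + ε) Es)(ap2 _+_(∑-*(+ N)(\e -> χ(ocut e)) Es)(∑ε m))) where
          each : ∀ e -> ocut e == tt ⊎ ocut e == ff -> χ(ocut e) * x e ≤ + N * χ(ocut e) + + ε
          each e(inl q) = subst2 _≤_(sym(tr(ap(\b -> χ b * x e) q)(1* _)))(sym(ap(_+ + ε)(tr(ap(\b -> + N * χ b) q)(*1(+ N)))))(in-box e)
          each e(inr q) = subst2 _≤_(sym(ap(\b -> χ b * x e) q))(sym(ap(_+ + ε)(tr(ap(\b -> + N * χ b) q)(*0(+ N)))))(+≤+ z≤n)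
         need< : + need k < 1# + r'
         need< = *-cancelˡ-<-nonNeg(+ N)(≤< carried(≤<(+≤ˡ((+ n + + m) * + ε) sum≤)(≤<(bd(lm(+ N * r')(+ n)(+ m)(+ ε)(+ κ))(d≥0 κ≥ℤ))(<≤(+-monoʳ-<(+ N * r')(+<+ κ<N))(eq≤(lm2(+ N) r')))))) where
          lm : ∀ w n m e κ -> w + κ == w + m * e +(n + m) * e +(κ -(n + m + m) * e)
          lm = ring
          lm2 : ∀ N r -> N * r + N == N *(1# + r)
          lm2 = ring
         need≤ : + need k ≤ r'
         need≤ = to(i<j⇒i≤pred[j] need<)(pred-suc r')

      N≥0 : 0# ≤ + N
      N≥0 = +≤+ z≤n

      rnd≥0 : ∀ e -> 0# ≤ rnd e
      rnd≥0 e with B e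
      ... | tt = rfl
      ... | ff = ⊓-glb N≥0(+≥0(z≥0(inl e))(+≤+ z≤n))

      rnd≤ : ∀ e -> rnd e ≤ + N
      rnd≤ e with B e
      ... | tt = N≥0
      ... | ff = i⊓j≤i(+ N)(x e + + κ)

      rnd-off : ∀ e -> B e == tt -> rnd e == 0#
      rnd-off e p = ap(\b -> if b then 0# else + N ⊓(x e + + κ)) p

      wt-rnd : ∀ S -> wt(cap B rnd(+ N))(cut S) == + N * size(\e -> B e ∧ cut S e) + ∑ Es(\e -> χ(cut S e ∧ not(B e)) * rnd e)
      wt-rnd S = tr(∑≡ Es \e _ -> each e(cut S e))(tr(∑-+(\e -> + N *(χ(B e ∧ cut S e) * 1#))(\e -> χ(cut S e ∧ not(B e)) * rnd e) Es)(ap(_+ ∑ Es \e -> χ(cut S e ∧ not(B e)) * rnd e)(∑-*(+ N)(\e -> χ(B e ∧ cut S e) * 1#) Es))) where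
       lm : ∀ N x -> 1# * N == N *(1# * 1#) + 0# * x
       lm = ring
       lm1 : ∀ N x -> 0# * N == N *(0# * 1#) + 0# * x
       lm1 = ring
       lm2 : ∀ N x -> x == N *(0# * 1#) + x
       lm2 = ring
       each : ∀ e b -> χ b * cap B rnd(+ N) e == + N *(χ(B e ∧ b) * 1#) + χ(b ∧ not(B e)) * rnd e
       each e b with B e
       each e tt | tt = lm(+ N) 0#
       each e ff | tt = lm1(+ N) 0#
       each e tt | ff = lm2(+ N)(1# *(+ N ⊓(x e + + κ)))
       each e ff | ff = lm2(+ N)(0# *(+ N ⊓(x e + + κ)))

      sol1 : LP B rnd(+ N)
      sol1 = record { D>0 = +<+(N.≤< z≤n κ<N) ;x≥0 = rnd≥0 ;x≤D = rnd≤ ;off = rnd-off ;meet = meet }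
       where
       sided : ∀ {a b r} -> Dem a b r -> ∀ S -> S ∋ a -> S ∌ b -> Lnk(\e -> B e ∧ cut S e) a b -> + N * + r ≤ wt(cap B rnd(+ N))(cut S)
       sided {r = r} dem S a∈ b∉ link = to(by-size(size F <? + r))(sym(wt-rnd S)) where
        F : ES
        F e = B e ∧ cut S e
        rest : Z
        rest = ∑ Es(\e -> χ(cut S e ∧ not(B e)) * rnd e)
        by-size : Dec(size F < + r) -> + N * + r ≤ + N * size F + rest
        by-size(no ¬l) = via(*≤ˡ(+ N)(≮⇒≥ ¬l))(bd refl(∑≥0 {f = \e -> χ(cut S e ∧ not(B e)) * rnd e} Es \e _ -> *≥0 {χ(cut S e ∧ not(B e))} {rnd e}(χ≥0(cut S e ∧ not(B e)))(rnd≥0 e)))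
        by-size(yes l) with cover dem F link l
        ... | k , refl , refl , forb≡ , r≤1 = via(*≤ˡ(+ N) r≤1)(by(lm(+ N)(+ need k)(size F))(+≤ʳ(+ N * size F)(enough S k a∈ b∉ forb≡))) where
         lm : ∀ N d f -> N *(d + f) == N * f + N * d
         lm = ring
       meet : ∀ {a b r} -> Dem a b r -> ∀ S -> Sep S a b -> Lnk(\e -> B e ∧ cut S e) a b -> + N * + r ≤ wt(cap B rnd(+ N))(cut S)
       meet {a} {b} dem S sep link with ∋∨∌ S a | ∋∨∌ S b
       ... | inl p | inl q = void(sep(tr p(sym q)))
       ... | inr p | inr q = void(sep(tr p(sym q)))
       ... | inl p | inr q = sided dem S p q link
       ... | inr p | inl q = to(sided dem(co S)(co-∋ S p)(co-∌ S q)(wid(\e h -> tr(ap(B e ∧_)(cut-co S e)) h) link))(∑≡ Es \e _ -> ap(\b -> χ b * cap B rnd(+ N) e)(cut-co S e))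

      sol-cost : cost rnd ≤ + ℓ + + ε + + m *(+ BIG * + κ)
      sol-cost = via(∑≤ Es \e _ -> each e)(by(∑-+(\e -> + c e * x e)(\_ -> + BIG * + κ) Es)(+≤ spent(eq≤(∑-all(+ BIG * + κ) m)))) where
       spent : ∑ Es(\e -> + c e * x e) ≤ + ℓ + + ε
       spent = subst2 _≤_(tr(+0 _) M-cost)(ap(_+ + ε)(tr(ap(_+ + ℓ) P-cost)(0+(+ ℓ))))(ok-row(inl(inl unit)))
       rnd≤x : ∀ e -> rnd e ≤ x e + + κ
       rnd≤x e with B e
       ... | tt = +≥0(z≥0(inl e))(+≤+ z≤n)
       ... | ff = i⊓j≤j(+ N)(x e + + κ)
       each : ∀ e -> + c e * rnd e ≤ + c e * x e + + BIG * + κ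
       each e = via(*≤ˡ(+ c e)(rnd≤x e))(by(*-distribˡ-+(+ c e)(x e)(+ κ))(+≤ʳ(+ c e * x e)(*≤ʳ(+ κ)(+≤+(c≤ e)))))

    -- The point found by an accepting run.
    module _ (acc'd : acc1 == tt) where

     rchd : Var C m -> Z
     rchd j = + toℕ(R.final steps j)

     open Values point rchd using (P; M)

     rchd-ok : ∀ r -> M r + + lo r ≤ P r + + hi r + + ε
     rchd-ok r = subst2 _≤_(ap(_+ + lo r)(nat-sum(neg r)))(ap(\p -> p + + hi r + + ε)(nat-sum(pos r)))(+≤+(true-≤ᵇ(all⁻(R.ok(R.final steps)) rows acc'd r(rows-all r)))) where
      nat-sum : ∀(f : Var C m -> ℕ) -> + Data.Nat.ListAction.sum(Data.List.map(\j -> f j N.* toℕ(R.final steps j)) vars) == ∑ vars(\j -> + f j * rchd j)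
      nat-sum f = tr(sum-∑(\j -> f j N.* toℕ(R.final steps j)) vars)(∑≡ vars \j _ -> pos-*(f j)(toℕ(R.final steps j)))

     solved : (∀ {a b r} -> Dem a b r -> ∀ F -> Lnk F a b -> size F < + r -> ∃[ k ] s k == a × t k == b ×(∀ e -> forb k e == F e) × + r ≤ + need k + size F) -> (∀ e -> c e N.≤ BIG) -> ∀ κ -> (n N.+ m N.+ m) N.* ε N.≤ κ -> κ N.< N -> ∃[ x ] LP B x(+ N) × cost x ≤ + ℓ + +(ε N.+ m N.*(BIG N.* κ))
     solved cover c≤ κ κ≥ κ<N = S.rnd rchd-ok , S.sol1 rchd-ok , to(S.sol-cost rchd-ok)(+-error ℓ ε m BIG κ)
      where module S = Solution cover c≤ κ κ≥ κ<N rchd(\_ -> +≤+ z≤n)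

 module Feasy {L : ℕ} (ds dt : Fin L -> Fin n) (dk : Fin L -> ℕ) (dk≤3 : ∀ d -> dk d N.≤ 3)
  (leq : ℕ -> ℕ -> Fin m -> Fin m -> Bool) where
  open Rows
  open Perc
  open Typed using (does-≡)
  open Tables using (gath; pairs; either; ∈-pairs; ∈-either)
  open Feasible

  open Algorithm src tgt ds dt dk leq public

  Dem : Fin n -> Fin n -> ℕ -> Set
  Dem a b r = ∃[ d ] ds d == a × dt d == b × dk d == r

  dem≤3 : ∀ {a b r} -> Dem a b r -> r N.≤ 3
  dem≤3(d , _ , _ , refl) = dk≤3 d

  sels-slts : Sels _≟ˢ_ slts
  sels-slts h(inl unit) = tr(∑-either(\z -> χ(does(inl unit ≟ˢ z)) * h z)(unit ∷ []) Es)(tr(ap2 _+_(tr(+0(1# * h(inl unit)))(1*(h(inl unit))))(∑-0 Es \e _ -> 0*(h(inr e))))(+0 _))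
  sels-slts h(inr e) = tr(∑-either(\z -> χ(does(inr e ≟ˢ z)) * h z)(unit ∷ []) Es)(tr(ap2 _+_(tr(+0(0# * h(inl unit)))(0*(h(inl unit))))(tr(∑≡ Es \f _ -> ap(\b -> χ b * h(inr f))(does-≡(inr e ≟ˢ inr f)(e Fin.≟ f)(\ { refl -> refl }) \ { refl -> refl }))(∑pt(\f -> h(inr f)) e)))(0+ _))

  sels-comms : Sels _≟ᶜ_ comms
  sels-comms = sels-pairs Fin._≟_(×.≡-dec _≟ˢ_ _≟ˢ_)(fins L)(pairs slts slts) ∑pt(sels-pairs _≟ˢ_ _≟ˢ_ slts slts sels-slts sels-slts)

  ∈-slts : ∀ a -> a ∈ slts
  ∈-slts = ∈-either {xs = unit ∷ []} {fins m}(\ { unit -> hd refl }) ∈-fins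

  ∈-comms : ∀ k -> k ∈ comms
  ∈-comms(d ,(a , b)) = ∈-pairs(∈-fins d)(∈-pairs(∈-slts a)(∈-slts b))

  open Closure Dem dem≤3

  does-true : ∀ {P : Set}(d : Dec P) -> does d == tt -> P
  does-true(yes p) _ = p

  module _ (F : ES) where

   merge-sound : ∀ l e -> (∀ {u v} -> l u == l v -> Lnk F u v) -> ∀ {u v} -> merge F l e u == merge F l e v -> Lnk F u v
   merge-sound l e h {u} {v} eq with F e in fe
   ... | tt = h eq
   ... | ff with l u Fin.≟ l(src e) | l v Fin.≟ l(src e)
   ... | yes p | yes q = h(tr p(sym q))
   ... | no _ | no _ = h eq
   ... | yes p | no _ = h p ⁀ edge e fe(ends e) ⁀ h eq
   ... | no _ | yes q = h eq ⁀ edge e fe(join-sym(ends e)) ⁀ back(h q)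

   merge-keeps : ∀ l e {u v} -> l u == l v -> merge F l e u == merge F l e v
   merge-keeps l e eq rewrite eq = refl

   labs-sound : ∀ xs l -> (∀ {u v} -> l u == l v -> Lnk F u v) -> ∀ {u v} -> foldl(merge F) l xs u == foldl(merge F) l xs v -> Lnk F u v
   labs-sound [] l h = h
   labs-sound(e ∷ xs) l h = labs-sound xs(merge F l e)(merge-sound l e h)

   labs-keep : ∀ xs l {u v} -> l u == l v -> foldl(merge F) l xs u == foldl(merge F) l xs v
   labs-keep [] l eq = eq
   labs-keep(e ∷ xs) l eq = labs-keep xs(merge F l e)(merge-keeps l e eq)

   merge-join : ∀ l e -> F e == ff -> merge F l e(src e) == merge F l e(tgt e)
   merge-join l e fe rewrite fe | dec-tt(l(src e) Fin.≟ l(src e)) refl with l(tgt e) Fin.≟ l(src e)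
   ... | yes _ = refl
   ... | no _ = refl

   labs-edge : ∀ xs l {e} -> e ∈ xs -> F e == ff -> foldl(merge F) l xs(src e) == foldl(merge F) l xs(tgt e)
   labs-edge(e ∷ xs) l(hd refl) fe = labs-keep xs(merge F l e)(merge-join l e fe)
   labs-edge(e ∷ xs) l(th p) fe = labs-edge xs(merge F l e) p fe

   lnk-labs : ∀ {s t} -> Lnk F s t -> labs F s == labs F t
   lnk-labs stop = refl
   lnk-labs(step e fe(inl(refl , refl)) p) = tr(labs-edge Es _(∈-fins e) fe)(lnk-labs p)
   lnk-labs(step e fe(inr(refl , refl)) p) = tr(sym(labs-edge Es _(∈-fins e) fe))(lnk-labs p)

   lnk? : ∀ s t -> Dec(Lnk F s t)
   lnk? s t = map′(labs-sound Es(\v -> v) \ { refl -> stop }) lnk-labs(labs F s Fin.≟ labs F t)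

   conn-lnk : ∀ {s t} -> conn F s t == tt -> Lnk F s t
   conn-lnk {s} {t} = does-true(lnk? s t)

   lnk-conn : ∀ {s t} -> Lnk F s t -> conn F s t == tt
   lnk-conn {s} {t} = dec-tt(lnk? s t)

  size-cong : ∀ {F G : ES} -> (∀ e -> F e == G e) -> size F == size G
  size-cong h = ∑≡ Es \e _ -> ap(\b -> χ b * 1#)(h e)

  size-hit : ∀ a -> size(hit a) == + used a
  size-hit(inl _) = ∑-0 Es \_ _ -> refl
  size-hit(inr e) = ∑pt(\_ -> 1#) e

  size-forb : ∀ k -> size(forb k) ≤ + fails1 k
  size-forb(d ,(a , b)) = to(∑≤ Es \e _ -> each(hit a e)(hit b e))(tr(∑-+(\e -> χ(hit a e) * 1#)(\e -> χ(hit b e) * 1#) Es)(ap2 _+_(size-hit a)(size-hit b))) where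
   each : ∀ x y -> χ(x ∨ y) * 1# ≤ χ x * 1# + χ y * 1#
   each tt tt = +≤+(s≤s z≤n)
   each tt ff = rfl
   each ff tt = rfl
   each ff ff = rfl

  remove : Fin m -> ES -> ES
  remove e F f = F f ∧ not(is e f)

  size-remove : ∀ F e -> F e == tt -> size F == 1# + size(remove e F)
  size-remove F e p = tr(∑≡ Es \f _ -> each f)(tr(∑-+(\f -> χ(is e f) * 1#)(\f -> χ(remove e F f) * 1#) Es)(ap(_+ size(remove e F))(∑pt(\_ -> 1#) e))) where
   each : ∀ f -> χ(F f) * 1# == χ(is e f) * 1# + χ(remove e F f) * 1#
   each f with T∨F(is e f)
   ... | inr q rewrite q | Bool.∧-identityʳ(F f) = sym(0+(χ(F f) * 1#))
   ... | inl q with isT {e} {f} q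
   ... | refl rewrite q | p = refl

  size-none : ∀ F -> (∀ e -> F e == ff) -> size F == 0#
  size-none F h = ∑-0 Es \e _ -> ap(\b -> χ b * 1#)(h e)

  some? : (F : ES) -> (∃[ e ] F e == tt) ⊎(∀ e -> F e == ff)
  some? F with Fin.any?(\e -> F e Bool.≟ tt)
  ... | yes p = inl p
  ... | no ¬p = inr \e -> ≢-true \q -> ¬p(e , q)

  remove-back : ∀ F e f -> F e == tt -> F f == is e f ∨ remove e F f
  remove-back F e f p with T∨F(is e f)
  ... | inr q rewrite q = sym(Bool.∧-identityʳ(F f))
  ... | inl q with isT {e} {f} q
  ... | refl rewrite q = p

  two-edges : ∀ F -> size F < + 3 -> ∃[ a ] ∃[ b ](∀ e -> hit a e ∨ hit b e == F e) × +(used a N.+ used b) == size F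
  two-edges F sml with some? F
  ... | inr h = inl unit , inl unit ,(\e -> sym(h e)) , sym(size-none F h)
  ... | inl(e , p) with some?(remove e F)
  ... | inr h = inr e , inl unit ,(\f -> tr(ap(is e f ∨_)(sym(h f)))(sym(remove-back F e f p))) , sym(tr(size-remove F e p)(ap(_+_ 1#)(size-none(remove e F) h)))
  ... | inl(e' , p') with some?(remove e'(remove e F))
  ... | inr h = inr e , inr e' ,(\f -> tr(ap(is e f ∨_)(tr(sym(Bool.∨-identityʳ(is e' f)))(tr(ap(is e' f ∨_)(sym(h f)))(sym(remove-back(remove e F) e' f p')))))(sym(remove-back F e f p))) , sym(tr(size-remove F e p)(tr(ap(_+_ 1#)(size-remove(remove e F) e' p'))(ap(\z -> 1# +(1# + z))(size-none(remove e'(remove e F)) h))))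
  ... | inl(e'' , p'') = void(<⇒≱ sml(to(bd {+ 3} refl(∑≥0 {f = \f -> χ(remove e''(remove e'(remove e F)) f) * 1#} Es \f _ -> nn(remove e''(remove e'(remove e F)) f)))(sym(tr(size-remove F e p)(tr(ap(_+_ 1#)(tr(size-remove(remove e F) e' p')(ap(_+_ 1#)(size-remove(remove e'(remove e F)) e'' p''))))(lm(size(remove e''(remove e'(remove e F)))))))))) where
   lm : ∀ z -> 1# +(1# +(1# + z)) == + 3 + z
   lm = ring
   nn : ∀ b -> 0# ≤ χ b * 1#
   nn tt = +≤+ z≤n
   nn ff = +≤+ z≤n

  ≰ᵇ : ∀ {a b} -> a N.≤ b -> (suc a N.≤ᵇ suc b) == tt
  ≰ᵇ l = ≤ᵇ-true(s≤s l)

  cover : ∀ {a b r} -> Dem a b r -> ∀ F -> Lnk F a b -> size F < + r -> ∃[ k ] source k == a × target k == b ×(∀ e -> forb k e == F e) × active k == tt × + r ≤ + need k + size F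
  cover {a} {b} {r}(d , refl , refl , refl) F link sml with two-edges F(<≤ sml(+≤+(dk≤3 d)))
  ... | x , y , same , count = k , refl , refl , same , act , to enough(ap2(\n s -> + n + s)(sym need≡) count) where
   k : Comm
   k = d ,(x , y)
   fails< : fails1 k N.< dk d
   fails< = drop‿+<+(≤<(eq≤ count) sml)
   act : active k == tt
   act = ∧-T(≤ᵇ-true fails<)(lnk-conn(forb k)(wid(\e q -> tr(same e) q) link))
   need≡ : need k == dk d ∸ fails1 k
   need≡ = ap(\b -> if b then dk d ∸ fails1 k else 0) act
   enough : + dk d ≤ +(dk d ∸ fails1 k N.+ fails1 k)
   enough = eq≤(ap +_(sym(N.m∸n+n≡m(N.lt fails<))))

  meant : ∀ k -> need k == 0 ⊎ ∃[ r ] Dem(source k)(target k) r × Lnk(forb k)(source k)(target k) × + need k + size(forb k) ≤ + r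
  meant k@(d , ab) = by-active(active k) refl where
   by-active : ∀ b -> active k == b -> need k == 0 ⊎ ∃[ r ] Dem(source k)(target k) r × Lnk(forb k)(source k)(target k) × + need k + size(forb k) ≤ + r
   by-active ff eq = inl(ap(\b -> if b then dk d ∸ fails1 k else 0) eq)
   by-active tt eq with ∧-e {suc(fails1 k) N.≤ᵇ dk d} eq
   ... | lt1 , link = inr(dk d ,(d , refl , refl , refl) , conn-lnk(forb k) link , to(+≤ʳ(+ need k)(size-forb k))(ap +_(tr(ap(\b -> (if b then dk d ∸ fails1 k else 0) N.+ fails1 k) eq)(N.m∸n+n≡m(N.lt(true-≤ᵇ lt1))))))

  Meets : ES -> Set
  Meets H = ∀ {a b r} -> Dem a b r -> ∀ F -> size F < + r -> Lnk F a b -> Lnk(\e -> not(H e) ∨ F e) a b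

  feas-meet : ∀ {H} -> feas H == tt -> Meets H
  feas-meet {H} ok {a} {b} dem F sml link with cover dem F link sml
  ... | k , refl , refl , same , act , _ = wid(\e q -> tr(ap(not(H e) ∨_)(sym(same e))) q)(conn-lnk(\e -> not(H e) ∨ forb k e)(tp(\x -> not x ∨ conn(\e -> not(H e) ∨ forb k e)(source k)(target k) == tt) act(all⁻(\k -> not(active k) ∨ conn(\e -> not(H e) ∨ forb k e)(source k)(target k)) comms(tr(sym(feas≡ H)) ok) k(∈-comms k))))

  meet-feas : ∀ {H} -> Meets H -> feas H == tt
  meet-feas {H} meet = tr(feas≡ H)(all⁺(\k -> not(active k) ∨ conn(\e -> not(H e) ∨ forb k e)(source k)(target k)) comms \k _ -> each k(active k) refl) where
   each : ∀ k b -> active k == b -> not b ∨ conn(\e -> not(H e) ∨ forb k e)(source k)(target k) == tt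
   each k ff _ = refl
   each k@(d , _) tt eq with ∧-e {suc(fails1 k) N.≤ᵇ dk d} eq
   ... | lt1 , link = lnk-conn(\e -> not(H e) ∨ forb k e)(meet(d , refl , refl , refl)(forb k)(≤<(size-forb k)(+<+(true-≤ᵇ lt1)))(conn-lnk(forb k) link))

  meet-solves : ∀ {H} -> Meets H -> Solves H
  meet-solves {H} meet {s} {t} {k} dem S sep link = by(1*(+ k))(to(by-size(size F <? + k))(∑≡ Es \e _ -> each(H e)(cut S e))) where
   F : ES
   F e = H e ∧ cut S e
   each : ∀ h c -> χ(h ∧ c) * 1# == χ c * χ h
   each tt tt = refl
   each tt ff = refl
   each ff tt = refl
   each ff ff = refl
   crs : ∀ {u v} -> Lnk(\e -> not(H e) ∨ F e) u v -> S ∋ u -> S ∌ v -> ∀ {A : Set} -> A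
   crs p u∈ v∉ with exits S p u∈ v∉
   ... | x with ∨-F {not(H(Exit.e x))}(Exit.e∉F x)
   ... | inH , notF = cl(∧-T(not-false inH)(cut-true S(Exit.joins x)(Exit.a∈ x)(Exit.b∉ x))) notF where
    not-false : ∀ {b} -> not b == ff -> b == tt
    not-false {tt} _ = refl
   by-size : Dec(size F < + k) -> + k ≤ size F
   by-size(no ¬l) = ≮⇒≥ ¬l
   by-size(yes l) with ∋∨∌ S s | ∋∨∌ S t
   ... | inl p | inl q = void(sep(tr p(sym q)))
   ... | inr p | inr q = void(sep(tr p(sym q)))
   ... | inl p | inr q = crs(meet dem F l link) p q
   ... | inr p | inl q = crs(back(meet dem F l link)) q p

  solves-meet : ∀ {H} -> Solves H -> Meets H
  solves-meet {H} solves {a} {b} {r} dem F sml link = stable(lnk? G a b) \ ¬link -> cmpt G a \(U , comp) -> blkd U comp ¬link where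
   G : ES
   G e = not(H e) ∨ F e
   blkd : ∀ U -> Cmpt G a U -> ¬ Lnk G a b -> Data.Empty.⊥
   blkd U comp ¬link = <⇒≱ sml(via(by(sym(1*(+ r)))(solves dem U apart(wid(\e q -> free e q) link)))(∑≤ Es \e _ -> each e(T∨F(cut U e))(T∨F(H e)))) where
    import Data.Empty
    apart : Sep U a b
    apart eq = ¬link(fst comp b(tr(sym eq)(snd comp a stop)))
    in-F : ∀ e -> cut U e == tt -> H e == tt -> F e == tt
    in-F e c h = tr(ap(\x -> not x ∨ F e)(sym h))(cmpt-cut {U = U} comp e c)
    free : ∀ e -> F e == ff -> H e ∧ cut U e == ff
    free e q = ≢-true \p -> cl(in-F e(snd(∧-e {H e} p))(fst(∧-e {H e} p))) q
    each : ∀ e -> cut U e == tt ⊎ cut U e == ff -> H e == tt ⊎ H e == ff -> χ(cut U e) * χ(H e) ≤ χ(F e) * 1#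
    each e(inl c)(inl h) rewrite in-F e c h | c | h = rfl
    each e(inr c) _ rewrite c = by(0*(χ(H e)))(nn(F e)) where
     nn : ∀ b -> 0# ≤ χ b * 1#
     nn tt = +≤+ z≤n
     nn ff = +≤+ z≤n
    each e(inl c)(inr h) rewrite h = by(*0(χ(cut U e)))(nn(F e)) where
     nn : ∀ b -> 0# ≤ χ b * 1#
     nn tt = +≤+ z≤n
     nn ff = +≤+ z≤n

  feas-solves : ∀ {H} -> feas H == tt -> Solves H
  feas-solves ok = meet-solves(feas-meet ok)

  solves-feas : ∀ {H} -> Solves H -> feas H == tt
  solves-feas s = meet-feas(solves-meet s)

  feas-mono : ∀ {A B : Fin m -> Bool} -> (∀ e -> A e == tt -> B e == tt) -> feas A == tt -> feas B == tt
  feas-mono {A} {B} h ok = meet-feas \dem F sml link -> wid(\e -> keep(F e)(h e))(feas-meet ok dem F sml link) where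
   keep : ∀ {a b} f -> (a == tt -> b == tt) -> not a ∨ f == ff -> not b ∨ f == ff
   keep {tt} {b} f h p rewrite h refl = p

 module Correct1 {L : ℕ} (ds dt : Fin L -> Fin n) (dk : Fin L -> ℕ) (dk≤3 : ∀ d -> dk d N.≤ 3)
  (leq : ℕ -> ℕ -> Fin m -> Fin m -> Bool)(W : Fin m -> Z)(W≥0 : ∀ e -> 0# ≤ W e)
  (leq-≤ : ∀ {u v e f} -> leq u v e f == tt -> + u * W e ≤ + v * W f)(≤-leq : ∀ {u v e f} -> + u * W e ≤ + v * W f -> leq u v e f == tt) where
  open Rows hiding (same)
  open Perc
  open Typed using (least; rept; pick)
  open Tables using (pairs; either)
  open import Data.Bool.ListAction using (all)
  open import Data.Nat.ListAction using (sum)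
  open Correct
  open Ratio

  open Feasy ds dt dk dk≤3 leq

  weight : (Fin m -> Bool) -> Z
  weight B = ∑ Es(\e -> χ(B e) * W e)

  seed : Fin m -> Fin m -> Bool
  seed e0 e = unav e ∨ does(e0 Fin.≟ e)

  module Rounding (c : Fin m -> ℕ) (c≤ : ∀ e -> c e N.≤ BIG) where
   open Relax Dem dem≤3 c

   module C = Comms comms ∈-comms (\ k k' -> does (k ≟ᶜ k')) (\ h k _ -> sels-comms h k) forb source target need N ε BIG

   acc-test : ∀ B ℓ -> acc1 c B ℓ == C.acc1 B ℓ
   acc-test B ℓ = tr(acc≡ c B ℓ)(ap(\k -> C.R.test B ℓ(suc(k N.*(3 N.* N N.*(3 N.* N))))) nVar≡)

   κ<M : κ N.< M
   κ<M = N.to(s≤s(N.r≤ κ(m N.* err)))(sym M≡)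

   err<M : m N.* err N.< M
   err<M = N.to(s≤s(N.l≤(m N.* err) κ))(sym M≡)

   M≤N : M N.≤ N
   M≤N = N.to(N.l≤ M M)(sym N≡)

   1≤BIG : 1 N.≤ BIG
   1≤BIG = N.to(s≤s z≤n)(sym BIG≡)

   to-acc : ∀ {B ℓ x D} -> LP B x D -> + N * cost x ≤ D * + ℓ -> acc1 c B ℓ == tt
   to-acc {B} {ℓ} lp h = tr(acc-test B ℓ)(C.Accepts.acc'd B ℓ meant c≤ 1≤BIG(N.eq≤(tr(ap(N._*(BIG N.* BIG))(sym nVar≡))(sym ε≡))) lp h)

   cover' : ∀ {a b r} -> Dem a b r -> ∀ F -> Lnk F a b -> size F < + r -> ∃[ k ] source k == a × target k == b ×(∀ e -> forb k e == F e) × + r ≤ + need k + size F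
   cover' dem F link sml = let(k , p , q , r , _ , l) = cover dem F link sml in k , p , q , r , l

   from-acc : ∀ {B ℓ} -> acc1 c B ℓ == tt -> ∃[ x ] LP B x(+ N) × cost x ≤ + ℓ + + err
   from-acc {B} {ℓ} h = tp(\z -> ∃[ x ] LP B x(+ N) × cost x ≤ + ℓ + + z)(sym err≡)(C.solved B ℓ(tr(sym(acc-test B ℓ)) h) cover' c≤ κ(N.eq≤(sym κ≡))(N.<≤ κ<M M≤N))

   val-≤ : ∀ {B ℓ} -> acc1 c B ℓ == tt -> val1 c B N.≤ ℓ
   val-≤ {B} h = N.by(val≡ c B)(Least.least-≤(acc1 c B)(N N.*(m N.* BIG)) h)

   val-acc : ∀ {B} -> val1 c B N.< N N.*(m N.* BIG) -> acc1 c B(val1 c B) == tt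
   val-acc {B} = tp(\v -> v N.< N N.*(m N.* BIG) -> acc1 c B v == tt)(sym(val≡ c B))(Least.least-holds(acc1 c B))

   N-split : + N == + 2 * + M
   N-split = tr(ap +_ N≡)(lm(+ M)) where
    lm : ∀ M -> M + M == + 2 * M
    lm = ring

   pays-some : ∀ {B} -> Forced B -> feas B == ff -> acc1 c B(val1 c B) == tt -> ∃[ e ] pays c B e == tt
   pays-some {B} forc infeas acc = stable(Fin.any? \e -> pays c B e Bool.≟ tt)(Step.decide-pairs forc >>= \pair? -> pure(witness(Step.buy forc pair? lp \s -> cl(solves-feas s) infeas))) where
    solved = from-acc {B} {val1 c B} acc
    x = fst solved
    lp = fst(snd solved)
    witness : ∀ {pair?} -> Step.Bought forc pair? x(+ N) -> ∃[ e ] pays c B e == tt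
    witness bt = e , ∧-T(ap not new)(≤ᵇ-true(N.to(N.+≤ˡ(M N.* c e)(val-≤(to-acc lp' affordable)))(N.m∸n+n≡m Mc≤))) where
     open Step.Bought bt renaming (lp to lp')
     D'>0 = LP.D>0 lp'
     instance
      D'-pos : ℤ.Positive D'
      D'-pos = ℤ.positive D'>0
     v : Z
     v = + val1 c B + + err
     bd1 : + N * cost x' ≤ D' *(v - + M * + c e)
     bd1 = *-cancelˡ-≤-pos(+ N * cost x')(D' *(v - + M * + c e))(+ 2)(via(bd(lm(+ N)(+ M) D'(cost x)(cost x')(+ c e) v N-split)(+≥0(d≥0 cheap)(*≥0 {+ 2 * D'} {v - cost x}(*≥0 {+ 2} {D'}(+≤+ z≤n)(lt D'>0))(d≥0(snd(snd solved)))))) rfl) where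
      lm1 : ∀ M D X X' c v -> + 2 *(D *(v - M * c)) == + 2 *((+ 2 * M) * X') +(+ 2 *(D * X) -(+ 2 * M) *(+ 2 * X' + c * D) +(+ 2 * D) *(v - X))
      lm1 = ring
      lm : ∀ N M D X X' c v -> N == + 2 * M -> + 2 *(D *(v - M * c)) == + 2 *(N * X') +(+ 2 *(D * X) - N *(+ 2 * X' + c * D) +(+ 2 * D) *(v - X))
      lm _ M D X X' c v refl = lm1 M D X X' c v
     cost≥0 : 0# ≤ + N * cost x'
     cost≥0 = *≥0 {+ N} {cost x'}(+≤+ z≤n)(∑≥0 {f = \e -> + c e * x' e} Es \e _ -> *≥0 {+ c e} {x' e}(+≤+ z≤n)(LP.x≥0 lp' e))
     rest≥0 : 0# ≤ v - + M * + c e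
     rest≥0 = *-cancelˡ-≤-pos 0#(v - + M * + c e) D'(by(*0 D')(via cost≥0 bd1))
     Mc≤ : M N.* c e N.≤ val1 c B N.+ err
     Mc≤ = drop‿+≤+(by(pos-* M(c e))(0≤i-j⇒j≤i rest≥0))
     affordable : + N * cost x' ≤ D' * +(val1 c B N.+ err ∸ M N.* c e)
     affordable = to bd1(ap(_*_ D')(sym(tr(sym(⊖-≥ Mc≤))(tr(sym(m-n≡m⊖n(val1 c B N.+ err)(M N.* c e)))(ap(\z -> v - z)(pos-* M(c e)))))))

   pays-elim : ∀ B e -> pays c B e == tt -> B e == ff × val1 c(add c B e) N.+ M N.* c e N.≤ val1 c B N.+ err
   pays-elim B e p = not-true(fst q) , true-≤ᵇ {val1 c(add c B e) N.+ M N.* c e} {val1 c B N.+ err}(snd q) where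
    q : not(B e) == tt ×(val1 c(add c B e) N.+ M N.* c e N.≤ᵇ val1 c B N.+ err) == tt
    q = ∧-e {not(B e)} {val1 c(add c B e) N.+ M N.* c e N.≤ᵇ val1 c B N.+ err} p

   c[_] : ES -> Z
   c[ B ] = ∑ Es(\e -> χ(B e) * + c e)

   module Loop (e0 : Fin m) (V : ℕ) (V≤ : val1 c (seed e0) N.≤ V) (sml : V N.+ m N.* err N.< N N.* (m N.* BIG)) where

    open Greedy.Greedy feas (val1 c) (\ B -> pick (pays c B) e0 Es) c M err (seed e0) V (N N.* (m N.* BIG)) using (Has; finished; final-price; state)

    forc : ∀ {B} -> Has B -> Forced B
    forc {B} h e e∉ = feas-solves(tr(sym(Bool.not-involutive _))(ap not(≢-true \p -> cl(h e(tr(ap(_∨ does(e0 Fin.≟ e)) p) refl)) e∉)))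

    pick1 : ∀ B -> Has B -> feas B == ff -> val1 c B N.< N N.*(m N.* BIG) -> B(pick(pays c B) e0 Es) == ff × val1 c(add c B(pick(pays c B) e0 Es)) N.+ M N.* c(pick(pays c B) e0 Es) N.≤ val1 c B N.+ err
    pick1 B has infeas val< = pays-elim B(pick(pays c B) e0 Es)(pick-true(pays c B) e0 Es(∈-fins(fst found))(snd found)) where
     found : ∃[ e ] pays c B e == tt
     found = pays-some {B}(forc has) infeas(val-acc {B} val<)

    guess-feas : feas(state m) == tt
    guess-feas = by-end(finished V≤ sml pick1) where
     by-end : feas(state m) == tt ⊎(∀ e -> state m e == tt) -> feas(state m) == tt
     by-end(inl p) = p
     by-end(inr h) = meet-feas \dem F sml link -> wid(\e q -> tr(ap(\b -> not b ∨ F e)(h e)) q) link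

    guess-price : + M * c[ state m ] ≤ + V + + M * c[ seed e0 ] + + m * + err
    guess-price = final-price V≤ sml pick1

  -- A comparison solution contains every unavoidable edge.
  module _ {H : Fin m -> Bool} (H-feas : feas H == tt) where
   open Buying Dem dem≤3 (\ _ -> 0#) (\ _ -> +≤+ z≤n) hiding (cap; cost; LP; module LP)

   seed⊆ : ∀ {e0} -> H e0 == tt -> ∀ e -> seed e0 e == tt -> H e == tt
   seed⊆ {e0} e0∈ e p with T∨F(H e)
   ... | inl q = q
   ... | inr q with T∨F(is e0 e)
   ... | inl i = tr(ap H(sym(isT {e0} i))) e0∈
   ... | inr i = cl(tr(sym(tr(ap(unav e ∨_) i)(Bool.∨-identityʳ(unav e)))) p)(ap not(meet-feas {wo e} \dem F sml link -> wid(\f -> keep F f)(feas-meet H-feas dem F sml link))) where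
    keep : ∀ F f -> not(H f) ∨ F f == ff -> not(wo e f) ∨ F f == ff
    keep F f r with T∨F(is e f) | ∨-F {not(H f)} r
    ... | inr j | _ , r' = ∨-Fs(ap(not ∘ not) j) r'
    ... | inl j | h , _ with isT {e} {f} j
    ... | refl = cl(tr(ap not q) refl) h

   forc-seed : ∀ e0 -> Forced(seed e0)
   forc-seed e0 e e∉ = feas-solves(tr(sym(Bool.not-involutive _))(ap not(≢-true \p -> cl(tr(ap(_∨ does(e0 Fin.≟ e)) p) refl) e∉)))

   -- Deleting further edges one at a time does not separate a demand while every deleted edge is avoidable.
   still-lnk : ∀ {a b r} -> Dem a b r -> ∀ F F' -> (∀ e -> F e == tt -> F' e == tt) -> (∀ f -> F' f == tt -> F f == tt ⊎ Meets(wo f)) -> size F' < + r -> Lnk F a b -> Lnk F' a b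
   still-lnk {a} {b} {r} dem F F' F⊆F' avoid1 sml link = wid last(go Es) where
    upTo : List(Fin m) -> ES
    upTo fs e = F e ∨(F' e ∧ any(\f -> is f e) fs)
    upTo⊆ : ∀ fs e -> upTo fs e == tt -> F' e == tt
    upTo⊆ fs e p with T∨F(F e)
    ... | inl q = F⊆F' e q
    ... | inr q = fst(∧-e {F' e}(tr(ap(_∨(F' e ∧ any(\f -> is f e) fs))(sym q)) p))
    any-is : ∀ fs {e} -> e ∈ fs -> any(\f -> is f e) fs == tt
    any-is(f ∷ fs) {e}(hd refl) = ap(_∨ any(\f -> is f e) fs)(is-refl e)
    any-is(f ∷ fs) {e}(th p) = tr(ap(is f e ∨_)(any-is fs p))(Bool.∨-zeroʳ(is f e))
    last : ∀ e -> upTo Es e == ff -> F' e == ff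
    last e p = tr(tr(sym(Bool.∧-identityʳ(F' e)))(ap(F' e ∧_)(sym(any-is Es(∈-fins e)))))(snd(∨-F {F e} p))
    go : ∀ fs -> Lnk(upTo fs) a b
    go [] = wid(\e q -> ∨-Fs q(Bool.∧-zeroʳ(F' e))) link
    go(f ∷ fs) = by-member(T∨F(F' f)) where
     same : ∀ e -> is f e == ff -> upTo(f ∷ fs) e == upTo fs e
     same e i = ap(\b -> F e ∨(F' e ∧(b ∨ any(\f -> is f e) fs))) i
     by-member : F' f == tt ⊎ F' f == ff -> Lnk(upTo(f ∷ fs)) a b
     by-member(inr f∉) = wid(\e q -> tr(out e(T∨F(is f e))) q)(go fs) where
      out : ∀ e -> is f e == tt ⊎ is f e == ff -> upTo(f ∷ fs) e == upTo fs e
      out e(inr i) = same e i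
      out e(inl i) with isT {f} {e} i
      ... | refl = tr(ap(\b -> F f ∨(b ∧ any(\f -> is f e)(f ∷ fs))) f∉)(sym(ap(\b -> F f ∨(b ∧ any(\f -> is f e) fs)) f∉))
     by-member(inl f∈) with avoid1 f f∈
     ... | inl f∈F = wid(\e q -> tr(out e(T∨F(is f e))) q)(go fs) where
      out : ∀ e -> is f e == tt ⊎ is f e == ff -> upTo(f ∷ fs) e == upTo fs e
      out e(inr i) = same e i
      out e(inl i) with isT {f} {e} i
      ... | refl = tr(ap(_∨(F' f ∧ any(\f -> is f e)(f ∷ fs))) f∈F)(sym(ap(_∨(F' f ∧ any(\f -> is f e) fs)) f∈F))
     ... | inr meet = wid(\e q -> avoid e(T∨F(is f e)) q)(meet dem(upTo fs)(≤<(wt-mono one one≥0 {upTo fs} {F'}(upTo⊆ fs)) sml)(go fs)) where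
      avoid : ∀ e -> is f e == tt ⊎ is f e == ff -> not(wo f e) ∨ upTo fs e == ff -> upTo(f ∷ fs) e == ff
      avoid e(inr i) q = tr(same e i)(snd(∨-F {not(wo f e)} q))
      avoid e(inl i) q = cl(ap(not ∘ not) i)(fst(∨-F {not(wo f e)} q))

   module _ {e0 : Fin m} (e0∈ : H e0 == tt) (heavy1 : ∀ e -> H e == tt -> W e ≤ W e0) where

    c : Fin m -> ℕ
    c = rwt e0

    module Cost e = Least (\ j -> leq K j e e0)

    c≤ : ∀ e -> c e N.≤ BIG
    c≤ e = Cost.least-bd e BIG

    open Rounding c c≤
    open Buying Dem dem≤3 (\ e -> + c e) (\ e -> +≤+ z≤n) using (LP; cap; cost)

    B1 : ES
    B1 = seed e0

    extra : ES
    extra e = H e ∧ not(B1 e)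

    cap≡ : ∀ e -> cap B1(χ ∘ extra) 1# e == χ(H e)
    cap≡ e with T∨F(B1 e)
    ... | inl p rewrite p | seed⊆ e0∈ e p = refl
    ... | inr p rewrite p | Bool.∧-identityʳ(H e) = refl

    initial : LP B1(χ ∘ extra) 1#
    initial = record { D>0 = +<+(s≤s z≤n) ;x≥0 = χ≥0 ∘ extra ;x≤D = \e -> ≤1(extra e)
     ;off = \e p -> ap χ(tr(ap(\b -> H e ∧ not b) p)(Bool.∧-zeroʳ(H e))) ;meet = meet } where
     ≤1 : ∀ b -> χ b ≤ 1#
     ≤1 tt = rfl
     ≤1 ff = +≤+ z≤n
     meet : ∀ {s t k} -> Dem s t k -> ∀ S -> Sep S s t -> Lnk(\e -> B1 e ∧ cut S e) s t -> 1# * + k ≤ wt(cap B1(χ ∘ extra) 1#)(cut S)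
     meet {s} {t} {k} dem S sep link = to(by-size(size F <? + k))(∑≡ Es \e _ -> ap(_*_(χ(cut S e)))(sym(cap≡ e))) where
      F : ES
      F e = H e ∧ cut S e
      each : ∀ h c -> χ(h ∧ c) * 1# == χ c * χ h
      each tt tt = refl
      each tt ff = refl
      each ff tt = refl
      each ff ff = refl
      avoid1 : ∀ f -> F f == tt -> B1 f ∧ cut S f == tt ⊎ Meets(wo f)
      avoid1 f p with T∨F(B1 f)
      ... | inl q = inl(∧-T q(snd(∧-e {H f} p)))
      ... | inr q = inr(solves-meet(forc-seed e0 f q))
      by-size : Dec(size F < + k) -> 1# * + k ≤ wt(χ ∘ H)(cut S)
      by-size(no ¬l) = by(1*(+ k))(to(≮⇒≥ ¬l)(∑≡ Es \e _ -> each(H e)(cut S e)))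
      by-size(yes l) = feas-solves H-feas dem S sep(still-lnk dem(\e -> B1 e ∧ cut S e) F(\e p -> ∧-T(seed⊆ e0∈ e(fst(∧-e {B1 e} p)))(snd(∧-e {B1 e} p))) avoid1 l link)

    X : ℕ
    X = sum(map(\e -> c e N.* b2n(extra e)) Es)

    cost≡ : cost(χ ∘ extra) == + X
    cost≡ = sym(tr(sum-∑(\e -> c e N.* b2n(extra e)) Es)(∑≡ Es \e _ -> tr(pos-*(c e)(b2n(extra e)))(ap(_*_(+ c e))(+b2n(extra e)))))

    c-split : c[ H ] == c[ B1 ] + + X
    c-split = tr(∑≡ Es \e _ -> each e(T∨F(B1 e)))(tr(∑-+(\e -> χ(B1 e) * + c e)(\e -> + c e * χ(extra e)) Es)(ap(_+_ c[ B1 ]) cost≡)) where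
     lm1 : ∀ c -> 1# * c == 1# * c + c * 0#
     lm1 = ring
     lm2 : ∀ h c -> h * c == 0# * c + c * h
     lm2 = ring
     each : ∀ e -> B1 e == tt ⊎ B1 e == ff -> χ(H e) * + c e == χ(B1 e) * + c e + + c e * χ(H e ∧ not(B1 e))
     each e(inl p) rewrite p | seed⊆ e0∈ e p = lm1(+ c e)
     each e(inr p) rewrite p | Bool.∧-identityʳ(H e) = lm2(χ(H e))(+ c e)

    K<BIG : K N.< BIG
    K<BIG = N.to(s≤s(N.by K≡(s≤s(N.+≤(at-least m)(at-least m)))))(sym BIG≡) where
     1≤K : 1 N.≤ K
     1≤K = N.to(s≤s z≤n)(sym K≡)
     at-least : ∀ j -> j N.≤ j N.* K
     at-least j = N.by(sym(N.*1 j))(N.*≤ʳ j 1≤K)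

    c-cheap : ∀ e -> H e == tt -> c e N.≤ K
    c-cheap e p = Cost.least-≤ e BIG(≤-leq(*≤ˡ(+ K)(heavy1 e p)))

    cH≤ : c[ H ] ≤ +(m N.* K)
    cH≤ = to(∑≤ Es \e _ -> each e(T∨F(H e)))(tr(∑-all(+ K) m)(sym(pos-* m K))) where
     each : ∀ e -> H e == tt ⊎ H e == ff -> χ(H e) * + c e ≤ + K
     each e(inl p) = by(tr(ap(\b -> χ b * + c e) p)(1*(+ c e)))(+≤+(c-cheap e p))
     each e(inr p) = by(ap(\b -> χ b * + c e) p)(+≤+ z≤n)

    c[]≥0 : ∀ B -> 0# ≤ c[ B ]
    c[]≥0 B = ∑≥0 {f = \e -> χ(B e) * + c e} Es(\e _ -> *≥0 {χ(B e)} {+ c e}(χ≥0(B e))(+≤+ z≤n))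

    val≤ : val1 c B1 N.≤ N N.* X
    val≤ = (val-≤(to-acc initial(eq≤(tr(ap(_*_(+ N)) cost≡)(tr(sym(pos-* N X))(sym(1*(+(N N.* X)))))))))

    room : N N.* X N.+ m N.* err N.< N N.*(m N.* BIG)
    room = N.<≤(N.+-monoʳ-<(N N.* X)(N.<≤ err<M M≤N))(N.by(tr(N.+-comm(N N.* X) N)(sym(N.*-suc N X)))(N.*≤ʳ N(N.via(s≤s X≤)(big m(Fin.toℕ<n e0))))) where
     X≤ : X N.≤ m N.* K
     X≤ = drop‿+≤+(via(bd(tr c-split(+-comm c[ B1 ](+ X)))(c[]≥0 B1)) cH≤)
     big : ∀ m' -> Data.Fin.toℕ e0 N.< m' -> suc(m' N.* K) N.≤ m' N.* BIG
     big(suc m') _ = N.by(N.+-comm 1(K N.+ m' N.* K))(N.by(tr(N.+-assoc K(m' N.* K) 1)(tr(ap(K N.+_)(N.+-comm(m' N.* K) 1))(N.+-suc K(m' N.* K))))(N.+≤ K<BIG(N.*≤ʳ m'(N.lt K<BIG))))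

    open Loop e0 (N N.* X) val≤ room

    c-tot : c[ guess e0 ] == + tot e0
    c-tot = sym(tr(tr(ap +_(tot≡ e0))(sum-∑(\e -> if guess e0 e then c e else 0) Es))(∑≡ Es \e _ -> each(guess e0 e)(c e))) where
     each : ∀ b j -> +(if b then j else 0) == χ b * + j
     each tt j = sym(1*(+ j))
     each ff j = refl

    tot≤ : + tot e0 + + c e0 ≤ + 2 * c[ H ]
    tot≤ = via(+≤ʳ(+ tot e0) c0≤)(by(ap(_+ c[ B1 ])(sym c-tot))(to(i<j⇒i≤pred[j] below)(pred-suc(+ 2 * c[ H ])))) where
     c0≤ : + c e0 ≤ c[ B1 ]
     c0≤ = wt-elem(\e -> + c e)(\e -> +≤+ z≤n) {B1} e0(tr(ap(unav e0 ∨_)(is-refl e0))(Bool.∨-zeroʳ(unav e0)))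
     below : c[ guess e0 ] + c[ B1 ] < 1# + + 2 * c[ H ]
     below = *-cancelˡ-<-nonNeg(+ M)(≤<(bd(tr(ap(\N' -> N' * + X + + M * c[ B1 ] + + m * + err + + M * c[ B1 ]) N-split)(lm(+ 2 * + M)(+ X)(+ M) c[ B1 ](+ m)(+ err) c[ guess e0 ]))(to(d≥0 M-bd)(ap(\N' -> N' * + X + + M * c[ B1 ] + + m * + err - + M * c[ guess e0 ]) N-split)))(<≤(+-monoˡ-<(+ M * c[ B1 ])(+-monoʳ-<(+ N * + X + + M * c[ B1 ])(≤<(eq≤(sym(pos-* m err)))(+<+ err<M))))(eq≤(tr(ap(\N' -> N' * + X + + M * c[ B1 ] + + M + + M * c[ B1 ]) N-split)(tr(lm2(+ M)(+ X) c[ B1 ])(ap(\z -> + M *(1# + + 2 * z))(sym c-split))))))) where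
      lm : ∀ N X M b m e g -> N * X + M * b + m * e + M * b == M *(g + b) +(N * X + M * b + m * e - M * g)
      lm = ring
      lm2 : ∀ M X b -> + 2 * M * X + M * b + M + M * b == M *(1# + + 2 *(b + X))
      lm2 = ring
      M-bd : + M * c[ guess e0 ] ≤ + N * + X + + M * c[ B1 ] + + m * + err
      M-bd = to(tp(\B -> + M * c[ B ] ≤ +(N N.* X) + + M * c[ B1 ] + + m * + err)(sym(guess≡ e0)) guess-price)(ap(\z -> z + + M * c[ B1 ] + + m * + err)(pos-* N X))

    guess-valid : valid e0 == tt
    guess-valid = tr(valid≡ e0)(∧-T(tr(ap feas(guess≡ e0)) guess-feas)(≤ᵇ-true(N.to(s≤s(N.via(drop‿+≤+(via(bd refl(+≤+(z≤n {c e0})))(via tot≤(to(*≤ˡ(+ 2) cH≤)(lm(+(m N.* K)))))))(N.n≤1+n _)))(sym BIG≡)))) where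
     lm : ∀ k -> + 2 * k == k + k
     lm = ring

    tot-cheap : + tot e0 * W e0 ≤ + 2 *(+ K * weight H)
    tot-cheap = via(*≤ʳ(W e0) {{ℤ.nonNegative(W≥0 e0)}} tot≤')(bd(lm(+ K) {+ m}(ap +_ K≡)(weight H)(c[ H ])(+ c e0)(W e0))(+≥0(+≥0(*≥0 {+ 2} {+ K * weight H + + m * W e0 - c[ H ] * W e0}(+≤+ z≤n)(d≥0 cH-cheap))(d≥0 c0-big))(W≥0 e0))) where
     tot≤' : + tot e0 ≤ + 2 * c[ H ] - + c e0
     tot≤' = bd(lm(+ tot e0)(+ c e0)(+ 2 * c[ H ]))(d≥0 tot≤) where
      lm : ∀ t c h -> h - c == t +(h -(t + c))
      lm = ring
     lemma0 : ∀ m w h c W -> + 2 *((1# +(m + m)) * w) ==(+ 2 * h - c) * W +(+ 2 *((1# +(m + m)) * w + m * W - h * W) +(c * W -(1# +(m + m)) * W) + W)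
     lemma0 = ring
     lm : ∀ K {m'} -> K == 1# +(m' + m') -> ∀ w h c W -> + 2 *(K * w) ==(+ 2 * h - c) * W +(+ 2 *(K * w + m' * W - h * W) +(c * W - K * W) + W)
     lm _ {m'} refl = lemma0 m'
     c0-big : + K * W e0 ≤ + c e0 * W e0
     c0-big = leq-≤(Cost.least-holds e0 {BIG}(N.≤<(c-cheap e0 e0∈) K<BIG))
     c-upper : ∀ e -> + c e * W e0 ≤ + K * W e + W e0
     c-upper e = by-val(c e) refl where
      by-val : ∀ j -> c e == j -> + j * W e0 ≤ + K * W e + W e0
      by-val zero _ = +≥0(*≥0 {+ K} {W e}(+≤+ z≤n)(W≥0 e))(W≥0 e0)
      by-val(suc j) eq = by(lm1(+ j)(W e0))(+≤ˡ(W e0)(lt(≰⇒> \l -> cl(≤-leq l)(Cost.least-fails e BIG(N.eq≤(sym eq)))))) where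
       lm1 : ∀ j w -> (1# + j) * w == j * w + w
       lm1 = ring
     cH-cheap : c[ H ] * W e0 ≤ + K * weight H + + m * W e0
     cH-cheap = by(tr(*-comm c[ H ](W e0))(sym(∑-*(W e0)(\e -> χ(H e) * + c e) Es)))(to(∑≤ Es \e _ -> each e(H e))(tr(∑-+(\e -> + K *(χ(H e) * W e))(\_ -> W e0) Es)(ap2 _+_(∑-*(+ K)(\e -> χ(H e) * W e) Es)(∑-all(W e0) m)))) where
      lm1 : ∀ w c -> w *(1# * c) == c * w
      lm1 = ring
      lm2 : ∀ K w w0 -> K * w + w0 == K *(1# * w) + w0
      lm2 = ring
      lm3 : ∀ K w w0 c -> K *(0# * w) + w0 == w0 *(0# * c) + w0
      lm3 = ring
      each : ∀ e b -> W e0 *(χ b * + c e) ≤ + K *(χ b * W e) + W e0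
      each e tt = by(lm1(W e0)(+ c e))(to(c-upper e)(lm2(+ K)(W e)(W e0)))
      each e ff = bd(lm3(+ K)(W e)(W e0)(+ c e))(W≥0 e0)

  weight≥0 : ∀ B -> 0# ≤ weight B
  weight≥0 B = ∑≥0 {f = \e -> χ(B e) * W e} Es(\e _ -> *≥0 {χ(B e)} {W e}(χ≥0(B e))(W≥0 e))

  sel : (Fin m -> Bool) -> (Fin m -> ℕ) -> Fin m -> ℕ
  sel g r e = if g e then r e else 0

  sel-≤ : ∀ g r e -> g e == tt -> r e N.≤ sum(map(sel g r) Es)
  sel-≤ g r e p = drop‿+≤+(by(ap(\b -> +(if b then r e else 0))(sym p))(to(term≤∑ {f = \e -> + sel g r e} Es(\_ _ -> +≤+ z≤n)(∈-fins e))(sym(sum-∑(sel g r) Es))))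

  sel-wgt : ∀ g r k {w0} -> (∀ e -> g e == tt -> + k * W e ≤ + r e * w0) -> + k * weight g ≤ + sum(map(sel g r) Es) * w0
  sel-wgt g r k {w0} h = by(sym(∑-*(+ k)(\e -> χ(g e) * W e) Es))(to(∑≤ Es \e _ -> each e(g e) refl)(tr(∑-* w0(\e -> + sel g r e) Es)(tr(ap(_*_ w0)(sym(sum-∑(sel g r) Es)))(*-comm w0(+ sum(map(sel g r) Es)))))) where
   lm : ∀ K w w0 -> K *(0# * w) == w0 * 0#
   lm = ring
   each : ∀ e b -> g e == b -> + k *(χ b * W e) ≤ w0 * +(if b then r e else 0)
   each e ff _ = eq≤(lm(+ k)(W e) w0)
   each e tt p = by(ap(_*_(+ k))(1*(W e)))(to(h e p)(*-comm(+ r e) w0))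

  valid-cheap : ∀ e -> valid e == tt -> + K * weight(guess e) ≤ + tot e * W e
  valid-cheap e0 v = to(sel-wgt(guess e0)(rwt e0) K \e p -> leq-≤(Correct.Least.least-holds(\j -> leq K j e e0) {BIG}(N.≤<(sel-≤(guess e0)(rwt e0) e p) tot<)))(ap(\t -> + t * W e0)(sym(tot≡ e0))) where
   tot< : sum(map(sel(guess e0)(rwt e0)) Es) N.< BIG
   tot< = N.≤<(N.eq≤(sym(tot≡ e0)))(true-≤ᵇ {suc(tot e0)} {BIG}(snd(∧-e {feas(guess e0)} {suc(tot e0) N.≤ᵇ BIG}(tr(sym(valid≡ e0)) v))))

  record Good(B : Fin m -> Bool)(H : Fin m -> Bool) : Set where
   field
    meet-dems : feas B == tt
    cheap : weight B ≤ + 2 * weight H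

  heavy-edge : ∀(H : Fin m -> Bool) -> (∀ e -> H e == ff) ⊎ ∃[ e0 ] H e0 == tt ×(∀ e -> H e == tt -> W e ≤ W e0)
  heavy-edge H = Data.Sum.swap(Data.Sum.map₁(\(e , p) -> let(e0 , q , h) = minl H(\e -> - W e) Es p in e0 , q , \f r -> neg-cancel-≤(h f(th(∈-fins f)) r))(some? H))

  result-good : ∀ H -> feas H == tt -> Good result H
  result-good H H-ok = by-empty(feas \_ -> ff) refl where
   by-empty : ∀ b -> feas(\_ -> ff) == b -> Good(\e -> not b ∧ [(\_ -> ff) ,(\e0 -> guess e0 e) ]′(pick best(inl unit) slts)) H
   by-empty tt eq = record { meet-dems = eq ;cheap = by(∑-0 Es \e _ -> 0*(W e))(*≥0 {+ 2} {weight H}(+≤+ z≤n)(weight≥0 H)) }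
   by-empty ff eq = by-heavy(heavy-edge H) where
    by-heavy : (∀ e -> H e == ff) ⊎(∃[ e0 ] H e0 == tt ×(∀ e -> H e == tt -> W e ≤ W e0)) -> Good(\e -> [(\_ -> ff) ,(\e0 -> guess e0 e) ]′(pick best(inl unit) slts)) H
    by-heavy(inl h) = cl(feas-mono {H} {\_ -> ff}(\e p -> cl p(h e)) H-ok) eq
    by-heavy(inr(e0 , e0∈ , heavy)) = by-pick(pick best(inl unit) slts)(pick-true best(inl unit) slts(∈-slts(inr e*)) best*) where
     v0 : valid e0 == tt
     v0 = guess-valid H-ok e0∈ heavy
     found = minl valid(\e -> + tot e * W e) Es v0
     e* = fst found
     imp : ∀ {a b} -> (a == tt -> b == tt) -> not a ∨ b == tt
     imp {tt} h = h refl
     imp {ff} h = refl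
     best* : best(inr e*) == tt
     best* = ∧-T(fst(snd found))(all⁺(\f -> not(valid f) ∨ leq(tot e*)(tot f) e* f) Es \f _ -> imp \v -> ≤-leq(snd(snd found) f(th(∈-fins f)) v))
     by-pick : ∀ a -> best a == tt -> Good(\e -> [(\_ -> ff) ,(\e0 -> guess e0 e) ]′ a) H
     by-pick(inr e) p = record { meet-dems = fst(∧-e {feas(guess e)} {suc(tot e) N.≤ᵇ BIG}(tr(sym(valid≡ e)) v)) ;cheap = *-cancelˡ-≤-pos(weight(guess e))(+ 2 * weight H)(+ suc(m N.+ m))
       (by(ap(\k -> + k * weight(guess e))(sym K≡))(via(valid-cheap e v)(via(leq-≤(tp(\b -> not b ∨ leq(tot e)(tot e0) e e0 == tt) v0(all⁻(\f -> not(valid f) ∨ leq(tot e)(tot f) e f) Es(snd q) e0(∈-fins e0))))(to(tot-cheap H-ok e0∈ heavy)(tr(lm(+ K)(weight H))(ap(\k -> + k *(+ 2 * weight H)) K≡)))))) } where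
      q : valid e == tt × all(\f -> not(valid f) ∨ leq(tot e)(tot f) e f) Es == tt
      q = ∧-e {valid e} {all(\f -> not(valid f) ∨ leq(tot e)(tot f) e f) Es} p
      v = fst q
      lm : ∀ k w -> + 2 *(k * w) == k *(+ 2 * w)
      lm = ring

  result-approximates : ∀ H -> feas H == tt -> feas result == tt × weight result ≤ + 2 * weight H
  result-approximates H ok = let good = result-good H ok in Good.meet-dems good , Good.cheap good

module Library where
 open N
 open TreeOps
 open Comp
 open Typed
 open Tables
 import Data.Fin as Fin
 import Data.Fin.Properties as Finₚ
 open import Data.List using () renaming (tabulate to tab)
 open import Data.Nat.ListAction using (sum)

 snoc-tab : {A : Set}(j : ℕ)(h : ℕ -> A) -> tab {n = suc j}(h ∘ toℕ) == tab {n = j}(h ∘ toℕ) ++ [ h j ]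
 snoc-tab zero h = refl
 snoc-tab(suc j) h = ap(h 0 ∷_)(snoc-tab j(h ∘ suc))

 num-≟ : ∀ m n -> does(num m ≟T num n) ==(m ≡ᵇ n)
 num-≟ zero zero = refl
 num-≟ zero(suc n) = refl
 num-≟(suc m) zero = refl
 num-≟(suc m)(suc n) = tr(does-≡(num(suc m) ≟T num(suc n))(num m ≟T num n)(\ { eq -> ap num(suc-injective(num-inj {suc m} {suc n} eq)) })(ap(node leaf)))(num-≟ m n)

 module Over'' (I : Set) (param : I -> Tree) where
  open Over' I param public

  Sub : Con -> Con -> Set₁
  Sub Γ ε = Level.Lift _ ⊤
   where import Level
  Sub Γ(Δ ▹ T) = Sub Γ Δ × Tm Γ T

  at1 : ∀ {Γ} Δ -> Sub Γ Δ -> ∀ i -> Env Γ i -> Env Δ i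
  at1 ε σ i γ = unit
  at1(Δ ▹ T)(σ , t) i γ = at1 Δ σ i γ , fn t i γ

  at⊩ : ∀ {Γ} Δ(σ : Sub Γ Δ) -> ⌊ Γ ⌋ ⊩ \(i , γ) -> tree Δ(at1 Δ σ i γ)
  at⊩ {Γ} ε σ = param⊩ Γ
  at⊩ {Γ}(Δ ▹ T)(σ , t) = pair(ok t)(at⊩ Δ σ)

  call : ∀ {Γ Δ T} -> Tm Δ T -> Sub Γ Δ -> Tm Γ T
  call {Γ} {Δ} t σ = tm(\i γ -> fn t i(at1 Δ σ i γ))(at⊩ Δ σ ⟫ ridx(\(i , γ) -> i , at1 Δ σ i γ)(ok t))

  call1 : ∀ {Γ A T} -> Tm(ε ▹ A) T -> Tm Γ A -> Tm Γ T
  call1 t a = call t(_ , a)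

  call2 : ∀ {Γ A B T} -> Tm(ε ▹ A ▹ B) T -> Tm Γ A -> Tm Γ B -> Tm Γ T
  call2 t a b = call t((_ , a) , b)

  call3 : ∀ {Γ A B C T} -> Tm(ε ▹ A ▹ B ▹ C) T -> Tm Γ A -> Tm Γ B -> Tm Γ C -> Tm Γ T
  call3 t a b c = call t(((_ , a) , b) , c)

  call4 : ∀ {Γ A B C D T} -> Tm(ε ▹ A ▹ B ▹ C ▹ D) T -> Tm Γ A -> Tm Γ B -> Tm Γ C -> Tm Γ D -> Tm Γ T
  call4 t a b c d = call t((((_ , a) , b) , c) , d)

  foldListT : ∀ {Γ A S} -> Tm Γ(ListT A) -> Tm Γ S -> (t : Tm(Γ ▹ S ▹ A) S)(q : Pol) -> (∀ i γ s x -> sz(enc S(fn t i((γ , s) , x))) ≤ sz(enc S s) + ⟦ q ⟧(sz(tree Γ γ) + sz(enc A x))) -> Tm Γ S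
  foldListT {Γ} {A} {S} xs s t q grow = tm(\i γ -> foldl(\s x -> fn t i((γ , s) , x))(fn s i γ)(fn xs i γ))(F.fold(ok xs)(ok s)(ridx(\((i , γ) , x , s) -> i ,(γ , s) , x)(ok t))) where
   module F = Fold {Γ = ⌊ Γ ⌋} {A = \ (i , _) -> El A i} {S = \ (i , _) -> El S i} (enc A) (enc S)
    (\(i , γ) -> fn xs i γ)(\(i , γ) -> fn s i γ)(\(i , γ) x s -> fn t i((γ , s) , x))
    q(\(i , γ) x s -> grow i γ s x)

  sumListT : ∀ {Γ A} -> Tm Γ(ListT A) -> Tm(Γ ▹ A) NatT -> Tm Γ NatT
  sumListT {Γ} {A} xs t = as(foldListT xs zeroT(v1 +T under t)(out(ok t) ∘P(con 1 ⊕ idP)) grow)(\i γ -> sum(map(\x -> fn t i(γ , x))(fn xs i γ)))(\i γ -> ap num(foldl-sum(\x -> fn t i(γ , x)) 0(fn xs i γ))) where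
   sz-add : ∀ a b -> sz(num(a + b)) ≤ sz(num a) + sz(num b)
   sz-add a b rewrite sz-num(a + b) | sz-num a | sz-num b = s≤s(by(lm a b)(+≤ʳ(a + a)(n≤1+n(b + b)))) where
    lm : ∀ a b -> a + b +(a + b) == a + a +(b + b)
    lm = ring
   grow : ∀ i γ s x -> sz(num(s + fn t i(γ , x))) ≤ sz(num s) + ⟦ out(ok t) ∘P(con 1 ⊕ idP) ⟧(sz(tree Γ γ) + sz(enc A x))
   grow i γ s x = via(sz-add s(fn t i(γ , x)))(+≤ʳ(sz(num s))(via(sml(ok t)(i , γ , x))(to(⟦ out(ok t) ⟧-mn(s≤s(eq≤(+-comm(sz(enc A x))(sz(tree Γ γ))))))(sym(∘P-e(out(ok t))(con 1 ⊕ idP) _)))))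

  infix 5 _≡T_

  _≡T_ : ∀ {Γ} -> Tm Γ NatT -> Tm Γ NatT -> Tm Γ BoolT
  s ≡T t = tm(\i γ -> fn s i γ ≡ᵇ fn t i γ)(conv(\(i , γ) -> ap bool(num-≟(fn s i γ)(fn t i γ)))(equal⊩(ok s)(ok t)))

  sameT : ∀ {Γ}(X : FinTy)(_≟_ : ∀ {i}(x y : El(base X) i) -> Dec(x == y)) -> Tm Γ(base X) -> Tm Γ(base X) -> Tm Γ BoolT
  sameT X _≟_ s t = as(eqT X s t)(\i γ -> does(fn s i γ ≟ fn t i γ))(\i γ -> ap bool(does-≡(decEq X(fn s i γ)(fn t i γ))(fn s i γ ≟ fn t i γ) id id))

  RangeF : Tm ε NatT -> FinTy
  RangeF U = record
   { base = ty(\i -> Fin(fn U i _))(num ∘ toℕ) ;elems = \i -> fins(fn U i _) ;cpl = ∈-fins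
   ;inj = \eq -> Finₚ.toℕ-injective(num-inj eq)
   ;listed = conv(\i -> ap list(done i))(ridx(\i -> i , _)(ok(sndT cntdn))) } where
   State : Ty
   State = Below U ×T ListT NatT
   next : Tm(ε ▹ State)(Below U)
   next = clipT U(predT(toℕT {U = U}(fstT v0)))
   bd1 : Pol
   bd1 = fst(below-bdd U)
   grow : ∀ i γ s -> sz(enc State(fn next i(γ , s) ,(toℕ(fn next i(γ , s)) ∷ snd s))) ≤ sz(enc State s) + ⟦ con 1 ⊕(bd1 ⊕ bd1) ⟧(sz(tree ε {i} γ))
   grow i γ(k , l) = lm(sz(num(toℕ(fn next i(γ , k , l)))))(sz(list(map num l)))(sz(num(toℕ k)))(⟦ bd1 ⟧(sz(param i)))(snd(below-bdd U) {i}(fn next i(γ , k , l))) where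
    eq1 : ∀ n l -> suc(n + suc(n + l)) == suc l +(1 +(n + n))
    eq1 = ring
    lm : ∀ n l k b -> n ≤ b -> suc(n + suc(n + l)) ≤ suc(k + l) +(1 +(b + b))
    lm n l k b h = by(eq1 n l)(+≤(s≤s(r≤ l k))(s≤s(+≤ h h)))
   cntdn : Tm ε State
   cntdn = reptT U(clipT U U ,T nilT)(next ,T consT(toℕT {U = U} next)(sndT v0))(con 1 ⊕(bd1 ⊕ bd1)) grow
   runs-down : ∀ i j(s : El State i) -> j ≤ fn U i _ -> toℕ(fst s) == j -> snd(rept j(\s -> fn next i(_ , s) ,(toℕ(fn next i(_ , s)) ∷ snd s)) s) == tab {n = j} toℕ ++ snd s
   runs-down i zero s le eq = refl
   runs-down i(suc j) s le eq = tr(runs-down i j _(via(n≤1+n j) le) next≡)(tr(ap(\k -> tab {n = j} toℕ ++ k ∷ snd s) next≡)(tr(sym(++-assoc(tab {n = j} toℕ) [ j ](snd s)))(ap(_++ snd s)(sym(snoc-tab j id))))) where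
    next≡ : toℕ(fn next i(_ , s)) == j
    next≡ = tr(toℕ-clip(fn U i _)(pred(toℕ(fst s))))(tr(ap(\k -> pred k ⊓ fn U i _) eq)(m≤n⇒m⊓n≡m(via(n≤1+n j) le)))
   done : ∀ i -> map num(snd(fn cntdn i _)) == map(num ∘ toℕ)(fins(fn U i _))
   done i = tr(ap(map num)(tr(runs-down i(fn U i _)(clip(fn U i _)(fn U i _) , []) rfl(tr(toℕ-clip _ _)(m≤n⇒m⊓n≡m rfl)))(++-identityʳ _)))(tr(map-tabulate toℕ num)(sym(map-tabulate id(num ∘ toℕ))))

module Parse where
 open N
 open import Defs
 open TreeOps using (Tree; leaf; node; bool; sz)
 open Comp
 open Typed
 open Tables
 open Library
 open Rows using (b2n)
 import Data.Fin as Fin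
 import Data.Fin.Properties as Finₚ
 open import Data.Integer using () renaming (∣_∣ to ∣_∣ℤ)
 open import Data.List using () renaming (tabulate to tab; replicate to repl)
 open import Data.Nat.ListAction using (sum)
 open import Data.Rational using (ℚ; ↥_; ↧ₙ_)
 open import Data.Vec using (toList)
 open import Data.Vec.Properties using (lookup-map)

 Sym : Set
 Sym = ⊤ ⊎ Bool

 dig : Fin 2 -> Bool
 dig zero = ff
 dig(suc _) = tt

 symb : Symbol -> Sym
 symb(bit d) = inr(dig d)
 symb # = inl unit

 symTree : Symbol -> Tree
 symTree(bit d) = node(node leaf leaf)(bool(dig d))
 symTree # = node leaf leaf

 bits : ℕ -> List Bool
 bits n = map dig(fst(toDigits 2 n))

 Bits : Set
 Bits = List Bool

 term : Bits -> List Sym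
 term ds = map inr ds ++ [ inl unit ]

 symb-encodeℕ : ∀ n -> map symb(encodeℕ n) == term(bits n)
 symb-encodeℕ n = tr(map-++ symb(map bit(fst(toDigits 2 n))) _)(ap(_++ [ inl unit ])(tr(sym(map-∘(fst(toDigits 2 n))))(map-∘(fst(toDigits 2 n)))))

 bits-ne : ∀ n -> ∃[ b ] ∃[ bs ] rev(bits n) == b ∷ bs
 bits-ne zero = ff , [] , refl
 bits-ne(suc n) = ne1(rev(bits(suc n))) refl where
  ne1 : ∀ ds -> rev(bits(suc n)) == ds -> ∃[ b ] ∃[ bs ] ds == b ∷ bs
  ne1(b ∷ bs) _ = b , bs , refl
  ne1 [] eq = absurd(fst(toDigits 2(suc n)))(snd(toDigits 2(suc n)))(tr(sym(reverse-involutive _))(ap rev eq)) where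
   absurd : ∀ {A : Set} ds -> fromDigits {2} ds == suc n -> map dig ds == [] -> A
   absurd []() _

 horner : ℕ -> ℕ -> Bool -> ℕ
 horner U v b = (v + v + b2n b) ⊓ U

 bits-val : ∀ U n -> n ≤ U -> foldl(horner U) 0(rev(bits n)) == n
 bits-val U n n≤U = tr(reverse-foldl(horner U) 0(bits n))(tr(go(fst(toDigits 2 n)))(tr(ap(_⊓ U)(snd(toDigits 2 n)))(m≤n⇒m⊓n≡m n≤U))) where
  reverse-foldl : {A B : Set}(f : B -> A -> B)(z : B)(xs : List A) -> foldl f z(rev xs) == foldr(\x y -> f y x) z xs
  reverse-foldl f z xs = foldl-ʳ++ f z xs {[]}
  double : ∀ b v -> (v ⊓ U + v ⊓ U + b) ⊓ U ==(b + v * 2) ⊓ U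
  double b v with ≤-total v U
  ... | inl l rewrite m≤n⇒m⊓n≡m l = ap(_⊓ U)(lm b v) where
   lm : ∀ b v -> v + v + b == b + v * 2
   lm = ring
  ... | inr l rewrite m≥n⇒m⊓n≡n l = tr(m≥n⇒m⊓n≡n(via(l≤ U U)(l≤(U + U) b)))(sym(m≥n⇒m⊓n≡n(via l(via(m≤m*n v 2)(r≤(v * 2) b)))))
  dig-val : ∀ d -> b2n(dig d) == toℕ d
  dig-val zero = refl
  dig-val(suc zero) = refl
  go : ∀ ds -> foldr(\x y -> horner U y x) 0(map dig ds) == fromDigits {2} ds ⊓ U
  go [] = refl
  go(d ∷ ds) = tr(ap2(\v b -> (v + v + b) ⊓ U)(go ds)(dig-val d))(double(toℕ d)(fromDigits {2} ds))

 Inst : Set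
 Inst = Σ[ I ∈ RSNDInstance ](∀ i -> RSNDInstance.requirement I i ≤ 3)

 module _ (inst : Inst) where
  open RSNDInstance (fst inst) using (∣V∣; ∣E∣; ends; weight; ℓ; demand)

  edgeFlds : Fin ∣E∣ -> List Bits
  edgeFlds e = bits(toℕ(fst(at ends e))) ∷ bits(toℕ(snd(at ends e))) ∷ bits ∣ ↥ at weight e ∣ℤ ∷ bits(↧ₙ at weight e) ∷ []

  demFlds : Fin ℓ -> List Bits
  demFlds d = bits(toℕ(fst(at demand d))) ∷ bits(toℕ(fst(snd(at demand d)))) ∷ bits(snd(snd(at demand d))) ∷ []

  flds : List Bits
  flds = repl ∣V∣ tt ∷ flat edgeFlds(fins ∣E∣) ++ [] ∷ flat demFlds(fins ℓ)

  syms : List Sym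
  syms = map symb(encodeRSND(fst inst))

  concat-term : ∀ {j} {v : Vec Word j}(f : Fin j -> List Bits) -> (∀ e -> map symb(at v e) == flat term(f e)) -> map symb(concat(toList v)) == flat term(flat f(fins j))
  concat-term {v = v} f h = tr(go v f h)(ap(\l -> flat term(concat l))(sym(map-tabulate id f))) where
   concatMap-++ : ∀ xs ys -> flat term(xs ++ ys) == flat term xs ++ flat term ys
   concatMap-++ [] ys = refl
   concatMap-++(x ∷ xs) ys = tr(ap(term x ++_)(concatMap-++ xs ys))(sym(++-assoc(term x)(flat term xs)(flat term ys)))
   go : ∀ {j}(v : Vec Word j)(f : Fin j -> List Bits) -> (∀ e -> map symb(at v e) == flat term(f e)) -> map symb(concat(toList v)) == flat term(concat(tab f))
   go Vec.[] f h = refl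
   go(x Vec.∷ v) f h = tr(map-++ symb x(concat(toList v)))(tr(ap2 _++_(h zero)(go v(f ∘ suc)(h ∘ suc)))(sym(concatMap-++(f zero)(concat(tab(f ∘ suc))))))

  private
   unary : ∀ j -> map symb(repl j(bit(suc zero))) == map inr(repl j tt)
   unary j = tr(map-replicate symb j _)(sym(map-replicate inr j tt))

   split : ∀ xs ys -> flat term(xs ++ [] ∷ ys) == flat term xs ++ inl unit ∷ flat term ys
   split [] ys = refl
   split(x ∷ xs) ys = tr(ap(term x ++_)(split xs ys))(sym(++-assoc(term x)(flat term xs) _))

   join : ∀ a w fs -> map symb w == flat term fs -> map symb(encodeℕ a ++ w) == flat term(bits a ∷ fs)
   join a w fs h = tr(map-++ symb(encodeℕ a) w)(ap2 _++_(symb-encodeℕ a) h)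

   single : ∀ a -> map symb(encodeℕ a) == flat term(bits a ∷ [])
   single a = tr(symb-encodeℕ a)(sym(++-identityʳ(term(bits a))))

   shape : (f : Fin ∣V∣ × Fin ∣V∣ -> ℚ -> Word)(g : Fin ∣V∣ × Fin ∣V∣ × ℕ -> Word) -> (∀ p w -> f p w == encodeℕ(toℕ(fst p)) ++ encodeℕ(toℕ(snd p)) ++ encodeℕ ∣ ↥ w ∣ℤ ++ encodeℕ(↧ₙ w)) -> (∀ d -> g d == encodeℕ(toℕ(fst d)) ++ encodeℕ(toℕ(fst(snd d))) ++ encodeℕ(snd(snd d))) -> map symb(repl ∣V∣(bit(suc zero)) ++ [ # ] ++ concat(toList(Vec.zipWith f ends weight)) ++ [ # ] ++ concat(toList(Vec.map g demand))) == flat term flds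
   shape f g f≡ g≡ = tr(map-++ symb(repl ∣V∣(bit(suc zero))) _)(tr(ap2 _++_(unary ∣V∣)(ap(inl unit ∷_)(tr(map-++ symb(concat(toList(Vec.zipWith f ends weight))) _)(ap2 _++_(concat-term {v = Vec.zipWith f ends weight} edgeFlds edge)(ap(inl unit ∷_)(concat-term {v = Vec.map g demand} demFlds dem))))))(tr(sym(++-assoc(map inr(repl ∣V∣ tt)) [ inl unit ] _))(ap(term(repl ∣V∣ tt) ++_)(sym(split(flat edgeFlds(fins ∣E∣))(flat demFlds(fins ℓ))))))) where
    edge : ∀ e -> map symb(at(Vec.zipWith f ends weight) e) == flat term(edgeFlds e)
    edge e = tr(ap(map symb)(tr(at-zip f e ends weight)(f≡(at ends e)(at weight e))))(join(toℕ(fst(at ends e))) _(bits(toℕ(snd(at ends e))) ∷ bits ∣ ↥ at weight e ∣ℤ ∷ bits(↧ₙ at weight e) ∷ [])(join(toℕ(snd(at ends e))) _(bits ∣ ↥ at weight e ∣ℤ ∷ bits(↧ₙ at weight e) ∷ [])(join ∣ ↥ at weight e ∣ℤ(encodeℕ(↧ₙ at weight e))(bits(↧ₙ at weight e) ∷ [])(single(↧ₙ at weight e)))))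
    dem : ∀ d -> map symb(at(Vec.map g demand) d) == flat term(demFlds d)
    dem d = tr(ap(map symb)(tr(lookup-map d g demand)(g≡(at demand d))))(join(toℕ(fst(at demand d))) _(bits(toℕ(fst(snd(at demand d)))) ∷ bits(snd(snd(at demand d))) ∷ [])(join(toℕ(fst(snd(at demand d)))) _(bits(snd(snd(at demand d))) ∷ [])(single(snd(snd(at demand d))))))

  syms≡ : syms == flat term flds
  syms≡ = shape _ _(\_ _ -> refl)(\_ -> refl)

 -- Splitting the word at #; fields and their digits come out in reverse order.
 spstep : List Bits × Bits -> Sym -> List Bits × Bits
 spstep(fs , cur)(inl _) = (cur ∷ fs) , []
 spstep(fs , cur)(inr b) = fs ,(b ∷ cur)

 split-term : ∀ xs fs -> foldl spstep(fs , [])(flat term xs) ==(map rev xs ʳ++ fs , [])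
 split-term [] fs = refl
 split-term(x ∷ xs) fs = tr(foldl-++ spstep(fs , [])(term x)(flat term xs))(tr(ap(\s -> foldl spstep s(flat term xs))(tr(foldl-++ spstep(fs , [])(map inr x) [ inl unit ])(tr(ap(\s -> spstep s(inl unit))(digits x [])) refl)))(split-term xs(rev x ∷ fs))) where
  digits : ∀ ds cur -> foldl spstep(fs , cur)(map inr ds) ==(fs , ds ʳ++ cur)
  digits [] cur = refl
  digits(d ∷ ds) cur = digits ds(d ∷ cur)

 Buffer : Set
 Buffer = ⊤ ⊎(Bits ×(⊤ ⊎(Bits ×(⊤ ⊎ Bits))))

 DemRec EdgeRec Grpd : Set
 DemRec = Bits ×(Bits × Bits)
 EdgeRec = Bits ×(Bits ×(Bits × Bits))
 Grpd = Bool ×(Buffer ×(List DemRec × List EdgeRec))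

 -- Groups of three until an empty field shows up, then groups of four.
 grp : Grpd -> Bits -> Grpd
 grp(ff , inl _ , ds , es) [] = tt , inl unit , ds , es
 grp(ff , inl _ , ds , es) f@(_ ∷ _) = ff , inr(f , inl unit) , ds , es
 grp(ff , inr(a , inl _) , ds , es) f = ff , inr(a , inr(f , inl unit)) , ds , es
 grp(ff , inr(a , inr(b , _)) , ds , es) f = ff , inl unit ,(f , b , a) ∷ ds , es
 grp(tt , inl _ , ds , es) f = tt , inr(f , inl unit) , ds , es
 grp(tt , inr(a , inl _) , ds , es) f = tt , inr(a , inr(f , inl unit)) , ds , es
 grp(tt , inr(a , inr(b , inl _)) , ds , es) f = tt , inr(a , inr(b , inr f)) , ds , es
 grp(tt , inr(a , inr(b , inr c)) , ds , es) f = tt , inl unit , ds ,(f , c , b , a) ∷ es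

 module _ (i : Inst) where
  open RSNDInstance (fst i) using (∣V∣; ∣E∣; ends; weight; ℓ; demand)

  demRec : Fin ℓ -> DemRec
  demRec d = rev(bits(toℕ(fst(at demand d)))) , rev(bits(toℕ(fst(snd(at demand d))))) , rev(bits(snd(snd(at demand d))))

  edgeRec : Fin ∣E∣ -> EdgeRec
  edgeRec e = rev(bits(toℕ(fst(at ends e)))) , rev(bits(toℕ(snd(at ends e)))) , rev(bits ∣ ↥ at weight e ∣ℤ) , rev(bits(↧ₙ at weight e))

  empty : Grpd
  empty = ff , inl unit , [] , []

  grpd : foldl grp empty(fst(foldl spstep([] , [])(syms i))) ==(tt , inr(rev(repl ∣V∣ tt) , inl unit) , map demRec(fins ℓ) , map edgeRec(fins ∣E∣))
  grpd = tr(ap(\w -> foldl grp empty(fst(foldl spstep([] , []) w)))(syms≡ i))(tr(ap(\s -> foldl grp empty(fst s))(split-term(flds i) []))(tr(foldl-ʳ++ grp empty(map rev(flds i)) {[]})(ap(\s -> grp s(rev(repl ∣V∣ tt)))(tr(ap(foldr back empty)(map-++ rev(flat(edgeFlds i)(fins ∣E∣)) _))(tr(foldr-++ back empty(map rev(flat(edgeFlds i)(fins ∣E∣))) _)(tr(ap(\s -> foldr back(grp s [])(map rev(flat(edgeFlds i)(fins ∣E∣))))(dems(fins ℓ)))(edges(map demRec(fins ℓ))(fins ∣E∣)))))))) where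
   back : Bits -> Grpd -> Grpd
   back f s = grp s f
   dems : ∀ xs -> foldr back empty(map rev(flat(demFlds i) xs)) ==(ff , inl unit , map demRec xs , [])
   dems [] = refl
   dems(d ∷ xs) = tr(ap(\s -> grp(grp(grp s(rev(bits(snd(snd(at demand d))))))(rev(bits(toℕ(fst(snd(at demand d)))))))(rev(bits(toℕ(fst(at demand d))))))(dems xs))(three(bits-ne(snd(snd(at demand d))))) where
    three : ∀ {k t s ds} -> (∃[ b ] ∃[ bs ] k == b ∷ bs) -> grp(grp(grp(ff , inl unit , ds , []) k) t) s ==(ff , inl unit ,(s , t , k) ∷ ds , [])
    three(_ , _ , refl) = refl
   edges : ∀ ds xs -> foldr back(tt , inl unit , ds , [])(map rev(flat(edgeFlds i) xs)) ==(tt , inl unit , ds , map edgeRec xs)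
   edges ds [] = refl
   edges ds(e ∷ xs) = ap(\s -> grp(grp(grp(grp s(rev(bits(↧ₙ at weight e))))(rev(bits ∣ ↥ at weight e ∣ℤ)))(rev(bits(toℕ(snd(at ends e))))))(rev(bits(toℕ(fst(at ends e))))))(edges ds xs)

module Reading where
 open N
 open import Defs
 open TreeOps using (Tree; leaf; node; bool; sz)
 open Comp
 open Typed
 open Tables
 open Library
 open Parse
 open Rows using (b2n)
 import Data.Fin as Fin
 import Data.Fin.Properties as Finₚ
 open import Data.Integer using () renaming (∣_∣ to ∣_∣ℤ)
 open import Data.List using () renaming (tabulate to tab; replicate to repl)
 open import Data.Nat.ListAction using (sum)
 open import Data.Rational using (ℚ; ↥_; ↧ₙ_)

 param : Inst -> Tree
 param(I , _) = list(map symTree(encodeRSND I))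

 open Over'' Inst param public

 UnitT SymT Fld BufferT DemRecT EdgeRecT GrpdT : Ty
 UnitT = base UnitF
 SymT = UnitT ⊎T BoolT
 Fld = ListT BoolT
 BufferT = UnitT ⊎T(Fld ×T(UnitT ⊎T(Fld ×T(UnitT ⊎T Fld))))
 DemRecT = Fld ×T(Fld ×T Fld)
 EdgeRecT = Fld ×T(Fld ×T(Fld ×T Fld))
 GrpdT = BoolT ×T(BufferT ×T(ListT DemRecT ×T ListT EdgeRecT))

 unitT : ∀ {Γ} -> Tm Γ UnitT
 unitT = tm(\_ _ -> unit) leaf⊩

 symsT : Tm ε(ListT SymT)
 symsT = tm(\i _ -> syms i)(conv(\(i , _) -> same {i}(encodeRSND(fst i))) whole) where
  same : ∀ {i} w -> list(map symTree w) == list(map(enc SymT {i})(map symb w))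
  same [] = refl
  same {i}(bit d ∷ w) = ap(node _)(same {i} w)
  same {i}(# ∷ w) = ap(node _)(same {i} w)

 sz-bool : ∀ b -> sz(bool b) ≤ 3
 sz-bool tt = rfl
 sz-bool ff = s≤s z≤n

 fldsT : Tm ε(ListT Fld)
 fldsT = fstT(foldListT {S = State} symsT(nilT ,T nilT) next(con 4) grow) where
  State : Ty
  State = ListT Fld ×T Fld
  next : Tm(ε ▹ State ▹ SymT) State
  next = as(case v0(consT(sndT v2)(fstT v2) ,T nilT)(fstT v2 ,T consT v0(sndT v2)))(\i((_ , s) , x) -> spstep s x) \ { i(_ , inl _) -> refl ;i(_ , inr _) -> refl }
  grow : ∀ i γ s x -> sz(enc State {i}(spstep s x)) ≤ sz(enc State {i} s) + ⟦ con 4 ⟧(sz(tree ε {i} γ) + sz(enc SymT {i} x))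
  grow i γ(fs , cur)(inl _) = to(l≤ _ 2)(lm(sz(enc(ListT Fld) {i} fs))(sz(enc Fld {i} cur))) where
   lm : ∀ f c -> suc(suc(c + f) + 1) + 2 == suc(f + c) + 4
   lm = ring
  grow i γ(fs , cur)(inr b) = to(s≤s(+≤ʳ(sz(enc(ListT Fld) {i} fs))(s≤s(+≤ˡ(sz(enc Fld {i} cur))(sz-bool b)))))(lm(sz(enc(ListT Fld) {i} fs))(sz(enc Fld {i} cur))) where
   lm : ∀ f c -> suc(f + suc(3 + c)) == suc(f + c) + 4
   lm = ring

 isNilT : ∀ {Γ T} -> Tm Γ(ListT T) -> Tm Γ BoolT
 isNilT {Γ} {T} t = tm(\i γ -> nil(fn t i γ))(conv(\(i , γ) -> ap bool(lm(fn t i γ)))(equal⊩(ok t) leaf⊩)) where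
  open import Relation.Nullary using (does)
  open TreeOps using (_≟T_)
  nil : {A : Set} -> List A -> Bool
  nil [] = tt
  nil(_ ∷ _) = ff
  lm : ∀ {i}(xs : List(El T i)) -> does(enc(ListT T) xs ≟T leaf) == nil xs
  lm [] = refl
  lm(x ∷ xs) = refl

 grpdT : Tm ε GrpdT
 grpdT = foldListT fldsT(falseT ,T(inj1T unitT ,T(nilT ,T nilT))) next(con 20 ⊕ idP)(\i γ s f -> grow {i} γ s f) where
  next : Tm(ε ▹ GrpdT ▹ Fld) GrpdT
  next = as(ite(fstT v1)(case(fstT(sndT v1))(trueT ,T(inj2T(v1 ,T inj1T unitT) ,T sndT(sndT v2)))(case(sndT v0)(trueT ,T(inj2T(fstT v1 ,T inj2T(v2 ,T inj1T unitT)) ,T sndT(sndT v3)))(case(sndT v0)(trueT ,T(inj2T(fstT v2 ,T inj2T(fstT v1 ,T inj2T v3)) ,T sndT(sndT(wk v3))))(trueT ,T(inj1T unitT ,T(fstT(sndT(sndT(wk v3))) ,T consT(v3 ,T(v0 ,T(fstT v1 ,T fstT v2)))(sndT(sndT(sndT(wk v3))))))))))(case(fstT(sndT v1))(ite(isNilT v1)(trueT ,T(inj1T unitT ,T sndT(sndT v2)))(falseT ,T(inj2T(v1 ,T inj1T unitT) ,T sndT(sndT v2))))(case(sndT v0)(falseT ,T(inj2T(fstT v1 ,T inj2T(v2 ,T inj1T unitT)) ,T sndT(sndT v3)))(falseT ,T(inj1T unitT ,T(consT(v2 ,T(fstT v0 ,T fstT v1))(fstT(sndT(sndT v3))) ,T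 sndT(sndT(sndT v3))))))))(\i((_ , s) , f) -> grp s f) \ { i((_ , ff , inl _ , _) , []) -> refl ;i((_ , ff , inl _ , _) , _ ∷ _) -> refl ;i((_ , ff , inr(_ , inl _) , _) , _) -> refl ;i((_ , ff , inr(_ , inr _) , _) , _) -> refl ;i((_ , tt , inl _ , _) , _) -> refl ;i((_ , tt , inr(_ , inl _) , _) , _) -> refl ;i((_ , tt , inr(_ , inr(_ , inl _)) , _) , _) -> refl ;i((_ , tt , inr(_ , inr(_ , inr _)) , _) , _) -> refl }
  module _ {i : Inst} where
   F : Bits -> ℕ
   F f = sz(enc Fld {i} f)
   D : List DemRec -> ℕ
   D ds = sz(enc(ListT DemRecT) {i} ds)
   E : List EdgeRec -> ℕ
   E es = sz(enc(ListT EdgeRecT) {i} es)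
   G : Grpd -> ℕ
   G s = sz(enc GrpdT {i} s)
   wn : ∀ {a b} t k f -> a + k == b + 18 + f -> a ≤ b +(20 +(t + f))
   wn {a} {b} t k f eq = via(l≤ a k)(by eq(by(+-assoc b 18 f)(+≤ʳ b(+≤ {18} {20}(≤ᵇ⇒≤ 18 20 _)(r≤ f t)))))
   grow : ∀ γ s f -> G(grp s f) ≤ G s +(20 +(sz(tree ε {i} γ) + F f))
   grow γ(ff , inl _ , ds , es) [] = wn {_} {G(ff , inl unit , ds , es)}(sz(tree ε {i} γ)) 17 1(lm(D ds)(E es)) where
    lm : ∀ d e -> suc(3 + suc(3 + suc(d + e))) + 17 == suc(1 + suc(3 + suc(d + e))) + 18 + 1
    lm = ring
   grow γ(ff , inl _ , ds , es) f@(_ ∷ _) = wn {_} {G(ff , inl unit , ds , es)}(sz(tree ε {i} γ)) 13(F f)(lm(D ds)(E es)(F f)) where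
    lm : ∀ d e f -> suc(1 + suc(suc(3 + suc(f + 3)) + suc(d + e))) + 13 == suc(1 + suc(3 + suc(d + e))) + 18 + f
    lm = ring
   grow γ(ff , inr(a , inl _) , ds , es) f = wn {_} {G(ff , inr(a , inl unit) , ds , es)}(sz(tree ε {i} γ)) 13(F f)(lm(D ds)(E es)(F f)(F a)) where
    lm : ∀ d e f a -> suc(1 + suc(suc(3 + suc(a + suc(3 + suc(f + 3)))) + suc(d + e))) + 13 == suc(1 + suc(suc(3 + suc(a + 3)) + suc(d + e))) + 18 + f
    lm = ring
   grow γ(ff , inr(a , inr(b , r)) , ds , es) f = wn {_} {G(ff , inr(a , inr(b , r)) , ds , es)}(sz(tree ε {i} γ))(22 + sz(enc(UnitT ⊎T Fld) {i} r))(F f)(lm(D ds)(E es)(F f)(F a)(F b)(sz(enc(UnitT ⊎T Fld) {i} r))) where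
    lm : ∀ d e f a b r -> suc(1 + suc(3 + suc(suc(suc(f + suc(b + a)) + d) + e))) +(22 + r) == suc(1 + suc(suc(3 + suc(a + suc(3 + suc(b + r)))) + suc(d + e))) + 18 + f
    lm = ring
   grow γ(tt , inl _ , ds , es) f = wn {_} {G(tt , inl unit , ds , es)}(sz(tree ε {i} γ)) 13(F f)(lm(D ds)(E es)(F f)) where
    lm : ∀ d e f -> suc(3 + suc(suc(3 + suc(f + 3)) + suc(d + e))) + 13 == suc(3 + suc(3 + suc(d + e))) + 18 + f
    lm = ring
   grow γ(tt , inr(a , inl _) , ds , es) f = wn {_} {G(tt , inr(a , inl unit) , ds , es)}(sz(tree ε {i} γ)) 13(F f)(lm(D ds)(E es)(F f)(F a)) where
    lm : ∀ d e f a -> suc(3 + suc(suc(3 + suc(a + suc(3 + suc(f + 3)))) + suc(d + e))) + 13 == suc(3 + suc(suc(3 + suc(a + 3)) + suc(d + e))) + 18 + f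
    lm = ring
   grow γ(tt , inr(a , inr(b , inl _)) , ds , es) f = wn {_} {G(tt , inr(a , inr(b , inl unit)) , ds , es)}(sz(tree ε {i} γ)) 17(F f)(lm(D ds)(E es)(F f)(F a)(F b)) where
    lm : ∀ d e f a b -> suc(3 + suc(suc(3 + suc(a + suc(3 + suc(b + suc(3 + f))))) + suc(d + e))) + 17 == suc(3 + suc(suc(3 + suc(a + suc(3 + suc(b + 3)))) + suc(d + e))) + 18 + f
    lm = ring
   grow γ(tt , inr(a , inr(b , inr c)) , ds , es) f = wn {_} {G(tt , inr(a , inr(b , inr c)) , ds , es)}(sz(tree ε {i} γ)) 25(F f)(lm(D ds)(E es)(F f)(F a)(F b)(F c)) where
    lm : ∀ d e f a b c -> suc(3 + suc(3 + suc(d + suc(suc(f + suc(c + suc(b + a))) + e)))) + 25 == suc(3 + suc(suc(3 + suc(a + suc(3 + suc(b + suc(3 + c))))) + suc(d + e))) + 18 + f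
    lm = ring

 module _ (i : Inst) where
  open RSNDInstance (fst i) using (∣V∣; ∣E∣; ends; weight; ℓ; demand)

  src tgt : Fin ∣E∣ -> Fin ∣V∣
  src e = fst(at ends e)
  tgt e = snd(at ends e)

  ds dt : Fin ℓ -> Fin ∣V∣
  ds d = fst(at demand d)
  dt d = fst(snd(at demand d))

  dk : Fin ℓ -> ℕ
  dk d = snd(snd(at demand d))

 demsT : Tm ε(ListT DemRecT)
 demsT = as(fstT(sndT(sndT grpdT)))(\i _ -> map(demRec i)(fins _)) \i _ -> ap(\s -> enc(ListT DemRecT) {i}(fst(snd(snd s))))(grpd i)

 edgesT : Tm ε(ListT EdgeRecT)
 edgesT = as(sndT(sndT(sndT grpdT)))(\i _ -> map(edgeRec i)(fins _)) \i _ -> ap(\s -> enc(ListT EdgeRecT) {i}(snd(snd(snd s))))(grpd i)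

 unaryT : Tm ε Fld
 unaryT = as(case(fstT(sndT grpdT)) nilT(fstT v0))(\i _ -> rev(repl(RSNDInstance.∣V∣(fst i)) tt)) \i _ -> ap(\s -> enc Fld {i}([(\_ -> []) , fst ]′(fst(snd s))))(grpd i)

 lenT : ∀ {Γ T} -> Tm Γ(ListT T) -> Tm Γ NatT
 lenT t = as(sumListT t(sucT zeroT))(\i γ -> len(fn t i γ))(\i γ -> ap num(ones(fn t i γ))) where
  ones : {A : Set}(xs : List A) -> sum(map(\_ -> 1) xs) == len xs
  ones [] = refl
  ones(x ∷ xs) = ap suc(ones xs)

 len-map-allFin : {A : Set}(n : ℕ)(f : Fin n -> A) -> len(map f(fins n)) == n
 len-map-allFin n f = tr(length-map f(fins n))(length-tabulate id)

 nT mT LT : Tm ε NatT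
 nT = as(lenT unaryT)(\i _ -> RSNDInstance.∣V∣(fst i)) \i _ -> ap num(tr(length-reverse(repl(RSNDInstance.∣V∣(fst i)) tt))(length-replicate _))
 mT = as(lenT edgesT)(\i _ -> RSNDInstance.∣E∣(fst i)) \i _ -> ap num(len-map-allFin _(edgeRec i))
 LT = as(lenT demsT)(\i _ -> RSNDInstance.ℓ(fst i)) \i _ -> ap num(len-map-allFin _(demRec i))

 VxF EdgeF DemF : FinTy
 VxF = RangeF nT
 EdgeF = RangeF mT
 DemF = RangeF LT

 nth-step : {A : Set} -> ℕ -> ℕ × A -> A -> ℕ × A
 nth-step j(k , r) x = suc k ,(if k ≡ᵇ j then x else r)

 nth : {A : Set} -> ℕ -> A -> List A -> A
 nth j d xs = snd(foldl(nth-step j)(0 , d) xs)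

 nth-tab : {A : Set} {n : ℕ}(f : Fin n -> A)(d : A)(e : Fin n) -> nth(toℕ e) d(tab f) == f e
 nth-tab f d e = go 0 f d e where
  later : ∀ {A : Set} {n} k j(f : Fin n -> A) r -> j Data.Nat.< k -> snd(foldl(nth-step j)(k , r)(tab f)) == r
  later {n = zero} k j f r l = refl
  later {n = suc n} k j f r l = tr(ap(\b -> snd(foldl(nth-step j)(suc k ,(if b then f zero else r))(tab(f ∘ suc))))(≢⇒≡ᵇ l))(later(suc k) j(f ∘ suc) r(m≤n⇒m≤1+n l)) where
   ≢⇒≡ᵇ : ∀ {j k} -> j Data.Nat.< k -> (k ≡ᵇ j) == ff
   ≢⇒≡ᵇ {zero} {suc k} _ = refl
   ≢⇒≡ᵇ {suc j} {suc k}(s≤s l) = ≢⇒≡ᵇ l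
  same : ∀ k -> (k ≡ᵇ k) == tt
  same zero = refl
  same(suc k) = same k
  dif : ∀ k j -> (k ≡ᵇ suc(k + j)) == ff
  dif zero j = refl
  dif(suc k) j = dif k j
  go : ∀ {A : Set} {n} k(f : Fin n -> A) r(e : Fin n) -> snd(foldl(nth-step(k + toℕ e))(k , r)(tab f)) == f e
  go k f r zero rewrite +0 k | same k = later(suc k) k(f ∘ suc)(f zero) rfl
  go k f r(suc e) rewrite +-suc k(toℕ e) | dif k(toℕ e) = go(suc k)(f ∘ suc) r e

 nthT : ∀ {Γ T} -> Tm Γ NatT -> Tm Γ T -> Tm Γ(ListT T) -> Tm Γ T
 nthT {Γ} {T} j d xs = as(sndT(foldListT {S = NatT ×T T} xs(zeroT ,T d)(sucT(fstT v1) ,T ite(fstT v1 ≡T wk(wk j)) v0(sndT v1))(con 2 ⊕ idP) grow))(\i γ -> nth(fn j i γ)(fn d i γ)(fn xs i γ))(\_ _ -> refl) where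
  pick-size : ∀ {i} b(x r : El T i) -> sz(enc T(if b then x else r)) ≤ sz(enc T r) + sz(enc T x)
  pick-size tt x r = r≤ _ _
  pick-size ff x r = l≤ _ _
  grow : ∀ i γ s x -> sz(enc(NatT ×T T)(nth-step(fn j i γ) s x)) ≤ sz(enc(NatT ×T T) s) +(2 +(sz(tree Γ γ) + sz(enc T x)))
  grow i γ(k , r) x = via(s≤s(+≤ʳ(sz(num(suc k)))(pick-size(k ≡ᵇ fn j i γ) x r)))(to(l≤ _(sz(tree Γ γ)))(lm(sz(num k))(sz(enc T r))(sz(enc T x))(sz(tree Γ γ)))) where
   lm : ∀ k r x t -> suc(suc(suc k) +(r + x)) + t == suc(k + r) +(2 +(t + x))
   lm = ring

 indexT : ∀ {Γ U} -> Tm Γ(base(RangeF U)) -> Tm Γ NatT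
 indexT t = tm(\i γ -> toℕ(fn t i γ))(ok t)

 edgeRecT : Tm(ε ▹ base EdgeF) EdgeRecT
 edgeRecT = as(nthT(indexT {U = mT} v0)(nilT ,T(nilT ,T(nilT ,T nilT)))(closed edgesT))(\i(_ , e) -> edgeRec i e) \i(_ , e) -> ap(enc EdgeRecT {i})(tr(ap(nth(toℕ e)([] , [] , [] , []))(map-tabulate id(edgeRec i)))(nth-tab(edgeRec i) _ e))

 demRecT : Tm(ε ▹ base DemF) DemRecT
 demRecT = as(nthT(indexT {U = LT} v0)(nilT ,T(nilT ,T nilT))(closed demsT))(\i(_ , d) -> demRec i d) \i(_ , d) -> ap(enc DemRecT {i})(tr(ap(nth(toℕ d)([] , [] , []))(map-tabulate id(demRec i)))(nth-tab(demRec i) _ d))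

 b2nT : ∀ {Γ} -> Tm Γ BoolT -> Tm Γ NatT
 b2nT t = as(ite t(sucT zeroT) zeroT)(\i γ -> b2n(fn t i γ))(\i γ -> lm(fn t i γ)) where
  lm : ∀ b -> num(if b then 1 else 0) == num(b2n b)
  lm tt = refl
  lm ff = refl

 decT : ∀ {Γ} -> Tm ε NatT -> Tm Γ Fld -> Tm Γ NatT
 decT {Γ} U t = foldListT t zeroT((v1 +T v1 +T b2nT v0) ⊓T closed U)(out(ok U)) grow where
  grow : ∀ i γ s x -> sz(num(horner(fn U i unit) s x)) ≤ sz(num s) + ⟦ out(ok U) ⟧(sz(tree Γ γ) + sz(bool x))
  grow i γ s x = via(via(sz-num-mono(m⊓n≤n(s + s + b2n x)(fn U i unit)))(via(sml(ok U)(i , unit))(⟦ out(ok U) ⟧-mn(via(param≤ Γ γ)(l≤ _ _)))))(r≤ _ _)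

 dec-as : ∀ {Γ T}(U : Tm ε NatT)(t : Tm Γ Fld)(f : ∀ i -> Env Γ i -> El T i)(k : ∀ i -> Env Γ i -> ℕ) -> (∀ i γ -> fn t i γ == rev(bits(k i γ))) -> (∀ i γ -> k i γ ≤ fn U i unit) -> (∀ i γ -> num(k i γ) == enc T(f i γ)) -> Tm Γ T
 dec-as U t f k bits≡ k≤ eq = tm f(conv(\(i , γ) -> tr(ap num(tr(ap(foldl(horner(fn U i unit)) 0)(bits≡ i γ))(bits-val(fn U i unit)(k i γ)(k≤ i γ))))(eq i γ))(ok(decT U t)))

 srcT tgtT : Tm(ε ▹ base EdgeF)(base VxF)
 srcT = dec-as nT(fstT edgeRecT)(\i(_ , e) -> src i e)(\i(_ , e) -> toℕ(src i e))(\_ _ -> refl)(\i(_ , e) -> lt(Finₚ.toℕ<n(src i e)))(\_ _ -> refl)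
 tgtT = dec-as nT(fstT(sndT edgeRecT))(\i(_ , e) -> tgt i e)(\i(_ , e) -> toℕ(tgt i e))(\_ _ -> refl)(\i(_ , e) -> lt(Finₚ.toℕ<n(tgt i e)))(\_ _ -> refl)

 dsT dtT : Tm(ε ▹ base DemF)(base VxF)
 dsT = dec-as nT(fstT demRecT)(\i(_ , d) -> ds i d)(\i(_ , d) -> toℕ(ds i d))(\_ _ -> refl)(\i(_ , d) -> lt(Finₚ.toℕ<n(ds i d)))(\_ _ -> refl)
 dtT = dec-as nT(fstT(sndT demRecT))(\i(_ , d) -> dt i d)(\i(_ , d) -> toℕ(dt i d))(\_ _ -> refl)(\i(_ , d) -> lt(Finₚ.toℕ<n(dt i d)))(\_ _ -> refl)

 dkT : Tm(ε ▹ base DemF) NatT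
 dkT = dec-as(sucT(sucT(sucT zeroT)))(sndT(sndT demRecT))(\i(_ , d) -> dk i d)(\i(_ , d) -> dk i d)(\_ _ -> refl)(\i(_ , d) -> snd i d)(\_ _ -> refl)

 numerT denomT : Tm(ε ▹ base EdgeF) Fld
 numerT = as(fstT(sndT(sndT edgeRecT)) ʳ++T nilT)(\i(_ , e) -> bits ∣ ↥ at(RSNDInstance.weight(fst i)) e ∣ℤ) \i(_ , e) -> ap(enc Fld {i})(reverse-involutive _)
 denomT = as(sndT(sndT(sndT edgeRecT)) ʳ++T nilT)(\i(_ , e) -> bits(↧ₙ at(RSNDInstance.weight(fst i)) e)) \i(_ , e) -> ap(enc Fld {i})(reverse-involutive _)

module Compare where
 open N
 open Typed using (rept)
 open Rows using (b2n)
 open Perc using (≤ᵇ-true; true-≤ᵇ)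
 open Parse using (Bits; bits; dig)
 open import Data.Nat.ListAction using (sum)

 -- The positions of the digits 1; the bound L only serves to limit the growth of the list in a single step.
 ones-step : ℕ -> ℕ × List ℕ -> Bool -> ℕ × List ℕ
 ones-step L(k , ps) b = suc k ,(if b then k ⊓ L ∷ ps else ps)

 ones : Bits -> List ℕ
 ones ds = snd(foldl(ones-step(len ds))(0 , []) ds)

 pows : List ℕ -> ℕ
 pows ps = sum(map(2 ^_) ps)

 pows-ones : ∀ n -> pows(ones(bits n)) == n
 pows-ones n = tr(go(fst(toDigits 2 n)) 0 [] rfl)(tr(+0 _)(snd(toDigits 2 n))) where
  L = len(bits n)
  go : ∀ ds k ps -> k + len(map dig ds) ≤ L -> pows(snd(foldl(ones-step L)(k , ps)(map dig ds))) == pows ps + 2 ^ k * fromDigits {2} ds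
  go [] k ps l = sym(tr(ap(pows ps +_)(*0(2 ^ k)))(+0 _))
  go(d ∷ ds) k ps l = tr(ap(\j -> pows(snd(foldl(ones-step L)(suc k ,(if dig d then j ∷ ps else ps))(map dig ds))))(m≤n⇒m⊓n≡m(via(n≤1+n k)(via(l≤(suc k) _) l'))))(tr(go ds(suc k) _ l')(dig-case d)) where
   l' : suc k + len(map dig ds) ≤ L
   l' = by(sym(+-suc k _)) l
   lemma0 : ∀ p t v -> p +(t +(t + 0)) * v == p + t *(0 + v * 2)
   lemma0 = ring
   lm1 : ∀ p t v -> t + p +(t +(t + 0)) * v == p + t *(1 + v * 2)
   lm1 = ring
   dig-case : ∀ d -> pows(if dig d then k ∷ ps else ps) + 2 ^ suc k * fromDigits {2} ds == pows ps + 2 ^ k *(toℕ d + fromDigits {2} ds * 2)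
   dig-case zero = lemma0(pows ps)(2 ^ k)(fromDigits {2} ds)
   dig-case(suc zero) = lm1(pows ps)(2 ^ k)(fromDigits {2} ds)

 coef : List ℕ -> List ℕ -> ℕ -> ℕ
 coef P Q k = sum(map(\i -> sum(map(\j -> b2n(i + j ≡ᵇ k)) Q)) P)

 val : (ℕ -> ℕ) -> ℕ -> ℕ
 val z zero = 0
 val z(suc W) = 2 ^ W * z W + val z W

 sum-map-* : {A : Set}(c : ℕ)(f : A -> ℕ)(xs : List A) -> sum(map(\x -> c * f x) xs) == c * sum(map f xs)
 sum-map-* c f [] = sym(*0 c)
 sum-map-* c f(x ∷ xs) = tr(ap(c * f x +_)(sum-map-* c f xs))(sym(*-distribˡ-+ c(f x) _))

 sum-map-+ : {A : Set}(f g : A -> ℕ)(xs : List A) -> sum(map(\x -> f x + g x) xs) == sum(map f xs) + sum(map g xs)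
 sum-map-+ f g [] = refl
 sum-map-+ f g(x ∷ xs) = tr(ap(f x + g x +_)(sum-map-+ f g xs))(lm(f x)(g x)(sum(map f xs))(sum(map g xs))) where
  lm : ∀ a b c d -> a + b +(c + d) == a + c +(b + d)
  lm = ring

 sum-map-cong : {A : Set} {f g : A -> ℕ}(xs : List A) -> (∀ x -> x ∈ xs -> f x == g x) -> sum(map f xs) == sum(map g xs)
 sum-map-cong [] h = refl
 sum-map-cong(x ∷ xs) h = ap2 _+_(h x(hd refl))(sum-map-cong xs \y -> h y ∘ th)

 sum-map-≤ : {A : Set} {f : A -> ℕ} {c : ℕ}(xs : List A) -> (∀ x -> f x ≤ c) -> sum(map f xs) ≤ len xs * c
 sum-map-≤ [] h = z≤n
 sum-map-≤(x ∷ xs) h = +≤(h x)(sum-map-≤ xs h)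

 ∈-≤-sum : ∀ {i} {xs : List ℕ} -> i ∈ xs -> i ≤ sum xs
 ∈-≤-sum(hd refl) = l≤ _ _
 ∈-≤-sum {xs = x ∷ _}(th p) = via(∈-≤-sum p)(r≤ _ x)

 val-* : ∀ c z W -> val(\k -> c * z k) W == c * val z W
 val-* c z zero = sym(*0 c)
 val-* c z(suc W) = tr(ap(2 ^ W *(c * z W) +_)(val-* c z W))(lm c(2 ^ W)(z W)(val z W)) where
  lm : ∀ c p z v -> p *(c * z) + c * v == c *(p * z + v)
  lm = ring

 val-sum : {A : Set}(g : A -> ℕ -> ℕ)(xs : List A)(W : ℕ) -> val(\k -> sum(map(\x -> g x k) xs)) W == sum(map(\x -> val(g x) W) xs)
 val-sum g xs zero = sym(tr(sum-map-* 0(\_ -> 0) xs) refl)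
 val-sum g xs(suc W) = tr(ap2 _+_(sym(sum-map-*(2 ^ W)(\x -> g x W) xs))(val-sum g xs W))(sym(sum-map-+(\x -> 2 ^ W * g x W)(\x -> val(g x) W) xs))

 val-point : ∀ c W -> c < W -> val(\k -> b2n(c ≡ᵇ k)) W == 2 ^ c
 val-point c(suc W)(s≤s c≤W) with m≤n⇒m<n∨m≡n c≤W
 ... | inl c<W = tr(ap2 _+_(tr(ap(\b -> 2 ^ W * b2n b)(dif c<W))(*0(2 ^ W)))(val-point c W c<W)) refl where
  dif : ∀ {c W} -> c < W -> (c ≡ᵇ W) == ff
  dif {zero} {suc W} _ = refl
  dif {suc c} {suc W}(s≤s l) = dif l
 ... | inr refl = tr(ap2 _+_(tr(ap(\b -> 2 ^ c * b2n b)(equal c))(*1(2 ^ c)))(beyond c c rfl))(+0 _) where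
  equal : ∀ c -> (c ≡ᵇ c) == tt
  equal zero = refl
  equal(suc c) = equal c
  above : ∀ {c W} -> W < c -> (c ≡ᵇ W) == ff
  above {suc c} {zero} _ = refl
  above {suc c} {suc W}(s≤s l) = above l
  beyond : ∀ c W -> W ≤ c -> val(\k -> b2n(c ≡ᵇ k)) W == 0
  beyond c zero _ = refl
  beyond c(suc W) l = tr(ap2 _+_(tr(ap(\b -> 2 ^ W * b2n b)(above l))(*0(2 ^ W)))(beyond c W(lt l))) refl

 val-coef : ∀ P Q W -> (∀ {i j} -> i ∈ P -> j ∈ Q -> i + j < W) -> val(coef P Q) W == pows P * pows Q
 val-coef P Q W h = tr(val-sum(\i k -> sum(map(\j -> b2n(i + j ≡ᵇ k)) Q)) P W)(tr(sum-map-cong P \i i∈ -> tr(val-sum(\j k -> b2n(i + j ≡ᵇ k)) Q W)(tr(sum-map-cong Q \j j∈ -> tr(val-point(i + j) W(h i∈ j∈))(tr(^-distribˡ-+-* 2 i j) refl))(tr(sum-map-*(2 ^ i)(2 ^_) Q)(*-comm(2 ^ i)(pows Q)))))(tr(sum-map-*(pows Q)(2 ^_) P)(*-comm(pows Q)(pows P))))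

 -- Horner's rule for the difference of two numbers with small digits, offset by C and clipped to [0, 2C].
 dif-step : (x y : ℕ -> ℕ) -> ℕ -> ℕ × ℕ -> ℕ × ℕ
 dif-step x y C(k , s) = pred k ,(((s + s + y(pred k)) ∸(x(pred k) + C)) ⊓(C + C))

 compare : (x y : ℕ -> ℕ) -> ℕ -> ℕ -> Bool
 compare x y C W = C ≤ᵇ snd(rept W(dif-step x y C)(W , C))

 module _ (x y : ℕ -> ℕ) (C : ℕ) (x≤ : ∀ k -> x k ≤ C) (y≤ : ∀ k -> y k ≤ C) where

  Clpd : ℕ -> ℕ -> ℕ -> Set
  Clpd s X Y = s + X == C + Y ⊎(s == C + C × C + X ≤ Y) ⊎(s == 0 × C + Y ≤ X)

  exact : ∀ {s X Y} k -> s + X == C + Y -> x k + C ≤ s + s + y k -> (s + s + y k ∸(x k + C)) +(X + X + x k) == C +(Y + Y + y k)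
  exact {s} {X} {Y} k eq l = +-cancelˡ-≡ C _ _(tr(lm1 C(s + s + y k ∸(x k + C)) X(x k))(tr(ap(_+(X + X))(m∸n+n≡m l))(tr(lm2 s(y k) X)(tr(ap(\e -> e + e + y k) eq)(lm3 C Y(y k)))))) where
   lm1 : ∀ C t X x -> C +(t +(X + X + x)) == t +(x + C) +(X + X)
   lm1 = ring
   lm2 : ∀ s y X -> s + s + y +(X + X) == s + X +(s + X) + y
   lm2 = ring
   lm3 : ∀ C Y y -> C + Y +(C + Y) + y == C +(C +(Y + Y + y))
   lm3 = ring

  clpd-step : ∀ {s X Y} k -> Clpd s X Y -> Clpd(((s + s + y k) ∸(x k + C)) ⊓(C + C))(X + X + x k)(Y + Y + y k)
  clpd-step {s} {X} {Y} k(inl eq) with ≤-total(s + s + y k)(x k + C)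
  ... | inl l = inr(inr(ap(_⊓(C + C))(m≤n⇒m∸n≡0 l) , +-cancelˡ-≤ C _ _(by(tr(lm1 C Y(y k))(tr(ap(\e -> e + e + y k)(sym eq))(lm2 s X(y k))))(to(+≤ˡ(X + X) l)(lm3(x k) C X))))) where
   lm1 : ∀ C Y y -> C +(C +(Y + Y + y)) == C + Y +(C + Y) + y
   lm1 = ring
   lm2 : ∀ s X y -> s + X +(s + X) + y == s + s + y +(X + X)
   lm2 = ring
   lm3 : ∀ x C X -> x + C +(X + X) == C +(X + X + x)
   lm3 = ring
  ... | inr l with ≤-total(s + s + y k ∸(x k + C))(C + C)
  ... | inl sml = inl(tr(ap(_+(X + X + x k))(m≤n⇒m⊓n≡m sml))(exact {s} {X} {Y} k eq l))
  ... | inr large = inr(inl(m≥n⇒m⊓n≡n large , +-cancelˡ-≤ C _ _(by(sym(+-assoc C C(X + X + x k)))(to(+≤ˡ(X + X + x k) large)(exact {s} {X} {Y} k eq l)))))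
  clpd-step {_} {X} {Y} k(inr(inl(refl , l))) = inr(inl(m≥n⇒m⊓n≡n(m+n≤o⇒m≤o∸n(C + C)(via(+≤ʳ(C + C)(+≤ˡ C(x≤ k)))(l≤(C + C +(C + C))(y k)))) , via(to(+≤ʳ C(+≤ʳ(X + X)(x≤ k)))(lm C X))(via(+≤ l l)(l≤(Y + Y)(y k))))) where
   lm : ∀ C X -> C +(X + X + C) == C + X +(C + X)
   lm = ring
  clpd-step {_} {X} {Y} k(inr(inr(refl , l))) = inr(inr(ap(_⊓(C + C))(m≤n⇒m∸n≡0(via(y≤ k)(r≤ C(x k)))) , via(to(+≤ʳ C(+≤ʳ(Y + Y)(y≤ k)))(lm C Y))(via(+≤ l l)(l≤(X + X)(x k))))) where
   lm : ∀ C X -> C +(X + X + C) == C + X +(C + X)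
   lm = ring

  clpd-run : ∀ W {s X Y} -> Clpd s X Y -> Clpd(snd(rept W(dif-step x y C)(W , s)))(2 ^ W * X + val x W)(2 ^ W * Y + val y W)
  clpd-run zero {s} {X} {Y} h = tp(\X -> Clpd s X(Y + 0 + 0))(lm X)(tp(Clpd s X)(lm Y) h) where
   lm : ∀ X -> X == X + 0 + 0
   lm = ring
  clpd-run(suc W) {s} {X} {Y} h = tp(\X' -> Clpd s' X'(2 ^ suc W * Y + val y(suc W)))(lm(2 ^ W) X(x W)(val x W))(tp(Clpd s'(2 ^ W *(X + X + x W) + val x W))(lm(2 ^ W) Y(y W)(val y W))(clpd-run W(clpd-step {s} {X} {Y} W h))) where
   s' = snd(rept(suc W)(dif-step x y C)(suc W , s))
   lm : ∀ p X x v -> p *(X + X + x) + v ==(p +(p + 0)) * X +(p * x + v)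
   lm = ring

  final : ∀ W -> Clpd(snd(rept W(dif-step x y C)(W , C)))(val x W)(val y W)
  final W = tp(\X -> Clpd s(X + val x W)(val y W))(*0(2 ^ W))(tp(\Y -> Clpd s(2 ^ W * 0 + val x W)(Y + val y W))(*0(2 ^ W))(clpd-run W {C} {0} {0}(inl refl)))
   where s = snd(rept W(dif-step x y C)(W , C))

  cmp-sound : 0 < C -> ∀ W -> compare x y C W == tt -> val x W ≤ val y W
  cmp-sound C>0 W h with final W | true-≤ᵇ {C} h
  ... | inl eq | l = +-cancelˡ-≤ C _ _(to(+≤ˡ(val x W) l) eq)
  ... | inr(inl(_ , le)) | _ = via(r≤ _ C) le
  ... | inr(inr(eq , _)) | l = void(<⇒≱ C>0(to l eq))

  cmp-cpl : 0 < C -> ∀ W -> val x W ≤ val y W -> compare x y C W == tt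
  cmp-cpl C>0 W h with final W
  ... | inl eq = ≤ᵇ-true(+-cancelʳ-≤(val x W) _ _(to(+≤ʳ C h)(sym eq)))
  ... | inr(inl(eq , _)) = ≤ᵇ-true(to(l≤ C C)(sym eq))
  ... | inr(inr(_ , le)) = void(<⇒≱(+-mono-<-≤ C>0 rfl)(via le h))

 count : List ℕ -> List ℕ -> ℕ
 count P Q = len P * len Q

 prods : ℕ -> ℕ -> (P Q P' Q' : List ℕ) -> Bool
 prods u v P Q P' Q' = compare(\k -> u * coef P Q k)(\k -> v * coef P' Q' k)(suc(u * count P Q + v * count P' Q'))(suc(sum P + sum Q +(sum P' + sum Q')))

 module _ (u v : ℕ) (P Q P' Q' : List ℕ) where

  private
   b2n≤1 : ∀ b -> b2n b ≤ 1
   b2n≤1 tt = rfl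
   b2n≤1 ff = z≤n

   coef≤ : ∀ P Q k -> coef P Q k ≤ count P Q
   coef≤ P Q k = sum-map-≤ P \i -> to(sum-map-≤ {f = \j -> b2n(i + j ≡ᵇ k)} Q \j -> b2n≤1(i + j ≡ᵇ k))(*1 _)

   x≤ : ∀(k : ℕ) -> u * coef P Q k ≤ suc(u * count P Q + v * count P' Q')
   x≤ k = m≤n⇒m≤1+n(via(*≤ʳ u(coef≤ P Q k))(l≤ _ _))

   y≤ : ∀(k : ℕ) -> v * coef P' Q' k ≤ suc(u * count P Q + v * count P' Q')
   y≤ k = m≤n⇒m≤1+n(via(*≤ʳ v(coef≤ P' Q' k))(r≤ _(u * count P Q)))

   W : ℕ
   W = suc(sum P + sum Q +(sum P' + sum Q'))

   left : val(\k -> u * coef P Q k) W == u *(pows P * pows Q)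
   left = tr(val-* u(coef P Q) W)(ap(u *_)(val-coef P Q W \i∈ j∈ -> s≤s(via(+≤(∈-≤-sum i∈)(∈-≤-sum j∈))(l≤ _ _))))

   right : val(\k -> v * coef P' Q' k) W == v *(pows P' * pows Q')
   right = tr(val-* v(coef P' Q') W)(ap(v *_)(val-coef P' Q' W \i∈ j∈ -> s≤s(via(+≤(∈-≤-sum i∈)(∈-≤-sum j∈))(r≤ _(sum P + sum Q)))))

  prods-sound : prods u v P Q P' Q' == tt -> u *(pows P * pows Q) ≤ v *(pows P' * pows Q')
  prods-sound h = by(sym left)(to(cmp-sound(\k -> u * coef P Q k)(\k -> v * coef P' Q' k)(suc(u * count P Q + v * count P' Q')) x≤ y≤(s≤s z≤n) W h) right)

  prods-cpl : u *(pows P * pows Q) ≤ v *(pows P' * pows Q') -> prods u v P Q P' Q' == tt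
  prods-cpl h = cmp-cpl(\k -> u * coef P Q k)(\k -> v * coef P' Q' k)(suc(u * count P Q + v * count P' Q')) x≤ y≤(s≤s z≤n) W(by left(to h(sym right)))

module Programs where
 open N
 open import Defs using (RSNDInstance)
 open TreeOps using (Tree; leaf; node; bool; sz)
 open Comp
 open Typed
 open Tables
 open Library
 open Parse
 open Reading
 open Compare
 open Rows using (b2n; same)
 import Data.Fin as Fin
 import Data.Fin.Properties as Finₚ
 open import Data.Integer using () renaming (∣_∣ to ∣_∣ℤ)
 open import Data.Rational using (ℚ; ↥_; ↧ₙ_)

 NatsT : Ty
 NatsT = ListT NatT

 onesT : ∀ {Γ} -> Tm Γ Fld -> Tm Γ NatsT
 onesT {Γ} t = as(sndT(foldListT {S = NatT ×T NatsT} t(zeroT ,T nilT)(sucT(fstT v1) ,T ite v0(consT(fstT v1 ⊓T wk(wk(lenT t)))(sndT v1))(sndT v1))(con 3 ⊕ out(ok(lenT t))) grow))(\i γ -> ones(fn t i γ))(\_ _ -> refl) where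
  grow : ∀ i γ s x -> sz(enc(NatT ×T NatsT) {i}(ones-step(len(fn t i γ)) s x)) ≤ sz(enc(NatT ×T NatsT) {i} s) +(3 + ⟦ out(ok(lenT t)) ⟧(sz(tree Γ γ) + sz(bool x)))
  grow i γ(k , ps) x = to(s≤s(+≤ʳ(sz(num(suc k)))(list≤ x)))(lm(sz(num k))(sz(enc NatsT {i} ps))(⟦ out(ok(lenT t)) ⟧(sz(tree Γ γ) + sz(bool x)))) where
   lm : ∀ k p l -> suc(suc(suc k) +(p + suc l)) == suc(k + p) +(3 + l)
   lm = ring
   list≤ : ∀ b -> sz(enc NatsT {i}(if b then k ⊓ len(fn t i γ) ∷ ps else ps)) ≤ sz(enc NatsT {i} ps) + suc(⟦ out(ok(lenT t)) ⟧(sz(tree Γ γ) + sz(bool x)))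
   list≤ tt = by(ap suc(+-comm(sz(num(k ⊓ len(fn t i γ))))(sz(enc NatsT {i} ps))))(by(sym(+-suc _ _))(+≤ʳ(sz(enc NatsT {i} ps))(s≤s(via(sz-num-mono(m⊓n≤n k _))(via(sml(ok(lenT t))(i , γ))(⟦ out(ok(lenT t)) ⟧-mn(l≤ _ _)))))))
   list≤ ff = l≤ _ _

 coefT : Tm(ε ▹ NatsT ▹ NatsT ▹ NatT) NatT
 coefT = sumListT v2(sumListT v2(b2nT(v1 +T v0 ≡T v2)))

 cntT : ∀ {Γ} -> Tm Γ NatsT -> Tm Γ NatsT -> Tm Γ NatT
 cntT P Q = lenT P *T lenT Q

 sumᴸ : ∀ {Γ} -> Tm Γ NatsT -> Tm Γ NatT
 sumᴸ P = as(sumListT P v0)(\i γ -> Data.Nat.ListAction.sum(fn P i γ))(\i γ -> ap(\l -> num(Data.Nat.ListAction.sum l))(Data.List.Properties.map-id(fn P i γ))) where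
  import Data.Nat.ListAction
  import Data.List.Properties

 v4 : ∀ {Γ S T U W X} -> Tm(Γ ▹ T ▹ S ▹ U ▹ W ▹ X) T
 v4 = wk v3

 v5 : ∀ {Γ S T U W X Y} -> Tm(Γ ▹ T ▹ S ▹ U ▹ W ▹ X ▹ Y) T
 v5 = wk v4

 v6 : ∀ {Γ S T U W X Y Z1} -> Tm(Γ ▹ T ▹ S ▹ U ▹ W ▹ X ▹ Y ▹ Z1) T
 v6 = wk v5

 prodsT : Tm(ε ▹ NatT ▹ NatT ▹ NatsT ▹ NatsT ▹ NatsT ▹ NatsT) BoolT
 prodsT = as(bind(sucT(v5 *T cntT v3 v2 +T v4 *T cntT v1 v0))(v0 ≤T sndT(reptT {S = NatT ×T NatT} W(W ,T v0) body(con 2 ⊗ idP) grow)))(\i((((((_ , u) , v) , P) , Q) , P') , Q') -> prods u v P Q P' Q')(\_ _ -> refl) where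
  Γ = ε ▹ NatT ▹ NatT ▹ NatsT ▹ NatsT ▹ NatsT ▹ NatsT ▹ NatT
  W : Tm Γ NatT
  W = sucT(sumᴸ v4 +T sumᴸ v3 +T(sumᴸ v2 +T sumᴸ v1))
  body : Tm(Γ ▹(NatT ×T NatT))(NatT ×T NatT)
  body = predT(fstT v0) ,T(((sndT v0 +T sndT v0 +T v6 *T call3 coefT v3 v2(predT(fstT v0))) ∸T(wk v6 *T call3 coefT v5 v4(predT(fstT v0)) +T v1)) ⊓T(v1 +T v1))
  size : ∀ {k p q C} -> p ≤ k -> q ≤ C + C -> suc(sz(num p) + sz(num q)) ≤ suc(sz(num k) + 1) + 2 * sz(num C)
  size {k} {p} {q} {C} p≤ q≤ = via(s≤s(+≤(sz-num-mono p≤)(sz-num-mono q≤)))(by(ap(\z -> suc(sz(num k) + z))(sz-num(C + C)))(by(lm(sz(num k)) C)(+≤ʳ(suc(sz(num k) + 1))(to(*≤ʳ 2(n≤1+n(C + C)))(ap(2 *_)(sym(sz-num C))))))) where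
   lm : ∀ k C -> suc(k + suc(C + C +(C + C))) == suc(k + 1) + 2 *(C + C)
   lm = ring
  grow : ∀ i γ s -> sz(enc(NatT ×T NatT) {i}(fn body i(γ , s))) ≤ sz(enc(NatT ×T NatT) {i} s) + 2 * sz(tree Γ {i} γ)
  grow i γ@(_ , C)(k , s) = via(size {k} {pred k} {snd(fn body i(γ , k , s))} {C}(pred[n]≤n {k})(m⊓n≤n _(C + C)))(+≤(s≤s(+≤ʳ(sz(num k))(to(s≤s z≤n)(sym(sz-num s)))))(*≤ʳ 2(via(l≤(sz(num C)) _)(n≤1+n _))))

 module _ (i : Inst) where
  open RSNDInstance (fst i) using (∣E∣; weight)

  numer denom : Fin ∣E∣ -> Bits
  numer e = bits ∣ ↥ at weight e ∣ℤ
  denom e = bits(↧ₙ at weight e)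

  leq : ℕ -> ℕ -> Fin ∣E∣ -> Fin ∣E∣ -> Bool
  leq u v e f = prods u v(ones(numer e))(ones(denom f))(ones(numer f))(ones(denom e))

 module A (i : Inst) = Algorithm (src i) (tgt i) (ds i) (dt i) (dk i) (leq i)

 V E Dm : Ty
 V = base VxF
 E = base EdgeF
 Dm = base DemF

 SlotF CommF ArcF VarF RowF : FinTy
 SlotF = UnitF ⊎F EdgeF
 CommF = DemF ×F(SlotF ×F SlotF)
 ArcF = CommF ×F(EdgeF ×F BoolF)
 VarF = EdgeF ⊎F ArcF
 RowF = (UnitF ⊎F(EdgeF ⊎F ArcF)) ⊎F(CommF ×F VxF)

 Slot Com EdgeSet Costs Labels : Ty
 Slot = base SlotF
 Com = base CommF
 EdgeSet = Table EdgeF BoolT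
 Costs = Table EdgeF NatT
 Labels = Table VxF V

 infixl 8 _∋T_ _·T_ _⟪_⟫T

 _∋T_ : ∀ {Γ} -> Tm Γ EdgeSet -> Tm Γ E -> Tm Γ BoolT
 f ∋T a = _∙_ {X = EdgeF} {BoolT} f a

 _·T_ : ∀ {Γ} -> Tm Γ Costs -> Tm Γ E -> Tm Γ NatT
 f ·T a = _∙_ {X = EdgeF} {NatT} f a

 _⟪_⟫T : ∀ {Γ} -> Tm Γ Labels -> Tm Γ V -> Tm Γ V
 f ⟪ a ⟫T = _∙_ {X = VxF} {V} f a

 leqT : Tm(ε ▹ NatT ▹ NatT ▹ E ▹ E) BoolT
 leqT = as(call prodsT((((((_ , v3) , v2) , onesT(call1 numerT v1)) , onesT(call1 denomT v0)) , onesT(call1 numerT v0)) , onesT(call1 denomT v1)))(\i((((_ , u) , v) , e) , f) -> leq i u v e f)(\_ _ -> refl)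

 hitT : Tm(ε ▹ Slot ▹ E) BoolT
 hitT = as(case v1 falseT(sameT EdgeF Fin._≟_ v0 v1))(\i((_ , a) , e) -> A.hit i a e)(\_ _ -> refl)

 usedT : Tm(ε ▹ Slot) NatT
 usedT = as(case v0 zeroT(sucT zeroT))(\i(_ , a) -> A.used i a)(\_ _ -> refl)

 forbT : Tm(ε ▹ Com ▹ E) BoolT
 forbT = as(call2 hitT(fstT(sndT v1)) v0 ∨T call2 hitT(sndT(sndT v1)) v0)(\i((_ , k) , e) -> A.forb i k e)(\_ _ -> refl)

 failsT : Tm(ε ▹ Com) NatT
 failsT = as(call1 usedT(fstT(sndT v0)) +T call1 usedT(sndT(sndT v0)))(\i(_ , k) -> A.fails1 i k)(\_ _ -> refl)

 sourceT targetT : Tm(ε ▹ Com) V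
 sourceT = as(call1 dsT(fstT v0))(\i(_ , k) -> A.source i k)(\_ _ -> refl)
 targetT = as(call1 dtT(fstT v0))(\i(_ , k) -> A.target i k)(\_ _ -> refl)

 labsT : Tm(ε ▹ EdgeSet) Labels
 labsT = as(foldBT EdgeF(table-bdd VxF(fin-bdd VxF))(tab1 VxF v0)(tab1 VxF(ite(notT(v3 ∋T v1) ∧T sameT VxF Fin._≟_(v2 ⟪ v0 ⟫T)(v2 ⟪ call1 srcT v1 ⟫T))(v2 ⟪ call1 tgtT v1 ⟫T)(v2 ⟪ v0 ⟫T))))(\i(_ , F) -> A.labs i F)(\_ _ -> refl)

 connT : Tm(ε ▹ EdgeSet ▹ V ▹ V) BoolT
 connT = as(sameT VxF Fin._≟_(call1 labsT v2 ⟪ v1 ⟫T)(call1 labsT v2 ⟪ v0 ⟫T))(\i(((_ , F) , s) , t) -> A.conn i F s t)(\_ _ -> refl)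

 activeT : Tm(ε ▹ Com) BoolT
 activeT = as((sucT(call1 failsT v0) ≤T call1 dkT(fstT v0)) ∧T call3 connT(tab1 EdgeF(call2 forbT v1 v0))(call1 sourceT v0)(call1 targetT v0))(\i(_ , k) -> A.active i k)(\_ _ -> refl)

 needT : Tm(ε ▹ Com) NatT
 needT = as(ite(call1 activeT v0)(call1 dkT(fstT v0) ∸T call1 failsT v0) zeroT)(\i(_ , k) -> A.need i k)(\_ _ -> refl)

 feasT : Tm(ε ▹ EdgeSet) BoolT
 feasT = as(allT CommF(notT(call1 activeT v0) ∨T call3 connT(tab1 EdgeF(notT(v2 ∋T v0) ∨T call2 forbT v1 v0))(call1 sourceT v0)(call1 targetT v0)))(\i(_ , H) -> A.feas i H)(\i(_ , H) -> ap bool(sym(A.feas≡ i H)))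

 KT BIGT nVarT εT κT errT MT NT UT : Tm ε NatT
 KT = as(sucT(mT +T mT))(\i _ -> A.K i)(\i _ -> ap num(sym(A.K≡ i)))
 BIGT = as(sucT(sucT(mT *T KT +T mT *T KT)))(\i _ -> A.BIG i)(\i _ -> ap num(sym(A.BIG≡ i)))
 nVarT = as(lenT {T = base VarF}(tm(\i _ -> elems VarF i)(ridx fst(listed VarF))))(\i _ -> A.nVar i)(\i _ -> ap num(sym(A.nVar≡ i)))
 εT = as(nVarT *T(BIGT *T BIGT))(\i _ -> A.ε i)(\i _ -> ap num(sym(A.ε≡ i)))
 κT = as((nT +T mT +T mT) *T εT)(\i _ -> A.κ i)(\i _ -> ap num(sym(A.κ≡ i)))
 errT = as(εT +T mT *T(BIGT *T κT))(\i _ -> A.err i)(\i _ -> ap num(sym(A.err≡ i)))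
 MT = as(sucT(mT *T errT +T κT))(\i _ -> A.M i)(\i _ -> ap num(sym(A.M≡ i)))
 NT = as(MT +T MT)(\i _ -> A.N i)(\i _ -> ap num(sym(A.N≡ i)))
 UT = sucT(sucT(sucT zeroT)) *T NT

 Point : Ty
 Point = Table VarF(Below UT)

 _⟨_⟩T : ∀ {Γ} -> Tm Γ Point -> Tm Γ(base VarF) -> Tm Γ NatT
 z ⟨ j ⟩T = toℕT {U = UT}(_∙_ {X = VarF} {Below UT} z j)

 posT : Tm(ε ▹ Costs ▹ EdgeSet ▹ NatT ▹ base RowF ▹ base VarF) NatT
 posT = as(case v1(case v0 zeroT(case v0 zeroT(case v3(b2nT(notT(call2 forbT(fstT v1)(fstT(sndT v1))) ∧T(notT(wk v6 ∋T fstT(sndT v1)) ∧T sameT EdgeF Fin._≟_(fstT(sndT v1)) v0))) zeroT)))(case v1 zeroT(b2nT(sameT CommF(\ {i} -> A._≟ᶜ_ i)(fstT v1)(fstT v0) ∧T(notT(sameT VxF Fin._≟_(sndT v1)(call1 targetT(fstT v1))) ∧T sameT VxF Fin._≟_(ite(sndT(sndT v0))(call1 srcT(fstT(sndT v0)))(call1 tgtT(fstT(sndT v0))))(sndT v1))))))(\i(((((_ , c) , B) , ℓ) , r) , j) -> A.pos i c B ℓ r j) \ { i((_ , inl(inl _)) , _) -> refl ;i((_ , inl(inr(inl _))) , _) -> refl ;i((_ , inl(inr(inr _))) , inl _) -> refl ;i((_ , inl(inr(inr _))) , inr _) -> refl ;i((_ , inr _) , inl _) -> refl ;i((_ , inr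 _) , inr _) -> refl }

 sameArcT : ∀ {Γ} -> Tm Γ(base ArcF) -> Tm Γ(base ArcF) -> Tm Γ BoolT
 sameArcT a b = sameT CommF(\ {i} -> A._≟ᶜ_ i)(fstT a)(fstT b) ∧T(sameT EdgeF Fin._≟_(fstT(sndT a))(fstT(sndT b)) ∧T as(ite(sndT(sndT a))(sndT(sndT b))(notT(sndT(sndT b))))(\i γ -> same(snd(snd(fn a i γ)))(snd(snd(fn b i γ)))) \i γ -> lm(snd(snd(fn a i γ))) ) where
  lm : ∀ x {y} -> bool(if x then y else not y) == bool(same x y)
  lm tt = refl
  lm ff = refl

 negT : Tm(ε ▹ Costs ▹ EdgeSet ▹ NatT ▹ base RowF ▹ base VarF) NatT
 negT = as(case v1(case v0(case v2(wk(wk v5) ·T v0) zeroT)(case v0(case v3(b2nT(sameT EdgeF Fin._≟_ v1 v0)) zeroT)(case v3 zeroT(b2nT(notT(notT(call2 forbT(fstT v1)(fstT(sndT v1))) ∧T wk v6 ∋T fstT(sndT v1)) ∧T sameArcT v1 v0)))))(case v1 zeroT(b2nT(sameT CommF(\ {i} -> A._≟ᶜ_ i)(fstT v1)(fstT v0) ∧T(notT(sameT VxF Fin._≟_(sndT v1)(call1 targetT(fstT v1))) ∧T sameT VxF Fin._≟_(ite(sndT(sndT v0))(call1 tgtT(fstT(sndT v0)))(call1 srcT(fstT(sndT v0))))(sndT v1))))))(\i(((((_ , c) , B) , ℓ) , r) , j) -> A.neg i c B ℓ r j) \ { i((_ , inl(inl _)) , inl _) -> refl ;i((_ , inl(inl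 _)) , inr _) -> refl ;i((_ , inl(inr(inl _))) , inl _) -> refl ;i((_ , inl(inr(inl _))) , inr _) -> refl ;i((_ , inl(inr(inr _))) , inl _) -> refl ;i((_ , inl(inr(inr _))) , inr _) -> refl ;i((_ , inr _) , inl _) -> refl ;i((_ , inr _) , inr _) -> refl }

 loT hiT : Tm(ε ▹ Costs ▹ EdgeSet ▹ NatT ▹ base RowF) NatT
 loT = as(case v0 zeroT(ite(sameT VxF Fin._≟_(sndT v0)(call1 sourceT(fstT v0)) ∧T notT(sameT VxF Fin._≟_(sndT v0)(call1 targetT(fstT v0))))(closed NT *T call1 needT(fstT v0)) zeroT))(\i((((_ , c) , B) , ℓ) , r) -> A.lo i c B ℓ r) \ { i(_ , inl _) -> refl ;i(_ , inr _) -> refl }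
 hiT = as(case v0(case v0 v3(case v0(closed NT) zeroT)) zeroT)(\i((((_ , c) , B) , ℓ) , r) -> A.hi i c B ℓ r) \ { i(_ , inl(inl _)) -> refl ;i(_ , inl(inr(inl _))) -> refl ;i(_ , inl(inr(inr _))) -> refl ;i(_ , inr _) -> refl }

 LP : Con
 LP = ε ▹ Costs ▹ EdgeSet ▹ NatT

 okT : Tm(LP ▹ Point ▹ base RowF) BoolT
 okT = as((sumT VarF(call negT(((((_ , wk v4) , v4) , v3) , v1) , v0) *T v2 ⟨ v0 ⟩T) +T call4 loT v4 v3 v2 v0) ≤T(sumT VarF(call posT(((((_ , wk v4) , v4) , v3) , v1) , v0) *T v2 ⟨ v0 ⟩T) +T call4 hiT v4 v3 v2 v0 +T closed εT))(\i(((((_ , c) , B) , ℓ) , z) , r) -> A.ok i c B ℓ z r)(\_ _ -> refl)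

 stepT : Tm(LP ▹ Point) Point
 stepT = as(bind(pickT RowF(notT okT)(inj1T(inj1T unitT)))(ite(call okT(((((_ , v4) , v3) , v2) , v1) , v0)) v1(tab1 VarF(clipT UT((v2 ⟨ v0 ⟩T +T call posT(((((_ , v5) , v4) , v3) , v1) , v0)) ∸T call negT(((((_ , v5) , v4) , v3) , v1) , v0))))))(\i((((_ , c) , B) , ℓ) , z) -> A.step i c B ℓ z)(\_ _ -> refl)

 accT : Tm LP BoolT
 accT = as(bind(loopT {S = Point}(table-bdd VarF(below-bdd UT))(closed(sucT(nVarT *T(UT *T UT))))(tab1 VarF(clipT UT zeroT)) stepT)(allT RowF okT))(\i(((_ , c) , B) , ℓ) -> A.acc1 i c B ℓ)(\i(((_ , c) , B) , ℓ) -> ap bool(sym(A.acc≡ i c B ℓ)))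

 valT : Tm(ε ▹ Costs ▹ EdgeSet) NatT
 valT = as(leastT(closed(NT *T(mT *T BIGT))) accT)(\i((_ , c) , B) -> A.val1 i c B)(\i((_ , c) , B) -> ap num(sym(A.val≡ i c B)))

 addT : Tm(ε ▹ EdgeSet ▹ E) EdgeSet
 addT = tab1 EdgeF(v2 ∋T v0 ∨T sameT EdgeF Fin._≟_ v1 v0)

 paysT : Tm(ε ▹ Costs ▹ EdgeSet ▹ E) BoolT
 paysT = as(notT(v1 ∋T v0) ∧T(call2 valT v2(call2 addT v1 v0) +T closed MT *T(v2 ·T v0) ≤T call2 valT v2 v1 +T closed errT))(\i(((_ , c) , B) , e) -> A.pays i c B e)(\_ _ -> refl)

 growT : Tm(ε ▹ E ▹ Costs ▹ EdgeSet) EdgeSet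
 growT = as(ite(call1 feasT v0) v0(call2 addT v0(pickT EdgeF(call3 paysT v2 v1 v0) v2)))(\i(((_ , e0) , c) , B) -> A.grow i c e0 B)(\_ _ -> refl)

 rnd-wgtT : Tm(ε ▹ E ▹ E) NatT
 rnd-wgtT = as(leastT(closed BIGT)(call4 leqT(closed KT) v0 v1 v2))(\i((_ , e0) , e) -> A.rwt i e0 e)(\_ _ -> refl)

 unavT : Tm(ε ▹ E) BoolT
 unavT = as(notT(call1 feasT(tab1 EdgeF(notT(sameT EdgeF Fin._≟_ v1 v0)))))(\i(_ , e) -> A.unav i e)(\_ _ -> refl)

 guessT : Tm(ε ▹ E) EdgeSet
 guessT = as(bind(tab1 EdgeF rnd-wgtT)(loopT {S = EdgeSet}(table-bdd EdgeF bool-bdd)(closed mT)(tab1 EdgeF(call1 unavT v0 ∨T sameT EdgeF Fin._≟_ v2 v0)) growT))(\i(_ , e0) -> A.guess i e0)(\i(_ , e0) -> ap(enc EdgeSet {i})(sym(A.guess≡ i e0)))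

 totT : Tm(ε ▹ E) NatT
 totT = as(bind guessT(sumT EdgeF(ite(v1 ∋T v0)(call2 rnd-wgtT v2 v0) zeroT)))(\i(_ , e0) -> A.tot i e0)(\i(_ , e0) -> ap num(sym(A.tot≡ i e0)))

 validT : Tm(ε ▹ E) BoolT
 validT = as(call1 feasT guessT ∧T(sucT totT ≤T closed BIGT))(\i(_ , e0) -> A.valid i e0)(\i(_ , e0) -> ap bool(sym(A.valid≡ i e0)))

 bestT : Tm(ε ▹ Slot) BoolT
 bestT = as(case v0 falseT(call1 validT v0 ∧T allT EdgeF(notT(call1 validT v0) ∨T call4 leqT(call1 totT v1)(call1 totT v0) v1 v0)))(\i(_ , a) -> A.best i a)(\_ _ -> refl)

 resultT : Tm ε EdgeSet
 resultT = as(bind(pickT SlotF bestT(inj1T unitT))(tab1 EdgeF(notT(call1 feasT(tab1 EdgeF falseT)) ∧T case v1 falseT(call1 guessT v0 ∋T v1))))(\i _ -> A.result i)(\_ _ -> refl)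

module Raw where
 open N
 open import Defs
 open Machine
 open TreeOps
 open Comp
 open Parse using (symTree; dig)

 word-tree : Word -> Tree
 word-tree w = list(map symTree w)

 sz-word-tree : ∀ w -> sz(word-tree w) ≤ 8 * len w + 1
 sz-word-tree [] = rfl
 sz-word-tree(x ∷ w) = to(s≤s(+≤(sym1≤ x)(sz-word-tree w)))(lm(len w)) where
  lm : ∀ n -> suc(7 +(8 * n + 1)) == 8 * suc n + 1
  lm = ring
  sym1≤ : ∀ x -> sz(symTree x) ≤ 7
  sym1≤(bit zero) = ≤ᵇ⇒≤ 5 7 _
  sym1≤(bit(suc zero)) = rfl
  sym1≤ # = ≤ᵇ⇒≤ 3 7 _

 put : List Symbol -> Prog
 put [] = skip
 put(x ∷ xs) = push 0F x ⨾ put xs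

 put-runs : ∀ xs {a b} -> put xs ⊢ ⟪ a ∣ b ∣ [] ∣ [] ⟫ ⇝[ 2 * len xs + 1 ] ⟪ xs ʳ++ a ∣ b ∣ [] ∣ [] ⟫
 put-runs [] = exl skip
 put-runs(x ∷ xs) = wn(eq≤(lm(len xs)))(exl push ⨟ put-runs xs) where
  lm : ∀ n -> 2 +(2 * n + 1) == 2 * suc n + 1
  lm = ring

 reader : Prog
 reader = spill 0F 1F ⨾ push 0F b0 ⨾ drain 1F(\x -> put((b1 ∷ code(symTree x)) ʳ++ []))

 reader-runs : ∀ w -> reader ⊢ main w ⇝[ 27 * len w + 4 ] main(code(word-tree w) ++ [])
 reader-runs w = wn(eq≤(lm(len w)))(ends(ap main(tr(ap(\v -> code(word-tree v))(ʳ++[] w))(sym(++-identityʳ(code(word-tree w))))))(spill1(\xs ys -> ⟪ xs ∣ ys ∣ [] ∣ [] ⟫)(\_ _ -> refl)(\_ _ _ -> refl)(\_ _ _ -> refl) w [] ⨟ exl push ⨟ takes(ap(\n -> n * 21 + 1)(tr(length-ʳ++ w)(+0(len w))))(drain-runs(\xs ys -> ⟪ code(word-tree ys) ∣ xs ∣ [] ∣ [] ⟫)(\_ _ -> refl)(\_ _ _ -> refl) each(w ʳ++ []) []))) where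
  lm : ∀ n -> (n * 6 + 1) +(2 +(n * 21 + 1)) == 27 * n + 4
  lm = ring
  each : ∀ x xs ys -> put((b1 ∷ code(symTree x)) ʳ++ []) ⊢ ⟪ code(word-tree ys) ∣ xs ∣ [] ∣ [] ⟫ ⇝[ 17 ] ⟪ code(word-tree(x ∷ ys)) ∣ xs ∣ [] ∣ [] ⟫
  each(bit zero) xs ys = wn(≤ᵇ⇒≤ 13 17 _)(put-runs((b1 ∷ code(symTree(bit zero))) ʳ++ []))
  each(bit(suc zero)) xs ys = put-runs((b1 ∷ code(symTree(bit(suc zero)))) ʳ++ [])
  each # xs ys = wn(≤ᵇ⇒≤ 9 17 _)(put-runs((b1 ∷ code(symTree #)) ʳ++ []))

 bitOf : Bool -> Symbol
 bitOf b = bit(if b then suc zero else zero)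

 writer : Prog
 writer = while 0F isB1(pop 0F ⨾ br1 0F isB1(pop 0F ⨾ pop 0F ⨾ pop 0F ⨾ push 1F b1)(pop 0F ⨾ push 1F b0)) ⨾ pop 0F ⨾ spill 1F 0F

 writer-runs : ∀ bs -> writer ⊢ main(code(list(map bool bs)) ++ []) ⇝[ 14 * len bs + 3 ] main(map bitOf bs)
 writer-runs bs = wn(eq≤(lm(len bs)))(tp(\c -> writer ⊢ main c ⇝[(len bs * 8 + 1) +(1 +(len bs * 6 + 1)) ] main(map bitOf bs))(sym(++-identityʳ(code(list(map bool bs)))))(go bs [] ⨟ exl pop ⨟ takes(ap(\n -> n * 6 + 1)(tr(length-ʳ++(map bitOf bs))(tr(+0 _)(Data.List.Properties.length-map bitOf bs))))(ends(ap main(ʳ++[](map bitOf bs)))(spill1(\xs ys -> ⟪ ys ∣ xs ∣ [] ∣ [] ⟫)(\_ _ -> refl)(\_ _ _ -> refl)(\_ _ _ -> refl)(map bitOf bs ʳ++ []) [])))) where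
  import Data.List.Properties
  lm : ∀ n -> (n * 8 + 1) +(1 +(n * 6 + 1)) == 14 * n + 3
  lm = ring
  cycle : Prog
  cycle = while 0F isB1(pop 0F ⨾ br1 0F isB1(pop 0F ⨾ pop 0F ⨾ pop 0F ⨾ push 1F b1)(pop 0F ⨾ push 1F b0))
  go : ∀ bs ys -> cycle ⊢ ⟪ code(list(map bool bs)) ∣ ys ∣ [] ∣ [] ⟫ ⇝[ len bs * 8 + 1 ] ⟪ b0 ∷ [] ∣ map bitOf bs ʳ++ ys ∣ [] ∣ [] ⟫
  go [] ys = exl(done refl)
  go(tt ∷ bs) ys = loop≤ refl(exl pop ⨟ then≤ refl(exl pop ⨟ exl pop ⨟ exl pop ⨟ exl push))(go bs(b1 ∷ ys))
  go(ff ∷ bs) ys = wn(by-slack 2(fewer(len bs)))(loop≤ refl(exl pop ⨟ else≤ refl(exl pop ⨟ exl push))(go bs(b0 ∷ ys))) where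
   fewer : ∀ n -> suc(1 + suc(1 + 2) +(n * 8 + 1)) + 2 == suc n * 8 + 1
   fewer = ring

 len≤sz : ∀ bs -> len bs ≤ sz(list(map bool bs))
 len≤sz [] = z≤n
 len≤sz(b ∷ bs) = s≤s(via(len≤sz bs)(r≤ _(sz(bool b))))

 -- A uniform program for a function from words to bit strings gives a polynomial-time machine.
 module Whole {I : Set} (word : I -> Word) (answer : I -> List Bool) (core : ctx I (\ i -> word-tree (word i)) ⊩ \ i -> list (map bool (answer i))) where

  program : Prog
  program = reader ⨾ prog core ⨾ writer

  bd1 : Pol
  bd1 = con 27 ⊗ idP ⊕ con 4 ⊕((time core ⊕(con 14 ⊗ out core ⊕ con 3)) ∘P(con 8 ⊗ idP ⊕ con 1))

  runs-wn : ∀ i -> program ⊢ start-stacks(word i) ⇝[ ⟦ bd1 ⟧(len(word i)) ] main(map bitOf(answer i))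
  runs-wn i = wn enough(reader-runs(word i) ⨟ runs core i [] ⨟ writer-runs(answer i)) where
   l = len(word i)
   s = sz(word-tree(word i))
   enough : 27 * l + 4 +(⟦ time core ⟧ s +(14 * len(answer i) + 3)) ≤ ⟦ bd1 ⟧ l
   enough = +≤ʳ(27 * l + 4)(to(+≤(⟦ time core ⟧-mn(sz-word-tree(word i)))(+≤ˡ 3(*≤ʳ 14(via(len≤sz(answer i))(via(sml core i)(⟦ out core ⟧-mn(sz-word-tree(word i))))))))(sym(∘P-e(time core ⊕(con 14 ⊗ out core ⊕ con 3))(con 8 ⊗ idP ⊕ con 1) l)))

  abstract
   solver : ∃[ M ] ∃[ c ] ∃[ d ] ∀ i -> OutputsWithin M(c * len(word i) Data.Nat.^ d + c)(word i)(map bitOf(answer i))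
   solver = machine program , fst poly , fst(snd poly) , \i -> machine-outputs {program} {word i}(snd(snd(runs-wn i)))(via(fst(snd(runs-wn i)))(snd(snd poly)(len(word i)))) where
    poly : ∃[ c ] ∃[ d ] ∀ n -> ⟦ bd1 ⟧ n ≤ c * n Data.Nat.^ d + c
    poly = polynomial-bd bd1

module Scale where
 open Sums using (∑)
 open import Data.Integer using (+_; -[1+_]) renaming (∣_∣ to ∣_∣ℤ)
 import Data.Integer.Tactic.RingSolver as ℤ-solver
 open import Data.List using () renaming (tabulate to tab)
 import Data.Nat.Tactic.RingSolver as ℕ-solver
 import Data.Nat.Coprimality as Coprime
 open import Data.Rational using (ℚ; mkℚ; 0ℚ; _≤_; _+_; _*_; ↥_; ↧_; ↧ₙ_; *≤*; toℚᵘ; Positive)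
 import Data.Rational.Properties as ℚₚ
 open import Data.Rational.Unnormalised using (mkℚᵘ; *≡*)
 import Data.Rational.Unnormalised.Properties as ℚᵘₚ
 open import Algebra.Properties.Monoid.Sum ℚₚ.+-0-monoid using (sum)

 ι : Z -> ℚ
 ι z = mkℚ z 0(Coprime.sym(Coprime.1-coprimeTo ∣ z ∣ℤ))

 ι-+ : ∀ a b -> ι a + ι b == ι(a Int.+ b)
 ι-+ a b = ℚₚ.toℚᵘ-injective(ℚᵘₚ.≃-trans(ℚₚ.toℚᵘ-homo-+(ι a)(ι b))(*≡*(lm a b))) where
  lm : ∀ a b -> (a Int.* + 1 Int.+ b Int.* + 1) Int.* + 1 ==(a Int.+ b) Int.* + 1
  lm = ℤ-solver.solve-∀

 ι-* : ∀ a b -> ι a * ι b == ι(a Int.* b)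
 ι-* a b = ℚₚ.toℚᵘ-injective(ℚᵘₚ.≃-trans(ℚₚ.toℚᵘ-homo-*(ι a)(ι b))(*≡* refl))

 ι-mono : ∀ {a b} -> a Int.≤ b -> ι a ≤ ι b
 ι-mono {a} {b} l = *≤*(Int.*≤ʳ(+ 1) l)

 -- A common denominator.
 common : ∀ {n} -> (Fin n -> ℕ) -> ℕ
 common {zero} d = 1
 common {suc n} d = suc(d zero) N.* common(d ∘ suc)

 common>0 : ∀ {n}(d : Fin n -> ℕ) -> 0 N.< common d
 common>0 {zero} d = s≤s z≤n
 common>0 {suc n} d = N.<≤(common>0(d ∘ suc))(N.l≤ _(d zero N.* common(d ∘ suc)))

 cof : ∀ {n}(d : Fin n -> ℕ) e -> ∃[ c ] c N.* suc(d e) == common d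
 cof {suc n} d zero = common(d ∘ suc) , N.*-comm(common(d ∘ suc))(suc(d zero))
 cof {suc n} d(suc e) = suc(d zero) N.* fst(cof(d ∘ suc) e) , tr(N.*-assoc(suc(d zero))(fst(cof(d ∘ suc) e))(suc(d(suc e))))(ap(suc(d zero) N.*_)(snd(cof(d ∘ suc) e)))

 ∑-tab : ∀ {A : Set} {n}(h : Fin n -> A)(g : A -> Z) -> ∑(tab h) g == ∑(fins n)(g ∘ h)
 ∑-tab {n = zero} h g = refl
 ∑-tab {n = suc n} h g = ap(Int._+_(g(h zero)))(tr(∑-tab(h ∘ suc) g)(sym(∑-tab suc(g ∘ h))))

 sum-scal : ∀ {n}(f : Fin n -> ℚ)(g : Fin n -> Z) q -> (∀ e -> f e * q == ι(g e)) -> sum f * q == ι(∑(fins n) g)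
 sum-scal {zero} f g q h = ℚₚ.*-zeroˡ q
 sum-scal {suc n} f g q h = tr(ℚₚ.*-distribʳ-+ q(f zero)(sum(f ∘ suc)))(tr(ap2 _+_(h zero)(tr(sum-scal(f ∘ suc)(g ∘ suc) q(h ∘ suc))(ap ι(sym(∑-tab suc g)))))(ι-+(g zero)(∑(tab suc) g)))

 module Weights {m : ℕ} (w : Fin m -> ℚ) (w≥0 : ∀ e -> 0ℚ ≤ w e) where

  den : Fin m -> ℕ
  den e = ℚ.denominator-1(w e)

  numer : Fin m -> ℕ
  numer e = ∣ ↥ w e ∣ℤ

  Q : ℕ
  Q = common den

  scal : Fin m -> ℕ
  scal e = numer e N.* fst(cof den e)

  scal-spec : ∀ e -> scal e N.* suc(den e) == numer e N.* Q
  scal-spec e = tr(N.*-assoc(numer e)(fst(cof den e))(suc(den e)))(ap(numer e N.*_)(snd(cof den e)))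

  scal-ι : ∀ e -> w e * ι(+ Q) == ι(+ scal e)
  scal-ι e = go(w e) refl(w≥0 e) where
   go : ∀ p -> w e == p -> 0ℚ ≤ p -> p * ι(+ Q) == ι(+ scal e)
   go(mkℚ -[1+ k ] d c) eq(*≤*())
   go(mkℚ(+ k) d c) eq _ = ℚₚ.toℚᵘ-injective(ℚᵘₚ.≃-trans(ℚₚ.toℚᵘ-homo-*(mkℚ(+ k) d c)(ι(+ Q)))(*≡*(tr(ap(Int._* + 1)(sym(Int.pos-* k Q)))(tr(Int.*1(+(k N.* Q)))(tr(ap +_ spec)(tr(Int.pos-*(scal e)(suc d))(ap(\j -> + scal e Int.* + j)(sym(N.*1(suc d)))))))))) where
    spec : k N.* Q == scal e N.* suc d
    spec = tr(ap(\p -> ∣ ↥ p ∣ℤ N.* Q)(sym eq))(tr(sym(scal-spec e))(ap(\p -> scal e N.* suc(ℚ.denominator-1 p)) eq))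

  Q>0 : Positive(ι(+ Q))
  Q>0 = pos Q(common>0 den) where
   pos : ∀ q -> 0 N.< q -> Positive(ι(+ q))
   pos(suc q) _ = _

  cmp-sums : ∀ {n}(f f' : Fin n -> ℚ)(g g' : Fin n -> Z) k -> (∀ e -> f e * ι(+ Q) == ι(g e)) -> (∀ e -> f' e * ι(+ Q) == ι(g' e)) -> ∑(fins n) g Int.≤ + k Int.* ∑(fins n) g' -> sum f ≤ ι(+ k) * sum f'
  cmp-sums {n} f f' g g' k h h' le = ℚₚ.*-cancelʳ-≤-pos(ι(+ Q)) {{Q>0}}(subst2 _≤_(sym(sum-scal f g _ h))(sym(tr(ℚₚ.*-assoc(ι(+ k))(sum f')(ι(+ Q)))(tr(ap(ι(+ k) *_)(sum-scal f' g' _ h'))(ι-*(+ k)(∑(fins n) g')))))(ι-mono le))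

  cross : ∀ u e f -> u N.*(numer e N.* suc(den f)) N.* Q == u N.* scal e N.*(suc(den e) N.* suc(den f))
  cross u e f = tr(lm1 u(numer e)(suc(den f)) Q)(tr(ap(\x -> u N.*(x N.* suc(den f)))(sym(scal-spec e)))(lm2 u(scal e)(suc(den e))(suc(den f)))) where
   lm1 : ∀ u n d Q -> u N.*(n N.* d) N.* Q == u N.*(n N.* Q N.* d)
   lm1 = ℕ-solver.solve-∀
   lm2 : ∀ u s d d' -> u N.*(s N.* d N.* d') == u N.* s N.*(d N.* d')
   lm2 = ℕ-solver.solve-∀

  cross-sound : ∀ u v e f -> u N.*(numer e N.* suc(den f)) N.≤ v N.*(numer f N.* suc(den e)) -> u N.* scal e N.≤ v N.* scal f
  cross-sound u v e f le = N.*-cancelʳ-≤(u N.* scal e)(v N.* scal f)(suc(den e) N.* suc(den f))(N.by(sym(cross u e f))(N.to(N.*≤ˡ Q le)(tr(cross v f e)(ap(v N.* scal f N.*_)(N.*-comm(suc(den f))(suc(den e)))))))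

  cross-cpl : ∀ u v e f -> u N.* scal e N.≤ v N.* scal f -> u N.*(numer e N.* suc(den f)) N.≤ v N.*(numer f N.* suc(den e))
  cross-cpl u v e f le = N.*-cancelʳ-≤ _ _ Q {{ℕ.>-nonZero(common>0 den)}}(N.by(cross u e f)(N.to(N.*≤ˡ(suc(den e) N.* suc(den f)) le)(tr(ap(v N.* scal f N.*_)(N.*-comm(suc(den e))(suc(den f))))(sym(cross v f e)))))

module Main where
 open import Defs hiding (#; step)
 open import Data.Integer using (+_)
 open import Data.Rational using (_/_)
 open Sums using (∑; χ; ∑≡)
 open Cuts using (VS; allVS; ∈-allVS)
 open TreeOps using (bool)
 open Comp
 open Typed
 open Tables
 open Library
 open Parse
 open Reading
 open Compare
 open Programs hiding (EdgeSet)
 open Raw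
 open Scale
 open Links using (T∨F; ∨-Fs; ∨-F)
 open import Data.Fin.Subset using (Subset; _─_; ∣_∣; _∈_) renaming (⊤ to allE)
 open import Data.List using () renaming (tabulate to tab)
 import Data.Rational as ℚ
 open import Data.Rational using (ℚ; 0ℚ; mkℚ; ↥_; ↧ₙ_)
 import Data.Rational.Properties as ℚₚ
 open import Data.Vec using (toList)
 open import Data.Vec.Properties using ([]=⇒lookup; lookup⇒[]=; tabulate∘lookup)
 open import Algebra.Properties.Monoid.Sum ℚₚ.+-0-monoid using (sum)
 open import Relation.Binary.Construct.Closure.ReflexiveTransitive using (Star; ε; _◅_)

 at-─ : ∀ {n}(p q : Subset n) e -> at(p ─ q) e ==(if at q e then ff else at p e)
 at-─(x ∷ p)(tt ∷ q) zero = refl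
 at-─(x ∷ p)(ff ∷ q) zero = refl
 at-─(x ∷ p)(y ∷ q)(suc e) = at-─ p q e

 ∣∣-∑ : ∀ {n}(F : Subset n) -> + ∣ F ∣ == ∑(fins n)(\e -> χ(at F e) Int.* + 1)
 ∣∣-∑ [] = refl
 ∣∣-∑(b ∷ F) = tr(single b)(ap(Int._+_(χ b Int.* + 1))(tr(∣∣-∑ F)(sym(∑-tab suc \e -> χ(at(b ∷ F) e) Int.* + 1)))) where
  single : ∀ b -> + ∣ b ∷ F ∣ == χ b Int.* + 1 Int.+ + ∣ F ∣
  single tt = refl
  single ff = refl

 module Instances (i : Inst) where
  open RSNDInstance (fst i)

  module W = Weights (at weight) weight≥0
  module F = Network.Feasy (src i) (tgt i) (ds i) (dt i) (dk i) (snd i) (leq i)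
  open Network using (Lnk; stop; step; wid)

  to-lnk : ∀ {A : EdgeSet} {F : Fin ∣E∣ -> Bool} -> (∀ e -> at A e == tt -> F e == ff) -> ∀ {s t} -> Path A s t -> Lnk(src i)(tgt i) F s t
  to-lnk h ε = stop
  to-lnk h((e , e∈ , inl eq) ◅ p) = step e(h e([]=⇒lookup e∈))(inl(ap fst eq , ap snd eq))(to-lnk h p)
  to-lnk h((e , e∈ , inr eq) ◅ p) = step e(h e([]=⇒lookup e∈))(inr(ap fst eq , ap snd eq))(to-lnk h p)

  to-path : ∀ {A : EdgeSet} {F : Fin ∣E∣ -> Bool} -> (∀ e -> F e == ff -> at A e == tt) -> ∀ {s t} -> Lnk(src i)(tgt i) F s t -> Path A s t
  to-path h stop = ε
  to-path h(step e f(inl(p , q)) l) = (e , lookup⇒[]= e _(h e f) , inl(ap2 _,_ p q)) ◅ to-path h l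
  to-path h(step e f(inr(p , q)) l) = (e , lookup⇒[]= e _(h e f) , inr(ap2 _,_ p q)) ◅ to-path h l

  ins : ∀ {a b} -> a == ff -> (if a then ff else b) == b
  ins refl = refl

  meet-rsnd : ∀ H -> F.Meets(at H) -> RSNDFeasible H
  meet-rsnd H meet d A sml path = to-path(\e q -> let(p , r) = ∨-F {not(at H e)} q in tr(at-─ H A e)(tr(ins r)(not-false p)))
   (meet(d , refl , refl , refl)(at A)(Int.≤<(Int.eq≤(sym(∣∣-∑ A)))(ℤ.+<+ sml))(to-lnk(\e q -> avoids e(tr(sym(at-─ allE A e)) q)) path)) where
   not-false : ∀ {b} -> not b == ff -> b == tt
   not-false {tt} _ = refl
   avoids : ∀ e -> (if at A e then ff else at allE e) == tt -> at A e == ff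
   avoids e q with at A e
   ... | ff = refl

  rsnd-meet : ∀ H -> RSNDFeasible H -> F.Meets(at H)
  rsnd-meet H ok(d , refl , refl , refl) G sml link = to-lnk(\e q -> keeps e(tr(sym(at-─ H A e)) q))(ok d A(Int.drop‿+<+(Int.≤<(Int.eq≤(tr(∣∣-∑ A)(F.size-cong A≡))) sml))(to-path(\e q -> tr(at-─ allE A e)(tr(ins(tr(A≡ e) q))(lookup-replicate e tt))) link)) where
   A : EdgeSet
   A = Vec.tabulate G
   A≡ : ∀ e -> at A e == G e
   A≡ = at-tab G
   keeps : ∀ e -> (if at A e then ff else at H e) == tt -> not(at H e) ∨ G e == ff
   keeps e q rewrite A≡ e with G e | at H e
   ... | ff | tt = refl

  feas-rsnd : ∀ H -> F.feas(at H) == tt -> RSNDFeasible H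
  feas-rsnd H ok = meet-rsnd H(F.feas-meet ok)

  rsnd-feas : ∀ H -> RSNDFeasible H -> F.feas(at H) == tt
  rsnd-feas H ok = F.meet-feas(rsnd-meet H ok)

  frn : ∀ {u : ℕ} {e f} -> u N.*(pows(ones(numer i e)) N.* pows(ones(denom i f))) == u N.*(W.numer e N.* ↧ₙ at weight f)
  frn {u} {e = e} {f} = ap2(\a b -> u N.*(a N.* b))(pows-ones(W.numer e))(pows-ones(↧ₙ at weight f))

  wgtℤ : Fin ∣E∣ -> Z
  wgtℤ e = + W.scal e

  leq-≤ : ∀ {u v e f} -> leq i u v e f == tt -> + u Int.* wgtℤ e Int.≤ + v Int.* wgtℤ f
  leq-≤ {u} {v} {e} {f} h = subst2 Int._≤_(Int.pos-* u(W.scal e))(Int.pos-* v(W.scal f))(ℤ.+≤+(W.cross-sound u v e f(subst2 N._≤_(frn {u} {e} {f})(frn {v} {f} {e})(prods-sound u v(ones(numer i e))(ones(denom i f))(ones(numer i f))(ones(denom i e)) h))))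

  ≤-leq : ∀ {u v e f} -> + u Int.* wgtℤ e Int.≤ + v Int.* wgtℤ f -> leq i u v e f == tt
  ≤-leq {u} {v} {e} {f} h = prods-cpl u v(ones(numer i e))(ones(denom i f))(ones(numer i f))(ones(denom i e))(subst2 N._≤_(sym(frn {u} {e} {f}))(sym(frn {v} {f} {e}))(W.cross-cpl u v e f(Int.drop‿+≤+(subst2 Int._≤_(sym(Int.pos-* u(W.scal e)))(sym(Int.pos-* v(W.scal f))) h))))

  good = Network.Correct1.result-approximates(src i)(tgt i)(ds i)(dt i)(dk i)(snd i)(leq i) wgtℤ(\_ -> ℤ.+≤+ z≤n)(\ {u} {v} {e} {f} -> leq-≤ {u} {v} {e} {f})(\ {u} {v} {e} {f} -> ≤-leq {u} {v} {e} {f})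

  wt : (Fin ∣E∣ -> Bool) -> Z
  wt H = ∑(fins ∣E∣)(\e -> χ(H e) Int.* wgtℤ e)

  tot-≤ : ∀ H G k -> wt(at H) Int.≤ + k Int.* wt(at G) -> totalWeight H ℚ.≤ ι(+ k) ℚ.* totalWeight G
  tot-≤ H G k = W.cmp-sums _ _(\e -> χ(at H e) Int.* wgtℤ e)(\e -> χ(at G e) Int.* wgtℤ e) k(each H)(each G) where
   each : ∀ H e -> (if at H e then at weight e else 0ℚ) ℚ.* ι(+ W.Q) == ι(χ(at H e) Int.* wgtℤ e)
   each H e with at H e
   ... | tt = tr(W.scal-ι e)(ap ι(sym(Int.1*(wgtℤ e))))
   ... | ff = ℚₚ.*-zeroˡ(ι(+ W.Q))

  opt : ∃[ S ] RSNDFeasible S ×(∀ S' -> RSNDFeasible S' -> totalWeight S ℚ.≤ totalWeight S')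
  opt = S , feas-rsnd S S-ok , \S' ok' -> tp(totalWeight S ℚ.≤_)(ℚₚ.*-identityˡ(totalWeight S'))(tot-≤ S S' 1(Int.to(S-least S'(th(∈-allVS S'))(rsnd-feas S' ok'))(sym(Int.1*(wt(at S')))))) where
   full : F.feas(at allE) == tt
   full = F.meet-feas \ {_} {_} {_} dem G sml link -> wid(src i)(tgt i)(\e q -> tr(ap(\b -> not b ∨ G e)(lookup-replicate e tt)) q) link
   found = Ratio.minl(\S -> F.feas(at S))(\S -> wt(at S))(allVS ∣E∣) {allE} full
   S = fst found
   S-ok = fst(snd found)
   S-least = snd(snd found)

  sol1 : EdgeSet
  sol1 = Vec.tabulate(A.result i)

  approx : MinimisationProblem.ApproximateSolution(3 -RSND)(+ 2 / 1) i sol1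
  approx = feas-rsnd sol1(F.feas-mono(\e p -> tr(at-tab(A.result i) e) p)(fst bounds)) , fst opt , snd opt , tot-≤ sol1(fst opt) 2(Int.by(∑≡(fins ∣E∣) \e _ -> ap(\b -> χ b Int.* wgtℤ e)(at-tab(A.result i) e))(snd bounds)) where
   bounds = good(at(fst opt))(rsnd-feas(fst opt)(fst(snd opt)))

 answer : Inst -> List Bool
 answer i = map(A.result i)(fins(RSNDInstance.∣E∣(fst i)))

 answerT : Tm Reading.ε(ListT BoolT)
 answerT = as(bind resultT(gathT EdgeF [ v1 ∋T v0 ]T nilT ʳ++T nilT))(\i _ -> answer i) \i _ -> ap(enc(ListT BoolT) {i})(tr(back(A.result i)(fins _) [] [])(++-identityʳ _)) where
  back : ∀ {A : Set}(f : A -> Bool) xs ys zs -> gath(\x -> [ f x ]) ys xs ʳ++ zs == ys ʳ++(map f xs Data.List.++ zs)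
  back f [] ys zs = refl
  back f(x ∷ xs) ys zs = back f xs(f x ∷ ys) zs

 encode-answer : ∀ i -> map bitOf(answer i) == encodeSubset(Instances.sol1 i)
 encode-answer i = ap(map bitOf)(tr(map-tabulate id(A.result i))(sym(toList-tab(A.result i)))) where
  toList-tab : ∀ {n}(f : Fin n -> Bool) -> toList(Vec.tabulate f) == tab f
  toList-tab {zero} f = refl
  toList-tab {suc n} f = ap(f zero ∷_)(toList-tab(f ∘ suc))

open import Defs
open import Data.Integer using (+_)
open import Data.Rational using (_/_)
open Main
open Parse
open Raw
open Comp
open Reading using (ok)

theorem1p1 : ∃[ M ] MinimisationProblem.IsPolyTimeApproximation (3 -RSND) (+ 2 / 1) M
theorem1p1 = let(M , c , d , run) = Whole.solver(\i -> encodeRSND(fst i)) answer(ridx(\i -> i , _)(ok answerT)) in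
  M , c , d , \i -> Instances.sol1 i , tp(OutputsWithin M _(encodeRSND(fst i)))(encode-answer i)(run i) , Instances.approx i
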